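{- Let $m$ and $n$ be positive integers, and put $\kappa := 2m+2n+2$ and $n':=2n$. Write $r := r_1+\cdots+r_m$. Then \begin{align*} &\sum_{r_*, s_*} \mathcal{D}_{m, n'}(r_*,s_*;q^{n'})\,q^{\mathcal{C}_{m, n'}(r_*,s_*)+r} \\ &\qquad = \frac{(q^2;q^2)_\infty (q^{\kappa/2};q^{\kappa/2})_\infty (q^\kappa;q^\kappa)_\infty^{n-1}}{(q;q)_\infty^{n+1}} \prod_{i=1}^n\theta(q^i;q^{\kappa/2}) \prod_{1\leq i < j \leq n}\theta(q^{j-i},q^{i+j};q^\kappa) \\ &\qquad = \frac{(q^\kappa;q^\kappa)_\infty^m}{(q;q)_\infty^m} \prod_{i=1}^m \theta(q^{i+1};q^\kappa) \prod_{1\leq i < j \leq m}\theta(q^{j-i},q^{i+j+1};q^\kappa), \end{align*} where the sum ranges over all integers $r_1 \geq \cdots \geq r_m\geq 0$ and, for each $1 \leq j \leq n'-1$, integers $s_1^{(j)} \geq \cdots \geq s_{2m}^{(j)} \geq 0$, subject to $s_i^{(j)} \geq s_i^{(j+1)}$ for $1\le j\le n'-2$ and $r_{\lceil i/2 \rceil} \geq s_i^{(1)}$ for $1\le i\le 2m$.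
   Context: Notation: for $k\ge 0$ an integer, $(a;p)_k=(1-a)(1-ap)\cdots(1-ap^{k-1})$, $(a;p)_\infty=\prod_{j\ge0}(1-ap^j)$; $\theta(a;p)=(a;p)_\infty(p/a;p)_\infty$ and $\theta(a_1,\dots,a_k;p)=\theta(a_1;p)\cdots\theta(a_k;p)$. Identities are of formal power series in $q$. For positive integers $M,N$ and integers $s_i^{(j)}$ ($1\le i\le M$, $0\le j\le N$), with the conventions $s_i^{(N)}=0$ for all $i$ and $s_{M+1}^{(j)}=0$ for all $j$, and $s^{(j)}:=s_1^{(j)}+\cdots+s_M^{(j)}$, define $$\mathcal{A}_{M,N}(s_*)= -\tfrac{N}{2}s^{(0)}+s^{(1)}+\cdots+s^{(N-1)}+\tfrac{N}{2}\sum_{i=1}^M\sum_{a=1}^N\big(s_i^{(a-1)}-s_i^{(a)}\big)^2,$$ $$\mathcal{B}_{M,N}(s_*;p)=\prod_{i=1}^M\prod_{a=1}^N\frac{(p;p)_{s_i^{(a-1)}-s_{i+1}^{(a)}}}{(p;p)_{s_i^{(a-1)}-s_i^{(a)}}\,(p;p)_{s_i^{(a)}-s_{i+1}^{(a)}}}\ \prod_{i=1}^M\frac{1}{(p;p)_{s_i^{(0)}-s_{i+1}^{(0)}}}.$$ Given integers $r_1\ge\cdots\ge r_m\ge0$ and integers $s_i^{(j)}$ ($1\le i\le 2m$, $1\le j\le N$, with $s_i^{(N)}=0$), define $\mathcal{C}_{m,N}(r_*,s_*):=\mathcal{A}_{2m,N}(s_*)$ and $\mathcal{D}_{m,N}(r_*,s_*;p):=\mathcal{B}_{2m,N}(s_*;p)$,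 where the level-$0$ entries are set to $s_i^{(0)}:=r_{\lceil i/2\rceil}$ for $1\le i\le 2m$ (and $s_{2m+1}^{(j)}=0$). -}

module Defs where

open import Data.Nat as ℕ using (ℕ; zero; suc; _∸_; _≤ᵇ_; _≡ᵇ_; ⌊_/2⌋)
open import Data.Integer as ℤ using (ℤ; +_; -[1+_]; _-_)
open import Data.Bool using (Bool; true; false; if_then_else_; _∧_)
open import Data.List using (List; []; _∷_; map; foldr; upTo; concatMap)
open import Data.Product using (_×_; _,_)
open import Data.Vec using (Vec; []; _∷_)

-- Formal power series in q with integer coefficients:
-- f : PS represents  Σ_{d ≥ 0} f d q^d.

PS : Set
PS = ℕ → ℤ

sumℤ : List ℤ → ℤ
sumℤ = foldr ℤ._+_ (+ 0)

sumℕ : List ℕ → ℕ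
sumℕ = foldr ℕ._+_ 0

all : {A : Set} → (A → Bool) → List A → Bool
all p = foldr (λ x b → p x ∧ b) true

𝟙 : PS
𝟙 zero    = + 1
𝟙 (suc _) = + 0

mono : ℕ → PS
mono k d = if k ≡ᵇ d then + 1 else + 0

_⊕_ : PS → PS → PS
(f ⊕ g) d = f d ℤ.+ g d

_⊖_ : PS → PS → PS
(f ⊖ g) d = f d ℤ.- g d

_⊗_ : PS → PS → PS
(f ⊗ g) d = sumℤ (map (λ i → f i ℤ.* g (d ∸ i)) (upTo (suc d)))

infixl 7 _⊗_
infixl 6 _⊕_ _⊖_

_^ᵖ_ : PS → ℕ → PS
f ^ᵖ zero    = 𝟙
f ^ᵖ (suc t) = f ⊗ (f ^ᵖ t)

prodPS : List PS → PS
prodPS = foldr _⊗_ 𝟙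

-- Multiplicative inverse of a series f with constant term 1:
-- 1/f = 1/(1 - g) = Σ_t g^t where g = 1 - f has zero constant term,
-- so the coefficient of q^d only involves t ≤ d.
-- (Only used for series with constant term 1.)
inv : PS → PS
inv f d = sumℤ (map (λ t → ((𝟙 ⊖ f) ^ᵖ t) d) (upTo (suc d)))

poch : ℕ → ℕ → ℕ → PS
poch a p k = prodPS (map (λ j → 𝟙 ⊖ mono (a ℕ.+ p ℕ.* j)) (upTo k))

-- infinite q-Pochhammer  (q^a ; q^p)_∞  for p ≥ 1: the factors with
-- j > d have exponent > d, so the coefficient of q^d is that of the
-- finite product with j ≤ d.
pochInf : ℕ → ℕ → PS
pochInf a p d = poch a p (suc d) d

-- θ(q^a ; q^p) = (q^a ; q^p)_∞ (q^(p-a) ; q^p)_∞   (used with 0 < a < p)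
theta : ℕ → ℕ → PS
theta a p = pochInf a p ⊗ pochInf (p ∸ a) p

coeffℤ : PS → ℤ → ℤ
coeffℤ f (+ d)    = f d
coeffℤ f -[1+ _ ] = + 0

-- Index data for the left-hand side, with N = 2n:
--   r : Vec ℕ m                     (r_1,...,r_m), 0-based
--   s : Vec (Vec ℕ (2m)) (N ∸ 1)    row j-1 is (s_1^(j),...,s_{2m}^(j)), 1 ≤ j ≤ N-1

nth : {k : ℕ} → Vec ℕ k → ℕ → ℕ
nth []       _       = 0
nth (x ∷ xs) zero    = x
nth (x ∷ xs) (suc i) = nth xs i

nthRow : {k j : ℕ} → Vec (Vec ℕ k) j → ℕ → ℕ → ℕ
nthRow []         _       i = 0
nthRow (xs ∷ xss) zero    i = nth xs i
nthRow (xs ∷ xss) (suc a) i = nthRow xss a i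

-- lev r s a i = s_{i+1}^{(a)}  (0-based index i), with
--   s_{i+1}^{(0)} = r_{⌈(i+1)/2⌉} = r[⌊i/2⌋] (0-based),
--   s^{(N)} = 0 and s_{2m+1}^{(a)} = 0 (out-of-range lookups give 0).
lev : {m j k : ℕ} → Vec ℕ m → Vec (Vec ℕ k) j → ℕ → ℕ → ℕ
lev {k = k} r s zero    i = if suc i ≤ᵇ k then nth r ⌊ i /2⌋ else 0
lev         r s (suc a) i = nthRow s a i

module _ (m n : ℕ) where

  N : ℕ
  N = 2 ℕ.* n

  Rs : Set
  Rs = Vec ℕ m

  Ss : Set
  Ss = Vec (Vec ℕ (2 ℕ.* m)) (N ∸ 1)

  valid : Rs → Ss → Bool
  valid r s =
       all (λ k → nth r (suc k) ≤ᵇ nth r k) (upTo (m ∸ 1))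
     ∧ all (λ j → all (λ i → L (suc j) (suc i) ≤ᵇ L (suc j) i) (upTo (2 ℕ.* m ∸ 1)))
           (upTo (N ∸ 1))
     ∧ all (λ j → all (λ i → L (2 ℕ.+ j) i ≤ᵇ L (suc j) i) (upTo (2 ℕ.* m)))
           (upTo (N ∸ 2))
     ∧ all (λ i → L 1 i ≤ᵇ L 0 i) (upTo (2 ℕ.* m))
    where
    L : ℕ → ℕ → ℕ
    L = lev r s

  sq : ℤ → ℤ
  sq x = x ℤ.* x

  -- 𝒞_{m,N}(r,s) = 𝒜_{2m,N}(s)  with level-0 entries r_{⌈i/2⌉}
  Cexp : Rs → Ss → ℤ
  Cexp r s =
      ℤ.- (+ n ℤ.* + tot 0)
      ℤ.+ sumℤ (map (λ a → + tot (suc a)) (upTo (N ∸ 1)))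
      ℤ.+ + n ℤ.* sumℤ (map (λ i → sumℤ (map (λ a → sq (+ L a i - + L (suc a) i)) (upTo N)))
                            (upTo (2 ℕ.* m)))
    where
    L : ℕ → ℕ → ℕ
    L = lev r s
    tot : ℕ → ℕ
    tot a = sumℕ (map (L a) (upTo (2 ℕ.* m)))

  rSum : Rs → ℕ
  rSum r = sumℕ (map (nth r) (upTo m))

  P : ℕ → PS
  P k = poch N N k

  -- 𝒟_{m,N}(r,s; q^N) = ℬ_{2m,N}(s; q^N) (subscripts are ≥ 0 under the constraints)
  Dser : Rs → Ss → PS
  Dser r s =
      prodPS (map (λ i → prodPS (map (λ a →
                  P (L a i ∸ L (suc a) (suc i))
                ⊗ inv (P (L a i ∸ L (suc a) i))
                ⊗ inv (P (L (suc a) i ∸ L (suc a) (suc i)))) (upTo N)))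
             (upTo (2 ℕ.* m)))
    ⊗ prodPS (map (λ i → inv (P (L 0 i ∸ L 0 (suc i)))) (upTo (2 ℕ.* m)))
    where
    L : ℕ → ℕ → ℕ
    L = lev r s

  termCoeff : Rs → Ss → ℤ → ℤ
  termCoeff r s d = coeffℤ (Dser r s) (d - (Cexp r s ℤ.+ + rSum r))

  allVecs : {A : Set} → List A → (k : ℕ) → List (Vec A k)
  allVecs xs zero    = [] ∷ []
  allVecs xs (suc k) = concatMap (λ x → map (x ∷_) (allVecs xs k)) xs

  lhsPartial : ℕ → ℤ → ℤ
  lhsPartial B d =
    sumℤ (concatMap (λ r → map (λ s → if valid r s then termCoeff r s d else + 0)
                             (allVecs (allVecs (upTo (suc B)) (2 ℕ.* m)) (N ∸ 1)))
                    (allVecs (upTo (suc B)) m))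

  h : ℕ
  h = m ℕ.+ n ℕ.+ 1

  κ : ℕ
  κ = 2 ℕ.* h

  pairs : ℕ → List (ℕ × ℕ)
  pairs k = concatMap (λ j → map (λ i → (suc i , suc j)) (upTo j)) (upTo k)

  rhs1 : PS
  rhs1 =
      pochInf 2 2 ⊗ pochInf h h ⊗ (pochInf κ κ ^ᵖ (n ∸ 1))
    ⊗ inv (pochInf 1 1 ^ᵖ (n ℕ.+ 1))
    ⊗ prodPS (map (λ i → theta (suc i) h) (upTo n))
    ⊗ prodPS (map (λ { (i , j) → theta (j ∸ i) κ ⊗ theta (i ℕ.+ j) κ }) (pairs n))

  rhs2 : PS
  rhs2 =
      (pochInf κ κ ^ᵖ m)
    ⊗ inv (pochInf 1 1 ^ᵖ m)
    ⊗ prodPS (map (λ i → theta (suc i ℕ.+ 1) κ) (upTo m))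
    ⊗ prodPS (map (λ { (i , j) → theta (j ∸ i) κ ⊗ theta (i ℕ.+ j ℕ.+ 1) κ }) (pairs m))

{-# OPTIONS --safe #-}

-- With t = q^(2n), the sums over s^(1), s^(2), ... iterate the branching rule of Hall-Littlewood
-- polynomials, one residue class of exponents modulo 2n at a time.  So the left-hand side is
-- Σ_r q^|r| P_λ(1, q, q², ...; t) with λ' = (r_1, r_1, r_2, r_2, ...), a bounded Littlewood sum.
-- Partial fractions turn it into a sum over all ways of inverting some of the variables.  As t is a
-- power of q, such a term vanishes unless the inverted exponents are given by one threshold in each of
-- n classes modulo 2n, which leaves a lattice sum over ℤⁿ with a type C Vandermonde factor.  It is a
-- determinant of theta series, and its transpose is the lattice sum of a type B sign sum with modulus
-- κ, which is a product.  The remaining constant does not depend on m, and for m = 0 the sum is 1.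
-- The second product follows from the first by moving one factor at a time from n to m.  The
-- calculation takes place in ℤ[[q]][1/q], modulo powers of q.
module Submission where

-- Position y stands for the variable x = q^(y + e/2). In type C e = 1: since |λ| = 2|r|, the factor
-- q^|r| turns the alphabet 1, q, q², ... into q^(1/2), q^(3/2), ..., and only the integers y + y' +
-- e occur as exponents. In type B e = 0. The variables are fixed powers of q, so there is no free
-- variable in which to take residues. Every residue argument is therefore a finite identity between
-- the elements 1/(1 - q^k), valid as long as no exponent k is zero; this is why positions have to
-- be kept distinct from each other and from each other's reflections. The value at infinity enters
-- by letting the pole function be the constant -1. The alphabet is infinite, and inverting
-- variables creates negative positions. All alphabets are cut to chains of 2b positions centred at
-- the origin. A negative position contributes a factor divisible by q, so a threshold at distance k
-- from the centre is worth at least q^k, and the truncated sums stabilise modulo every q^D. The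
-- sign-sum factor of type B is chosen so that its limit along a progression is the product 1/(q^v;
-- q^(κ/2))_∞ and its sum over all signs is again a product.

open import Level using (0ℓ)
open import Algebra.Bundles using (CommutativeRing)
open import Data.Bool using (Bool; true; false)
open import Data.Empty using (⊥-elim)
open import Data.Integer as Z using (ℤ; +_; -[1+_])
import Data.Integer.Properties as ZP
import Data.Integer.Tactic.RingSolver as ZS
open import Data.List using (List; []; _∷_; _++_; length; map)
open import Data.List.Relation.Unary.All as All using (All; []; _∷_)
open import Data.Nat as N using (ℕ; zero; suc; _∸_; z≤n; s≤s)
import Data.Nat.Properties as NP
import Data.Nat.Tactic.RingSolver as NS
open import Data.Product using (_×_; _,_; proj₁; proj₂; ∃)
open import Data.Sum using (inj₁; inj₂)
open import Data.Unit using (⊤; tt)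
open import Relation.Binary.PropositionalEquality as E using (_≡_; _≢_)
open import Relation.Nullary using (yes; no)

open import Algebra.Solver.Ring.AlmostCommutativeRing using (AlmostCommutativeRing; fromCommutativeRing; _-Raw-AlmostCommutative⟶_)
open import Data.Maybe using (Maybe; just; nothing; is-just)

-- Commutative rings and normalisation

-- The laws of a commutative ring, restated so that their types mention only its fields:
-- the types that the standard library derives for them unfold to very large terms.
module LightRing (R : CommutativeRing 0ℓ 0ℓ) where
 private module C = CommutativeRing R
 open CommutativeRing R public using (Carrier; _≈_; _+_; _*_; -_; 0#; 1#)

 infixl 6 _-_
 infix 1 begin_
 infixr 2 _≈⟨_⟩_ _≈⟨_⟨_
 infix 3 _∎

 _-_ : Carrier → Carrier → Carrier
 x - y = x + (- y)

 refl : ∀ {x} → x ≈ x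
 refl = C.refl
 sym : ∀ {x y} → x ≈ y → y ≈ x
 sym = C.sym
 trans : ∀ {x y z} → x ≈ y → y ≈ z → x ≈ z
 trans = C.trans
 reflexive : ∀ {x y} → x E.≡ y → x ≈ y
 reflexive = C.reflexive
 begin_ : ∀ {x y} → x ≈ y → x ≈ y
 begin p = p
 _≈⟨_⟩_ : ∀ x {y z} → x ≈ y → y ≈ z → x ≈ z
 x ≈⟨ p ⟩ q = trans p q
 _≈⟨_⟨_ : ∀ x {y z} → y ≈ x → y ≈ z → x ≈ z
 x ≈⟨ p ⟨ q = trans (sym p) q
 _∎ : ∀ x → x ≈ x
 x ∎ = refl
 +-cong : ∀ {x y u v} → x ≈ y → u ≈ v → x + u ≈ y + v
 +-cong = C.+-cong
 +-congˡ : ∀ {x y z} → y ≈ z → x + y ≈ x + z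
 +-congˡ = C.+-congˡ
 +-congʳ : ∀ {x y z} → y ≈ z → y + x ≈ z + x
 +-congʳ = C.+-congʳ
 *-cong : ∀ {x y u v} → x ≈ y → u ≈ v → x * u ≈ y * v
 *-cong = C.*-cong
 *-congˡ : ∀ {x y z} → y ≈ z → x * y ≈ x * z
 *-congˡ = C.*-congˡ
 *-congʳ : ∀ {x y z} → y ≈ z → y * x ≈ z * x
 *-congʳ = C.*-congʳ
 -‿cong : ∀ {x y} → x ≈ y → - x ≈ - y
 -‿cong = C.-‿cong
 +-assoc : ∀ x y z → (x + y) + z ≈ x + (y + z)
 +-assoc = C.+-assoc
 *-assoc : ∀ x y z → (x * y) * z ≈ x * (y * z)
 *-assoc = C.*-assoc
 +-comm : ∀ x y → x + y ≈ y + x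
 +-comm = C.+-comm
 *-comm : ∀ x y → x * y ≈ y * x
 *-comm = C.*-comm
 +-identityˡ : ∀ x → 0# + x ≈ x
 +-identityˡ = C.+-identityˡ
 +-identityʳ : ∀ x → x + 0# ≈ x
 +-identityʳ = C.+-identityʳ
 *-identityˡ : ∀ x → 1# * x ≈ x
 *-identityˡ = C.*-identityˡ
 *-identityʳ : ∀ x → x * 1# ≈ x
 *-identityʳ = C.*-identityʳ
 zeroˡ : ∀ x → 0# * x ≈ 0#
 zeroˡ = C.zeroˡ
 zeroʳ : ∀ x → x * 0# ≈ 0#
 zeroʳ = C.zeroʳ
 distribˡ : ∀ x y z → x * (y + z) ≈ x * y + x * z
 distribˡ = C.distribˡ
 distribʳ : ∀ x y z → (y + z) * x ≈ y * x + z * x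
 distribʳ = C.distribʳ
 -‿inverseˡ : ∀ x → - x + x ≈ 0#
 -‿inverseˡ = C.-‿inverseˡ
 -‿inverseʳ : ∀ x → x + - x ≈ 0#
 -‿inverseʳ = C.-‿inverseʳ

-- Ring normalisation with integer coefficients in an arbitrary commutative ring.
module IntSolver (R : CommutativeRing 0ℓ 0ℓ) where
 import Algebra.Solver.Ring
 import Data.Vec as Vec
 open import Data.Bool using (T)
 open import Data.Vec.N-ary using (N-ary; _$ⁿ_; curryⁿ; curryⁿ-cong; Eq)
 open CommutativeRing R
 open import Algebra.Properties.Ring ring using (-‿distribˡ-*; -‿distribʳ-*; -0#≈0#; -‿involutive; -‿+-comm)
 open import Algebra.Properties.Semiring.Mult.TCOptimised semiring using (1+×; ×-homo-+; ×1-homo-*) renaming (_×_ to _·_)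
 open import Relation.Binary.Reasoning.Setoid setoid

 ⟦_⟧ℤ : ℤ → Carrier
 ⟦ + n ⟧ℤ = n · 1#
 ⟦ -[1+ n ] ⟧ℤ = - (suc n · 1#)

 private
  ⟦-⟧ : ∀ i → ⟦ Z.- i ⟧ℤ ≈ - ⟦ i ⟧ℤ
  ⟦-⟧ (+ zero) = sym -0#≈0#
  ⟦-⟧ (+ suc n) = refl
  ⟦-⟧ -[1+ n ] = sym (-‿involutive _)

  ⟦⊖⟧ : ∀ m n → ⟦ m Z.⊖ n ⟧ℤ ≈ m · 1# - n · 1#
  ⟦⊖⟧ m zero = sym (trans (+-congˡ -0#≈0#) (+-identityʳ _))
  ⟦⊖⟧ zero (suc n) = sym (+-identityˡ _)
  ⟦⊖⟧ (suc m) (suc n) = begin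
   ⟦ suc m Z.⊖ suc n ⟧ℤ ≡⟨ E.cong ⟦_⟧ℤ (ZP.[1+m]⊖[1+n]≡m⊖n m n) ⟩
   ⟦ m Z.⊖ n ⟧ℤ ≈⟨ ⟦⊖⟧ m n ⟩
   m · 1# - n · 1# ≈⟨ +-identityˡ _ ⟨
   0# + (m · 1# - n · 1#) ≈⟨ +-congʳ (-‿inverseʳ 1#) ⟨
   (1# - 1#) + (m · 1# - n · 1#) ≈⟨ +-assoc _ _ _ ⟩
   1# + (- 1# + (m · 1# - n · 1#)) ≈⟨ +-congˡ (trans (sym (+-assoc _ _ _)) (trans (+-congʳ (+-comm _ _)) (+-assoc _ _ _))) ⟩
   1# + (m · 1# + (- 1# - n · 1#)) ≈⟨ +-assoc _ _ _ ⟨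
   (1# + m · 1#) + (- 1# - n · 1#) ≈⟨ +-congˡ (-‿+-comm _ _) ⟩
   (1# + m · 1#) - (1# + n · 1#) ≈⟨ +-cong (1+× m 1#) (-‿cong (1+× n 1#)) ⟨
   suc m · 1# - suc n · 1# ∎

  ⟦+⟧ : ∀ i j → ⟦ i Z.+ j ⟧ℤ ≈ ⟦ i ⟧ℤ + ⟦ j ⟧ℤ
  ⟦+⟧ (+ m) (+ n) = ×-homo-+ 1# m n
  ⟦+⟧ (+ m) -[1+ n ] = ⟦⊖⟧ m (suc n)
  ⟦+⟧ -[1+ m ] (+ n) = trans (⟦⊖⟧ n (suc m)) (+-comm _ _)
  ⟦+⟧ -[1+ m ] -[1+ n ] = begin
   - (suc (suc (m N.+ n)) · 1#) ≡⟨ E.cong (λ k → - (suc k · 1#)) (E.sym (NP.+-suc m n)) ⟩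
   - ((suc m N.+ suc n) · 1#) ≈⟨ -‿cong (×-homo-+ 1# (suc m) (suc n)) ⟩
   - (suc m · 1# + suc n · 1#) ≈⟨ -‿+-comm _ _ ⟨
   - (suc m · 1#) - suc n · 1# ∎

  ⟦+*⟧ : ∀ m j → ⟦ + m Z.* j ⟧ℤ ≈ m · 1# * ⟦ j ⟧ℤ
  ⟦+*⟧ m (+ n) = trans (reflexive (E.cong ⟦_⟧ℤ (E.sym (ZP.pos-* m n)))) (×1-homo-* m n)
  ⟦+*⟧ m -[1+ n ] = begin
   ⟦ + m Z.* -[1+ n ] ⟧ℤ ≡⟨ E.cong ⟦_⟧ℤ (E.sym (ZP.neg-distribʳ-* (+ m) (+ suc n))) ⟩
   ⟦ Z.- (+ m Z.* + suc n) ⟧ℤ ≈⟨ ⟦-⟧ (+ m Z.* + suc n) ⟩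
   - ⟦ + m Z.* + suc n ⟧ℤ ≈⟨ -‿cong (⟦+*⟧ m (+ suc n)) ⟩
   - (m · 1# * (suc n · 1#)) ≈⟨ -‿distribʳ-* _ _ ⟩
   m · 1# * - (suc n · 1#) ∎

  ⟦*⟧ : ∀ i j → ⟦ i Z.* j ⟧ℤ ≈ ⟦ i ⟧ℤ * ⟦ j ⟧ℤ
  ⟦*⟧ (+ m) j = ⟦+*⟧ m j
  ⟦*⟧ -[1+ m ] j = begin
   ⟦ -[1+ m ] Z.* j ⟧ℤ ≡⟨ E.cong ⟦_⟧ℤ (E.sym (ZP.neg-distribˡ-* (+ suc m) j)) ⟩
   ⟦ Z.- (+ suc m Z.* j) ⟧ℤ ≈⟨ ⟦-⟧ (+ suc m Z.* j) ⟩
   - ⟦ + suc m Z.* j ⟧ℤ ≈⟨ -‿cong (⟦+*⟧ (suc m) j) ⟩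
   - (suc m · 1# * ⟦ j ⟧ℤ) ≈⟨ -‿distribˡ-* _ _ ⟩
   - (suc m · 1#) * ⟦ j ⟧ℤ ∎

 acr : AlmostCommutativeRing 0ℓ 0ℓ
 acr = fromCommutativeRing R

 morphism : CommutativeRing.rawRing ZP.+-*-commutativeRing -Raw-AlmostCommutative⟶ acr
 morphism = record
  { ⟦_⟧ = ⟦_⟧ℤ ; +-homo = ⟦+⟧ ; *-homo = ⟦*⟧ ; -‿homo = ⟦-⟧
  ; 0-homo = refl ; 1-homo = refl }

 private
  dec : ∀ i j → Maybe (⟦ i ⟧ℤ ≈ ⟦ j ⟧ℤ)
  dec i j with i Z.≟ j
  ... | yes E.refl = just refl
  ... | no _ = nothing

 private
  module RS = Algebra.Solver.Ring (CommutativeRing.rawRing ZP.+-*-commutativeRing) acr morphism dec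
 open RS public using (_:=_; _:+_; _:*_; _:-_; :-_; con; Polynomial)

 -- Comparing the normal forms as syntax is cheaper for the type checker than comparing values.
 solve : ∀ n (f : N-ary n (Polynomial n) (Polynomial n × Polynomial n)) → let e = f $ⁿ Vec.map RS.var (Vec.allFin n) in
  T (is-just (RS.normalise (proj₁ e) RS.≟N RS.normalise (proj₂ e))) → Eq n _≈_ (curryⁿ RS.⟦ proj₁ e ⟧) (curryⁿ RS.⟦ proj₂ e ⟧)
 solve n f p = curryⁿ-cong _≈_ RS.⟦ e₁ ⟧ RS.⟦ e₂ ⟧ (λ ρ → trans (sym (RS.correct e₁ ρ)) (trans (equal (RS.normalise e₁ RS.≟N RS.normalise e₂) p ρ) (RS.correct e₂ ρ)))
  where
  e₁ = proj₁ (f $ⁿ Vec.map RS.var (Vec.allFin n))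
  e₂ = proj₂ (f $ⁿ Vec.map RS.var (Vec.allFin n))
  equal : ∀ {p q} (m : Maybe (p RS.≈N q)) → T (is-just m) → ∀ ρ → RS.⟦ p ⟧N ρ ≈ RS.⟦ q ⟧N ρ
  equal (just e) _ ρ = RS.⟦ e ⟧N-cong ρ

 :1 : ∀ {n} → Polynomial n
 :1 = con (+ 1)

 :0 : ∀ {n} → Polynomial n
 :0 = con (+ 0)

-- Laurent series in q, axiomatically

record QRing : Set₁ where
 field
  R : CommutativeRing 0ℓ 0ℓ
 open LightRing R public
 field
  qz : ℤ → Carrier
  qz-0 : qz (+ 0) ≈ 1#
  qz-+ : ∀ k l → qz (k Z.+ l) ≈ qz k * qz l
  -- The inverse of 1 - q^k, always expanded in positive powers of q: for k < 0 it is -q^(-k)/(1 -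
  -- q^(-k)). This choice of expansion is what makes `Int-a` possible.
  a : ℤ → Carrier
  a-inv : ∀ {k} → k ≢ + 0 → (1# - qz k) * a k ≈ 1#
  -- The subring of series without negative powers of q. Congruence modulo q^D is expressed through
  -- it.
  Int : Carrier → Set
  Int-resp : ∀ {x y} → x ≈ y → Int x → Int y
  Int-1 : Int 1#
  Int-+ : ∀ {x y} → Int x → Int y → Int (x + y)
  Int-* : ∀ {x y} → Int x → Int y → Int (x * y)
  Int-neg : ∀ {x} → Int x → Int (- x)
  Int-qz : ∀ k → Int (qz (+ k))
  Int-a : ∀ k → Int (a k)

-- Sums over splittings, choices and bounded lists

module Sums (R : CommutativeRing 0ℓ 0ℓ) where
 open LightRing R
 open IntSolver R

 -- Sums over subsets run over order-preserving splittings. Summands are compared only under such a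
 -- witness, so that distinctness and similar facts about S pass to both blocks.
 data Split {X : Set} : List X → List X → List X → Set where
  [] : Split [] [] []
  lft : ∀ {s S K J} → Split S K J → Split (s ∷ S) (s ∷ K) J
  rgt : ∀ {s S K J} → Split S K J → Split (s ∷ S) K (s ∷ J)

 data Pick {X : Set} : List X → X → List X → Set where
  here : ∀ {x xs} → Pick (x ∷ xs) x xs
  there : ∀ {x y xs r} → Pick xs y r → Pick (x ∷ xs) y (x ∷ r)

 module _ {X : Set} where
  Spl : List X → (List X → List X → Carrier) → Carrier
  Spl [] f = f [] []
  Spl (s ∷ S) f = Spl S (λ K J → f (s ∷ K) J) + Spl S (λ K J → f K (s ∷ J))

  Sel : List X → (X → List X → Carrier) → Carrier
  Sel [] f = 0#
  Sel (x ∷ xs) f = f x xs + Sel xs (λ y r → f y (x ∷ r))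

  Π : List X → (X → Carrier) → Carrier
  Π [] f = 1#
  Π (x ∷ xs) f = f x * Π xs f

  Spl-cong : ∀ S {f g : List X → List X → Carrier} →
        (∀ {K J} → Split S K J → f K J ≈ g K J) → Spl S f ≈ Spl S g
  Spl-cong [] e = e []
  Spl-cong (s ∷ S) e = +-cong (Spl-cong S (λ p → e (lft p))) (Spl-cong S (λ p → e (rgt p)))

  Sel-cong : ∀ S {f g : X → List X → Carrier} →
        (∀ {x r} → Pick S x r → f x r ≈ g x r) → Sel S f ≈ Sel S g
  Sel-cong [] e = refl
  Sel-cong (s ∷ S) e = +-cong (e here) (Sel-cong S (λ p → e (there p)))

  Π-cong : ∀ S {f g : X → Carrier} → (∀ x → f x ≈ g x) → Π S f ≈ Π S g
  Π-cong [] e = refl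
  Π-cong (s ∷ S) e = *-cong (e s) (Π-cong S e)

  Π-congA : ∀ {S} {f g : X → Carrier} → All (λ x → f x ≈ g x) S → Π S f ≈ Π S g
  Π-congA [] = refl
  Π-congA (e ∷ es) = *-cong e (Π-congA es)

  +-inter : ∀ w x y z → (w + x) + (y + z) ≈ (w + y) + (x + z)
  +-inter = solve 4 (λ w x y z → (w :+ x) :+ (y :+ z) := (w :+ y) :+ (x :+ z)) tt

  *-inter : ∀ w x y z → (w * x) * (y * z) ≈ (w * y) * (x * z)
  *-inter = solve 4 (λ w x y z → (w :* x) :* (y :* z) := (w :* y) :* (x :* z)) tt

  Spl-+ : ∀ S (f g : List X → List X → Carrier) →
      Spl S (λ K J → f K J + g K J) ≈ Spl S f + Spl S g
  Spl-+ [] f g = refl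
  Spl-+ (s ∷ S) f g = trans (+-cong (Spl-+ S _ _) (Spl-+ S _ _)) (+-inter _ _ _ _)

  Spl-* : ∀ S c (f : List X → List X → Carrier) →
      Spl S (λ K J → c * f K J) ≈ c * Spl S f
  Spl-* [] c f = refl
  Spl-* (s ∷ S) c f = trans (+-cong (Spl-* S _ _) (Spl-* S _ _)) (sym (distribˡ _ _ _))

  Spl-0 : ∀ S → Spl S (λ _ _ → 0#) ≈ 0#
  Spl-0 [] = refl
  Spl-0 (s ∷ S) = trans (+-cong (Spl-0 S) (Spl-0 S)) (+-identityˡ _)

  Sel-+ : ∀ S (f g : X → List X → Carrier) →
      Sel S (λ K J → f K J + g K J) ≈ Sel S f + Sel S g
  Sel-+ [] f g = sym (+-identityˡ _)
  Sel-+ (s ∷ S) f g = trans (+-congˡ (Sel-+ S _ _)) (+-inter _ _ _ _)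

  Sel-* : ∀ S c (f : X → List X → Carrier) →
      Sel S (λ K J → c * f K J) ≈ c * Sel S f
  Sel-* [] c f = sym (zeroʳ _)
  Sel-* (s ∷ S) c f = trans (+-congˡ (Sel-* S _ _)) (sym (distribˡ _ _ _))

  -- Both sides distribute S over three blocks K, A, B.
  Spl-assoc : ∀ S (g : List X → List X → List X → Carrier) →
        Spl S (λ K J → Spl J (λ A B → g K A B)) ≈ Spl S (λ I B → Spl I (λ K A → g K A B))
  Spl-assoc [] g = refl
  Spl-assoc (s ∷ S) g = begin
   _ ≈⟨ +-congˡ (Spl-+ S _ _) ⟩
   _ ≈⟨ +-assoc _ _ _ ⟨
   _ ≈⟨ +-cong (+-cong (Spl-assoc S _) (Spl-assoc S _)) (Spl-assoc S _) ⟩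
   _ ≈⟨ +-congʳ (Spl-+ S _ _) ⟨
   _ ∎

  -- Choosing a block and then a point outside it, or a larger block and a point inside it.
  Spl-Sel : ∀ S (g : List X → X → List X → Carrier) (h : X → List X → List X → Carrier) →
       (∀ {K J x J'} → Split S K J → Pick J x J' → ∀ {I} → Split S I J' → Pick I x K → g K x J' ≈ h x K J') →
       Spl S (λ K J → Sel J (λ x J' → g K x J')) ≈ Spl S (λ I B → Sel I (λ x K → h x K B))
  Spl-Sel [] g h e = refl
  Spl-Sel (s ∷ S) g h e = begin
   _ ≈⟨ +-congˡ (Spl-+ S _ _) ⟩
   _ ≈⟨ comb P Q₁ Q₂ ⟩
   _ ≈⟨ +-cong (+-cong
     (Spl-cong S (λ p → e (rgt p) here (lft p) here))
     (Spl-Sel S _ (λ x K B → h x (s ∷ K) B) (λ p i p' i' → e (lft p) i (lft p') (there i'))))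
     (Spl-Sel S _ (λ x K B → h x K (s ∷ B)) (λ p i p' i' → e (rgt p) (there i) (rgt p') i')) ⟩
   _ ≈⟨ +-congʳ (Spl-+ S _ _) ⟨
   _ ∎
   where
   P = Spl S (λ K J → Sel J (g (s ∷ K)))
   Q₁ = Spl S (λ K J → g K s J)
   Q₂ = Spl S (λ K J → Sel J (λ y r → g K y (s ∷ r)))
   comb : ∀ x y z → x + (y + z) ≈ (y + x) + z
   comb = solve 3 (λ x y z → x :+ (y :+ z) := (y :+ x) :+ z) tt

  Sel-Spl : ∀ S (g : X → List X → List X → Carrier) (h : List X → X → List X → Carrier) →
       (∀ {x r K J'} → Pick S x r → Split r K J' → ∀ {J} → Split S K J → Pick J x J' → g x K J' ≈ h K x J') →
       Sel S (λ x r → Spl r (λ K J' → g x K J')) ≈ Spl S (λ K J → Sel J (λ x J' → h K x J'))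
  Sel-Spl [] g h e = refl
  Sel-Spl (s ∷ S) g h e = begin
   _ ≈⟨ +-congˡ (Sel-+ S _ _) ⟩
   _ ≈⟨ comb P Q₁ Q₂ ⟩
   _ ≈⟨ +-cong
     (Sel-Spl S _ (λ K x J' → h (s ∷ K) x J') (λ i p p' i' → e (there i) (lft p) (lft p') i'))
     (+-cong (Spl-cong S (λ p → e here p (rgt p) here))
      (Sel-Spl S _ (λ K x J' → h K x (s ∷ J')) (λ i p p' i' → e (there i) (rgt p) (rgt p') (there i')))) ⟩
   _ ≈⟨ +-congˡ (Spl-+ S _ _) ⟨
   _ ∎
   where
   P = Spl S (g s)
   Q₁ = Sel S (λ x r → Spl r (λ K J' → g x (s ∷ K) J'))
   Q₂ = Sel S (λ x r → Spl r (λ K J' → g x K (s ∷ J')))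
   comb : ∀ x y z → x + (y + z) ≈ y + (x + z)
   comb = solve 3 (λ x y z → x :+ (y :+ z) := y :+ (x :+ z)) tt

  Π-pick : ∀ {S x r} (f : X → Carrier) → Pick S x r → Π S f ≈ f x * Π r f
  Π-pick f here = refl
  Π-pick {y ∷ S} {x} {_ ∷ r} f (there p) = trans (*-congˡ (Π-pick f p)) (comb (f y) (f x) (Π r f))
   where
   comb : ∀ x y z → x * (y * z) ≈ y * (x * z)
   comb = solve 3 (λ x y z → x :* (y :* z) := y :* (x :* z)) tt

  Π-split : ∀ {S K J} (f : X → Carrier) → Split S K J → Π S f ≈ Π K f * Π J f
  Π-split f [] = sym (*-identityˡ _)
  Π-split f (lft p) = trans (*-congˡ (Π-split f p)) (sym (*-assoc _ _ _))
  Π-split {y ∷ S} {K} {_ ∷ J} f (rgt p) = trans (*-congˡ (Π-split f p)) (comb (f y) (Π K f) (Π J f))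
   where
   comb : ∀ x y z → x * (y * z) ≈ y * (x * z)
   comb = solve 3 (λ x y z → x :* (y :* z) := y :* (x :* z)) tt

  Π-* : ∀ S (f g : X → Carrier) → Π S (λ x → f x * g x) ≈ Π S f * Π S g
  Π-* [] f g = sym (*-identityˡ _)
  Π-* (s ∷ S) f g = trans (*-congˡ (Π-* S f g)) (*-inter _ _ _ _)

  Π-1 : ∀ S → Π S (λ _ → 1#) ≈ 1#
  Π-1 [] = refl
  Π-1 (s ∷ S) = trans (*-identityˡ _) (Π-1 S)

  Π-++ : ∀ S T (f : X → Carrier) → Π (S ++ T) f ≈ Π S f * Π T f
  Π-++ [] T f = sym (*-identityˡ _)
  Π-++ (s ∷ S) T f = trans (*-congˡ (Π-++ S T f)) (sym (*-assoc _ _ _))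

 Π-map : ∀ {X Y : Set} (φ : X → Y) S (f : Y → Carrier) → Π (map φ S) f ≈ Π S (λ x → f (φ x))
 Π-map φ [] f = refl
 Π-map φ (s ∷ S) f = *-congˡ (Π-map φ S f)

 module _ {X : Set} {P : X → Set} where
  All-pick : ∀ {S x r} → Pick S x r → All P S → P x × All P r
  All-pick here (p ∷ ps) = p , ps
  All-pick (there i) (p ∷ ps) with All-pick i ps
  ... | px , pr = px , p ∷ pr

  All-split : ∀ {S K J} → Split S K J → All P S → All P K × All P J
  All-split [] [] = [] , []
  All-split (lft s) (p ∷ ps) with All-split s ps
  ... | k , j = p ∷ k , j
  All-split (rgt s) (p ∷ ps) with All-split s ps
  ... | k , j = k , p ∷ j

 sumTo : ℕ → (ℕ → Carrier) → Carrier
 sumTo zero f = 0#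
 sumTo (suc n) f = f zero + sumTo n (λ i → f (suc i))

 sumTo-cong : ∀ n {f g : ℕ → Carrier} → (∀ i → i N.< n → f i ≈ g i) → sumTo n f ≈ sumTo n g
 sumTo-cong zero e = refl
 sumTo-cong (suc n) e = +-cong (e 0 (N.s≤s N.z≤n)) (sumTo-cong n (λ i l → e (suc i) (N.s≤s l)))

 sumTo-+ : ∀ n (f g : ℕ → Carrier) → sumTo n (λ i → f i + g i) ≈ sumTo n f + sumTo n g
 sumTo-+ zero f g = sym (+-identityˡ _)
 sumTo-+ (suc n) f g = trans (+-congˡ (sumTo-+ n _ _)) (+-inter {X = ℕ} _ _ _ _)

 sumTo-* : ∀ n c (f : ℕ → Carrier) → sumTo n (λ i → c * f i) ≈ c * sumTo n f
 sumTo-* zero c f = sym (zeroʳ _)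
 sumTo-* (suc n) c f = trans (+-congˡ (sumTo-* n c _)) (sym (distribˡ _ _ _))

 sumTo-0 : ∀ n → sumTo n (λ _ → 0#) ≈ 0#
 sumTo-0 zero = refl
 sumTo-0 (suc n) = trans (+-identityˡ _) (sumTo-0 n)

 ΣL : ℕ → ℕ → (List ℕ → Carrier) → Carrier
 ΣL B zero f = f []
 ΣL B (suc n) f = sumTo (suc B) (λ x → ΣL B n (λ v → f (x ∷ v)))

 ΣL-cong : ∀ B n {f g : List ℕ → Carrier} → (∀ v → length v ≡ n → All (N._≤ B) v → f v ≈ g v) → ΣL B n f ≈ ΣL B n g
 ΣL-cong B zero e = e [] E.refl []
 ΣL-cong B (suc n) e = sumTo-cong (suc B) (λ { i (N.s≤s l) → ΣL-cong B n (λ v q p → e (i ∷ v) (E.cong suc q) (l ∷ p)) })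

 ΣL-+ : ∀ B n (f g : List ℕ → Carrier) → ΣL B n (λ v → f v + g v) ≈ ΣL B n f + ΣL B n g
 ΣL-+ B zero f g = refl
 ΣL-+ B (suc n) f g = trans (sumTo-cong (suc B) (λ i _ → ΣL-+ B n (λ v → f (i ∷ v)) (λ v → g (i ∷ v))))
  (sumTo-+ (suc B) (λ i → ΣL B n (λ v → f (i ∷ v))) (λ i → ΣL B n (λ v → g (i ∷ v))))

 ΣL-* : ∀ B n c (f : List ℕ → Carrier) → ΣL B n (λ v → c * f v) ≈ c * ΣL B n f
 ΣL-* B zero c f = refl
 ΣL-* B (suc n) c f = trans (sumTo-cong (suc B) (λ i _ → ΣL-* B n c (λ v → f (i ∷ v))))
  (sumTo-* (suc B) c (λ i → ΣL B n (λ v → f (i ∷ v))))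

 ΣL-0 : ∀ B n → ΣL B n (λ _ → 0#) ≈ 0#
 ΣL-0 B zero = refl
 ΣL-0 B (suc n) = trans (sumTo-cong (suc B) (λ i _ → ΣL-0 B n)) (sumTo-0 (suc B))

open import Data.Nat using (_≤_)

-- Determinants and Vandermonde products

module Determinants (R : CommutativeRing 0ℓ 0ℓ) where
 open LightRing R
 open IntSolver R
 open Sums R

 -- The signs are those of a Laplace expansion along one row or column.
 Sel± : {X : Set} → List X → (X → List X → Carrier) → Carrier
 Sel± [] f = 0#
 Sel± (x ∷ xs) f = f x xs - Sel± xs (λ y r → f y (x ∷ r))

 module _ {X : Set} where
  Sel±-cong : ∀ S {f g : X → List X → Carrier} → (∀ {x r} → Pick S x r → f x r ≈ g x r) → Sel± S f ≈ Sel± S g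
  Sel±-cong [] e = refl
  Sel±-cong (s ∷ S) e = +-cong (e here) (-‿cong (Sel±-cong S (λ p → e (there p))))

  Sel±-+ : ∀ S (f g : X → List X → Carrier) → Sel± S (λ x r → f x r + g x r) ≈ Sel± S f + Sel± S g
  Sel±-+ [] f g = sym (+-identityˡ _)
  Sel±-+ (s ∷ S) f g = trans (+-congˡ (-‿cong (Sel±-+ S _ _))) (solve 4 (λ a b c d → (a :+ b) :- (c :+ d) := (a :- c) :+ (b :- d)) tt _ _ _ _)

  Sel±-* : ∀ S c (f : X → List X → Carrier) → Sel± S (λ x r → c * f x r) ≈ c * Sel± S f
  Sel±-* [] c f = sym (zeroʳ _)
  Sel±-* (s ∷ S) c f = trans (+-congˡ (-‿cong (Sel±-* S c _))) (solve 3 (λ a b c → c :* a :- c :* b := c :* (a :- b)) tt _ _ c)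

  Sel±-neg : ∀ S (f : X → List X → Carrier) → Sel± S (λ x r → - f x r) ≈ - Sel± S f
  Sel±-neg [] f = solve 0 (:0 := :- :0) tt
  Sel±-neg (s ∷ S) f = trans (+-congˡ (-‿cong (Sel±-neg S _))) (solve 2 (λ a b → :- a :- :- b := :- (a :- b)) tt _ _)

 Sel±-comm : ∀ {X Y : Set} S T (f : X → List X → Y → List Y → Carrier) →
       Sel± S (λ x r → Sel± T (λ y s → f x r y s)) ≈ Sel± T (λ y s → Sel± S (λ x r → f x r y s))
 Sel±-comm [] T f = sym (zeros T)
  where
  zeros : ∀ T → Sel± T (λ _ _ → 0#) ≈ 0#
  zeros [] = refl
  zeros (t ∷ T) = trans (+-congˡ (-‿cong (zeros T))) (-‿inverseʳ 0#)
 Sel±-comm (x ∷ S) T f = trans (+-congˡ (-‿cong (Sel±-comm S T _))) (trans (+-congˡ (sym (Sel±-neg T _))) (sym (Sel±-+ T _ _)))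

 module _ {I J : Set} (m : I → J → Carrier) where
  det det′ : List I → List J → Carrier
  det [] js = 1#
  det (i ∷ is) js = Sel± js (λ j r → m i j * det is r)
  det′ is [] = 1#
  det′ is (j ∷ js) = Sel± is (λ i r → m i j * det′ r js)

  private
   length-pick : ∀ {X : Set} {S : List X} {x r} → Pick S x r → length S ≡ suc (length r)
   length-pick here = E.refl
   length-pick (there i) = E.cong suc (length-pick i)

  -- Apart from the common corner term, each expansion is expanded once more in the other direction.
  -- Both become the same double sum over a row and a column, up to `Sel±-comm`.
  det≈det′ : ∀ n is js → length is ≡ n → length js ≡ n → det is js ≈ det′ is js
  det≈det′ zero [] [] _ _ = refl
  det≈det′ (suc n) (i ∷ is) (j ∷ js) p q = +-cong (*-congˡ (det≈det′ n is js p′ q′)) (-‿cong (begin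
   _ ≈⟨ Sel±-cong js (λ {j'} {r} k → trans (*-congˡ (det≈det′ n is (j ∷ r) p′ (E.trans (E.sym (length-pick k)) q′))) (sym (Sel±-* is _ _))) ⟩
   _ ≈⟨ Sel±-comm js is _ ⟩
   _ ≈⟨ Sel±-cong is (λ {i'} {s} k → trans (Sel±-cong js (λ {j'} {r} k' → trans (solve 3 (λ x y z → x :* (y :* z) := y :* (x :* z)) tt _ _ _)
       (*-congˡ (*-congˡ (sym (sub n p′ q′ k k'))))))
      (trans (Sel±-* js _ _) (*-congˡ (det≈det′ n (i ∷ s) js (E.trans (E.sym (length-pick k)) p′) q′)))) ⟩
   _ ∎))
   where
   p′ = NP.suc-injective p
   q′ = NP.suc-injective q
   sub : ∀ n → length is ≡ n → length js ≡ n → ∀ {i' s j' r} → Pick is i' s → Pick js j' r → det s r ≈ det′ s r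
   sub zero l _ k k' with E.trans (E.sym (length-pick k)) l
   ... | ()
   sub (suc n) l l' {s = s} {r = r} k k' = det≈det′ n s r (NP.suc-injective (E.trans (E.sym (length-pick k)) l)) (NP.suc-injective (E.trans (E.sym (length-pick k')) l'))

 module Vandermonde {X : Set} (ξ : X → Carrier) where
  V : List X → Carrier
  V [] = 1#
  V (x ∷ xs) = Π xs (λ y → ξ x - ξ y) * V xs

  -- A determinant expanded along its column φ, whose minors are Vandermonde products. Divided by V
  -- it is the divided difference of φ.
  L : (X → Carrier) → List X → Carrier
  L φ xs = Sel± xs (λ x r → φ x * V r)

  private
   -- Lagrange interpolation of the constant 1, evaluated at c and multiplied by the Vandermonde
   -- product.
   lagrange : ∀ c x xs → Sel± (x ∷ xs) (λ y r → Π r (λ z → c - ξ z) * V r) ≈ V (x ∷ xs)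
   lagrange c x [] = solve 0 (:1 :* :1 :- :0 := :1 :* :1) tt
   lagrange c x (y ∷ ys) = begin
    _ ≈⟨ +-congˡ (-‿cong (Sel±-cong T step)) ⟩
    _ ≈⟨ +-congˡ (-‿cong (trans (Sel±-+ T (λ z r → A * f₁ r) (λ z r → - B * f₂ r)) (+-cong (trans (Sel±-* T A (λ _ → f₁)) (*-congˡ (lagrange (ξ x) y ys))) (trans (Sel±-* T (- B) (λ _ → f₂)) (*-congˡ (lagrange c y ys)))))) ⟩
    _ ≈⟨ solve 3 (λ a b v → a :* v :- (a :* v :+ :- b :* v) := b :* v) tt A B (V T) ⟩
    B * V T ∎
    where
    T = y ∷ ys
    A = Π T (λ z → c - ξ z)
    B = Π T (λ z → ξ x - ξ z)
    f₁ f₂ : List X → Carrier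
    f₁ r = Π r (λ z → ξ x - ξ z) * V r
    f₂ r = Π r (λ z → c - ξ z) * V r
    step : ∀ {z r} → Pick T z r → Π (x ∷ r) (λ z → c - ξ z) * V (x ∷ r) ≈ A * (Π r (λ z → ξ x - ξ z) * V r) + (- B) * (Π r (λ z → c - ξ z) * V r)
    step {z} {r} k = sym (trans (+-cong (*-congʳ (Π-pick _ k)) (*-congʳ (-‿cong (Π-pick _ k))))
     (solve 6 (λ c x z p q v → ((c :- z) :* p) :* (q :* v) :+ (:- ((x :- z) :* q)) :* (p :* v) := ((c :- x) :* p) :* (q :* v)) tt c (ξ x) (ξ z) _ _ (V r)))

  L-1 : ∀ x y xs → L (λ _ → 1#) (x ∷ y ∷ xs) ≈ 0#
  L-1 x y xs = begin
   _ ≈⟨ +-cong (*-identityˡ _) (-‿cong (trans (Sel±-cong T (λ {_} {r} _ → *-identityˡ (Π r (λ z → ξ x - ξ z) * V r))) (lagrange (ξ x) y xs))) ⟩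
   V T - V T ≈⟨ -‿inverseʳ _ ⟩
   0# ∎
   where T = y ∷ xs

  -- Write ξ y = ξ x - (ξ x - ξ y). The difference completes the product over the remaining nodes to
  -- the product over all of xs, which comes out of the sum.
  L-ξ : ∀ φ x xs → L (λ y → ξ y * φ y) (x ∷ xs) ≈ ξ x * L φ (x ∷ xs) + Π xs (λ y → ξ x - ξ y) * L φ xs
  L-ξ φ x xs = begin
   _ ≈⟨ +-congˡ (-‿cong (trans (Sel±-cong xs step) (trans (Sel±-+ xs _ _) (+-cong (Sel±-* xs (ξ x) _) (Sel±-* xs (- w) _))))) ⟩
   _ ≈⟨ solve 6 (λ x f v s w l → x :* f :* v :- (x :* s :+ :- w :* l) := x :* (f :* v :- s) :+ w :* l) tt (ξ x) (φ x) (V xs) s₁ w (L φ xs) ⟩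
   _ ∎
   where
   w = Π xs (λ y → ξ x - ξ y)
   s₁ = Sel± xs (λ y r → φ y * (Π r (λ z → ξ x - ξ z) * V r))
   step : ∀ {y r} → Pick xs y r → ξ y * φ y * (Π r (λ z → ξ x - ξ z) * V r) ≈ ξ x * (φ y * (Π r (λ z → ξ x - ξ z) * V r)) + (- w) * (φ y * V r)
   step {y} {r} k = sym (trans (+-congˡ (*-congʳ (-‿cong (Π-pick _ k))))
    (solve 5 (λ x y f p v → x :* (f :* (p :* v)) :+ (:- ((x :- y) :* p)) :* (f :* v) := y :* f :* (p :* v)) tt (ξ x) (ξ y) (φ y) _ (V r)))

  L-+ : ∀ φ ψ xs → L (λ y → φ y + ψ y) xs ≈ L φ xs + L ψ xs
  L-+ φ ψ xs = trans (Sel±-cong xs (λ _ → distribʳ _ _ _)) (Sel±-+ xs _ _)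

  L-* : ∀ c φ xs → L (λ y → c * φ y) xs ≈ c * L φ xs
  L-* c φ xs = trans (Sel±-cong xs (λ _ → *-assoc _ _ _)) (Sel±-* xs c _)

  -- A three-term recurrence makes φ k monic of degree k in ξ.
  module Recurrence (c d : Carrier) (φ : ℕ → X → Carrier)
   (φ₀ : ∀ x → φ 0 x ≈ 1#) (φ₁ : ∀ x → φ 1 x ≈ ξ x + d)
   (φ₂ : ∀ k x → φ (2 N.+ k) x ≈ ξ x * φ (suc k) x - c * φ k x) where

   private
    L-cong : ∀ {φ ψ : X → Carrier} → (∀ x → φ x ≈ ψ x) → ∀ xs → L φ xs ≈ L ψ xs
    L-cong e xs = Sel±-cong xs (λ _ → *-congʳ (e _))

    L-φ₂ : ∀ k x xs → L (φ (2 N.+ k)) (x ∷ xs) ≈ ξ x * L (φ (suc k)) (x ∷ xs) + Π xs (λ y → ξ x - ξ y) * L (φ (suc k)) xs + (- c) * L (φ k) (x ∷ xs)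
    L-φ₂ k x xs = trans (L-cong (λ y → trans (φ₂ k y) (solve 3 (λ u c v → u :- c :* v := u :+ (:- c) :* v) tt (ξ y * φ (suc k) y) c (φ k y))) (x ∷ xs))
     (trans (L-+ _ _ (x ∷ xs)) (+-cong (L-ξ (φ (suc k)) x xs) (L-* (- c) (φ k) (x ∷ xs))))

    L-φ₁ : ∀ x xs → L (φ 1) (x ∷ xs) ≈ ξ x * L (φ 0) (x ∷ xs) + Π xs (λ y → ξ x - ξ y) * L (φ 0) xs + d * L (φ 0) (x ∷ xs)
    L-φ₁ x xs = trans (L-cong (λ y → trans (φ₁ y) (+-cong (trans (sym (*-identityʳ _)) (*-congˡ (sym (φ₀ y)))) (trans (sym (*-identityʳ _)) (*-congˡ (sym (φ₀ y)))))) (x ∷ xs))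
     (trans (L-+ _ _ (x ∷ xs)) (+-cong (L-ξ (φ 0) x xs) (L-* d (φ 0) (x ∷ xs))))

   -- A divided difference kills polynomials whose degree is less than the number of nodes minus
   -- one. In the boundary degree, treated by `top`, it returns the leading coefficient 1.
   low : ∀ k xs → 2 N.+ k ≤ length xs → L (φ k) xs ≈ 0#
   low zero (x ∷ y ∷ xs) _ = trans (L-cong φ₀ (x ∷ y ∷ xs)) (L-1 x y xs)
   low zero (x ∷ []) (s≤s ())
   low (suc zero) (x ∷ xs) (s≤s p) = trans (L-φ₁ x xs) (trans (+-cong (+-cong (*-congˡ (low 0 (x ∷ xs) (NP.m≤n⇒m≤1+n p))) (*-congˡ (low 0 xs p))) (*-congˡ (low 0 (x ∷ xs) (NP.m≤n⇒m≤1+n p))))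
     (solve 3 (λ x y z → x :* :0 :+ y :* :0 :+ z :* :0 := :0) tt _ _ _))
   low (suc (suc k)) (x ∷ xs) (s≤s p) = trans (L-φ₂ k x xs) (trans (+-cong (+-cong (*-congˡ (low (suc k) (x ∷ xs) (NP.m≤n⇒m≤1+n p))) (*-congˡ (low (suc k) xs p))) (*-congˡ (low k (x ∷ xs) (NP.m≤n⇒m≤1+n (NP.<⇒≤ p)))))
     (solve 3 (λ x y z → x :* :0 :+ y :* :0 :+ z :* :0 := :0) tt _ _ _))

   top : ∀ k xs → length xs ≡ suc k → L (φ k) xs ≈ V xs
   top zero (x ∷ []) _ = trans (+-congʳ (*-congʳ (φ₀ x))) (solve 0 (:1 :* :1 :- :0 := :1 :* :1) tt)
   top (suc zero) (x ∷ xs) p = trans (L-φ₁ x xs) (trans (+-cong (+-cong (*-congˡ (low 0 (x ∷ xs) (NP.≤-reflexive (E.sym p)))) (*-congˡ (top 0 xs (NP.suc-injective p)))) (*-congˡ (low 0 (x ∷ xs) (NP.≤-reflexive (E.sym p)))))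
     (solve 4 (λ x y z v → x :* :0 :+ y :* v :+ z :* :0 := y :* v) tt _ _ _ _))
   top (suc (suc k)) (x ∷ xs) p = trans (L-φ₂ k x xs) (trans (+-cong (+-cong (*-congˡ (low (suc k) (x ∷ xs) (NP.≤-reflexive (E.sym p)))) (*-congˡ (top (suc k) xs (NP.suc-injective p)))) (*-congˡ (low k (x ∷ xs) (NP.≤-trans (NP.n≤1+n _) (NP.≤-reflexive (E.sym p))))))
     (solve 4 (λ x y z v → x :* :0 :+ y :* v :+ z :* :0 := y :* v) tt _ _ _ _))

   down : ℕ → List ℕ
   down zero = []
   down (suc n) = n ∷ down n

   det-V : ∀ (y : X → Carrier) n xs → length xs ≡ n → det (λ k x → y x * φ k x) (down n) xs ≈ Π xs y * V xs
   det-V y zero [] _ = sym (*-identityˡ _)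
   det-V y (suc n) xs p = begin
    _ ≈⟨ Sel±-cong xs (λ {x} {r} k → trans (*-congˡ (det-V y n r (NP.suc-injective (E.trans (E.sym (lp k)) p))))
        (trans (solve 4 (λ a b c d → a :* b :* (c :* d) := (a :* c) :* (b :* d)) tt _ _ _ _) (*-congʳ (sym (Π-pick y k))))) ⟩
    _ ≈⟨ Sel±-* xs _ _ ⟩
    _ ≈⟨ *-congˡ (top n xs p) ⟩
    _ ∎
    where
    lp : ∀ {S : List X} {x r} → Pick S x r → length S ≡ suc (length r)
    lp here = E.refl
    lp (there i) = E.cong suc (lp i)

-- Geometric factors in q and the Hall-Littlewood kernel

module LatticeSum (Q : QRing) (H : ℕ) (M≢0 : H N.+ H ≢ 0) (e : ℤ) where

 open QRing Q public
 open IntSolver R public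
 open Sums R public

 -- This module is used twice: with H = n and e = 1 for type C, where t = q^(2n), and with H = m + n
 -- + 1 and e = 0 for type B, where the modulus is κ.
 M₀ : ℕ
 M₀ = H N.+ H

 qz-cong : ∀ {k l} → k ≡ l → qz k ≈ qz l
 qz-cong e = reflexive (E.cong qz e)

 b : ℤ → Carrier
 b k = a k - 1#

 a-cong : ∀ {k l} → k ≡ l → a k ≈ a l
 a-cong e = reflexive (E.cong a e)

 b-cong : ∀ {k l} → k ≡ l → b k ≈ b l
 b-cong e = reflexive (E.cong b e)

 neg≢0 : ∀ {k} → k ≢ + 0 → Z.- k ≢ + 0
 neg≢0 {k} k≢0 e = k≢0 (E.trans (E.sym (ZP.neg-involutive k)) (E.cong Z.-_ e))

 qz-inv : ∀ k → qz (Z.- k) * qz k ≈ 1#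
 qz-inv k = begin
  _ ≈⟨ qz-+ (Z.- k) k ⟨
  _ ≈⟨ qz-cong (ZP.+-inverseˡ k) ⟩
  qz (+ 0) ≈⟨ qz-0 ⟩
  1# ∎

 b≈qa : ∀ {k} → k ≢ + 0 → b k ≈ qz k * a k
 b≈qa {k} k≢0 = begin
  a k - 1# ≈⟨ +-congˡ (-‿cong (a-inv k≢0)) ⟨
  _ ≈⟨ solve 2 (λ x y → x :- (:1 :- y) :* x := y :* x) tt _ _ ⟩
  qz k * a k ∎

 inverse-unique : ∀ {u x y} → u * x ≈ 1# → u * y ≈ 1# → x ≈ y
 inverse-unique {u} {x} {y} ux uy = begin
  x ≈⟨ *-identityʳ x ⟨
  x * 1# ≈⟨ *-congˡ uy ⟨
  x * (u * y) ≈⟨ solve 3 (λ x u y → x :* (u :* y) := (u :* x) :* y) tt x u y ⟩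
  (u * x) * y ≈⟨ *-congʳ ux ⟩
  1# * y ≈⟨ *-identityˡ y ⟩
  y ∎

 a-neg : ∀ {k} → k ≢ + 0 → a (Z.- k) ≈ 1# - a k
 a-neg {k} k≢0 = inverse-unique (a-inv (neg≢0 k≢0)) (begin
  _ ≈⟨ solve 2 (λ p x → (:1 :- p) :* (:1 :- x) := :1 :- x :+ p :* (x :- :1)) tt _ _ ⟩
  _ ≈⟨ +-congˡ (*-congˡ (b≈qa k≢0)) ⟩
  _ ≈⟨ +-congˡ (trans (sym (*-assoc _ _ _)) (trans (*-congʳ (qz-inv k)) (*-identityˡ _))) ⟩
  _ ≈⟨ solve 1 (λ x → :1 :- x :+ x := :1) tt _ ⟩
  1# ∎)
  where p = qz (Z.- k)

 b-neg : ∀ {k} → k ≢ + 0 → b (Z.- k) ≈ - 1# - b k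
 b-neg {k} k≢0 = trans (+-congʳ (a-neg k≢0)) (solve 1 (λ x → :1 :- x :- :1 := :- :1 :- (x :- :1)) tt _)

 b-neg′ : ∀ {k} → k ≢ + 0 → b (Z.- k) ≈ - a k
 b-neg′ {k} k≢0 = trans (b-neg k≢0) (solve 1 (λ x → :- :1 :- (x :- :1) := :- x) tt _)

 a-neg′ : ∀ {k} → k ≢ + 0 → a (Z.- k) ≈ - (qz k * a k)
 a-neg′ {k} k≢0 = begin
  a (Z.- k) ≈⟨ a-neg k≢0 ⟩
  1# - a k ≈⟨ solve 1 (λ x → :1 :- x := :- (x :- :1)) tt _ ⟩
  - b k ≈⟨ -‿cong (b≈qa k≢0) ⟩
  _ ∎

 -- With k = z - p and l = z - p' this separates two simple poles in q^z: each coefficient is the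
 -- other factor evaluated at the pole.
 b-mul : ∀ {k l} → k ≢ + 0 → l ≢ + 0 → l Z.- k ≢ + 0 →
     b k * b l ≈ b k * b (l Z.- k) + b l * b (k Z.- l)
 b-mul {k} {l} k≢0 l≢0 lk≢0 = begin
  b k * b l ≈⟨ *-cong (b≈qa k≢0) bl ⟩
  _ ≈⟨ solve 5 (λ u v A B C →
     (u :* A) :* (u :* v :* B) := (u :* A) :* (v :* C) :+ (u :* v :* B) :* (:- C)
      :- u :* v :* (A :* C :- B :* C :- u :* A :* B)) tt u v A B C ⟩
  _ ≈⟨ +-congˡ (-‿cong (trans (*-congˡ key) (zeroʳ _))) ⟩
  _ ≈⟨ solve 1 (λ x → x :- :0 := x) tt _ ⟩
  _ ≈⟨ +-cong (*-cong (b≈qa k≢0) (b≈qa lk≢0)) (*-cong bl bkl) ⟨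
  _ ∎
  where
  u = qz k
  v = qz (l Z.- k)
  A = a k
  B = a l
  C = a (l Z.- k)
  qzl : qz l ≈ u * v
  qzl = trans (qz-cong (lem k l)) (qz-+ k (l Z.- k))
   where
   lem : ∀ k l → l ≡ k Z.+ (l Z.- k)
   lem = ZS.solve-∀
  bl : b l ≈ u * v * B
  bl = trans (b≈qa l≢0) (*-congʳ qzl)
  bkl : b (k Z.- l) ≈ - C
  bkl = trans (b-cong (lem k l)) (b-neg′ lk≢0)
   where
   lem : ∀ k l → k Z.- l ≡ Z.- (l Z.- k)
   lem = ZS.solve-∀
  invB : (1# - u * v) * B ≈ 1#
  invB = trans (*-congʳ (+-congˡ (-‿cong (sym qzl)))) (a-inv l≢0)
  key : A * C - B * C - u * A * B ≈ 0#
  key = begin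
   _ ≈⟨ solve 4 (λ A B C u → A :* C :- B :* C :- u :* A :* B := A :* C :* :1 :- B :* C :* :1 :- u :* A :* B :* :1) tt A B C u ⟩
   _ ≈⟨ +-cong (+-cong (*-congˡ invB) (-‿cong (*-congˡ (a-inv k≢0)))) (-‿cong (*-congˡ (a-inv lk≢0))) ⟨
   _ ≈⟨ solve 5 (λ A B C u v → A :* C :* ((:1 :- u :* v) :* B) :- B :* C :* ((:1 :- u) :* A) :- u :* A :* B :* ((:1 :- v) :* C) := :0) tt A B C u v ⟩
   0# ∎

 t : Carrier
 t = qz (+ M₀)

 -- The factor (x - t y)/(x - y) of Hall-Littlewood theory at y/x = q^k, written so that its only
 -- pole sits in `b`.
 w : ℤ → Carrier
 w k = 1# + (1# - t) * b k

 w-cong : ∀ {k l} → k ≡ l → w k ≈ w l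
 w-cong e = reflexive (E.cong w e)

 w-neg : ∀ {k} → k ≢ + 0 → w (Z.- k) ≈ t - (1# - t) * b k
 w-neg {k} k≢0 = trans (+-congˡ (*-congˡ (b-neg k≢0)))
  (solve 2 (λ t x → :1 :+ (:1 :- t) :* (:- :1 :- x) := t :- (:1 :- t) :* x) tt _ _)

 -- w k = (1 - q^(M+k)) / (1 - q^k)
 w≈ : ∀ {k} → k ≢ + 0 → w k ≈ (1# - qz (+ M₀ Z.+ k)) * a k
 w≈ {k} k≢0 = begin
  _ ≈⟨ +-congʳ (a-inv k≢0) ⟨
  _ ≈⟨ +-congˡ (*-congˡ (b≈qa k≢0)) ⟩
  _ ≈⟨ solve 3 (λ t u x → (:1 :- u) :* x :+ (:1 :- t) :* (u :* x) := (:1 :- t :* u) :* x) tt _ _ _ ⟩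
  _ ≈⟨ *-congʳ (+-congˡ (-‿cong (qz-+ (+ M₀) k))) ⟨
  _ ∎

 -- The numerator of w at k is the denominator at k + M₀, so products of w along a progression with
 -- step M₀ telescope.
 w-tel : ∀ {k} → k ≢ + 0 → k Z.+ + M₀ ≢ + 0 → w k * a (k Z.+ + M₀) ≈ a k
 w-tel {k} k≢0 kM≢0 = begin
  _ ≈⟨ *-congʳ (w≈ k≢0) ⟩
  _ ≈⟨ *-congʳ (*-congʳ (+-congˡ (-‿cong (qz-cong (ZP.+-comm (+ M₀) k))))) ⟩
  _ ≈⟨ solve 3 (λ x y z → x :* y :* z := y :* (x :* z)) tt _ _ _ ⟩
  _ ≈⟨ *-congˡ (a-inv kM≢0) ⟩
  a k * 1# ≈⟨ *-identityʳ _ ⟩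
  a k ∎

 -- The numerator 1 - t q^k vanishes here. A position u together with `bar (u + M₀)` meets exactly
 -- this factor.
 w-zero : M₀ ≢ 0 → w (Z.- (+ M₀)) ≈ 0#
 w-zero M≢0 = begin
  _ ≈⟨ +-congˡ (*-congˡ (b-neg′ M≢)) ⟩
  _ ≈⟨ solve 2 (λ x y → :1 :+ x :* :- y := :1 :- x :* y) tt _ _ ⟩
  _ ≈⟨ +-congˡ (-‿cong (a-inv M≢)) ⟩
  1# - 1# ≈⟨ -‿inverseʳ 1# ⟩
  0# ∎
  where
  M≢ : + M₀ ≢ + 0
  M≢ e = M≢0 (ZP.+-injective e)

 -- As functions of q^k, the zero of each factor is the pole of the other, so their product is
 -- constant.
 w-w : ∀ {k} → k ≢ + 0 → k Z.- + M₀ ≢ + 0 → w (Z.- k) * w (k Z.- + M₀) ≈ t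
 w-w {k} k≢0 l≢0 = begin
  _ ≈⟨ *-cong (w≈ (neg≢0 k≢0)) (w≈ l≢0) ⟩
  _ ≈⟨ *-cong (*-cong (+-congˡ (-‿cong (qz-cong (e₁ (+ M₀) k)))) (a-neg′ k≢0)) (*-congʳ (+-congˡ (-‿cong (qz-cong (e₂ (+ M₀) k))))) ⟩
  _ ≈⟨ solve 5 (λ p x A y B → ((:1 :- p) :* :- (x :* A)) :* ((:1 :- x) :* B) := (:- (x :* (:1 :- p) :* B)) :* ((:1 :- x) :* A)) tt (qz (Z.- l)) (qz k) (a k) 1# (a l) ⟩
  _ ≈⟨ trans (*-congˡ (a-inv k≢0)) (*-identityʳ _) ⟩
  _ ≈⟨ -‿cong (*-congʳ (*-congʳ (trans (qz-cong (e₃ (+ M₀) k)) (qz-+ (+ M₀) l)))) ⟩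
  _ ≈⟨ solve 4 (λ t x p B → :- (t :* x :* (:1 :- p) :* B) := t :* ((p :* x :- x) :* B)) tt _ _ _ _ ⟩
  _ ≈⟨ *-congˡ (*-congʳ (+-congʳ (qz-inv l))) ⟩
  _ ≈⟨ trans (*-congˡ (a-inv l≢0)) (*-identityʳ t) ⟩
  t ∎
  where
  l = k Z.- + M₀
  e₁ : ∀ m k → m Z.+ Z.- k ≡ Z.- (k Z.- m)
  e₁ = ZS.solve-∀
  e₂ : ∀ m k → m Z.+ (k Z.- m) ≡ k
  e₂ = ZS.solve-∀
  e₃ : ∀ m k → k ≡ m Z.+ (k Z.- m)
  e₃ = ZS.solve-∀

 b-w : ∀ {k} → k ≢ + 0 → k Z.- + M₀ ≢ + 0 → b k ≈ b (k Z.- + M₀) * w (Z.- k)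
 b-w {k} k≢0 l≢0 = sym (begin
  _ ≈⟨ *-cong (trans (b-cong (e₀ (+ M₀) k)) (b-neg′ nl)) (w≈ (neg≢0 k≢0)) ⟩
  _ ≈⟨ solve 3 (λ x y z → :- x :* (y :* z) := :- (z :* (y :* x))) tt _ _ _ ⟩
  _ ≈⟨ -‿cong (trans (*-congˡ (a-inv nl)) (*-identityʳ _)) ⟩
  - a (Z.- k) ≈⟨ b-neg′ (neg≢0 k≢0) ⟨
  _ ≈⟨ b-cong (ZP.neg-involutive k) ⟩
  b k ∎)
  where
  l = k Z.- + M₀
  e₀ : ∀ m k → k Z.- m ≡ Z.- (m Z.+ Z.- k)
  e₀ = ZS.solve-∀
  nl : + M₀ Z.+ Z.- k ≢ + 0
  nl e = l≢0 (E.trans (e₀ (+ M₀) k) (E.cong Z.-_ e))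

 -- Partial fractions in q^z

 Distinct : List ℤ → Set
 Distinct [] = ⊤
 Distinct (s ∷ S) = All (s ≢_) S × Distinct S

 Distinct-pick : ∀ {S x r} → Pick S x r → Distinct S → All (x ≢_) r × Distinct r
 Distinct-pick here (d , ds) = d , ds
 Distinct-pick (there i) (d , ds) with Distinct-pick i ds | All-pick i d
 ... | x≢r , dr | s≢x , s≢r = ((λ e → s≢x (E.sym e)) ∷ x≢r) , (s≢r , dr)

 Distinct-split : ∀ {S K J} → Split S K J → Distinct S → Distinct K × Distinct J
 Distinct-split [] _ = tt , tt
 Distinct-split (lft s) (d , ds) with Distinct-split s ds
 ... | dk , dj = (proj₁ (All-split s d) , dk) , dj
 Distinct-split (rgt s) (d , ds) with Distinct-split s ds
 ... | dk , dj = dk , (proj₂ (All-split s d) , dj)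

 diff≢0 : ∀ {x y} → x ≢ y → x Z.- y ≢ + 0
 diff≢0 {x} {y} x≢y e = x≢y (ZP.i-j≡0⇒i≡j x y e)

 -- Partial fractions.  An item (p , σ) is the factor w (z - p) or w (p - z), seen as
 -- a function of q^z with its only pole at z = p; the pole function b (z - p)
 -- is kept abstract (β) so that z = ∞, where it is -1, is also covered.
 Item : Set
 Item = ℤ × Bool

 cst lin : Bool → Carrier
 cst true = 1#
 cst false = t
 lin true = 1# - t
 lin false = - (1# - t)

 ev : (ℤ → Carrier) → Item → Carrier
 ev β (p , σ) = cst σ + lin σ * β p

 poles : List Item → List ℤ
 poles = map proj₁

 PoleRel : (ℤ → Carrier) → ℤ → ℤ → Set
 PoleRel β p p' = β p * β p' ≈ β p * b (p Z.- p') + β p' * b (p' Z.- p)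

 data Pairwise (P : ℤ → ℤ → Set) : List ℤ → Set where
  [] : Pairwise P []
  _∷_ : ∀ {x xs} → All (P x) xs → Pairwise P xs → Pairwise P (x ∷ xs)

 -- The constant is the value at q^z = 0, where every pole function vanishes. In the induction the
 -- relation `PoleRel` splits each product of the new pole with an old one. The pieces at the new
 -- pole p add up to the same expansion evaluated at z = p, which is `IH′`.
 partial-fractions : ∀ β its → Distinct (poles its) → Pairwise (PoleRel β) (poles its) →
  Π its (ev β) ≈ Π its (λ i → cst (proj₂ i)) +
          Sel its (λ i r → lin (proj₂ i) * β (proj₁ i) * Π r (ev (λ p' → b (proj₁ i Z.- p'))))
 partial-fractions β [] _ _ = sym (+-identityʳ _)
 partial-fractions β ((p , σ) ∷ its) (p≢ , dist) (rel ∷ rels) = begin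
  _ ≈⟨ *-congˡ IH ⟩
  _ ≈⟨ expand c l (β p) C _ ⟩
  _ ≈⟨ +-congˡ (+-congˡ (+-cong (sym (Sel-* its c _)) (trans (sym (Sel-* its (l * β p) _)) (Sel-cong its swap)))) ⟩
  _ ≈⟨ +-congˡ (+-congˡ (+-congˡ (Sel-+ its _ _))) ⟩
  _ ≈⟨ +-congˡ (+-congˡ (+-congˡ (+-congʳ (Sel-* its (l * β p) _)))) ⟩
  _ ≈⟨ collect (c * C) (l * β p) C _ _ _ ⟩
  _ ≈⟨ +-congˡ (+-cong (*-congˡ (sym IH′)) (trans (sym (Sel-+ its _ _)) (Sel-cong its (λ {i} {r} _ → fin i r)))) ⟩
  _ ∎
  where
  c = cst σ
  l = lin σ
  C = Π its (λ i → cst (proj₂ i))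
  f g : Item → Carrier
  f i = lin (proj₂ i) * β (proj₁ i)
  g i = lin (proj₂ i) * b (p Z.- proj₁ i)
  E : Item → List Item → Carrier
  E i r = Π r (ev (λ p' → b (proj₁ i Z.- p')))
  IH : Π its (ev β) ≈ C + Sel its (λ i r → f i * E i r)
  IH = partial-fractions β its dist rels
  pairs : ∀ xs → All (p ≢_) xs → Distinct xs → Pairwise (PoleRel (λ p' → b (p Z.- p'))) xs
  pairs [] _ _ = []
  pairs (x ∷ xs) (n ∷ ns) (d , ds) = go xs ns d ∷ pairs xs ns ds
   where
   go : ∀ ys → All (p ≢_) ys → All (x ≢_) ys → All (PoleRel (λ p' → b (p Z.- p')) x) ys
   go [] _ _ = []
   go (y ∷ ys) (m ∷ ms) (e ∷ es) = trans (b-mul (diff≢0 n) (diff≢0 m) (λ z → diff≢0 e (E.trans (E.sym (e₁ p x y)) z)))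
     (+-cong (*-congˡ (b-cong (e₁ p x y))) (*-congˡ (b-cong (e₁ p y x)))) ∷ go ys ms es
    where
    e₁ : ∀ p x y → (p Z.- y) Z.- (p Z.- x) ≡ x Z.- y
    e₁ = ZS.solve-∀
  IH′ : Π its (ev (λ p' → b (p Z.- p'))) ≈ C + Sel its (λ i r → g i * E i r)
  IH′ = partial-fractions (λ p' → b (p Z.- p')) its dist (pairs (poles its) p≢ dist)
  expand : ∀ c l β C s → (c + l * β) * (C + s) ≈ c * C + (l * β * C + (c * s + l * β * s))
  expand = solve 5 (λ c l β C s → (c :+ l :* β) :* (C :+ s) := c :* C :+ (l :* β :* C :+ (c :* s :+ l :* β :* s))) tt
  collect : ∀ x y C s₁ s₂ s₃ → x + (y * C + (s₁ + (y * s₂ + s₃))) ≈ x + (y * (C + s₂) + (s₁ + s₃))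
  collect = solve 6 (λ x y C s₁ s₂ s₃ → x :+ (y :* C :+ (s₁ :+ (y :* s₂ :+ s₃))) := x :+ (y :* (C :+ s₂) :+ (s₁ :+ s₃))) tt
  relAt : ∀ {i r} → Pick its i r → PoleRel β p (proj₁ i)
  relAt = go its rel
   where
   go : ∀ its → All (PoleRel β p) (poles its) → ∀ {i r} → Pick its i r → PoleRel β p (proj₁ i)
   go (i ∷ its) (e ∷ es) here = e
   go (i ∷ its) (e ∷ es) (there k) = go its es k
  swap : ∀ {i r} → Pick its i r → l * β p * (f i * E i r) ≈ l * β p * (g i * E i r) + l * b (proj₁ i Z.- p) * (f i * E i r)
  swap {i} {r} k = begin
   _ ≈⟨ solve 5 (λ l x m y e → l :* x :* (m :* y :* e) := l :* m :* e :* (x :* y)) tt _ _ _ _ _ ⟩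
   _ ≈⟨ *-congˡ (relAt k) ⟩
   _ ≈⟨ solve 7 (λ l x m y e u v → l :* m :* e :* (x :* u :+ y :* v) := l :* x :* (m :* u :* e) :+ l :* v :* (m :* y :* e)) tt
       l (β p) (lin (proj₂ i)) (β (proj₁ i)) (E i r) (b (p Z.- proj₁ i)) (b (proj₁ i Z.- p)) ⟩
   _ ∎
  fin : ∀ i r → c * (f i * E i r) + l * b (proj₁ i Z.- p) * (f i * E i r) ≈ f i * ((c + l * b (proj₁ i Z.- p)) * E i r)
  fin i r = solve 5 (λ c f e l u → c :* (f :* e) :+ l :* u :* (f :* e) := f :* ((c :+ l :* u) :* e)) tt _ _ _ _ _

 -- With u = q^k and v = q^l: 1/(1 - u) + 1/(1 - v) - 1 = (1 - uv)/((1 - u)(1 - v)).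
 a-mul : ∀ {k l} → k ≢ + 0 → l ≢ + 0 → k Z.+ l ≢ + 0 → a k * a l ≈ a (k Z.+ l) * (a k + a l - 1#)
 a-mul {k} {l} nk nl nkl = sym (begin
  _ ≈⟨ *-congˡ (+-cong (+-cong (trans (sym (*-identityʳ A')) (*-congˡ (sym (a-inv nl)))) (trans (sym (*-identityʳ B)) (*-congˡ (sym (a-inv nk)))))
                (-‿cong (trans (sym (*-identityʳ 1#)) (*-cong (sym (a-inv nk)) (sym (a-inv nl)))))) ⟩
  _ ≈⟨ solve 5 (λ C A B u v → C :* (A :* ((:1 :- v) :* B) :+ B :* ((:1 :- u) :* A) :- ((:1 :- u) :* A) :* ((:1 :- v) :* B)) := ((:1 :- u :* v) :* C) :* (A :* B)) tt C A' B u v ⟩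
  _ ≈⟨ *-congʳ (trans (*-congʳ (+-congˡ (-‿cong (sym (qz-+ k l))))) (a-inv nkl)) ⟩
  1# * (A' * B) ≈⟨ *-identityˡ _ ⟩
  A' * B ∎)
  where
  A' = a k
  B = a l
  C = a (k Z.+ l)
  u = qz k
  v = qz l

 tp : ℕ → Carrier
 tp zero = 1#
 tp (suc n) = t * tp n

 Sel-map : ∀ {X Y : Set} (φ : X → Y) S (f : Y → List Y → Carrier) →
      Sel (map φ S) f ≈ Sel S (λ x r → f (φ x) (map φ r))
 Sel-map φ [] f = refl
 Sel-map φ (s ∷ S) f = +-congˡ (Sel-map φ S _)

 ev⁻ : ∀ z p → z ≢ p → ev (λ p → b (z Z.- p)) (p , false) ≈ w (p Z.- z)
 ev⁻ z p z≢p = begin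
  _ ≈⟨ solve 2 (λ t x → t :+ :- (:1 :- t) :* x := t :- (:1 :- t) :* x) tt t (b (z Z.- p)) ⟩
  _ ≈⟨ w-neg (diff≢0 z≢p) ⟨
  _ ≈⟨ w-cong (lem z p) ⟩
  w (p Z.- z) ∎
  where
  lem : ∀ z p → Z.- (z Z.- p) ≡ p Z.- z
  lem = ZS.solve-∀

 poleRel-b : ∀ {z p p'} → z ≢ p → z ≢ p' → p ≢ p' → PoleRel (λ p → b (z Z.- p)) p p'
 poleRel-b {z} {p} {p'} n n' d = trans (b-mul (diff≢0 n) (diff≢0 n') (λ e → diff≢0 d (E.trans (E.sym (lem z p p')) e)))
   (+-cong (*-congˡ (b-cong (lem z p p'))) (*-congˡ (b-cong (lem z p' p))))
  where
  lem : ∀ z p p' → (z Z.- p') Z.- (z Z.- p) ≡ p Z.- p'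
  lem = ZS.solve-∀

 poleRel-∞ : ∀ {p p'} → p ≢ p' → PoleRel (λ _ → - 1#) p p'
 poleRel-∞ {p} {p'} d = sym (begin
  _ ≈⟨ +-congˡ (*-congˡ (trans (b-cong (lem p p')) (b-neg (diff≢0 d)))) ⟩
  _ ≈⟨ solve 1 (λ x → :- :1 :* x :+ :- :1 :* (:- :1 :- x) := :- :1 :* :- :1) tt (b (p Z.- p')) ⟩
  - 1# * - 1# ∎)
  where
  lem : ∀ p p' → p' Z.- p ≡ Z.- (p Z.- p')
  lem = ZS.solve-∀

 pairwise : ∀ {P : ℤ → ℤ → Set} (Z : ℤ → Set) → (∀ {p p'} → Z p → Z p' → p ≢ p' → P p p') →
       ∀ {xs} → All Z xs → Distinct xs → Pairwise P xs
 pairwise Z f [] _ = []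
 pairwise {P} Z f (z ∷ zs) (d , ds) = go zs d ∷ pairwise Z f zs ds
  where
  go : ∀ {ys} → All Z ys → All (_ ≢_) ys → All (P _) ys
  go [] [] = []
  go (m ∷ ms) (e ∷ es) = f z m e ∷ go ms es

 pairwise-b : ∀ {z xs} → All (z ≢_) xs → Distinct xs → Pairwise (PoleRel (λ p → b (z Z.- p))) xs
 pairwise-b {z} = pairwise (z ≢_) poleRel-b

 pairwise-∞ : ∀ {xs} → Distinct xs → Pairwise (PoleRel (λ _ → - 1#)) xs
 pairwise-∞ d = pairwise (λ _ → ⊤) (λ _ _ → poleRel-∞) (All.universal (λ _ → tt) _) d

 poles-map : ∀ σ C → poles (map (_, σ) C) ≡ C
 poles-map σ [] = E.refl
 poles-map σ (c ∷ C) = E.cong (c ∷_) (poles-map σ C)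

 Π-cst-false : ∀ {X : Set} (C : List X) → Π C (λ _ → t) ≈ tp (length C)
 Π-cst-false [] = refl
 Π-cst-false (c ∷ C) = *-congˡ (Π-cst-false C)

 module _ (β : ℤ → Carrier) (σ : Bool) (C : List ℤ) (d : Distinct C) (r : Pairwise (PoleRel β) C) where
  partial-fractions-map : Π C (λ p → ev β (p , σ)) ≈ Π C (λ _ → cst σ) +
   Sel C (λ j r → lin σ * β j * Π r (λ i → ev (λ p' → b (j Z.- p')) (i , σ)))
  partial-fractions-map = begin
   _ ≈⟨ Π-map (_, σ) C _ ⟨
   _ ≈⟨ partial-fractions β (map (_, σ) C)
                            (E.subst Distinct (E.sym (poles-map σ C)) d)
                            (E.subst (Pairwise (PoleRel β)) (E.sym (poles-map σ C)) r) ⟩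
   _ ≈⟨ +-cong (Π-map (_, σ) C _)
                            (trans (Sel-map (_, σ) C _) (Sel-cong C (λ {j} {r} _ → *-congˡ (Π-map (_, σ) r _)))) ⟩
   _ ∎

 PF⁺ : ∀ z C → Distinct C → All (z ≢_) C →
    Π C (λ j → w (z Z.- j)) ≈ 1# + Sel C (λ j r → (1# - t) * b (z Z.- j) * Π r (λ i → w (j Z.- i)))
 PF⁺ z C d n = trans (partial-fractions-map (λ p → b (z Z.- p)) true C d (pairwise-b n d)) (+-congʳ (Π-1 C))

 private
  rest : ∀ {C j r} → Pick C j r → Distinct C → Π r (λ i → ev (λ p' → b (j Z.- p')) (i , false)) ≈ Π r (λ i → w (i Z.- j))
  rest i d = Π-congA (All.map (λ {x} j≢x → ev⁻ _ x j≢x) (proj₁ (Distinct-pick i d)))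

 PF⁻ : ∀ z C → Distinct C → All (z ≢_) C →
    Π C (λ j → w (j Z.- z)) ≈ tp (length C) + Sel C (λ j r → - (1# - t) * b (z Z.- j) * Π r (λ i → w (i Z.- j)))
 PF⁻ z C d n = begin
  _ ≈⟨ Π-congA (All.map (λ {x} z≢x → sym (ev⁻ z x z≢x)) n) ⟩
  _ ≈⟨ partial-fractions-map (λ p → b (z Z.- p)) false C d (pairwise-b n d) ⟩
  _ ≈⟨ +-cong (Π-cst-false C) (Sel-cong C (λ i → *-congˡ (rest i d))) ⟩
  _ ∎

 -- The expansion at q^z = ∞: the pole functions become -1 and every factor w (j - z) becomes 1.
 PF⁻∞ : ∀ C → Distinct C → 1# ≈ tp (length C) + Sel C (λ j r → (1# - t) * Π r (λ i → w (i Z.- j)))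
 PF⁻∞ C d = begin
  1# ≈⟨ Π-1 C ⟨
  _ ≈⟨ Π-cong C (λ _ → solve 1 (λ t → :1 := t :+ :- (:1 :- t) :* :- :1) tt t) ⟩
  _ ≈⟨ partial-fractions-map (λ _ → - 1#) false C d (pairwise-∞ d) ⟩
  _ ≈⟨ +-cong (Π-cst-false C) (Sel-cong C (λ i → *-cong (solve 1 (λ t → :- (:1 :- t) :* :- :1 := :1 :- t) tt t) (rest i d))) ⟩
  _ ∎

 -- Subtracting the expansion at infinity from `PF⁻` replaces the value at q^z = 0 by the value 1 at
 -- infinity.
 PF⁻′ : ∀ z C → Distinct C → All (z ≢_) C →
     Π C (λ j → w (j Z.- z)) ≈ 1# + Sel C (λ j r → (1# - t) * b (j Z.- z) * Π r (λ i → w (i Z.- j)))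
 PF⁻′ z C d n = begin
  _ ≈⟨ PF⁻ z C d n ⟩
  _ ≈⟨ solve 3 (λ x y z → x :+ y := (x :+ z) :+ (y :- z)) tt _ s₁ s₂ ⟩
  _ ≈⟨ +-cong (sym (PF⁻∞ C d)) (trans (+-congˡ (trans (solve 1 (λ x → :- x := :- :1 :* x) tt s₂) (sym (Sel-* C (- 1#) _))))
    (trans (sym (Sel-+ C _ _)) (Sel-cong C (λ {j} {r} i → comb {j} {r} (proj₁ (All-pick i n)))))) ⟩
  _ ∎
  where
  s₁ = Sel C (λ j r → - (1# - t) * b (z Z.- j) * Π r (λ i → w (i Z.- j)))
  s₂ = Sel C (λ j r → (1# - t) * Π r (λ i → w (i Z.- j)))
  lem : ∀ z j → j Z.- z ≡ Z.- (z Z.- j)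
  lem = ZS.solve-∀
  comb : ∀ {j r} → z ≢ j → - (1# - t) * b (z Z.- j) * Π r (λ i → w (i Z.- j)) + - 1# * ((1# - t) * Π r (λ i → w (i Z.- j)))
           ≈ (1# - t) * b (j Z.- z) * Π r (λ i → w (i Z.- j))
  comb {j} {r} e = trans (solve 3 (λ t x p → :- (:1 :- t) :* x :* p :+ :- :1 :* ((:1 :- t) :* p) := (:1 :- t) :* (:- :1 :- x) :* p) tt t (b (z Z.- j)) (Π r (λ i → w (i Z.- j))))
   (*-congʳ (*-congˡ (sym (trans (b-cong (lem z j)) (b-neg (diff≢0 e))))))

 -- The pole b (z - j) is absorbed into w (j - z) by shifting z to z - M₀.
 PF-shift : ∀ z C → Distinct C → All (z ≢_) C → All (λ i → z Z.- + M₀ ≢ i) C →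
    tp (length C) - Π C (λ j → w (j Z.- z)) ≈ Sel C (λ j r → (1# - t) * b (z Z.- j) * (Π r (λ i → w (j Z.- i)) * Π r (λ i → w (i Z.- z))))
 PF-shift z C d n n' = begin
  _ ≈⟨ +-congʳ prod ⟩
  P * P' - P ≈⟨ +-congʳ (*-congˡ (PF⁺ (z Z.- + M₀) C d n')) ⟩
  _ ≈⟨ solve 2 (λ p s → p :* (:1 :+ s) :- p := p :* s) tt P s ⟩
  P * s ≈⟨ Sel-* C P _ ⟨
  _ ≈⟨ Sel-cong C step ⟩
  _ ∎
  where
  P = Π C (λ j → w (j Z.- z))
  P' = Π C (λ j → w ((z Z.- + M₀) Z.- j))
  s = Sel C (λ j r → (1# - t) * b ((z Z.- + M₀) Z.- j) * Π r (λ i → w (j Z.- i)))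
  e₁ : ∀ z j → j Z.- z ≡ Z.- (z Z.- j)
  e₁ = ZS.solve-∀
  e₂ : ∀ z j m → (z Z.- m) Z.- j ≡ (z Z.- j) Z.- m
  e₂ = ZS.solve-∀
  ne : ∀ {j} → z Z.- + M₀ ≢ j → (z Z.- j) Z.- + M₀ ≢ + 0
  ne {j} x e = diff≢0 x (E.trans (e₂ z j (+ M₀)) e)
  prod : tp (length C) ≈ P * P'
  prod = trans (sym (Π-cst-false C)) (trans (Π-congA (go C n n')) (Π-* C _ _))
   where
   go : ∀ C → All (z ≢_) C → All (λ i → z Z.- + M₀ ≢ i) C → All (λ j → t ≈ w (j Z.- z) * w ((z Z.- + M₀) Z.- j)) C
   go [] _ _ = []
   go (j ∷ C) (x ∷ xs) (y ∷ ys) = trans (sym (w-w (diff≢0 x) (ne y))) (*-cong (w-cong (E.sym (e₁ z j))) (w-cong (E.sym (e₂ z j (+ M₀))))) ∷ go C xs ys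
  step : ∀ {j r} → Pick C j r → P * ((1# - t) * b ((z Z.- + M₀) Z.- j) * Π r (λ i → w (j Z.- i))) ≈ (1# - t) * b (z Z.- j) * (Π r (λ i → w (j Z.- i)) * Π r (λ i → w (i Z.- z)))
  step {j} {r} i = begin
   _ ≈⟨ *-congʳ (Π-pick (λ j → w (j Z.- z)) i) ⟩
   _ ≈⟨ solve 5 (λ u y t v x → u :* y :* ((:1 :- t) :* v :* x) := (:1 :- t) :* (v :* u) :* (x :* y)) tt (w (j Z.- z)) Y t (b ((z Z.- + M₀) Z.- j)) X ⟩
   _ ≈⟨ *-congʳ (*-congˡ (sym (trans (b-w (diff≢0 (proj₁ (All-pick i n))) (ne (proj₁ (All-pick i n'))))
                (*-cong (b-cong (E.sym (e₂ z j (+ M₀)))) (w-cong (E.sym (e₁ z j))))))) ⟩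
   _ ∎
   where
   X = Π r (λ i → w (j Z.- i))
   Y = Π r (λ i → w (i Z.- z))

 -- Hall-Littlewood polynomials and their poles in one variable

 δ : ℕ → ℕ → Carrier
 δ zero zero = 1#
 δ (suc m) (suc n) = δ m n
 δ _ _ = 0#

 δ-cong : ∀ m n {x y} → (m ≡ n → x ≈ y) → δ m n * x ≈ δ m n * y
 δ-cong zero zero e = *-congˡ (e E.refl)
 δ-cong (suc m) (suc n) e = δ-cong m n (λ p → e (E.cong suc p))
 δ-cong zero (suc n) e = trans (zeroˡ _) (sym (zeroˡ _))
 δ-cong (suc m) zero e = trans (zeroˡ _) (sym (zeroˡ _))

 length-split : ∀ {X : Set} {S K J : List X} → Split S K J → length K N.+ length J ≡ length S
 length-split [] = E.refl
 length-split (lft s) = E.cong suc (length-split s)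
 length-split {K = K} {J = _ ∷ J} (rgt s) = E.trans (NP.+-suc (length K) (length J)) (E.cong suc (length-split s))

 length-pick : ∀ {X : Set} {S : List X} {x r} → Pick S x r → length S ≡ suc (length r)
 length-pick here = E.refl
 length-pick (there i) = E.cong suc (length-pick i)

 W : List ℤ → List ℤ → Carrier
 W K J = Π K (λ k → Π J (λ j → w (j Z.- k)))

 xs : List ℤ → Carrier
 xs K = Π K qz

 W-∷ʳ : ∀ K j J → W K (j ∷ J) ≈ Π K (λ k → w (j Z.- k)) * W K J
 W-∷ʳ K j J = Π-* K _ _

 W-pickʳ : ∀ K {J j J'} → Pick J j J' → W K J ≈ Π K (λ k → w (j Z.- k)) * W K J'
 W-pickʳ K {J} {j} {J'} i = trans (Π-cong K (λ k → Π-pick (λ j → w (j Z.- k)) i)) (Π-* K _ _)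

 W-pickˡ : ∀ {K k K'} J → Pick K k K' → W K J ≈ Π J (λ j → w (j Z.- k)) * W K' J
 W-pickˡ J i = Π-pick (λ k → Π J (λ j → w (j Z.- k))) i

 -- The Hall-Littlewood polynomial P_λ evaluated at the variables q^s (s in S), where
 -- the list is the conjugate partition λ'; the first column selects the variables
 -- with positive exponent.
 HL : List ℕ → List ℤ → Carrier
 HL [] S = 1#
 HL (c ∷ cs) S = Spl S (λ K J → δ (length K) c * (xs K * W K J * HL cs K))

 -- The part of HL at z ∷ S in which z increases the first column.
 HL₁ HLt₁ : List ℕ → ℤ → List ℤ → Carrier
 HL₁ [] z S = 0#
 HL₁ (c ∷ cs) z S = Spl S (λ K J → δ (suc (length K)) c * (qz z * xs K * W K J * HL cs (z ∷ K)))
 HLt₁ [] z S = 0#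
 HLt₁ (c ∷ cs) z S = Spl S (λ K J → δ (suc (length K)) c * (tp (length J) * (qz z * xs K * W K J * HL cs (z ∷ K))))

 -- The point z - M₀ is excluded as well because `PF-shift` expands a product there.
 Generic : ℤ → List ℤ → Set
 Generic z S = Distinct S × All (z ≢_) S × All (λ i → z Z.- + M₀ ≢ i) S

 Generic-split : ∀ {z S K J} → Split S K J → Generic z S → Generic z K × Generic z J
 Generic-split s (d , n , n') =
  (proj₁ (Distinct-split s d) , proj₁ (All-split s n) , proj₁ (All-split s n')) ,
  (proj₂ (Distinct-split s d) , proj₂ (All-split s n) , proj₂ (All-split s n'))

 private
  pp : ℤ → List ℕ → List ℤ → Carrier
  pp z c I = Sel I (λ j K → (1# - t) * b (z Z.- j) * Π K (λ k → w (j Z.- k)) * HL c (z ∷ K))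

 -- Fix a splitting of I into K and J. The terms with z outside the column differ by Π w (z - j) - 1
 -- over J, which `PF⁺` expands. The term with z inside carries Π w (j - z), and `HLt₁` supplies the
 -- constant t^|J| that `PF-shift` needs. What remains are poles at points of J, and summing over
 -- the splittings of the rest gives `HL c (z ∷ K)`.
 HL-pole : ∀ c z I → Generic z I → Π I (λ i → w (z Z.- i)) * HL c I - HL c (z ∷ I) + HLt₁ c z I ≈ pp z c I
 HL-pole [] z I (d , n , n') = begin
  _ ≈⟨ solve 1 (λ p → p :* :1 :- :1 :+ :0 := p :- :1) tt P ⟩
  P - 1# ≈⟨ +-congʳ (PF⁺ z I d n) ⟩
  (1# + s) - 1# ≈⟨ solve 1 (λ s → (:1 :+ s) :- :1 := s) tt s ⟩
  s ≈⟨ Sel-cong I (λ _ → sym (*-identityʳ _)) ⟩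
  pp z [] I ∎
  where
  P = Π I (λ i → w (z Z.- i))
  s = Sel I (λ j r → (1# - t) * b (z Z.- j) * Π r (λ i → w (j Z.- i)))
 HL-pole (c ∷ cs) z I g = begin
  _ ≈⟨ +-congʳ (+-cong (sym (Spl-* I P F)) (-‿cong (sym (Spl-+ I G₁ G₂)))) ⟩
  _ ≈⟨ +-congʳ (+-congˡ (trans (solve 1 (λ x → :- x := :- :1 :* x) tt _) (sym (Spl-* I (- 1#) _)))) ⟩
  _ ≈⟨ +-congʳ (Spl-+ I _ _) ⟨
  _ ≈⟨ Spl-+ I _ _ ⟨
  _ ≈⟨ Spl-cong I main ⟩
  _ ≈⟨ Sel-Spl I h′ h (λ _ _ _ _ → refl) ⟨
  _ ≈⟨ Sel-cong I (λ {j} {r} _ → trans (Spl-cong r (λ s → *-congʳ (*-congˡ (sym (Π-split (λ k → w (j Z.- k)) s)))))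
      (trans (Spl-* r _ _) (*-congˡ (Spl-+ r _ _)))) ⟩
  _ ∎
  where
  P = Π I (λ i → w (z Z.- i))
  F G₁ G₂ H″ : List ℤ → List ℤ → Carrier
  F K J = δ (length K) c * (xs K * W K J * HL cs K)
  G₁ K J = δ (suc (length K)) c * (xs (z ∷ K) * W (z ∷ K) J * HL cs (z ∷ K))
  G₂ K J = δ (length K) c * (xs K * W K (z ∷ J) * HL cs K)
  H″ K J = δ (suc (length K)) c * (tp (length J) * (qz z * xs K * W K J * HL cs (z ∷ K)))
  h : List ℤ → ℤ → List ℤ → Carrier
  h K j J' = (1# - t) * b (z Z.- j) * (Π K (λ k → w (j Z.- k)) * Π J' (λ k → w (j Z.- k))) * (G₁ K J' + G₂ K J')
  h′ : ℤ → List ℤ → List ℤ → Carrier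
  h′ j K J' = h K j J'
  main : ∀ {K J} → Split I K J → P * F K J + - 1# * (G₁ K J + G₂ K J) + H″ K J ≈ Sel J (λ j J' → h K j J')
  main {K} {J} s = begin
   _ ≈⟨ +-congʳ (+-cong (*-congʳ (Π-split (λ i → w (z Z.- i)) s)) (*-congˡ (+-congˡ (*-congˡ (*-congʳ (*-congˡ (W-∷ʳ K z J))))))) ⟩
   _ ≈⟨ arrange ΠK ΠJ d₀ (xs K) (W K J) (HL cs K) d₁ (qz z) ΠJz Hz T ⟩
   _ ≈⟨ +-cong (*-congˡ (PF-shift z J dJ nJ nJ')) (*-congˡ (trans (+-congʳ (PF⁺ z J dJ nJ)) (solve 1 (λ s → (:1 :+ s) :- :1 := s) tt _))) ⟩
   _ ≈⟨ +-cong (Sel-* J u₁ _) (Sel-* J u₂ _) ⟨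
   _ ≈⟨ Sel-+ J _ _ ⟨
   _ ≈⟨ Sel-cong J step ⟩
   _ ∎
   where
   gJ = proj₂ (Generic-split s g)
   dJ = proj₁ gJ
   nJ = proj₁ (proj₂ gJ)
   nJ' = proj₂ (proj₂ gJ)
   ΠK = Π K (λ i → w (z Z.- i))
   ΠJ = Π J (λ i → w (z Z.- i))
   ΠJz = Π J (λ j → w (j Z.- z))
   d₀ = δ (length K) c
   d₁ = δ (suc (length K)) c
   Hz = HL cs (z ∷ K)
   T = tp (length J)
   u₁ = d₁ * (qz z * xs K * W K J * Hz)
   u₂ = d₀ * (xs K * ΠK * W K J * HL cs K)
   arrange : ∀ ΠK ΠJ d₀ x W y d₁ q p h T → (ΠK * ΠJ) * (d₀ * (x * W * y)) + - 1# * (d₁ * ((q * x) * (p * W) * h) + d₀ * (x * (ΠK * W) * y)) + d₁ * (T * (q * x * W * h))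
        ≈ d₁ * (q * x * W * h) * (T - p) + d₀ * (x * ΠK * W * y) * (ΠJ - 1#)
   arrange = solve 11 (λ ΠK ΠJ d₀ x W y d₁ q p h T → (ΠK :* ΠJ) :* (d₀ :* (x :* W :* y)) :+ :- :1 :* (d₁ :* ((q :* x) :* (p :* W) :* h) :+ d₀ :* (x :* (ΠK :* W) :* y)) :+ d₁ :* (T :* (q :* x :* W :* h))
        := d₁ :* (q :* x :* W :* h) :* (T :- p) :+ d₀ :* (x :* ΠK :* W :* y) :* (ΠJ :- :1)) tt
   step : ∀ {j r} → Pick J j r →
    u₁ * ((1# - t) * b (z Z.- j) * (Π r (λ i → w (j Z.- i)) * Π r (λ i → w (i Z.- z)))) + u₂ * ((1# - t) * b (z Z.- j) * Π r (λ i → w (j Z.- i))) ≈ h K j r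
   step {j} {r} i = begin
    _ ≈⟨ +-cong (*-congʳ (*-congˡ (*-congʳ (*-congˡ (W-pickʳ K i))))) (*-congʳ (*-congˡ (*-congʳ (*-congˡ (W-pickʳ K i))))) ⟩
    _ ≈⟨ solve 12 (λ d₁ q x Z W h A X Y d₀ p y → d₁ :* (q :* x :* (Z :* W) :* h) :* (A :* (X :* Y)) :+ d₀ :* (x :* p :* (Z :* W) :* y) :* (A :* X)
        := A :* (Z :* X) :* (d₁ :* ((q :* x) :* (Y :* W) :* h) :+ d₀ :* (x :* (p :* W) :* y))) tt
        d₁ (qz z) (xs K) Z (W K r) Hz A X Y d₀ ΠK (HL cs K) ⟩
    _ ≈⟨ *-congˡ (+-congˡ (*-congˡ (*-congʳ (*-congˡ (W-∷ʳ K z r))))) ⟨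
    h K j r ∎
    where
    A = (1# - t) * b (z Z.- j)
    X = Π r (λ i → w (j Z.- i))
    Y = Π r (λ i → w (i Z.- z))
    Z = Π K (λ k → w (j Z.- k))

 -- Expand Π w (j - z) where z lies in the first column. The value at infinity gives `HL₁`. The pole
 -- at j belonging to K is regrouped under I, which is K together with j; there `HL-pole` sums all
 -- poles, and its term Π w (z - i) cancels the contribution with z outside the column.
 HL-recursion : ∀ c cs z S → Generic z S → HL (c ∷ cs) (z ∷ S) ≈
  HL₁ (c ∷ cs) z S + Spl S (λ I B → δ (length I) c * (xs I * W I B * (HL cs (z ∷ I) - HLt₁ cs z I)))
 HL-recursion c cs z S g@(d , n , n') = begin
  _ ≈⟨ +-congʳ (trans (Spl-cong S split₁) (Spl-+ S _ _)) ⟩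
  _ ≈⟨ +-congʳ (+-congˡ (trans (Spl-Sel S u v match) (Spl-cong S (λ {I} {B} s → collect s)))) ⟩
  _ ≈⟨ trans (+-assoc _ _ _) (+-congˡ (trans (sym (Spl-+ S _ _)) (Spl-cong S (λ {I} {B} s → final {I} {B} s)))) ⟩
  _ ∎
  where
  ΠJ : List ℤ → Carrier
  ΠJ J = Π J (λ j → w (j Z.- z))
  u : List ℤ → ℤ → List ℤ → Carrier
  u K j J' = δ (suc (length K)) c * (xs K * (Π K (λ k → w (j Z.- k)) * W K J') * HL cs (z ∷ K) * - ((1# - t) * (qz j * b (z Z.- j)) * Π J' (λ i → w (i Z.- j))))
  v : ℤ → List ℤ → List ℤ → Carrier
  v j K J' = u K j J'
  match : ∀ {K J x J'} → Split S K J → Pick J x J' → ∀ {I} → Split S I J' → Pick I x K → u K x J' ≈ v x K J'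
  match _ _ _ _ = refl
  e₁ : ∀ z j → j Z.- z ≡ Z.- (z Z.- j)
  e₁ = ZS.solve-∀
  e₂ : ∀ z j → z Z.+ (j Z.- z) ≡ j
  e₂ = ZS.solve-∀
  qb : ∀ {j} → z ≢ j → qz z * b (j Z.- z) ≈ - (qz j * b (z Z.- j))
  qb {j} z≢j = begin
   _ ≈⟨ *-congˡ (b≈qa (diff≢0 (λ e → z≢j (E.sym e)))) ⟩
   _ ≈⟨ *-assoc _ _ _ ⟨
   _ ≈⟨ *-cong (trans (sym (qz-+ z (j Z.- z))) (qz-cong (e₂ z j))) (trans (a-cong (e₁ z j)) (a-neg (diff≢0 z≢j))) ⟩
   _ ≈⟨ solve 2 (λ x y → x :* (:1 :- y) := :- (x :* (y :- :1))) tt (qz j) (a (z Z.- j)) ⟩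
   _ ∎
  split₁ : ∀ {K J} → Split S K J → δ (suc (length K)) c * ((qz z * xs K) * (ΠJ J * W K J) * HL cs (z ∷ K)) ≈
   δ (suc (length K)) c * (qz z * xs K * W K J * HL cs (z ∷ K)) + Sel J (λ j J' → u K j J')
  split₁ {K} {J} s = begin
   _ ≈⟨ *-congˡ (*-congʳ (*-congˡ (*-congʳ (PF⁻′ z J (proj₁ gJ) (proj₁ (proj₂ gJ)))))) ⟩
   _ ≈⟨ solve 6 (λ D q x s W h → D :* ((q :* x) :* ((:1 :+ s) :* W) :* h) := D :* (q :* x :* W :* h) :+ (D :* (q :* x :* W :* h)) :* s) tt D (qz z) (xs K) s′ (W K J) Hz ⟩
   _ ≈⟨ +-congˡ (sym (Sel-* J _ _)) ⟩
   _ ≈⟨ +-congˡ (Sel-cong J step) ⟩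
   _ ∎
   where
   gJ = proj₂ (Generic-split s g)
   D = δ (suc (length K)) c
   Hz = HL cs (z ∷ K)
   s′ = Sel J (λ j r → (1# - t) * b (j Z.- z) * Π r (λ i → w (i Z.- j)))
   step : ∀ {j r} → Pick J j r → (D * (qz z * xs K * W K J * Hz)) * ((1# - t) * b (j Z.- z) * Π r (λ i → w (i Z.- j))) ≈ u K j r
   step {j} {r} i = begin
    _ ≈⟨ solve 8 (λ D q x W h t y Y → (D :* (q :* x :* W :* h)) :* ((:1 :- t) :* y :* Y) := D :* (x :* W :* h :* ((:1 :- t) :* (q :* y) :* Y))) tt D (qz z) (xs K) (W K J) Hz t (b (j Z.- z)) Y ⟩
    _ ≈⟨ *-congˡ (*-cong (*-congʳ (*-congˡ (W-pickʳ K i))) (trans (*-congʳ (*-congˡ (qb (proj₁ (All-pick i (proj₁ (proj₂ gJ)))))))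
        (solve 3 (λ x y z → x :* :- y :* z := :- (x :* y :* z)) tt (1# - t) (qz j * b (z Z.- j)) Y))) ⟩
    u K j r ∎
    where Y = Π r (λ i → w (i Z.- j))
  collect : ∀ {I B} → Split S I B → Sel I (λ x K → v x K B) ≈ δ (length I) c * (xs I * W I B * - pp z cs I)
  collect {I} {B} s = begin
   _ ≈⟨ Sel-cong I step ⟩
   _ ≈⟨ Sel-* I _ _ ⟩
   _ ≈⟨ solve 3 (λ d x p → :- (d :* x) :* p := d :* (x :* :- p)) tt (δ (length I) c) (xs I * W I B) (pp z cs I) ⟩
   _ ∎
   where
   step : ∀ {j K} → Pick I j K → v j K B ≈ - (δ (length I) c * (xs I * W I B)) * ((1# - t) * b (z Z.- j) * Π K (λ k → w (j Z.- k)) * HL cs (z ∷ K))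
   step {j} {K} i = sym (begin
    _ ≈⟨ *-congʳ (-‿cong (*-cong (reflexive (E.cong (λ l → δ l c) (length-pick i))) (*-cong (Π-pick qz i) (W-pickˡ B i)))) ⟩
    _ ≈⟨ solve 9 (λ D q x Y W t b X h → :- (D :* ((q :* x) :* (Y :* W))) :* ((:1 :- t) :* b :* X :* h) := D :* (x :* (X :* W) :* h :* :- ((:1 :- t) :* (q :* b) :* Y))) tt
        D (qz j) (xs K) Y (W K B) t (b (z Z.- j)) X Hz ⟩
    v j K B ∎)
    where
    D = δ (suc (length K)) c
    X = Π K (λ k → w (j Z.- k))
    Y = Π B (λ i → w (i Z.- j))
    Hz = HL cs (z ∷ K)
  final : ∀ {I B} → Split S I B → δ (length I) c * (xs I * W I B * - pp z cs I) + δ (length I) c * (xs I * W I (z ∷ B) * HL cs I)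
      ≈ δ (length I) c * (xs I * W I B * (HL cs (z ∷ I) - HLt₁ cs z I))
  final {I} {B} s = begin
   _ ≈⟨ +-cong (*-congˡ (*-congˡ (-‿cong (sym (HL-pole cs z I (proj₁ (Generic-split s g))))))) (*-congˡ (*-congʳ (*-congˡ (W-∷ʳ I z B)))) ⟩
   _ ≈⟨ solve 7 (λ D x W P h h' k → D :* (x :* W :* :- (P :* h :- h' :+ k)) :+ D :* (x :* (P :* W) :* h) := D :* (x :* W :* (h' :- k))) tt
       D (xs I) (W I B) P (HL cs I) (HL cs (z ∷ I)) (HLt₁ cs z I) ⟩
   _ ∎
   where
   D = δ (length I) c
   P = Π I (λ i → w (z Z.- i))

 -- Congruences modulo powers of q

 Int-0 : Int 0#
 Int-0 = Int-resp (-‿inverseʳ 1#) (Int-+ Int-1 (Int-neg Int-1))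

 Int-- : ∀ {x y} → Int x → Int y → Int (x - y)
 Int-- p q = Int-+ p (Int-neg q)

 infix 4 _≈[_]_
 -- Congruence modulo q^D: the difference, divided by q^D, has no negative powers of q. The two
 -- sides themselves may have some.
 _≈[_]_ : Carrier → ℕ → Carrier → Set
 x ≈[ D ] y = Int (qz (Z.- (+ D)) * (x - y))

 module _ {D : ℕ} where
  private Z = qz (Z.- (+ D))

  ≈⇒≈[] : ∀ {x y} → x ≈ y → x ≈[ D ] y
  ≈⇒≈[] {x} {y} e = Int-resp (sym (trans (*-congˡ (trans (+-congʳ e) (-‿inverseʳ y))) (zeroʳ Z))) Int-0

  ≈[]-refl : ∀ {x} → x ≈[ D ] x
  ≈[]-refl = ≈⇒≈[] refl

  ≈[]-sym : ∀ {x y} → x ≈[ D ] y → y ≈[ D ] x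
  ≈[]-sym {x} {y} p = Int-resp (solve 3 (λ z x y → :- (z :* (x :- y)) := z :* (y :- x)) tt Z x y) (Int-neg p)

  ≈[]-trans : ∀ {x y z} → x ≈[ D ] y → y ≈[ D ] z → x ≈[ D ] z
  ≈[]-trans {x} {y} {z} p q = Int-resp (solve 4 (λ Z x y z → Z :* (x :- y) :+ Z :* (y :- z) := Z :* (x :- z)) tt Z x y z) (Int-+ p q)

  ≈[]-+ : ∀ {x y u v} → x ≈[ D ] y → u ≈[ D ] v → x + u ≈[ D ] y + v
  ≈[]-+ {x} {y} {u} {v} p q = Int-resp (solve 5 (λ Z x y u v → Z :* (x :- y) :+ Z :* (u :- v) := Z :* ((x :+ u) :- (y :+ v))) tt Z x y u v) (Int-+ p q)

  ≈[]-*ˡ : ∀ {x y c} → Int c → x ≈[ D ] y → c * x ≈[ D ] c * y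
  ≈[]-*ˡ {x} {y} {c} i p = Int-resp (solve 4 (λ Z x y c → c :* (Z :* (x :- y)) := Z :* (c :* x :- c :* y)) tt Z x y c) (Int-* i p)

  ≈[]-* : ∀ {x y u v} → Int x → Int v → x ≈[ D ] y → u ≈[ D ] v → x * u ≈[ D ] y * v
  ≈[]-* {x} {y} {u} {v} ix iv p q = Int-resp
   (solve 5 (λ Z x y u v → v :* (Z :* (x :- y)) :+ x :* (Z :* (u :- v)) := Z :* (x :* u :- y :* v)) tt Z x y u v)
   (Int-+ (Int-* iv p) (Int-* ix q))

  qz≈[]0 : ∀ k → D N.≤ k → qz (+ k) ≈[ D ] 0#
  qz≈[]0 k D≤k = Int-resp
   (begin
    _ ≈⟨ qz-cong (E.trans (E.sym (ZP.⊖-≥ D≤k)) (E.trans (E.sym (ZP.m-n≡m⊖n k D)) (ZP.+-comm (+ k) (Z.- (+ D))))) ⟩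
    _ ≈⟨ qz-+ _ _ ⟩
    Z * qz (+ k) ≈⟨ solve 2 (λ z x → z :* x := z :* (x :- :0)) tt Z (qz (+ k)) ⟩
    _ ∎)
   (Int-qz _)

  0-*ˡ : ∀ {x c} → Int c → x ≈[ D ] 0# → c * x ≈[ D ] 0#
  0-*ˡ {x} {c} i p = ≈[]-trans (≈[]-*ˡ i p) (≈⇒≈[] (zeroʳ c))

  0-*ʳ : ∀ {x c} → Int c → x ≈[ D ] 0# → x * c ≈[ D ] 0#
  0-*ʳ {x} {c} i p = ≈[]-trans (≈⇒≈[] (*-comm x c)) (0-*ˡ i p)

  0-+ : ∀ {x y} → x ≈[ D ] 0# → y ≈[ D ] 0# → x + y ≈[ D ] 0#
  0-+ p q = ≈[]-trans (≈[]-+ p q) (≈⇒≈[] (+-identityˡ 0#))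

 ≈[]-weaken : ∀ {D D' x y} → D N.≤ D' → x ≈[ D' ] y → x ≈[ D ] y
 ≈[]-weaken {D} {D'} {x} {y} le p = Int-resp
  (trans (sym (*-assoc _ _ _)) (*-congʳ (trans (sym (qz-+ (+ (D' N.∸ D)) (Z.- (+ D')))) (qz-cong lem))))
  (Int-* (Int-qz (D' N.∸ D)) p)
  where
  alg : ∀ x y → (x Z.- y) Z.+ Z.- x ≡ Z.- y
  alg = ZS.solve-∀
  lem : + (D' N.∸ D) Z.+ Z.- (+ D') ≡ Z.- (+ D)
  lem = E.trans (E.cong (Z._+ Z.- (+ D')) (E.trans (E.sym (ZP.⊖-≥ le)) (E.sym (ZP.m-n≡m⊖n D' D)))) (alg (+ D') (+ D))

 Int-t : Int t
 Int-t = Int-qz M₀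

 Int-b : ∀ k → Int (b k)
 Int-b k = Int-- (Int-a k) Int-1

 Int-w : ∀ k → Int (w k)
 Int-w k = Int-+ Int-1 (Int-* (Int-- Int-1 Int-t) (Int-b k))

 Int-tp : ∀ n → Int (tp n)
 Int-tp zero = Int-1
 Int-tp (suc n) = Int-* Int-t (Int-tp n)

 Int-Π : ∀ {X : Set} (S : List X) {f : X → Carrier} → (∀ x → Int (f x)) → Int (Π S f)
 Int-Π [] i = Int-1
 Int-Π (s ∷ S) i = Int-* (i s) (Int-Π S i)

 Int-ΠA : ∀ {X : Set} {S : List X} {f : X → Carrier} → All (λ x → Int (f x)) S → Int (Π S f)
 Int-ΠA [] = Int-1
 Int-ΠA (i ∷ is) = Int-* i (Int-ΠA is)

 Int-Spl : ∀ {X : Set} (S : List X) {f : List X → List X → Carrier} → (∀ {K J} → Split S K J → Int (f K J)) → Int (Spl S f)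
 Int-Spl [] i = i []
 Int-Spl (s ∷ S) i = Int-+ (Int-Spl S (λ p → i (lft p))) (Int-Spl S (λ p → i (rgt p)))

 Int-δ : ∀ m n → Int (δ m n)
 Int-δ zero zero = Int-1
 Int-δ (suc m) (suc n) = Int-δ m n
 Int-δ zero (suc n) = Int-0
 Int-δ (suc m) zero = Int-0

 data NonNeg : ℤ → Set where
  nonNeg : ∀ k → NonNeg (+ k)

 Int-qz⁺ : ∀ {k} → NonNeg k → Int (qz k)
 Int-qz⁺ (nonNeg k) = Int-qz k

 Int-HL : ∀ c S → All NonNeg S → Int (HL c S)
 Int-HL [] S p = Int-1
 Int-HL (c ∷ cs) S p = Int-Spl S λ {K} {J} s →
  Int-* (Int-δ (length K) c) (Int-* (Int-* (Int-ΠA (All.map Int-qz⁺ (proj₁ (All-split s p))))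
   (Int-Π K (λ k → Int-Π J (λ j → Int-w _)))) (Int-HL cs K (proj₁ (All-split s p))))

 open import Data.Nat using (_≤_)

 -- The branching rule, column by column

 hd : List ℕ → ℕ
 hd [] = 0
 hd (c ∷ _) = c

 -- Sums over the partitions obtained by removing a horizontal strip, with the
 -- Hall-Littlewood branching weights; the index tells whether the first column shrinks.
 Es₀ Es₁ : ℤ → List ℕ → (List ℕ → Carrier) → Carrier
 Es₀ z [] g = g []
 Es₀ z (c ∷ cs) g = Es₀ z cs (λ d → g (c ∷ d)) + (1# - tp (suc c ∸ hd cs)) * Es₁ z cs (λ d → g (c ∷ d))
 Es₁ z [] g = 0#
 Es₁ z (zero ∷ cs) g = 0#
 Es₁ z (suc c ∷ cs) g = qz z * (Es₀ z cs (λ d → g (c ∷ d)) + Es₁ z cs (λ d → g (c ∷ d)))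

 module _ (B : ℕ) where
  Es₀-cong : ∀ z c {f g : List ℕ → Carrier} → All (_≤ B) c →
        (∀ e → hd e ≡ hd c → length e ≡ length c → All (_≤ B) e → f e ≈ g e) → Es₀ z c f ≈ Es₀ z c g
  Es₁-cong : ∀ z c {f g : List ℕ → Carrier} → All (_≤ B) c →
        (∀ e → suc (hd e) ≡ hd c → length e ≡ length c → All (_≤ B) e → f e ≈ g e) → Es₁ z c f ≈ Es₁ z c g
  Es₀-cong z [] _ h = h [] E.refl E.refl []
  Es₀-cong z (c ∷ cs) (p ∷ ps) h = +-cong
   (Es₀-cong z cs ps (λ e _ l q → h (c ∷ e) E.refl (E.cong suc l) (p ∷ q)))
   (*-congˡ (Es₁-cong z cs ps (λ e _ l q → h (c ∷ e) E.refl (E.cong suc l) (p ∷ q))))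
  Es₁-cong z [] _ h = refl
  Es₁-cong z (zero ∷ cs) _ h = refl
  Es₁-cong z (suc c ∷ cs) (p ∷ ps) h = *-congˡ (+-cong
   (Es₀-cong z cs ps (λ e _ l q → h (c ∷ e) E.refl (E.cong suc l) (NP.<⇒≤ p ∷ q)))
   (Es₁-cong z cs ps (λ e _ l q → h (c ∷ e) E.refl (E.cong suc l) (NP.<⇒≤ p ∷ q))))

  module _ {D : ℕ} where
   Es₀-mod : ∀ z c {f g : List ℕ → Carrier} → All (_≤ B) c → NonNeg z →
        (∀ e → length e ≡ length c → All (_≤ B) e → f e ≈[ D ] g e) → Es₀ z c f ≈[ D ] Es₀ z c g
   Es₁-mod : ∀ z c {f g : List ℕ → Carrier} → All (_≤ B) c → NonNeg z →
        (∀ e → length e ≡ length c → All (_≤ B) e → f e ≈[ D ] g e) → Es₁ z c f ≈[ D ] Es₁ z c g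
   Es₀-mod z [] _ n h = h [] E.refl []
   Es₀-mod z (c ∷ cs) (p ∷ ps) n h = ≈[]-+
    (Es₀-mod z cs ps n (λ e l q → h (c ∷ e) (E.cong suc l) (p ∷ q)))
    (≈[]-*ˡ (Int-- Int-1 (Int-tp (suc c ∸ hd cs))) (Es₁-mod z cs ps n (λ e l q → h (c ∷ e) (E.cong suc l) (p ∷ q))))
   Es₁-mod z [] _ n h = ≈[]-refl
   Es₁-mod z (zero ∷ cs) _ n h = ≈[]-refl
   Es₁-mod z (suc c ∷ cs) (p ∷ ps) n h = ≈[]-*ˡ (Int-qz⁺ n) (≈[]-+
    (Es₀-mod z cs ps n (λ e l q → h (c ∷ e) (E.cong suc l) (NP.<⇒≤ p ∷ q)))
    (Es₁-mod z cs ps n (λ e l q → h (c ∷ e) (E.cong suc l) (NP.<⇒≤ p ∷ q))))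

 Es₀-+ : ∀ z c (f g : List ℕ → Carrier) → Es₀ z c (λ d → f d + g d) ≈ Es₀ z c f + Es₀ z c g
 Es₁-+ : ∀ z c (f g : List ℕ → Carrier) → Es₁ z c (λ d → f d + g d) ≈ Es₁ z c f + Es₁ z c g
 Es₀-+ z [] f g = refl
 Es₀-+ z (c ∷ cs) f g = trans (+-cong (Es₀-+ z cs _ _) (*-congˡ (Es₁-+ z cs _ _)))
  (solve 5 (λ x y u v k → (x :+ y) :+ k :* (u :+ v) := (x :+ k :* u) :+ (y :+ k :* v)) tt _ _ _ _ _)
 Es₁-+ z [] f g = sym (+-identityˡ _)
 Es₁-+ z (zero ∷ cs) f g = sym (+-identityˡ _)
 Es₁-+ z (suc c ∷ cs) f g = trans (*-congˡ (+-cong (Es₀-+ z cs _ _) (Es₁-+ z cs _ _)))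
  (solve 5 (λ x y u v k → k :* ((x :+ y) :+ (u :+ v)) := k :* (x :+ u) :+ k :* (y :+ v)) tt _ _ _ _ _)

 Es₀-* : ∀ z c k (f : List ℕ → Carrier) → Es₀ z c (λ d → k * f d) ≈ k * Es₀ z c f
 Es₁-* : ∀ z c k (f : List ℕ → Carrier) → Es₁ z c (λ d → k * f d) ≈ k * Es₁ z c f
 Es₀-* z [] k f = refl
 Es₀-* z (c ∷ cs) k f = trans (+-cong (Es₀-* z cs k _) (*-congˡ (Es₁-* z cs k _)))
  (solve 4 (λ x u l k → k :* x :+ l :* (k :* u) := k :* (x :+ l :* u)) tt _ _ _ k)
 Es₁-* z [] k f = sym (zeroʳ _)
 Es₁-* z (zero ∷ cs) k f = sym (zeroʳ _)
 Es₁-* z (suc c ∷ cs) k f = trans (*-congˡ (+-cong (Es₀-* z cs k _) (Es₁-* z cs k _)))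
  (solve 4 (λ x u l k → l :* (k :* x :+ k :* u) := k :* (l :* (x :+ u))) tt _ _ _ k)

 Es₀-Spl : ∀ {X : Set} z c (S : List X) (u : List X → List X → Carrier) (g : List ℕ → List X → Carrier) →
      Es₀ z c (λ d → Spl S (λ K J → u K J * g d K)) ≈ Spl S (λ K J → u K J * Es₀ z c (λ d → g d K))
 Es₀-Spl z c [] u g = Es₀-* z c _ _
 Es₀-Spl z c (s ∷ S) u g = trans (Es₀-+ z c _ _) (+-cong (Es₀-Spl z c S _ (λ d K → g d (s ∷ K))) (Es₀-Spl z c S _ g))

 Es₁-Spl : ∀ {X : Set} z c (S : List X) (u : List X → List X → Carrier) (g : List ℕ → List X → Carrier) →
      Es₁ z c (λ d → Spl S (λ K J → u K J * g d K)) ≈ Spl S (λ K J → u K J * Es₁ z c (λ d → g d K))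
 Es₁-Spl z c [] u g = Es₁-* z c _ _
 Es₁-Spl z c (s ∷ S) u g = trans (Es₁-+ z c _ _) (+-cong (Es₁-Spl z c S _ (λ d K → g d (s ∷ K))) (Es₁-Spl z c S _ g))

 private
  HL-∷ : ∀ c d S → HL (c ∷ d) S ≈ Spl S (λ K J → (δ (length K) c * (xs K * W K J)) * HL d K)
  HL-∷ c d S = Spl-cong S (λ _ → sym (*-assoc _ _ _))

 bound : List ℕ → ℕ
 bound [] = 0
 bound (c ∷ cs) = c N.+ bound cs

 ≤bound : ∀ c → All (_≤ bound c) c
 ≤bound [] = []
 ≤bound (c ∷ cs) = NP.m≤m+n c _ ∷ All.map (λ p → NP.≤-trans p (NP.m≤n+m _ c)) (≤bound cs)

 private
  Es₀-ext : ∀ z c {f g : List ℕ → Carrier} → (∀ e → f e ≈ g e) → Es₀ z c f ≈ Es₀ z c g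
  Es₀-ext z c h = Es₀-cong (bound c) z c (≤bound c) (λ e _ _ _ → h e)
  Es₁-ext : ∀ z c {f g : List ℕ → Carrier} → (∀ e → f e ≈ g e) → Es₁ z c f ≈ Es₁ z c g
  Es₁-ext z c h = Es₁-cong (bound c) z c (≤bound c) (λ e _ _ _ → h e)

 -- Simultaneous induction over the columns through `HL-recursion`. The weight 1 - t^(suc c - hd cs)
 -- comes from the difference of `HL₁` and `HLt₁`: on a set with c elements the second is t^(suc c -
 -- hd cs) times the first.
 HL-branch₀ : ∀ z c S → Generic z S → Es₀ z c (λ d → HL d S) ≈ HL c (z ∷ S) - HL₁ c z S
 HL-branch₁ : ∀ z c S → Generic z S → Es₁ z c (λ d → HL d S) ≈ HL₁ c z S
 HL-branch₀ z [] S g = solve 0 (:1 := :1 :- :0) tt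
 HL-branch₀ z (c ∷ cs) S g = begin
  _ ≈⟨ +-cong (trans (Es₀-ext z cs (λ d → HL-∷ c d S)) (Es₀-Spl z cs S u HL)) (*-congˡ (trans (Es₁-ext z cs (λ d → HL-∷ c d S)) (Es₁-Spl z cs S u HL))) ⟩
  _ ≈⟨ +-congˡ (sym (Spl-* S e₁ _)) ⟩
  _ ≈⟨ Spl-+ S _ _ ⟨
  _ ≈⟨ Spl-cong S step ⟩
  _ ≈⟨ solve 2 (λ x y → x := (y :+ x) :- y) tt _ (HL₁ (c ∷ cs) z S) ⟩
  _ ≈⟨ +-congʳ (HL-recursion c cs z S g) ⟨
  _ ∎
  where
  u : List ℤ → List ℤ → Carrier
  u K J = δ (length K) c * (xs K * W K J)
  e₁ = 1# - tp (suc c ∸ hd cs)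
  tw : ∀ cs K → length K ≡ c → tp (suc c ∸ hd cs) * HL₁ cs z K ≈ HLt₁ cs z K
  tw [] K l = zeroʳ _
  tw (c₂ ∷ cs′) K l = trans (sym (Spl-* K _ _)) (Spl-cong K (λ {A} {B} s →
   trans (solve 3 (λ x y z → x :* (y :* z) := y :* (x :* z)) tt _ _ _)
    (δ-cong (suc (length A)) c₂ (λ eq → *-congʳ (reflexive (E.cong tp (E.trans (E.cong₂ (λ x y → suc x ∸ y) (E.trans (E.sym l) (E.sym (length-split s))) (E.sym eq)) (NP.m+n∸m≡n (length A) (length B)))))))))
  step : ∀ {K J} → Split S K J → u K J * Es₀ z cs (λ d → HL d K) + e₁ * (u K J * Es₁ z cs (λ d → HL d K)) ≈ δ (length K) c * (xs K * W K J * (HL cs (z ∷ K) - HLt₁ cs z K))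
  step {K} {J} s = begin
   _ ≈⟨ +-cong (*-congˡ (HL-branch₀ z cs K gK)) (*-congˡ (*-congˡ (HL-branch₁ z cs K gK))) ⟩
   _ ≈⟨ solve 5 (λ d x h k T → (d :* x) :* (h :- k) :+ (:1 :- T) :* ((d :* x) :* k) := d :* (x :* (h :- T :* k))) tt (δ (length K) c) (xs K * W K J) (HL cs (z ∷ K)) (HL₁ cs z K) (tp (suc c ∸ hd cs)) ⟩
   _ ≈⟨ δ-cong (length K) c (λ l → *-congˡ (+-congˡ (-‿cong (tw cs K l)))) ⟩
   _ ∎
   where gK = proj₁ (Generic-split s g)
 HL-branch₁ z [] S g = refl
 HL-branch₁ z (zero ∷ cs) S g = sym (trans (Spl-cong S (λ _ → zeroˡ _)) (Spl-0 S))
 HL-branch₁ z (suc c ∷ cs) S g = begin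
  _ ≈⟨ *-congˡ (+-cong (trans (Es₀-ext z cs (λ d → HL-∷ c d S)) (Es₀-Spl z cs S u HL)) (trans (Es₁-ext z cs (λ d → HL-∷ c d S)) (Es₁-Spl z cs S u HL))) ⟩
  _ ≈⟨ trans (*-congˡ (sym (Spl-+ S _ _))) (sym (Spl-* S _ _)) ⟩
  _ ≈⟨ Spl-cong S step ⟩
  _ ∎
  where
  u : List ℤ → List ℤ → Carrier
  u K J = δ (length K) c * (xs K * W K J)
  step : ∀ {K J} → Split S K J → qz z * (u K J * Es₀ z cs (λ d → HL d K) + u K J * Es₁ z cs (λ d → HL d K)) ≈ δ (length K) c * (qz z * xs K * W K J * HL cs (z ∷ K))
  step {K} {J} s = begin
   _ ≈⟨ *-congˡ (+-cong (*-congˡ (HL-branch₀ z cs K gK)) (*-congˡ (HL-branch₁ z cs K gK))) ⟩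
   _ ≈⟨ solve 6 (λ q d x w h k → q :* (d :* (x :* w) :* (h :- k) :+ d :* (x :* w) :* k) := d :* (q :* x :* w :* h)) tt (qz z) (δ (length K) c) (xs K) (W K J) (HL cs (z ∷ K)) (HL₁ cs z K) ⟩
   _ ∎
   where gK = proj₁ (Generic-split s g)

 Es : ℤ → List ℕ → (List ℕ → Carrier) → Carrier
 Es z c g = Es₀ z c g + Es₁ z c g

 HL-branch : ∀ z c S → Generic z S → HL c (z ∷ S) ≈ Es z c (λ d → HL d S)
 HL-branch z c S g = sym (trans (+-cong (HL-branch₀ z c S g) (HL-branch₁ z c S g)) (solve 2 (λ x y → (x :- y) :+ y := x) tt _ _))

 module _ {D : ℕ} where
  sumTo-mod : ∀ n {f g : ℕ → Carrier} → (∀ i → i N.< n → f i ≈[ D ] g i) → sumTo n f ≈[ D ] sumTo n g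
  sumTo-mod zero e = ≈[]-refl
  sumTo-mod (suc n) e = ≈[]-+ (e 0 (s≤s z≤n)) (sumTo-mod n (λ i l → e (suc i) (s≤s l)))

  sumTo-single : ∀ n c {f : ℕ → Carrier} → c N.< n → (∀ i → i ≢ c → f i ≈[ D ] 0#) → sumTo n f ≈[ D ] f c
  sumTo-single (suc n) zero l e = ≈[]-trans (≈[]-+ ≈[]-refl (≈[]-trans (sumTo-mod n (λ i _ → e (suc i) (λ ()))) (≈⇒≈[] (sumTo-0 n)))) (≈⇒≈[] (+-identityʳ _))
  sumTo-single (suc n) (suc c) (s≤s l) e = ≈[]-trans (≈[]-+ (e 0 (λ ())) (sumTo-single n c l (λ i i≢ → e (suc i) (λ { E.refl → i≢ E.refl })))) (≈⇒≈[] (+-identityˡ _))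

 ΣL-mod : ∀ {D} B n {f g : List ℕ → Carrier} → (∀ v → length v ≡ n → All (_≤ B) v → f v ≈[ D ] g v) → ΣL B n f ≈[ D ] ΣL B n g
 ΣL-mod B zero e = e [] E.refl []
 ΣL-mod B (suc n) e = sumTo-mod (suc B) (λ { i (s≤s l) → ΣL-mod B n (λ v q p → e (i ∷ v) (E.cong suc q) (l ∷ p)) })

 Es₀-ΣL : ∀ z c B n (f : List ℕ → List ℕ → Carrier) → Es₀ z c (λ e → ΣL B n (f e)) ≈ ΣL B n (λ d → Es₀ z c (λ e → f e d))
 Es₁-ΣL : ∀ z c B n (f : List ℕ → List ℕ → Carrier) → Es₁ z c (λ e → ΣL B n (f e)) ≈ ΣL B n (λ d → Es₁ z c (λ e → f e d))
 Es₀-ΣL z [] B n f = refl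
 Es₀-ΣL z (c ∷ cs) B n f = trans (+-cong (Es₀-ΣL z cs B n _) (trans (*-congˡ (Es₁-ΣL z cs B n _)) (sym (ΣL-* B n _ _)))) (sym (ΣL-+ B n _ _))
 Es₁-ΣL z [] B n f = sym (ΣL-0 B n)
 Es₁-ΣL z (zero ∷ cs) B n f = sym (ΣL-0 B n)
 Es₁-ΣL z (suc c ∷ cs) B n f = trans (*-congˡ (trans (+-cong (Es₀-ΣL z cs B n _) (Es₁-ΣL z cs B n _)) (sym (ΣL-+ B n _ _)))) (sym (ΣL-* B n _ _))

 -- Branching along a whole geometric progression

 -- (t;t)_n and its inverse
 fac ifac : ℕ → Carrier
 fac zero = 1#
 fac (suc n) = fac n * (1# - tp (suc n))
 ifac zero = 1#
 ifac (suc n) = ifac n * a (+ (M₀ N.* suc n))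

 tp≈qz : ∀ n → tp n ≈ qz (+ (M₀ N.* n))
 tp≈qz zero = trans (sym qz-0) (qz-cong (E.cong +_ (E.sym (NP.*-zeroʳ M₀))))
 tp≈qz (suc n) = trans (*-congˡ (tp≈qz n)) (trans (sym (qz-+ (+ M₀) (+ (M₀ N.* n)))) (qz-cong (E.cong +_ (E.sym (NP.*-suc M₀ n)))))

 at-inv : ∀ n → (1# - tp (suc n)) * a (+ (M₀ N.* suc n)) ≈ 1#
 at-inv n = trans (*-congʳ (+-congˡ (-‿cong (tp≈qz (suc n))))) (a-inv (λ e → nz (ZP.+-injective e)))
  where
  nz : M₀ N.* suc n ≢ 0
  nz e with NP.m*n≡0⇒m≡0∨n≡0 M₀ e
  ... | inj₁ x = M≢0 x

 fac-ifac : ∀ n → fac n * ifac n ≈ 1#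
 fac-ifac zero = *-identityˡ _
 fac-ifac (suc n) = trans (*-inter {X = ℕ} _ _ _ _) (trans (*-cong (fac-ifac n) (at-inv n)) (*-identityˡ _))

 ifac-suc : ∀ n → ifac n ≈ (1# - tp (suc n)) * ifac (suc n)
 ifac-suc n = sym (trans (solve 3 (λ x y z → x :* (y :* z) := y :* (x :* z)) tt _ _ _) (trans (*-congˡ (at-inv n)) (*-identityʳ _)))

 -- 1/(t;t)_{c-d}, zero for d > c
 ifd : ℕ → ℕ → Carrier
 ifd c zero = ifac c
 ifd zero (suc d) = 0#
 ifd (suc c) (suc d) = ifd c d

 le : ℕ → ℕ → Carrier
 le zero n = 1#
 le (suc m) zero = 0#
 le (suc m) (suc n) = le m n

 ifd-suc : ∀ c e → ifd c (suc e) ≈ (1# - tp (c ∸ e)) * ifd c e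
 ifd-suc zero zero = sym (trans (*-congʳ (-‿inverseʳ 1#)) (zeroˡ _))
 ifd-suc zero (suc e) = sym (zeroʳ _)
 ifd-suc (suc c) zero = ifac-suc c
 ifd-suc (suc c) (suc e) = ifd-suc c e

 ifd-≤ : ∀ {c d} → d ≤ c → ifd c d ≈ ifac (c ∸ d)
 ifd-≤ z≤n = refl
 ifd-≤ (s≤s p) = ifd-≤ p

 ifd-> : ∀ {c d} → c N.< d → ifd c d ≈ 0#
 ifd-> {zero} {suc d} _ = refl
 ifd-> {suc c} {suc d} (s≤s p) = ifd-> p

 le-≤ : ∀ {m n} → m ≤ n → le m n ≈ 1#
 le-≤ z≤n = refl
 le-≤ (s≤s p) = le-≤ p

 le-> : ∀ {m n} → n N.< m → le m n ≈ 0#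
 le-> {suc m} {zero} _ = refl
 le-> {suc m} {suc n} (s≤s p) = le-> p

 tp-+ : ∀ m n → tp (m N.+ n) ≈ tp m * tp n
 tp-+ zero n = sym (*-identityˡ _)
 tp-+ (suc m) n = trans (*-congˡ (tp-+ m n)) (sym (*-assoc _ _ _))

 -- q^{z + (z+M) + ... + (z+(k-1)M₀)}
 pw : ℤ → ℕ → Carrier
 pw z zero = 1#
 pw z (suc k) = qz z * pw (z Z.+ + M₀) k

 pw-shift : ∀ z k → pw (z Z.+ + M₀) k ≈ tp k * pw z k
 pw-shift z zero = sym (*-identityˡ _)
 pw-shift z (suc k) = trans (*-cong (qz-+ z (+ M₀)) (pw-shift (z Z.+ + M₀) k))
  (solve 4 (λ q t T p → (q :* t) :* (T :* p) := (t :* T) :* (q :* p)) tt (qz z) t (tp k) (pw (z Z.+ + M₀) k))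

 -- Branching for the alphabet q^z, q^(z+M), q^(z+2M), ...
 Tm : ℤ → List ℕ → List ℕ → Carrier
 Tm z [] [] = 1#
 Tm z (c ∷ cs) (d ∷ ds) = le (hd ds) d * (pw z (c ∸ d) * ifd c d * (fac (c ∸ hd ds) * ifd c (hd cs)) * Tm z cs ds)
 Tm z _ _ = 0#

 private
  -- The q-Pascal rule in base t for the Gaussian binomial of c' - d₂ over c₂ - d₂, with the factor
  -- 1/(t;t)_(c₂-d₂) removed.
  key : ∀ c' c₂ d₂ → d₂ ≤ c₂ → d₂ ≤ c' →
     fac (c' ∸ d₂) * (ifd c' c₂ * tp (c₂ ∸ d₂) + ifd c' (c₂ ∸ 1) * (1# - tp (c₂ ∸ d₂))) ≈ fac (suc c' ∸ d₂) * ifd (suc c') c₂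
  key c' zero zero p q = trans (*-congˡ (solve 2 (λ x y → x :* :1 :+ x :* (:1 :- :1) := x) tt (ifac c') 1#)) (trans (fac-ifac c') (sym (fac-ifac (suc c'))))
  key c' (suc e) d₂ p q with e N.≤? c'
  ... | yes e≤c = begin
   _ ≈⟨ *-congˡ (+-congʳ (*-congʳ (ifd-suc c' e))) ⟩
   _ ≈⟨ solve 4 (λ f x i T → f :* ((:1 :- x) :* i :* T :+ i :* (:1 :- T)) := (f :* (:1 :- x :* T)) :* i) tt (fac (c' ∸ d₂)) (tp (c' ∸ e)) (ifd c' e) T ⟩
   _ ≈⟨ *-congʳ (*-congˡ (+-congˡ (-‿cong (trans (sym (tp-+ (c' ∸ e) (suc e ∸ d₂))) (reflexive (E.cong tp ar)))))) ⟩
   _ ≈⟨ *-congʳ (reflexive (E.cong fac (E.sym (NP.+-∸-assoc 1 q)))) ⟩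
   _ ∎
   where
   T = tp (suc e ∸ d₂)
   ar : c' ∸ e N.+ (suc e ∸ d₂) ≡ suc (c' ∸ d₂)
   ar = E.trans (E.sym (NP.+-∸-assoc (c' ∸ e) p)) (E.trans (E.cong (_∸ d₂) (E.trans (NP.+-suc (c' ∸ e) e) (E.cong suc (NP.m∸n+n≡m e≤c)))) (NP.+-∸-assoc 1 q))
  ... | no e≰c = trans (*-congˡ (trans (+-cong (trans (*-congʳ (ifd-> {c'} {suc e} (NP.m<n⇒m<1+n (NP.≰⇒> e≰c)))) (zeroˡ _)) (trans (*-congʳ (ifd-> {c'} {e} (NP.≰⇒> e≰c))) (zeroˡ _))) (+-identityˡ _)))
     (trans (zeroʳ _) (sym (trans (*-congˡ (ifd-> {c'} {e} (NP.≰⇒> e≰c))) (zeroʳ _))))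

  Tm-zero : ∀ z cs ds → hd cs N.< hd ds → Tm z cs ds ≈ 0#
  Tm-zero z [] (d ∷ ds) p = refl
  Tm-zero z (c ∷ cs) (d ∷ ds) p = trans (*-congˡ (trans (*-congʳ (trans (*-congʳ (trans (*-congˡ (ifd-> {c} {d} p)) (zeroʳ _))) (zeroˡ _))) (zeroˡ _))) (zeroʳ _)

 -- Shifting the alphabet by M₀ multiplies the weight of the c - d boxes in the first column by
 -- t^(c-d). So the strips that avoid this column make up the share t^(c-d) of `Tm`, and those that
 -- meet it make up the rest.
 Tm-Es₀ : ∀ z c d → Es₀ z c (λ e → Tm (z Z.+ + M₀) e d) ≈ tp (hd c ∸ hd d) * Tm z c d
 Tm-Es₁ : ∀ z c d → Es₁ z c (λ e → Tm (z Z.+ + M₀) e d) ≈ (1# - tp (hd c ∸ hd d)) * Tm z c d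
 Tm-Es₀ z [] [] = sym (*-identityˡ _)
 Tm-Es₀ z [] (d ∷ ds) = sym (zeroʳ _)
 Tm-Es₀ z (c ∷ cs) [] = trans (+-cong (zz₀ cs) (trans (*-congˡ (zz₁ cs)) (zeroʳ _))) (trans (+-identityˡ _) (sym (zeroʳ _)))
  where
  zz₀ : ∀ cs → Es₀ z cs (λ _ → 0#) ≈ 0#
  zz₀ cs = trans (trans (Es₀-pointwise z cs (λ _ → sym (zeroˡ 0#))) (Es₀-* z cs 0# (λ _ → 0#))) (zeroˡ _)
   where
   Es₀-pointwise : ∀ z c {f g : List ℕ → Carrier} → (∀ e → f e ≈ g e) → Es₀ z c f ≈ Es₀ z c g
   Es₀-pointwise z c h = Es₀-cong (bound c) z c (≤bound c) (λ e _ _ _ → h e)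
  zz₁ : ∀ cs → Es₁ z cs (λ _ → 0#) ≈ 0#
  zz₁ cs = trans (trans (Es₁-cong (bound cs) z cs (≤bound cs) (λ _ _ _ _ → sym (zeroˡ 0#))) (Es₁-* z cs 0# (λ _ → 0#))) (zeroˡ _)
 Tm-Es₀ z (c ∷ cs) (d ∷ ds) = begin
  _ ≈⟨ +-cong (trans (Es₀-cong B z cs (≤bound cs) (λ e h _ _ → step₀ e h)) (Es₀-* z cs _ _))
        (*-congˡ (trans (Es₁-cong B z cs (≤bound cs) (λ e h _ _ → step₁ e h)) (Es₁-* z cs _ _))) ⟩
  _ ≈⟨ +-cong (*-congˡ (Tm-Es₀ z cs ds)) (last cs) ⟩
  _ ≈⟨ +-cong (*-congʳ (*-congʳ X≈)) (*-congʳ (*-congʳ X≈)) ⟩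
  _ ≈⟨ solve 8 (λ L S p i f j u T → (L :* ((S :* p) :* i :* f)) :* j :* (u :* T) :+ (L :* ((S :* p) :* i :* f)) :* j :* ((:1 :- u) :* T)
      := S :* (L :* (p :* i :* (f :* j) :* T))) tt (le (hd ds) d) (tp (c ∸ d)) (pw z (c ∸ d)) (ifd c d) (fac (c ∸ hd ds)) (ifd c (hd cs)) (tp k') T' ⟩
  _ ∎
  where
  z' = z Z.+ + M₀
  B = bound cs
  k' = hd cs ∸ hd ds
  T' = Tm z cs ds
  X = le (hd ds) d * (pw z' (c ∸ d) * ifd c d * fac (c ∸ hd ds))
  X≈ : X ≈ le (hd ds) d * ((tp (c ∸ d) * pw z (c ∸ d)) * ifd c d * fac (c ∸ hd ds))
  X≈ = *-congˡ (*-congʳ (*-congʳ (pw-shift z (c ∸ d))))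
  arr : ∀ L p i f j T → L * (p * i * (f * j) * T) ≈ (L * (p * i * f)) * j * T
  arr = solve 6 (λ L p i f j T → L :* (p :* i :* (f :* j) :* T) := (L :* (p :* i :* f)) :* j :* T) tt
  step₀ : ∀ e → hd e ≡ hd cs → Tm z' (c ∷ e) (d ∷ ds) ≈ X * ifd c (hd cs) * Tm z' e ds
  step₀ e h = trans (arr _ _ _ _ _ _) (*-congʳ (*-congˡ (reflexive (E.cong (ifd c) h))))
  step₁ : ∀ e → suc (hd e) ≡ hd cs → Tm z' (c ∷ e) (d ∷ ds) ≈ X * ifd c (hd cs ∸ 1) * Tm z' e ds
  step₁ e h = trans (arr _ _ _ _ _ _) (*-congʳ (*-congˡ (reflexive (E.cong (ifd c) (E.cong (_∸ 1) h)))))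
  last : ∀ cs → (1# - tp (suc c ∸ hd cs)) * (X * ifd c (hd cs ∸ 1) * Es₁ z cs (λ e → Tm z' e ds)) ≈ X * ifd c (hd cs) * ((1# - tp (hd cs ∸ hd ds)) * Tm z cs ds)
  last [] = trans (*-congˡ (zeroʳ _)) (trans (zeroʳ _) (sym (trans (*-congˡ (nil ds)) (zeroʳ _))))
   where
   nil : ∀ ds → (1# - tp (0 ∸ hd ds)) * Tm z [] ds ≈ 0#
   nil [] = trans (*-congʳ (-‿inverseʳ 1#)) (zeroˡ _)
   nil (_ ∷ _) = zeroʳ _
  last (zero ∷ cs) = trans (*-congˡ (zeroʳ _)) (trans (zeroʳ _) (sym (trans (*-congˡ (trans (*-congʳ (trans (+-congˡ (-‿cong (reflexive (E.cong tp (NP.0∸n≡0 (hd ds)))))) (-‿inverseʳ 1#))) (zeroˡ _))) (zeroʳ _))))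
  last (suc e ∷ cs) = begin
   _ ≈⟨ *-congˡ (*-congˡ (Tm-Es₁ z (suc e ∷ cs) ds)) ⟩
   _ ≈⟨ solve 4 (λ u X i Y → u :* (X :* i :* Y) := X :* (u :* i) :* Y) tt (1# - tp (c ∸ e)) X (ifd c e) Y ⟩
   _ ≈⟨ *-congʳ (*-congˡ (sym (ifd-suc c e))) ⟩
   _ ∎
   where Y = (1# - tp (suc e ∸ hd ds)) * Tm z (suc e ∷ cs) ds
 Tm-Es₁ z [] [] = sym (trans (*-congʳ (-‿inverseʳ 1#)) (zeroˡ _))
 Tm-Es₁ z [] (d ∷ ds) = sym (zeroʳ _)
 Tm-Es₁ z (zero ∷ cs) ds = sym (trans (*-congʳ (trans (+-congˡ (-‿cong (reflexive (E.cong tp (NP.0∸n≡0 (hd ds)))))) (-‿inverseʳ 1#))) (zeroˡ _))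
 Tm-Es₁ z (suc c ∷ cs) [] = trans (*-congˡ (+-cong (trans (Es₀-cong (bound cs) z cs (≤bound cs) (λ _ _ _ _ → sym (zeroˡ 0#))) (trans (Es₀-* z cs 0# (λ _ → 0#)) (zeroˡ _)))
   (trans (Es₁-cong (bound cs) z cs (≤bound cs) (λ _ _ _ _ → sym (zeroˡ 0#))) (trans (Es₁-* z cs 0# (λ _ → 0#)) (zeroˡ _)))))
   (trans (*-congˡ (+-identityˡ _)) (trans (zeroʳ _) (sym (zeroʳ _))))
 Tm-Es₁ z (suc c ∷ cs) (d ∷ ds) = begin
  _ ≈⟨ *-congˡ (+-cong (trans (Es₀-cong B z cs (≤bound cs) (λ e h _ _ → step₀ e h)) (Es₀-* z cs _ _))
        (trans (Es₁-cong B z cs (≤bound cs) (λ e h _ _ → step₁ e h)) (Es₁-* z cs _ _))) ⟩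
  _ ≈⟨ *-congˡ (+-cong (*-congˡ (Tm-Es₀ z cs ds)) (*-congˡ (Tm-Es₁ z cs ds))) ⟩
  _ ≈⟨ solve 10 (λ q L p i f j u T j' o → q :* ((L :* (p :* i :* f)) :* j :* (u :* T) :+ (L :* (p :* i :* f)) :* j' :* ((:1 :- u) :* T))
      := L :* (((q :* p) :* i) :* (f :* (j :* u :+ j' :* (:1 :- u))) :* T)) tt (qz z) (le (hd ds) d) (pw z' (c ∸ d)) (ifd c d) (fac (c ∸ hd ds)) (ifd c (hd cs)) (tp k') T' (ifd c (hd cs ∸ 1)) 1# ⟩
  _ ≈⟨ cases ⟩
  _ ≈⟨ solve 6 (λ L u p i f T → L :* ((u :* (p :* i)) :* f :* T) := u :* (L :* (p :* i :* f :* T))) tt (le (hd ds) d) (1# - tp (suc c ∸ d)) (pw z (suc c ∸ d)) (ifd (suc c) d) (fac (suc c ∸ hd ds) * ifd (suc c) (hd cs)) T' ⟩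
  _ ∎
  where
  z' = z Z.+ + M₀
  B = bound cs
  k' = hd cs ∸ hd ds
  T' = Tm z cs ds
  X = le (hd ds) d * (pw z' (c ∸ d) * ifd c d * fac (c ∸ hd ds))
  arr : ∀ L p i f j T → L * (p * i * (f * j) * T) ≈ (L * (p * i * f)) * j * T
  arr = solve 6 (λ L p i f j T → L :* (p :* i :* (f :* j) :* T) := (L :* (p :* i :* f)) :* j :* T) tt
  step₀ : ∀ e → hd e ≡ hd cs → Tm z' (c ∷ e) (d ∷ ds) ≈ X * ifd c (hd cs) * Tm z' e ds
  step₀ e h = trans (arr _ _ _ _ _ _) (*-congʳ (*-congˡ (reflexive (E.cong (ifd c) h))))
  step₁ : ∀ e → suc (hd e) ≡ hd cs → Tm z' (c ∷ e) (d ∷ ds) ≈ X * ifd c (hd cs ∸ 1) * Tm z' e ds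
  step₁ e h = trans (arr _ _ _ _ _ _) (*-congʳ (*-congˡ (reflexive (E.cong (ifd c) (E.cong (_∸ 1) h)))))
  first : ∀ {d} → (qz z * pw z' (c ∸ d)) * ifd c d ≈ (1# - tp (suc c ∸ d)) * (pw z (suc c ∸ d) * ifd (suc c) d)
  first {d} with d N.≤? c
  ... | yes p = trans (*-congˡ (ifd-suc (suc c) d)) (trans (*-congʳ (reflexive (E.cong (pw z) (E.sym (NP.+-∸-assoc 1 p)))))
          (solve 3 (λ p u i → p :* (u :* i) := u :* (p :* i)) tt _ _ _))
  ... | no ¬p = trans (trans (*-congˡ (ifd-> {c} {d} (NP.≰⇒> ¬p))) (zeroʳ _))
          (sym (trans (*-congʳ (trans (+-congˡ (-‿cong (reflexive (E.cong tp (NP.m≤n⇒m∸n≡0 (NP.≰⇒> ¬p)))))) (-‿inverseʳ 1#))) (zeroˡ _)))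
  kills : ∀ {u x y x' y'} → u ≈ 0# → u * (x * y * T') ≈ u * (x' * y' * T')
  kills e = trans (*-congʳ e) (trans (zeroˡ _) (sym (trans (*-congʳ e) (zeroˡ _))))
  cases : le (hd ds) d * (((qz z * pw z' (c ∸ d)) * ifd c d) * (fac (c ∸ hd ds) * (ifd c (hd cs) * tp k' + ifd c (hd cs ∸ 1) * (1# - tp k'))) * T')
     ≈ le (hd ds) d * (((1# - tp (suc c ∸ d)) * (pw z (suc c ∸ d) * ifd (suc c) d)) * (fac (suc c ∸ hd ds) * ifd (suc c) (hd cs)) * T')
  cases with hd ds N.≤? d
  ... | no ¬p = kills (le-> (NP.≰⇒> ¬p))
  ... | yes p with hd ds N.≤? hd cs
  ... | no ¬r = *-congˡ (trans (trans (*-congˡ T0) (zeroʳ _)) (sym (trans (*-congˡ T0) (zeroʳ _))))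
   where T0 = Tm-zero z cs ds (NP.≰⇒> ¬r)
  ... | yes r with d N.≤? c
  ... | yes s = *-congˡ (*-congʳ (*-cong (first {d}) (key c (hd cs) (hd ds) r (NP.≤-trans p s))))
  ... | no ¬s = *-congˡ (*-congʳ (trans (trans (*-congʳ (trans (*-congˡ (ifd-> {c} {d} (NP.≰⇒> ¬s))) (zeroʳ _))) (zeroˡ _))
             (sym (trans (*-congʳ (trans (*-congʳ (trans (+-congˡ (-‿cong (reflexive (E.cong tp (NP.m≤n⇒m∸n≡0 (NP.≰⇒> ¬s)))))) (-‿inverseʳ 1#))) (zeroˡ _))) (zeroˡ _)))))

 Tm-Es : ∀ z c d → Es z c (λ e → Tm (z Z.+ + M₀) e d) ≈ Tm z c d
 Tm-Es z c d = trans (+-cong (Tm-Es₀ z c d) (Tm-Es₁ z c d)) (solve 2 (λ u T → u :* T :+ (:1 :- u) :* T := T) tt _ _)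

 prog : ℤ → ℕ → List ℤ
 prog z zero = []
 prog z (suc k) = z ∷ prog (z Z.+ + M₀) k

 dom : List ℕ → Carrier
 dom [] = 1#
 dom (c ∷ cs) = le (hd cs) c * dom cs

 Int-le : ∀ m n → Int (le m n)
 Int-le zero n = Int-1
 Int-le (suc m) zero = Int-0
 Int-le (suc m) (suc n) = Int-le m n

 Int-fac : ∀ n → Int (fac n)
 Int-fac zero = Int-1
 Int-fac (suc n) = Int-* (Int-fac n) (Int-- Int-1 (Int-tp (suc n)))

 Int-ifac : ∀ n → Int (ifac n)
 Int-ifac zero = Int-1
 Int-ifac (suc n) = Int-* (Int-ifac n) (Int-a _)

 Int-ifd : ∀ c d → Int (ifd c d)
 Int-ifd c zero = Int-ifac c
 Int-ifd zero (suc d) = Int-0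
 Int-ifd (suc c) (suc d) = Int-ifd c d

 Int-pw : ∀ z k → Int (pw (+ z) k)
 Int-pw z zero = Int-1
 Int-pw z (suc k) = Int-* (Int-qz z) (Int-pw (z N.+ M₀) k)

 Int-Tm : ∀ z c d → Int (Tm (+ z) c d)
 Int-Tm z [] [] = Int-1
 Int-Tm z (c ∷ cs) (d ∷ ds) = Int-* (Int-le (hd ds) d) (Int-* (Int-* (Int-* (Int-pw z (c ∸ d)) (Int-ifd c d)) (Int-* (Int-fac (c ∸ hd ds)) (Int-ifd c (hd cs)))) (Int-Tm z cs ds))
 Int-Tm z [] (d ∷ ds) = Int-0
 Int-Tm z (c ∷ cs) [] = Int-0

 -- Far out in the alphabet the branching matrix is the identity.
 Tm-far : ∀ {D} z B c (g : List ℕ → Carrier) → D ≤ z → All (_≤ B) c → (∀ d → Int (g d)) →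
      ΣL B (length c) (λ d → Tm (+ z) c d * g d) ≈[ D ] dom c * g c
 Tm-far z B [] g le′ _ i = ≈[]-refl
 Tm-far {D} z B (c ∷ cs) g D≤z (c≤B ∷ ps) i = ≈[]-trans
  (sumTo-single (suc B) c {f = λ x → ΣL B n (λ v → Tm (+ z) (c ∷ cs) (x ∷ v) * g (x ∷ v))} (s≤s c≤B) other)
  (≈[]-trans (≈⇒≈[] (ΣL-cong B n (λ v _ _ → diag v)))
  (≈[]-trans (Tm-far z B cs g′ D≤z ps (λ d → Int-* (Int-* (Int-le (hd d) c) (Int-* (Int-fac (c ∸ hd d)) (Int-ifd c (hd cs)))) (i (c ∷ d))))
  (≈⇒≈[] end)))
  where
  n = length cs
  g′ : List ℕ → Carrier
  g′ v = (le (hd v) c * (fac (c ∸ hd v) * ifd c (hd cs))) * g (c ∷ v)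
  diag : ∀ v → Tm (+ z) (c ∷ cs) (c ∷ v) * g (c ∷ v) ≈ Tm (+ z) cs v * g′ v
  diag v = trans (*-congʳ (*-congˡ (*-congʳ (*-congʳ (*-cong (reflexive (E.cong (pw (+ z)) (NP.n∸n≡0 c))) (trans (ifd-≤ (NP.≤-refl {c})) (reflexive (E.cong ifac (NP.n∸n≡0 c)))))))))
   (solve 4 (λ L f T g → (L :* (:1 :* :1 :* f :* T)) :* g := T :* ((L :* f) :* g)) tt (le (hd v) c) _ _ _)
  end : dom cs * g′ cs ≈ dom (c ∷ cs) * g (c ∷ cs)
  end with hd cs N.≤? c
  ... | yes p = trans (*-congˡ (*-congʳ (*-congˡ (trans (*-congˡ (ifd-≤ p)) (fac-ifac (c ∸ hd cs))))))
          (solve 3 (λ d l g → d :* ((l :* :1) :* g) := (l :* d) :* g) tt _ _ _)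
  ... | no ¬p = trans (trans (*-congˡ (trans (*-congʳ (trans (*-congʳ l0) (zeroˡ _))) (zeroˡ _))) (zeroʳ _)) (sym (trans (*-congʳ (trans (*-congʳ l0) (zeroˡ _))) (zeroˡ _)))
   where l0 = le-> {hd cs} {c} (NP.≰⇒> ¬p)
  pw0 : ∀ k → k ≢ 0 → pw (+ z) k ≈[ D ] 0#
  pw0 zero k≢0 = ⊥-elim (k≢0 E.refl)
  pw0 (suc k) _ = 0-*ʳ (Int-pw (z N.+ M₀) k) (qz≈[]0 z D≤z)
  fst0 : ∀ x → x ≢ c → pw (+ z) (c ∸ x) * ifd c x ≈[ D ] 0#
  fst0 x x≢c with x N.≤? c
  ... | yes p = 0-*ʳ (Int-ifd c x) (pw0 (c ∸ x) (λ e → x≢c (NP.≤-antisym p (NP.m∸n≡0⇒m≤n e))))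
  ... | no ¬p = ≈⇒≈[] (trans (*-congˡ (ifd-> {c} {x} (NP.≰⇒> ¬p))) (zeroʳ _))
  other : ∀ x → x ≢ c → ΣL B n (λ v → Tm (+ z) (c ∷ cs) (x ∷ v) * g (x ∷ v)) ≈[ D ] 0#
  other x x≢c = ≈[]-trans (ΣL-mod B n (λ v _ _ → 0-*ʳ (i (x ∷ v)) (0-*ˡ (Int-le (hd v) x)
    (0-*ʳ (Int-Tm z cs v) (0-*ʳ (Int-* (Int-fac (c ∸ hd v)) (Int-ifd c (hd cs))) (fst0 x x≢c)))))) (≈⇒≈[] (ΣL-0 B n))

 -- Each column selects a subset of the previous one, so `HL` is already zero when the column
 -- lengths do not decrease weakly.
 HL-dom : ∀ c S → dom c * HL c S ≈ HL c S
 HL-dom [] S = *-identityˡ _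
 HL-dom (c ∷ cs) S = trans (sym (Spl-* S _ _)) (Spl-cong S (λ {K} {J} s → begin
   _ ≈⟨ solve 5 (λ l d e x h → (l :* d) :* (e :* (x :* h)) := e :* (x :* (l :* (d :* h)))) tt (le (hd cs) c) (dom cs) (δ (length K) c) (xs K * W K J) (HL cs K) ⟩
   _ ≈⟨ δ-cong (length K) c (λ l → *-congˡ (trans (*-congˡ (HL-dom cs K)) (drop cs K l))) ⟩
   _ ∎))
  where
  δ0 : ∀ m n → m N.< n → δ m n ≈ 0#
  δ0 zero (suc n) _ = refl
  δ0 (suc m) (suc n) (s≤s p) = δ0 m n p
  drop : ∀ cs K → length K ≡ c → le (hd cs) c * HL cs K ≈ HL cs K
  drop [] K l = *-identityˡ _
  drop (c₂ ∷ cs) K l with c₂ N.≤? c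
  ... | yes p = trans (*-congʳ (le-≤ p)) (*-identityˡ _)
  ... | no ¬p = trans (*-congˡ z0) (trans (zeroʳ _) (sym z0))
   where
   z0 : HL (c₂ ∷ cs) K ≈ 0#
   z0 = trans (Spl-cong K (λ {A} {B} s → trans (*-congʳ (δ0 (length A) c₂ (NP.≤-<-trans (E.subst (length A ≤_) (E.trans (length-split s) l) (NP.m≤m+n _ _)) (NP.≰⇒> ¬p)))) (zeroˡ _))) (Spl-0 K)

 data AllGeneric : List ℤ → Set where
  [] : AllGeneric []
  _∷_ : ∀ {z S} → Generic z S → AllGeneric S → AllGeneric (z ∷ S)

 -- `HL-branch` removes the first letter and `Tm-Es` puts it back into the closed form. After b
 -- letters the progression has reached exponent D, where `Tm-far` makes the remaining branching
 -- trivial.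
 HL-prog : ∀ {D} b z B c S → D ≤ z N.+ b N.* M₀ → All (_≤ B) c → All NonNeg S → AllGeneric (prog (+ z) b ++ S) →
      HL c (prog (+ z) b ++ S) ≈[ D ] ΣL B (length c) (λ d → Tm (+ z) c d * HL d S)
 HL-prog zero z B c S D≤ ps nn g = ≈[]-sym (≈[]-trans (Tm-far z B c (λ d → HL d S) (E.subst (_ ≤_) (NP.+-identityʳ z) D≤) ps (λ d → Int-HL d S nn)) (≈⇒≈[] (HL-dom c S)))
 HL-prog {D} (suc b) z B c S D≤ ps nn (g ∷ gs) =
  ≈[]-trans (≈⇒≈[] (HL-branch (+ z) c S′ g))
  (≈[]-trans (≈[]-+ (Es₀-mod B (+ z) c ps (nonNeg z) IH) (Es₁-mod B (+ z) c ps (nonNeg z) IH))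
  (≈⇒≈[] (begin
   _ ≈⟨ +-cong (Es₀-ΣL (+ z) c B n _) (Es₁-ΣL (+ z) c B n _) ⟩
   _ ≈⟨ ΣL-+ B n _ _ ⟨
   _ ≈⟨ ΣL-cong B n (λ d _ _ → pull d) ⟩
   _ ∎)))
  where
  n = length c
  S′ = prog (+ (z N.+ M₀)) b ++ S
  IH : ∀ e → length e ≡ n → All (_≤ B) e → HL e S′ ≈[ D ] ΣL B n (λ d → Tm (+ (z N.+ M₀)) e d * HL d S)
  IH e l q = E.subst (λ k → HL e S′ ≈[ D ] ΣL B k (λ d → Tm (+ (z N.+ M₀)) e d * HL d S)) l
   (HL-prog b (z N.+ M₀) B e S (E.subst (D ≤_) (E.sym (NP.+-assoc z M₀ (b N.* M₀))) D≤) q nn gs)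
  pull : ∀ d → Es₀ (+ z) c (λ e → Tm (+ (z N.+ M₀)) e d * HL d S) + Es₁ (+ z) c (λ e → Tm (+ (z N.+ M₀)) e d * HL d S) ≈ Tm (+ z) c d * HL d S
  pull d = begin
   _ ≈⟨ +-cong (Es₀-cong (bound c) (+ z) c (≤bound c) (λ _ _ _ _ → *-comm _ _)) (Es₁-cong (bound c) (+ z) c (≤bound c) (λ _ _ _ _ → *-comm _ _)) ⟩
   _ ≈⟨ +-cong (Es₀-* (+ z) c (HL d S) _) (Es₁-* (+ z) c (HL d S) _) ⟩
   _ ≈⟨ distribˡ _ _ _ ⟨
   _ ≈⟨ *-congˡ (Tm-Es (+ z) c d) ⟩
   _ ≈⟨ *-comm _ _ ⟩
   _ ∎

 -- Reflections and sums over all signs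

 -- Reflection of positions: if position y carries the variable x, then bar y carries 1/x.
 bar : ℤ → ℤ
 bar y = Z.- e Z.- y

 -- The exponent of the product of the two variables, position y standing for q^(y + e/2).
 sm : ℤ → ℤ → ℤ
 sm x y = x Z.+ y Z.+ e

 bar-bar : ∀ y → bar (bar y) ≡ y
 bar-bar y = lem e y
  where
  lem : ∀ e y → Z.- e Z.- (Z.- e Z.- y) ≡ y
  lem = ZS.solve-∀

 sm-comm : ∀ x y → sm x y ≡ sm y x
 sm-comm x y = E.cong (Z._+ e) (ZP.+-comm x y)

 sm≡ : ∀ x y → sm x y ≡ x Z.- bar y
 sm≡ x y = lem e x y
  where
  lem : ∀ e x y → x Z.+ y Z.+ e ≡ x Z.- (Z.- e Z.- y)
  lem = ZS.solve-∀

 sm-bar : ∀ x y → sm x (bar y) ≡ x Z.- y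
 sm-bar x y = lem e x y
  where
  lem : ∀ e x y → x Z.+ (Z.- e Z.- y) Z.+ e ≡ x Z.- y
  lem = ZS.solve-∀

 bar-sm : ∀ x y → sm (bar x) y ≡ y Z.- x
 bar-sm x y = E.trans (sm-comm (bar x) y) (sm-bar y x)

 bar-bar- : ∀ x y → bar x Z.- bar y ≡ y Z.- x
 bar-bar- x y = lem e x y
  where
  lem : ∀ e x y → (Z.- e Z.- x) Z.- (Z.- e Z.- y) ≡ y Z.- x
  lem = ZS.solve-∀

 -bar : ∀ x y → x Z.- bar y ≡ sm x y
 -bar x y = E.sym (sm≡ x y)

 bar- : ∀ x y → bar x Z.- y ≡ sm (bar x) (bar y)
 bar- x y = E.sym (sm-bar (bar x) y)

 bar-inj : ∀ {x y} → bar x ≡ bar y → x ≡ y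
 bar-inj {x} {y} p = E.trans (E.sym (bar-bar x)) (E.trans (E.cong bar p) (bar-bar y))

 sm≢0 : ∀ {x y} → x ≢ bar y → sm x y ≢ + 0
 sm≢0 {x} {y} n p = diff≢0 n (E.trans (E.sym (sm≡ x y)) p)

 Sep : ℤ → ℤ → Set
 Sep x y = (x ≢ y) × (x ≢ bar y)

 Sep-barʳ : ∀ {x y} → Sep x y → Sep x (bar y)
 Sep-barʳ {x} {y} (p , q) = q , λ r → p (E.trans r (bar-bar y))

 Sep-barˡ : ∀ {x y} → Sep x y → Sep (bar x) y
 Sep-barˡ {x} {y} (p , q) = (λ r → q (E.trans (E.sym (bar-bar x)) (E.cong bar r))) , λ r → p (bar-inj r)

 Sep-sym : ∀ {x y} → Sep x y → Sep y x
 Sep-sym {x} {y} (p , q) = (λ r → p (E.sym r)) , λ r → q (E.trans (E.sym (bar-bar x)) (E.cong bar (E.sym r)))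

 NonSelf : ℤ → Set
 NonSelf x = x ≢ bar x

 Separated : List ℤ → Set
 Separated [] = ⊤
 Separated (s ∷ S) = (NonSelf s × All (Sep s) S) × Separated S

 Separated-pick : ∀ {S x r} → Pick S x r → Separated S → (NonSelf x × All (Sep x) r) × Separated r
 Separated-pick here (p , ps) = p , ps
 Separated-pick (there i) ((n , p) , ps) with Separated-pick i ps | All-pick i p
 ... | (nx , sx) , sr | sep , pr = (nx , Sep-sym sep ∷ sx) , ((n , pr) , sr)

 Separated-split : ∀ {S K J} → Split S K J → Separated S → Separated K × Separated J
 Separated-split [] _ = tt , tt
 Separated-split (lft s) ((n , p) , ps) with Separated-split s ps
 ... | k , j = ((n , proj₁ (All-split s p)) , k) , j
 Separated-split (rgt s) ((n , p) , ps) with Separated-split s ps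
 ... | k , j = k , ((n , proj₂ (All-split s p)) , j)

 Separated⇒Distinct : ∀ S → Separated S → Distinct S
 Separated⇒Distinct [] _ = tt
 Separated⇒Distinct (s ∷ S) ((_ , p) , ps) = All.map proj₁ p , Separated⇒Distinct S ps

 Distinct-bar : ∀ S → Distinct S → Distinct (map bar S)
 Distinct-bar [] _ = tt
 Distinct-bar (s ∷ S) (p , ps) = go S p , Distinct-bar S ps
  where
  go : ∀ T → All (s ≢_) T → All (bar s ≢_) (map bar T)
  go [] [] = []
  go (y ∷ T) (n ∷ ns) = (λ r → n (bar-inj r)) ∷ go T ns

 All-bar : ∀ {P R : ℤ → Set} → (∀ {y} → P y → R (bar y)) → ∀ {S} → All P S → All R (map bar S)
 All-bar h [] = []
 All-bar h (p ∷ ps) = h p ∷ All-bar h ps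

 Sgn : List ℤ → (List ℤ → Carrier) → Carrier
 Sgn [] g = g []
 Sgn (s ∷ S) g = Sgn S (λ Y → g (s ∷ Y)) + Sgn S (λ Y → g (bar s ∷ Y))

 data Signed : List ℤ → List ℤ → Set where
  [] : Signed [] []
  pos : ∀ {s S Y} → Signed S Y → Signed (s ∷ S) (s ∷ Y)
  neg : ∀ {s S Y} → Signed S Y → Signed (s ∷ S) (bar s ∷ Y)

 Sgn-cong : ∀ S {f g : List ℤ → Carrier} → (∀ {Y} → Signed S Y → f Y ≈ g Y) → Sgn S f ≈ Sgn S g
 Sgn-cong [] h = h []
 Sgn-cong (s ∷ S) h = +-cong (Sgn-cong S (λ p → h (pos p))) (Sgn-cong S (λ p → h (neg p)))

 Sgn-+ : ∀ S (f g : List ℤ → Carrier) → Sgn S (λ Y → f Y + g Y) ≈ Sgn S f + Sgn S g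
 Sgn-+ [] f g = refl
 Sgn-+ (s ∷ S) f g = trans (+-cong (Sgn-+ S _ _) (Sgn-+ S _ _)) (+-inter {X = ℤ} _ _ _ _)

 Sgn-* : ∀ S c (f : List ℤ → Carrier) → Sgn S (λ Y → c * f Y) ≈ c * Sgn S f
 Sgn-* [] c f = refl
 Sgn-* (s ∷ S) c f = trans (+-cong (Sgn-* S c _) (Sgn-* S c _)) (sym (distribˡ _ _ _))

 Sgn-Sel : ∀ S (h : ℤ → List ℤ → Carrier) →
      Sgn S (λ Y → Sel Y h) ≈ Sel S (λ s r → Sgn r (λ Y → h s Y + h (bar s) Y))
 Sgn-Sel [] h = refl
 Sgn-Sel (s ∷ S) h = begin
  _ ≈⟨ +-cong (Sgn-+ S _ _) (Sgn-+ S _ _) ⟩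
  _ ≈⟨ +-inter {X = ℤ} _ _ _ _ ⟩
  _ ≈⟨ +-cong (sym (Sgn-+ S _ _)) (+-cong (Sgn-Sel S _) (Sgn-Sel S _)) ⟩
  _ ≈⟨ +-congˡ (sym (Sel-+ S _ _)) ⟩
  _ ∎

 Signed-All : ∀ {P : ℤ → Set} → (∀ {x} → P x → P (bar x)) → ∀ {S Y} → Signed S Y → All P S → All P Y
 Signed-All h [] [] = []
 Signed-All h (pos s) (p ∷ ps) = p ∷ Signed-All h s ps
 Signed-All h (neg s) (p ∷ ps) = h p ∷ Signed-All h s ps

 NonSelf-bar : ∀ {x} → NonSelf x → NonSelf (bar x)
 NonSelf-bar n r = n (bar-inj r)

 Signed-Separated : ∀ {S Y} → Signed S Y → Separated S → Separated Y
 Signed-Separated [] _ = tt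
 Signed-Separated (pos s) ((n , p) , ps) = (n , Signed-All Sep-barʳ s p) , Signed-Separated s ps
 Signed-Separated (neg s) ((n , p) , ps) = (NonSelf-bar n , Signed-All Sep-barʳ s (All.map Sep-barˡ p)) , Signed-Separated s ps

 length-Signed : ∀ {S Y} → Signed S Y → length Y ≡ length S
 length-Signed [] = E.refl
 length-Signed (pos s) = E.cong suc (length-Signed s)
 length-Signed (neg s) = E.cong suc (length-Signed s)

 PF-sm : ∀ z Y → Distinct Y → All (λ y → z ≢ bar y) Y →
  Π Y (λ y → w (sm z y)) ≈ 1# + Sel Y (λ y r → (1# - t) * b (sm z y) * Π r (λ y' → w (y' Z.- y)))
 PF-sm z Y d n = begin
  _ ≈⟨ Π-cong Y (λ y → w-cong (sm≡ z y)) ⟩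
  _ ≈⟨ Π-map bar Y _ ⟨
  _ ≈⟨ PF⁺ z (map bar Y) (Distinct-bar Y d) (go Y n) ⟩
  _ ≈⟨ +-congˡ (Sel-map bar Y _) ⟩
  _ ≈⟨ +-congˡ (Sel-cong Y (λ {y} {r} _ → *-cong (*-congˡ (b-cong (-bar z y)))
                          (trans (Π-map bar r _) (Π-cong r (λ y' → w-cong (bar-bar- y y')))))) ⟩
  _ ∎
  where
  go : ∀ Y → All (λ y → z ≢ bar y) Y → All (z ≢_) (map bar Y)
  go [] [] = []
  go (y ∷ Y) (p ∷ ps) = p ∷ go Y ps

 module Weighted (f : ℤ → Carrier) where
  -- The product side of Littlewood-type identities: Π f(x_i) times Π (1 - t x_i x_j)/(1 - x_i x_j)
  -- over i < j.
  F : List ℤ → Carrier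
  F [] = 1#
  F (y ∷ Y) = f y * Π Y (λ y' → w (sm y y')) * F Y

  F-pick : ∀ {Y y r} → Pick Y y r → F Y ≈ f y * Π r (λ y' → w (sm y y')) * F r
  F-pick here = refl
  F-pick {x ∷ Y} {y} {_ ∷ r} (there i) = begin
   _ ≈⟨ *-cong (*-congˡ (Π-pick _ i)) (F-pick i) ⟩
   _ ≈⟨ *-congʳ (*-congˡ (*-congʳ (w-cong (sm-comm x y)))) ⟩
   _ ≈⟨ solve 6 (λ fx w P fy R F → fx :* (w :* P) :* (fy :* R :* F) := fy :* (w :* R) :* (fx :* P :* F)) tt (f x) (w (sm y x)) P (f y) R' (F r) ⟩
   _ ∎
   where
   P = Π r (λ y' → w (sm x y'))
   R' = Π r (λ y' → w (sm y y'))

  -- The constant-term evaluation: the sum over all signs of F has a product form, by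
  -- comparing the partial fraction expansions in z at z and at ∞.
  module SignSum (c μ : Carrier) (Good : ℤ → Set)
   (good-bar : ∀ {x} → Good x → Good (bar x))
   (f-bar : ∀ {y} → Good y → f y + f (bar y) ≈ c)
   (f-rel : ∀ {z s} → Good z → Good s → Sep z s →
     f s * (f z * b (sm z s) + f (bar z) * b (sm (bar z) s)) +
     f (bar s) * (f z * b (sm z (bar s)) + f (bar z) * b (sm (bar z) (bar s))) ≈ c * μ) where

   private
    Qs : ℤ → List ℤ → Carrier
    Qs s r = Π r (λ k → w (sm s k)) * Π r (λ k → w (k Z.- s))

    Qs-bar : ∀ s r → Qs (bar s) r ≈ Qs s r
    Qs-bar s r = trans (*-cong (Π-cong r (λ k → w-cong (bar-sm s k))) (Π-cong r (λ k → w-cong (E.trans (-bar k s) (sm-comm k s))))) (*-comm _ _)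

    H″ : List ℤ → Carrier
    H″ S = Sel S (λ s r → Sgn r (λ Y → (1# - t) * (F Y * Qs s Y)))

    at∞ : ∀ S → Separated S → All Good S → Sgn S F ≈ tp (length S) * Sgn S F + c * H″ S
    at∞ S sep good = begin
     Sgn S F ≈⟨ Sgn-cong S (λ {Y} s → trans (sym (*-identityʳ _)) (*-congˡ (PF⁻∞ Y (Separated⇒Distinct Y (Signed-Separated s sep))))) ⟩
     _ ≈⟨ Sgn-cong S (λ {Y} s → trans (distribˡ _ _ _) (+-cong (trans (*-comm _ _) (*-congʳ (reflexive (E.cong tp (length-Signed s))))) (trans (sym (Sel-* Y _ _)) (Sel-cong Y step)))) ⟩
     _ ≈⟨ Sgn-+ S _ _ ⟩
     _ ≈⟨ +-cong (Sgn-* S _ _) (Sgn-Sel S h) ⟩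
     _ ≈⟨ +-congˡ (trans (Sel-cong S (λ {s} {r} i → trans (Sgn-cong r (λ {Y} _ → pair s Y (proj₁ (All-pick i good)))) (Sgn-* r c _))) (Sel-* S c _)) ⟩
     _ ∎
     where
     h : ℤ → List ℤ → Carrier
     h y r = f y * ((1# - t) * (F r * Qs y r))
     step : ∀ {Y y r} → Pick Y y r → F Y * ((1# - t) * Π r (λ i → w (i Z.- y))) ≈ h y r
     step {Y} {y} {r} i = trans (*-congʳ (F-pick i)) (solve 5 (λ f p F u q → (f :* p :* F) :* (u :* q) := f :* (u :* (F :* (p :* q)))) tt _ _ _ _ _)
     pair : ∀ s Y → Good s → h s Y + h (bar s) Y ≈ c * ((1# - t) * (F Y * Qs s Y))
     pair s Y g = trans (+-congˡ (*-congˡ (*-congˡ (*-congˡ (Qs-bar s Y))))) (trans (sym (distribʳ _ _ _)) (*-congʳ (f-bar g)))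

    atz : ∀ z S → Separated (z ∷ S) → All Good (z ∷ S) → Sgn (z ∷ S) F ≈ c * Sgn S F + c * μ * H″ S
    atz z S ((ns , sepz) , sep) (gz ∷ good) = begin
     _ ≈⟨ Sgn-+ S _ _ ⟨
     _ ≈⟨ Sgn-cong S each ⟩
     _ ≈⟨ Sgn-+ S _ _ ⟩
     _ ≈⟨ +-cong (Sgn-* S _ _) (Sgn-Sel S h) ⟩
     _ ≈⟨ +-congˡ (trans (Sel-cong S (λ {s} {r} i → trans (Sgn-cong r (λ {Y} _ → pair s Y (proj₁ (All-pick i good)) (proj₁ (All-pick i sepz)))) (Sgn-* r _ _))) (Sel-* S _ _)) ⟩
     _ ∎
     where
     k : ℤ → Carrier
     k y = f z * b (sm z y) + f (bar z) * b (sm (bar z) y)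
     h : ℤ → List ℤ → Carrier
     h y r = f y * k y * ((1# - t) * (F r * Qs y r))
     step : ∀ {Y y r} → Pick Y y r → F Y * (f z * ((1# - t) * b (sm z y) * Π r (λ i → w (i Z.- y))) + f (bar z) * ((1# - t) * b (sm (bar z) y) * Π r (λ i → w (i Z.- y)))) ≈ h y r
     step {Y} {y} {r} i = trans (*-congʳ (F-pick i))
      (solve 9 (λ f p F u q fz bz fz' bz' → (f :* p :* F) :* (fz :* (u :* bz :* q) :+ fz' :* (u :* bz' :* q)) := f :* (fz :* bz :+ fz' :* bz') :* (u :* (F :* (p :* q)))) tt _ _ _ _ _ _ _ _ _)
     each : ∀ {Y} → Signed S Y → F (z ∷ Y) + F (bar z ∷ Y) ≈ c * F Y + Sel Y h
     each {Y} s = begin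
      _ ≈⟨ +-cong (*-congʳ (*-congˡ (PF-sm z Y dY (All.map proj₂ sY)))) (*-congʳ (*-congˡ (PF-sm (bar z) Y dY (All.map (λ p → proj₂ (Sep-barˡ p)) sY)))) ⟩
      _ ≈⟨ solve 5 (λ x y s₁ s₂ F → x :* (:1 :+ s₁) :* F :+ y :* (:1 :+ s₂) :* F := (x :+ y) :* F :+ F :* (x :* s₁ :+ y :* s₂)) tt (f z) (f (bar z)) s₁ s₂ (F Y) ⟩
      _ ≈⟨ +-cong (*-congʳ (f-bar gz)) (trans (*-congˡ (trans (+-cong (sym (Sel-* Y _ _)) (sym (Sel-* Y _ _))) (sym (Sel-+ Y _ _)))) (trans (sym (Sel-* Y _ _)) (Sel-cong Y step))) ⟩
      _ ∎
      where
      dY = Separated⇒Distinct Y (Signed-Separated s sep)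
      sY : All (Sep z) Y
      sY = Signed-All Sep-barʳ s sepz
      s₁ = Sel Y (λ y r → (1# - t) * b (sm z y) * Π r (λ y' → w (y' Z.- y)))
      s₂ = Sel Y (λ y r → (1# - t) * b (sm (bar z) y) * Π r (λ y' → w (y' Z.- y)))
     pair : ∀ s Y → Good s → Sep z s → h s Y + h (bar s) Y ≈ c * μ * ((1# - t) * (F Y * Qs s Y))
     pair s Y g sp = trans (+-congˡ (*-congˡ (*-congˡ (*-congˡ (Qs-bar s Y))))) (trans (sym (distribʳ _ _ _)) (*-congʳ (f-rel gz g sp)))

   -- The expansion at infinity determines c times the residue sum `H″` as (1 - t^|S|) times the sum
   -- over S. Inserted into the expansion at z, this eliminates `H″`.
   sign-sum-step : ∀ z S → Separated (z ∷ S) → All Good (z ∷ S) → Sgn (z ∷ S) F ≈ (c + μ * (1# - tp (length S))) * Sgn S F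
   sign-sum-step z S sep good@(_ ∷ gs) = begin
    _ ≈⟨ atz z S sep good ⟩
    _ ≈⟨ solve 5 (λ c G μ H″ T → c :* G :+ c :* μ :* H″ := c :* G :+ μ :* ((T :* G :+ c :* H″) :- T :* G)) tt c G μ (H″ S) (tp (length S)) ⟩
    _ ≈⟨ +-congˡ (*-congˡ (+-congʳ (sym (at∞ S (proj₂ sep) gs)))) ⟩
    _ ≈⟨ solve 4 (λ c G μ T → c :* G :+ μ :* (G :- T :* G) := (c :+ μ :* (:1 :- T)) :* G) tt c G μ (tp (length S)) ⟩
    _ ∎
    where G = Sgn S F

  F⁻ : List ℤ → Carrier
  F⁻ J = F (map bar J)

  -- J collects the inverted positions. An inverted j and an uninverted k share the factor w (k -
  -- j), so the mixed factors form `W J K`.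
  Sgn≈Spl : ∀ S (φ : ℤ → Carrier) → Sgn S (λ Y → Π Y φ * F Y) ≈ Spl S (λ J K → Π (map bar J) φ * F⁻ J * W J K * F K * Π K φ)
  Sgn≈Spl [] φ = solve 0 (:1 :* :1 := :1 :* :1 :* :1 :* :1 :* :1) tt
  Sgn≈Spl (z ∷ S) φ = trans (+-comm _ _) (+-cong neg-part pos-part)
   where
   arr : ∀ φz fz → ∀ p q F → φz * p * (fz * q * F) ≈ (φz * fz) * ((p * q) * F)
   arr = solve 5 (λ φz fz p q F → φz :* p :* (fz :* q :* F) := (φz :* fz) :* ((p :* q) :* F)) tt
   half : ∀ y → Sgn S (λ Y → Π (y ∷ Y) φ * F (y ∷ Y)) ≈ (φ y * f y) * Spl S (λ J K → Π (map bar J) (λ k → φ k * w (sm y k)) * F⁻ J * W J K * F K * Π K (λ k → φ k * w (sm y k)))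
   half y = trans (Sgn-cong S (λ {Y} _ → trans (arr _ _ _ _ _) (*-congˡ (*-congʳ (sym (Π-* Y _ _))))))
    (trans (Sgn-* S _ _) (*-congˡ (Sgn≈Spl S (λ k → φ k * w (sm y k)))))
   pos-part : Sgn S (λ Y → Π (z ∷ Y) φ * F (z ∷ Y)) ≈ Spl S (λ J K → Π (map bar J) φ * F⁻ J * W J (z ∷ K) * F (z ∷ K) * Π (z ∷ K) φ)
   pos-part = trans (half z) (trans (sym (Spl-* S _ _)) (Spl-cong S (λ {J} {K} _ → begin
    _ ≈⟨ *-congˡ (*-cong (*-congʳ (*-congʳ (*-congʳ (trans (Π-* (map bar J) _ _) (*-congˡ (trans (Π-map bar J _) (Π-cong J (λ j → w-cong (sm-bar z j))))))))) (Π-* K _ _)) ⟩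
    _ ≈⟨ solve 9 (λ φz fz p u F' W F q v → (φz :* fz) :* ((p :* u) :* F' :* W :* F :* (q :* v)) := p :* F' :* (u :* W) :* (fz :* v :* F) :* (φz :* q)) tt _ _ _ _ _ _ _ _ _ ⟩
    _ ≈⟨ *-congʳ (*-congʳ (*-congˡ (W-∷ʳ J z K))) ⟨
    _ ∎)))
    where
    ΠJ : List ℤ → Carrier
    ΠJ J = Π (map bar J) φ
   neg-part : Sgn S (λ Y → Π (bar z ∷ Y) φ * F (bar z ∷ Y)) ≈ Spl S (λ J K → Π (map bar (z ∷ J)) φ * F⁻ (z ∷ J) * W (z ∷ J) K * F K * Π K φ)
   neg-part = trans (half (bar z)) (trans (sym (Spl-* S _ _)) (Spl-cong S (λ {J} {K} _ → begin
    _ ≈⟨ *-congˡ (*-cong (*-congʳ (*-congʳ (*-congʳ (Π-* (map bar J) _ _)))) (trans (Π-* K _ _) (*-congˡ (Π-cong K (λ k → w-cong (bar-sm z k)))))) ⟩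
    _ ≈⟨ solve 9 (λ φz fz p u F' W F q v → (φz :* fz) :* ((p :* u) :* F' :* W :* F :* (q :* v)) := (φz :* p) :* (fz :* u :* F') :* (v :* W) :* F :* q) tt _ _ _ _ _ _ _ _ _ ⟩
    _ ∎)))

 -- The alternating sum

 open import Data.List.Properties using (map-++)
 open import Data.List.Relation.Unary.All.Properties using (++⁺)

 Sel-++ : ∀ {X : Set} (A B : List X) (h : X → List X → Carrier) →
      Sel (A ++ B) h ≈ Sel A (λ x r → h x (r ++ B)) + Sel B (λ x r → h x (A ++ r))
 Sel-++ [] B h = sym (+-identityˡ _)
 Sel-++ (x ∷ A) B h = trans (+-congˡ (Sel-++ A B _)) (sym (+-assoc _ _ _))

 private
  distinct-disjoint : ∀ A B → Distinct (A ++ B) → All (λ x → All (x ≢_) B) A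
  distinct-disjoint [] B _ = []
  distinct-disjoint (x ∷ A) B (p , ps) = go A p ∷ distinct-disjoint A B ps
   where
   go : ∀ A → All (x ≢_) (A ++ B) → All (x ≢_) B
   go [] q = q
   go (_ ∷ A) (_ ∷ q) = go A q

  distinct-right : ∀ A B → Distinct (A ++ B) → Distinct B
  distinct-right [] B d = d
  distinct-right (x ∷ A) B (_ , ds) = distinct-right A B ds

 PF-mixed : ∀ z A B → Distinct (A ++ B) → All (z ≢_) A → All (z ≢_) B →
  Π A (λ p → w (z Z.- p)) * Π B (λ p → w (p Z.- z)) ≈ tp (length B)
   + (Sel A (λ p r → (1# - t) * b (z Z.- p) * (Π r (λ p' → w (p Z.- p')) * Π B (λ p' → w (p' Z.- p))))
   + Sel B (λ p r → - (1# - t) * b (z Z.- p) * (Π A (λ p' → w (p Z.- p')) * Π r (λ p' → w (p' Z.- p)))))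
 PF-mixed z A B d nA nB = begin
  _ ≈⟨ *-cong (sym (Π-map (_, true) A (ev β))) (trans (Π-congA (All.map (λ {x} n → sym (ev⁻ z x n)) nB)) (sym (Π-map (_, false) B (ev β)))) ⟩
  _ ≈⟨ Π-++ A′ B′ (ev β) ⟨
  _ ≈⟨ partial-fractions β (A′ ++ B′) (E.subst Distinct (E.sym pl) d)
                     (E.subst (Pairwise (PoleRel β)) (E.sym pl) (pairwise-b (++⁺ nA nB) d)) ⟩
  _ ≈⟨ +-cong (trans (Π-++ A′ B′ _) (trans (*-cong (trans (Π-map (_, true) A _) (Π-1 A)) (trans (Π-map (_, false) B _) (Π-cst-false B))) (*-identityˡ _)))
     (trans (Sel-++ A′ B′ _) (+-cong (trans (Sel-map (_, true) A _) (Sel-cong A partA)) (trans (Sel-map (_, false) B _) (Sel-cong B partB)))) ⟩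
  _ ∎
  where
  β : ℤ → Carrier
  β p = b (z Z.- p)
  A′ = map (_, true) A
  B′ = map (_, false) B
  pl : poles (A′ ++ B′) ≡ A ++ B
  pl = E.trans (map-++ proj₁ A′ B′) (E.cong₂ _++_ (poles-map true A) (poles-map false B))
  evB : ∀ p r → All (p ≢_) r → Π (map (_, false) r) (ev (λ p' → b (p Z.- p'))) ≈ Π r (λ p' → w (p' Z.- p))
  evB p r n = trans (Π-map (_, false) r _) (Π-congA (All.map (λ {x} q → ev⁻ p x q) n))
  partA : ∀ {p r} → Pick A p r → (1# - t) * β p * Π (map (_, true) r ++ B′) (ev (λ p' → b (p Z.- p'))) ≈ (1# - t) * b (z Z.- p) * (Π r (λ p' → w (p Z.- p')) * Π B (λ p' → w (p' Z.- p)))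
  partA {p} {r} i = *-congˡ (trans (Π-++ (map (_, true) r) B′ _) (*-cong (Π-map (_, true) r _) (evB p B (proj₁ (All-pick i (distinct-disjoint A B d))))))
  partB : ∀ {p r} → Pick B p r → - (1# - t) * β p * Π (A′ ++ map (_, false) r) (ev (λ p' → b (p Z.- p'))) ≈ - (1# - t) * b (z Z.- p) * (Π A (λ p' → w (p Z.- p')) * Π r (λ p' → w (p' Z.- p)))
  partB {p} {r} i = *-congˡ (trans (Π-++ A′ (map (_, false) r) _) (*-cong (Π-map (_, true) A _) (evB p r (proj₁ (Distinct-pick i (distinct-right A B d))))))

 P₂ P₂⁻ : List ℤ → Carrier
 P₂ [] = 1#
 P₂ (i ∷ I) = Π I (λ i' → w (sm i i')) * P₂ I
 P₂⁻ [] = 1#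
 P₂⁻ (j ∷ J) = Π J (λ j' → w (sm (bar j) (bar j'))) * P₂⁻ J

 private
  comm₃ : ∀ x y z → x * (y * z) ≈ y * (x * z)
  comm₃ = solve 3 (λ x y z → x :* (y :* z) := y :* (x :* z)) tt

 P₂-pick : ∀ {I i r} → Pick I i r → P₂ I ≈ Π r (λ i' → w (sm i i')) * P₂ r
 P₂-pick here = refl
 P₂-pick {x ∷ I} {i} {_ ∷ r} (there k) = trans (*-cong (Π-pick _ k) (P₂-pick k))
  (trans (*-congʳ (*-congʳ (w-cong (sm-comm x i)))) (solve 4 (λ w p q r → (w :* p) :* (q :* r) := (w :* q) :* (p :* r)) tt _ _ _ _))

 P₂⁻-pick : ∀ {I i r} → Pick I i r → P₂⁻ I ≈ Π r (λ i' → w (sm (bar i) (bar i'))) * P₂⁻ r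
 P₂⁻-pick here = refl
 P₂⁻-pick {x ∷ I} {i} {_ ∷ r} (there k) = trans (*-cong (Π-pick _ k) (P₂⁻-pick k))
  (trans (*-congʳ (*-congʳ (w-cong (sm-comm (bar x) (bar i))))) (solve 4 (λ w p q r → (w :* p) :* (q :* r) := (w :* q) :* (p :* r)) tt _ _ _ _))

 sg : List ℤ → Carrier
 sg [] = 1#
 sg (_ ∷ I) = - sg I

 sg-pick : ∀ {I i r} → Pick I i r → sg I ≈ - sg r
 sg-pick here = refl
 sg-pick (there k) = -‿cong (sg-pick k)

 alt : List ℤ → List ℤ → Carrier
 alt I J = sg I * (P₂ I * P₂⁻ J * W I J)

 Alt : List ℤ → Carrier
 Alt S = Spl S alt

 alt-pickˡ : ∀ {I i I'} J → Pick I i I' → alt I J ≈ - alt I' J * (Π I' (λ i' → w (sm i i')) * Π J (λ j → w (j Z.- i)))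
 alt-pickˡ J k = trans (*-cong (sg-pick k) (*-cong (*-congʳ (P₂-pick k)) (W-pickˡ J k)))
  (solve 6 (λ s p P Q u W → :- s :* ((p :* P) :* Q :* (u :* W)) := :- (s :* (P :* Q :* W)) :* (p :* u)) tt _ _ _ _ _ _)

 alt-pickʳ : ∀ I {J j J'} → Pick J j J' → alt I J ≈ alt I J' * (Π J' (λ j' → w (sm (bar j) (bar j'))) * Π I (λ i → w (j Z.- i)))
 alt-pickʳ I k = trans (*-congˡ (*-cong (*-congˡ (P₂⁻-pick k)) (W-pickʳ I k)))
  (solve 6 (λ s p P Q u W → s :* (P :* (p :* Q) :* (u :* W)) := (s :* (P :* Q :* W)) :* (p :* u)) tt _ _ _ _ _ _)

 -- As a function of q^z the sum has no poles (the residues vanish by induction) and it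
 -- vanishes at q^z = 0.
 alternating-sum : ∀ n z S → length S ≡ n → Separated (z ∷ S) → Alt (z ∷ S) ≈ 0#
 alternating-sum n z S len ((_ , sepz) , sep) = begin
  _ ≈⟨ Spl-+ S _ _ ⟨
  _ ≈⟨ Spl-cong S expand ⟩
  _ ≈⟨ Spl-+ S _ _ ⟩
  _ ≈⟨ +-cong (trans (sym (Spl-Sel S (λ K x B → gI x K B) gI (λ _ _ _ _ → refl))) (sym (Sel-Spl S gI (λ K x B → gI x K B) (λ _ _ _ _ → refl))))
        (sym (Sel-Spl S (λ x K B → gJ K x B) gJ (λ _ _ _ _ → refl))) ⟩
  _ ≈⟨ Sel-+ S _ _ ⟨
  _ ≈⟨ Sel-cong S (λ i → vanish i) ⟩
  _ ≈⟨ Sel-0 S ⟩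
  0# ∎
  where
  Sel-0 : ∀ (S : List ℤ) → Sel S (λ _ _ → 0#) ≈ 0#
  Sel-0 [] = refl
  Sel-0 (s ∷ S) = trans (+-identityˡ _) (Sel-0 S)
  u = 1# - t
  gI : ℤ → List ℤ → List ℤ → Carrier
  gI i I' J = alt I' J * (Π I' (λ i' → w (sm i i')) * Π J (λ j → w (j Z.- i))) *
   (u * b (z Z.- bar i) * (Π I' (λ i' → w (i' Z.- i)) * Π J (λ j → w (sm i j)))
    - u * b (z Z.- i) * (Π I' (λ i' → w (i Z.- i')) * Π J (λ j → w (sm (bar i) (bar j)))))
  gJ : List ℤ → ℤ → List ℤ → Carrier
  gJ I j J' = alt I J' * (Π J' (λ j' → w (sm (bar j) (bar j'))) * Π I (λ i → w (j Z.- i))) *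
   (u * b (z Z.- j) * (Π I (λ i → w (sm j i)) * Π J' (λ j' → w (j' Z.- j)))
    - u * b (z Z.- bar j) * (Π I (λ i → w (sm (bar j) (bar i))) * Π J' (λ j' → w (j Z.- j'))))
  expand : ∀ {I J} → Split S I J → alt (z ∷ I) J + alt I (z ∷ J) ≈ Sel I (λ i I' → gI i I' J) + Sel J (λ j J' → gJ I j J')
  expand {I} {J} s = begin
   _ ≈⟨ +-congˡ (*-congˡ (*-congˡ (W-∷ʳ I z J))) ⟩
   _ ≈⟨ solve 8 (λ s a P Q c W d f → :- s :* ((a :* P) :* Q :* (c :* W)) :+ s :* (P :* (d :* Q) :* (f :* W)) := (s :* (P :* Q :* W)) :* (f :* d :- a :* c)) tt
       (sg I) (Π I (λ i → w (sm z i))) (P₂ I) (P₂⁻ J) (Π J (λ j → w (j Z.- z))) (W I J) (Π J (λ j → w (sm (bar z) (bar j)))) (Π I (λ i → w (z Z.- i))) ⟩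
   _ ≈⟨ *-congˡ (+-cong first (-‿cong second)) ⟩
   -- Both products have the value t^|J| at q^z = 0, so the constants cancel and only poles remain.
   _ ≈⟨ solve 6 (λ x T a b c d → x :* ((T :+ (a :+ b)) :- (T :+ (c :+ d))) := (:- x :* (c :- a)) :+ x :* (b :- d)) tt (alt I J) (tp (length J)) sA sB sC sD ⟩
   _ ≈⟨ +-cong (*-congˡ (Sel-- I _ _)) (*-congˡ (Sel-- J _ _)) ⟩
   _ ≈⟨ +-cong (trans (sym (Sel-* I _ _)) (Sel-cong I stepI)) (trans (sym (Sel-* J _ _)) (Sel-cong J stepJ)) ⟩
   _ ∎
   where
   Sel-- : ∀ (T : List ℤ) (f g : ℤ → List ℤ → Carrier) → Sel T f - Sel T g ≈ Sel T (λ x r → f x r - g x r)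
   Sel-- [] f g = -‿inverseʳ 0#
   Sel-- (x ∷ T) f g = trans (solve 4 (λ a b c d → (a :+ b) :- (c :+ d) := (a :- c) :+ (b :- d)) tt _ _ _ _) (+-congˡ (Sel-- T _ _))
   sep-IJ = Separated-split s sep
   dI = Separated⇒Distinct I (proj₁ sep-IJ)
   dJ = Separated⇒Distinct J (proj₂ sep-IJ)
   zI = proj₁ (All-split s sepz)
   zJ = proj₂ (All-split s sepz)
   cross : ∀ {S I J} → Split S I J → Separated S → All (λ i → All (Sep i) J) I
   cross [] _ = []
   cross (lft s) ((n , p) , ps) = proj₂ (All-split s p) ∷ cross s ps
   cross {I = I} (rgt s) ((n , p) , ps) = go (proj₁ (All-split s p)) (cross s ps)
    where
    go : ∀ {I x J} → All (Sep x) I → All (λ i → All (Sep i) J) I → All (λ i → All (Sep i) (x ∷ J)) I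
    go [] [] = []
    go (q ∷ qs) (r ∷ rs) = (Sep-sym q ∷ r) ∷ go qs rs
   dist-++ : ∀ {A B} → Distinct A → Distinct B → All (λ x → All (x ≢_) B) A → Distinct (A ++ B)
   dist-++ {[]} _ dB _ = dB
   dist-++ {x ∷ A} (p , ps) dB (q ∷ qs) = ++⁺ p q , dist-++ ps dB qs
   sA = Sel I (λ i r → u * b (z Z.- i) * (Π r (λ i' → w (i Z.- i')) * Π J (λ j → w (sm (bar i) (bar j)))))
   sB = Sel J (λ j r → - u * b (z Z.- bar j) * (Π I (λ i → w (sm (bar j) (bar i))) * Π r (λ j' → w (j Z.- j'))))
   sC = Sel I (λ i r → u * b (z Z.- bar i) * (Π r (λ i' → w (i' Z.- i)) * Π J (λ j → w (sm i j))))
   sD = Sel J (λ j r → - u * b (z Z.- j) * (Π I (λ i → w (sm j i)) * Π r (λ j' → w (j' Z.- j))))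
   first : Π I (λ i → w (z Z.- i)) * Π J (λ j → w (sm (bar z) (bar j))) ≈ tp (length J) + (sA + sB)
   first = begin
    _ ≈⟨ *-congˡ (trans (Π-cong J (λ j → w-cong (bar-sm z (bar j)))) (sym (Π-map bar J _))) ⟩
    _ ≈⟨ PF-mixed z I (map bar J) (dist-++ dI (Distinct-bar J dJ) (All.map (λ q → All-bar proj₂ q) (cross s sep))) (All.map proj₁ zI) (All-bar proj₂ zJ) ⟩
    _ ≈⟨ +-cong (reflexive (E.cong tp (length-map J))) (+-cong
        (Sel-cong I (λ {i} _ → *-congˡ (*-congˡ (trans (Π-map bar J _) (Π-cong J (λ j → w-cong (E.sym (bar-sm i (bar j)))))))))
        (trans (Sel-map bar J _) (Sel-cong J (λ {j} {r} _ → *-congˡ (*-cong (Π-cong I (λ i → w-cong (bar- j i))) (trans (Π-map bar r _) (Π-cong r (λ j' → w-cong (bar-bar- j' j))))))))) ⟩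
    _ ∎
    where
    length-map : ∀ (J : List ℤ) → length (map bar J) ≡ length J
    length-map [] = E.refl
    length-map (_ ∷ J) = E.cong suc (length-map J)
   second : Π I (λ i → w (sm z i)) * Π J (λ j → w (j Z.- z)) ≈ tp (length J) + (sC + sD)
   second = begin
    _ ≈⟨ *-congʳ (trans (Π-cong I (λ i → w-cong (sm≡ z i))) (sym (Π-map bar I _))) ⟩
    _ ≈⟨ PF-mixed z (map bar I) J (dist-++ (Distinct-bar I dI) dJ (All-bar (λ {i} q → All.map (λ p → proj₁ (Sep-barˡ p)) q) (cross s sep))) (All-bar proj₂ zI) (All.map proj₁ zJ) ⟩
    _ ≈⟨ +-congˡ (+-cong
        (trans (Sel-map bar I _) (Sel-cong I (λ {i} {r} _ → *-congˡ (*-cong (trans (Π-map bar r _) (Π-cong r (λ i' → w-cong (bar-bar- i i')))) (Π-cong J (λ j → w-cong (E.trans (-bar j i) (sm-comm j i))))))))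
        (Sel-cong J (λ {j} {r} _ → *-congˡ (*-congʳ (trans (Π-map bar I _) (Π-cong I (λ i → w-cong (-bar j i)))))))) ⟩
    _ ∎
   stepI : ∀ {i I'} → Pick I i I' → - alt I J * (u * b (z Z.- bar i) * (Π I' (λ i' → w (i' Z.- i)) * Π J (λ j → w (sm i j))) - u * b (z Z.- i) * (Π I' (λ i' → w (i Z.- i')) * Π J (λ j → w (sm (bar i) (bar j))))) ≈ gI i I' J
   stepI {i} {I'} k = *-congʳ (trans (-‿cong (alt-pickˡ J k)) (solve 2 (λ x y → :- (:- x :* y) := x :* y) tt (alt I' J) (Π I' (λ i' → w (sm i i')) * Π J (λ j → w (j Z.- i)))))
   stepJ : ∀ {j J'} → Pick J j J' → alt I J * (- u * b (z Z.- bar j) * (Π I (λ i → w (sm (bar j) (bar i))) * Π J' (λ j' → w (j Z.- j'))) - - u * b (z Z.- j) * (Π I (λ i → w (sm j i)) * Π J' (λ j' → w (j' Z.- j)))) ≈ gJ I j J'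
   stepJ {j} {J'} k = *-cong (alt-pickʳ I k) (solve 5 (λ u x X y Y → :- u :* x :* X :- :- u :* y :* Y := u :* y :* Y :- u :* x :* X) tt u (b (z Z.- bar j)) _ (b (z Z.- j)) _)
  both : ∀ s {r I J} → Split r I J → gI s I J + gJ I s J ≈ u * b (z Z.- bar s) *
    (Π r (λ k → w (sm s k)) * Π r (λ k → w (k Z.- s)) - Π r (λ k → w (sm (bar s) (bar k))) * Π r (λ k → w (s Z.- k))) * alt I J
  both s {r} {I} {J} p = trans
   (solve 12 (λ A u β γ a₁ a₂ b₁ b₂ c₁ c₂ d₁ d₂ →
     A :* (a₁ :* b₂) :* (u :* β :* (b₁ :* a₂) :- u :* γ :* (d₁ :* c₂)) :+ A :* (c₂ :* d₁) :* (u :* γ :* (a₁ :* b₂) :- u :* β :* (c₁ :* d₂))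
     := u :* β :* ((a₁ :* a₂) :* (b₁ :* b₂) :- (c₁ :* c₂) :* (d₁ :* d₂)) :* A) tt
     (alt I J) u (b (z Z.- bar s)) (b (z Z.- s)) (Π I (λ k → w (sm s k))) (Π J (λ k → w (sm s k))) (Π I (λ k → w (k Z.- s))) (Π J (λ k → w (k Z.- s)))
     (Π I (λ k → w (sm (bar s) (bar k)))) (Π J (λ k → w (sm (bar s) (bar k)))) (Π I (λ k → w (s Z.- k))) (Π J (λ k → w (s Z.- k))))
   (*-congʳ (*-congˡ (+-cong (*-cong (sym (Π-split _ p)) (sym (Π-split _ p))) (-‿cong (*-cong (sym (Π-split _ p)) (sym (Π-split _ p)))))))
  vanish : ∀ {s r} → Pick S s r → Spl r (gI s) + Spl r (λ I J → gJ I s J) ≈ 0#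
  vanish {s} {r} k = trans (sym (Spl-+ r _ _)) (trans (Spl-cong r (both s)) (trans (Spl-* r _ _) (ih n r len k (proj₂ (Separated-pick k sep)))))
   where
   ih : ∀ n r → length S ≡ n → Pick S s r → Separated r → u * b (z Z.- bar s) *
    (Π r (λ k → w (sm s k)) * Π r (λ k → w (k Z.- s)) - Π r (λ k → w (sm (bar s) (bar k))) * Π r (λ k → w (s Z.- k))) * Alt r ≈ 0#
   -- Without further variables the bracket is a difference of two empty products; otherwise `Alt r`
   -- vanishes by induction.
   ih n [] l p sr = trans (*-congʳ (trans (*-congˡ (-‿inverseʳ _)) (zeroʳ _))) (zeroˡ _)
   ih zero (x ∷ r) l p sr with E.trans (E.sym (length-pick p)) l
   ... | ()
   ih (suc n) (x ∷ r) l p sr with n | NP.suc-injective (E.trans (E.sym (length-pick p)) l)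
   ... | suc n' | l' = trans (*-congˡ (alternating-sum n' x r (NP.suc-injective l') sr)) (zeroʳ _)
   ... | zero | ()

 -- Littlewood identities

 W-splitˡ : ∀ {K A B} J → Split K A B → W K J ≈ W A J * W B J
 W-splitˡ J s = Π-split _ s

 W-splitʳ : ∀ K {J A B} → Split J A B → W K J ≈ W K A * W K B
 W-splitʳ K s = trans (Π-cong K (λ k → Π-split _ s)) (Π-* K _ _)

 ε∅ : List ℤ → Carrier
 ε∅ [] = 1#
 ε∅ (_ ∷ _) = 0#

 Spl-ε∅ : ∀ S (h : List ℤ → List ℤ → Carrier) → Spl S (λ K B → ε∅ K * h K B) ≈ h [] S
 Spl-ε∅ [] h = *-identityˡ _
 Spl-ε∅ (s ∷ S) h = trans (+-cong (trans (Spl-cong S (λ _ → zeroˡ _)) (Spl-0 S)) (Spl-ε∅ S (λ K B → h K (s ∷ B)))) (+-identityˡ _)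

 pow : Carrier → ℕ → Carrier
 pow x zero = 1#
 pow x (suc m) = x * pow x m

 -- The intended case is f i = 1/(1 - x²) and X i = x² for the variable x at i. The identities use
 -- only `X-f` and `base`.
 module Bounded (f X : ℤ → Carrier) (Good : ℤ → Set)
  (X-f : ∀ {i} → Good i → X i * f i ≈ - f (bar i))
  (base : ∀ S → Separated S → All Good S → Sgn S (Weighted.F f) ≈ 1#) where
  open Weighted f

  Nice : List ℤ → Set
  Nice S = Separated S × All Good S

  Nice-split : ∀ {S K J} → Split S K J → Nice S → Nice K × Nice J
  Nice-split s (p , q) = (proj₁ (Separated-split s p) , proj₁ (All-split s q)) , (proj₂ (Separated-split s p) , proj₂ (All-split s q))

  private
   F≈ : ∀ Y → F Y ≈ Π Y f * P₂ Y
   F≈ [] = sym (*-identityˡ _)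
   F≈ (y ∷ Y) = trans (*-congˡ (F≈ Y)) (solve 4 (λ f p q r → f :* p :* (q :* r) := (f :* q) :* (p :* r)) tt _ _ _ _)

   P₂⁻≈ : ∀ J → P₂ (map bar J) ≈ P₂⁻ J
   P₂⁻≈ [] = refl
   P₂⁻≈ (j ∷ J) = *-cong (Π-map bar J _) (P₂⁻≈ J)

   neg-Π : ∀ I → All Good I → Π I X * Π I f ≈ sg I * Π I (λ i → f (bar i))
   neg-Π [] _ = refl
   neg-Π (i ∷ I) (g ∷ gs) = trans (*-inter {X = ℤ} _ _ _ _) (trans (*-cong (X-f g) (neg-Π I gs)) (solve 3 (λ x s p → :- x :* (s :* p) := :- s :* (x :* p)) tt _ _ _))

  one-conv : ∀ S → Nice S → Spl S (λ J K → F⁻ J * W J K * F K) ≈ 1#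
  one-conv S (p , q) = begin
   _ ≈⟨ Spl-cong S (λ {J} {K} _ → trans (solve 3 (λ x y z → x :* y :* z := :1 :* x :* y :* z :* :1) tt _ _ _) (*-cong (*-congʳ (*-congʳ (*-congʳ (sym (Π-1 (map bar J)))))) (sym (Π-1 K)))) ⟩
   _ ≈⟨ Sgn≈Spl S (λ _ → 1#) ⟨
   _ ≈⟨ Sgn-cong S (λ {Y} _ → trans (*-congʳ (Π-1 Y)) (*-identityˡ _)) ⟩
   Sgn S F ≈⟨ base S p q ⟩
   1# ∎

  -- On I the factor X turns f i into -f (bar i). Then Π f (bar i) over all of S can be taken out,
  -- and `Alt S` is left.
  delta-conv : ∀ S → Nice S → Spl S (λ I J → Π I X * F I * W I J * F⁻ J) ≈ ε∅ S
  delta-conv S (p , q) = begin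
   Spl S (λ I J → Π I X * F I * W I J * F⁻ J) ≈⟨ Spl-cong S (λ {I} {J} s → begin
    _ ≈⟨ *-cong (*-congʳ (*-congˡ (F≈ I))) (trans (F≈ (map bar J)) (*-cong (Π-map bar J f) (P₂⁻≈ J))) ⟩
    _ ≈⟨ solve 6 (λ X f P W g Q → X :* (f :* P) :* W :* (g :* Q) := (X :* f) :* (g :* (P :* Q :* W))) tt _ _ _ _ _ _ ⟩
    _ ≈⟨ *-congʳ (neg-Π I (proj₁ (All-split s q))) ⟩
    _ ≈⟨ solve 4 (λ s x y z → (s :* x) :* (y :* z) := (x :* y) :* (s :* z)) tt _ _ _ _ ⟩
    _ ≈⟨ *-congʳ (sym (Π-split _ s)) ⟩
    _ ∎) ⟩
   Spl S (λ I J → Π S (λ i → f (bar i)) * alt I J) ≈⟨ Spl-* S _ _ ⟩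
   Π S (λ i → f (bar i)) * Alt S ≈⟨ fin S p ⟩
   ε∅ S ∎
   where
   fin : ∀ S → Separated S → Π S (λ i → f (bar i)) * Alt S ≈ ε∅ S
   fin [] _ = solve 0 (:1 :* (:1 :* (:1 :* :1 :* :1)) := :1) tt
   fin (s ∷ S) p = trans (*-congˡ (alternating-sum (length S) s S E.refl p)) (zeroʳ _)

  -- The one-step form of Littlewood's identity  Σ_λ P_{2λ} = F.
  littlewood : ∀ S → Nice S → Spl S (λ I J → Π I X * F I * W I J) ≈ F S
  littlewood S nS = begin
   -- The 1 inserted by `one-conv` splits J into A and B. Regrouping I with A makes `delta-conv`
   -- applicable, which leaves only the term with both empty.
   _ ≈⟨ Spl-cong S (λ {I} {J} s → trans (sym (*-identityʳ _)) (trans (*-congˡ (sym (one-conv J (proj₂ (Nice-split s nS))))) (sym (Spl-* J _ _)))) ⟩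
   _ ≈⟨ Spl-cong S (λ {I} {J} _ → Spl-cong J (λ {A} {B} s → *-congʳ (*-congˡ (W-splitʳ I s)))) ⟩
   _ ≈⟨ Spl-assoc S _ ⟩
   _ ≈⟨ Spl-cong S (λ {K} {B} s → trans (Spl-cong K (λ {I} {A} s' → trans
       (solve 7 (λ x f w v g u h → x :* f :* (w :* v) :* (g :* u :* h) := ((v :* u) :* h) :* (x :* f :* w :* g)) tt _ _ _ _ _ _ _)
       (*-congʳ (*-congʳ (sym (W-splitˡ B s'))))))
      (trans (Spl-* K _ _) (trans (*-congˡ (delta-conv K (proj₁ (Nice-split s nS)))) (*-comm _ _)))) ⟩
   _ ≈⟨ Spl-ε∅ S _ ⟩
   1# * F S ≈⟨ *-identityˡ _ ⟩
   F S ∎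

  -- Each step accounts for two equal columns: the first selects I and the second has to keep all of
  -- it, hence the weight X, a squared variable.
  Φ : ℕ → List ℤ → Carrier
  Φ zero S = 1#
  Φ (suc m) S = Spl S (λ I J → Π I X * Φ m I * W I J)

  -- Macdonald's bounded analogue, for partitions with λ_1 ≤ m.
  bounded-littlewood : ∀ m S → Nice S → Φ m S ≈ Spl S (λ J K → Π J (λ j → pow (X j) m) * F⁻ J * W J K * F K)
  bounded-littlewood zero S nS = sym (trans (Spl-cong S (λ {J} {K} _ → *-congʳ (*-congʳ (trans (*-congʳ (Π-1 J)) (*-identityˡ _))))) (one-conv S nS))
  bounded-littlewood (suc m) S nS = begin
   _ ≈⟨ Spl-cong S (λ {I} {J} s → trans (*-congʳ (*-congˡ (bounded-littlewood m I (proj₁ (Nice-split s nS)))))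
       (trans (solve 3 (λ x p w → x :* p :* w := (x :* w) :* p) tt _ _ _) (sym (Spl-* I _ _)))) ⟩
   _ ≈⟨ Spl-cong S (λ {I} {J} _ → Spl-cong I (λ {A} {B} s → trans (*-congʳ (*-cong (Π-split X s) (W-splitˡ J s)))
       (solve 8 (λ xa xb wa wb p g w F → (xa :* xb) :* (wa :* wb) :* (p :* g :* w :* F) := (xa :* p) :* g :* (w :* wa) :* (xb :* F :* wb)) tt _ _ _ _ _ _ _ _))) ⟩
   _ ≈⟨ Spl-assoc S _ ⟨
   _ ≈⟨ Spl-cong S (λ {A} {C} s → trans (Spl-cong C (λ {B} {J} s' → *-congʳ (*-cong (*-congʳ (sym (Π-* A _ _))) (sym (W-splitʳ A s')))))
       (trans (Spl-* C _ _) (*-congˡ (littlewood C (proj₂ (Nice-split s nS)))))) ⟩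
   _ ∎

  Φ≈Sgn : ∀ m S (g : ℤ → Carrier) → Nice S → All (λ s → g s ≈ 1# × g (bar s) ≈ pow (X s) m) S →
      Φ m S ≈ Sgn S (λ Y → Π Y g * F Y)
  Φ≈Sgn m S g nS gs = trans (bounded-littlewood m S nS) (trans (Spl-cong S (λ {J} {K} s →
    trans (sym (*-identityʳ _)) (*-cong (*-congʳ (*-congʳ (*-congʳ (trans (sym (Π-congA (All.map proj₂ (proj₁ (All-split s gs))))) (sym (Π-map bar J g))))))
     (sym (trans (Π-congA (All.map proj₁ (proj₂ (All-split s gs)))) (Π-1 K))))))
   (sym (Sgn≈Spl S g)))

 -- Collapse of sign sums to thresholds

 open import Data.List.Properties using (++-assoc)
 open import Data.List.Relation.Binary.Permutation.Propositional as Perm using (_↭_; prep; swap)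
 open import Data.List.Relation.Binary.Permutation.Propositional.Properties using (++-comm)

 Sgn-++ : ∀ S T (g : List ℤ → Carrier) → Sgn (S ++ T) g ≈ Sgn S (λ Y → Sgn T (λ Y' → g (Y ++ Y')))
 Sgn-++ [] T g = refl
 Sgn-++ (s ∷ S) T g = +-cong (Sgn-++ S T _) (Sgn-++ S T _)

 data Flip : List ℤ → List ℤ → Set where
  [] : Flip [] []
  same : ∀ {s S T} → Flip S T → Flip (s ∷ S) (s ∷ T)
  flip : ∀ {s S T} → Flip S T → Flip (s ∷ S) (bar s ∷ T)

 Sgn-flip : ∀ {S T} (g : List ℤ → Carrier) → Flip S T → Sgn S g ≈ Sgn T g
 Sgn-flip g [] = refl
 Sgn-flip g (same p) = +-cong (Sgn-flip _ p) (Sgn-flip _ p)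
 Sgn-flip {s ∷ S} {_ ∷ T} g (flip p) = trans (+-cong (Sgn-flip _ p) (Sgn-flip _ p))
  (trans (+-comm _ _) (+-congˡ (reflexive (E.cong (λ x → Sgn T (λ Y → g (x ∷ Y))) (E.sym (bar-bar s))))))

 Sgn-↭ : ∀ {S T} (g : List ℤ → Carrier) → (∀ {Y Z} → Y ↭ Z → g Y ≈ g Z) → S ↭ T → Sgn S g ≈ Sgn T g
 Sgn-↭ g h Perm.refl = refl
 Sgn-↭ g h (prep x p) = +-cong (Sgn-↭ _ (λ q → h (prep _ q)) p) (Sgn-↭ _ (λ q → h (prep _ q)) p)
 Sgn-↭ {_ ∷ _ ∷ S} {_ ∷ _ ∷ T} g h (swap x y p) = trans
  (+-cong (+-cong (half x y) (half x (bar y))) (+-cong (half (bar x) y) (half (bar x) (bar y)))) (+-inter {X = ℤ} _ _ _ _)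
  where
  half : ∀ x y → Sgn S (λ Y → g (x ∷ y ∷ Y)) ≈ Sgn T (λ Y → g (y ∷ x ∷ Y))
  half x y = trans (Sgn-cong S (λ _ → h (swap x y Perm.refl))) (Sgn-↭ _ (λ q → h (prep _ (prep _ q))) p)
 Sgn-↭ g h (Perm.trans p q) = trans (Sgn-↭ g h p) (Sgn-↭ g h q)

 Π-↭ : ∀ {S T : List ℤ} (φ : ℤ → Carrier) → S ↭ T → Π S φ ≈ Π T φ
 Π-↭ φ Perm.refl = refl
 Π-↭ φ (prep x p) = *-congˡ (Π-↭ φ p)
 Π-↭ φ (swap x y p) = trans (*-congˡ (*-congˡ (Π-↭ φ p))) (solve 3 (λ x y z → x :* (y :* z) := y :* (x :* z)) tt _ _ _)
 Π-↭ φ (Perm.trans p q) = trans (Π-↭ φ p) (Π-↭ φ q)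

 sh : ℤ → ℕ → ℤ
 sh z zero = z
 sh z (suc r) = sh (z Z.+ + M₀) r

 -- A threshold pattern: the first r positions of the chain are inverted and the later ones are not.
 part : ℤ → ℕ → ℕ → List ℤ
 part z l r = map bar (prog z r) ++ prog (sh z r) (l ∸ r)

 Vanishing : (List ℤ → Carrier) → Set
 Vanishing g = ∀ Pre u rest → g (Pre ++ u ∷ bar (u Z.+ + M₀) ∷ rest) ≈ 0#

 private
  Sgn-0 : ∀ S → Sgn S (λ _ → 0#) ≈ 0#
  Sgn-0 [] = refl
  Sgn-0 (s ∷ S) = trans (+-cong (Sgn-0 S) (Sgn-0 S)) (+-identityˡ _)

  -- Once a position is not inverted, inverting the next one gives zero; so no later position of the
  -- chain is inverted either.
  straight : ∀ l u (g : List ℤ → Carrier) → (∀ rest → g (bar u ∷ rest) ≈ 0#) → Vanishing g → Sgn (prog u l) g ≈ g (prog u l)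
  straight zero u g h v = refl
  straight (suc l) u g h v = trans (+-cong (straight l (u Z.+ + M₀) (λ Y → g (u ∷ Y)) (λ rest → v [] u rest) (λ Pre → v (u ∷ Pre)))
   (trans (Sgn-cong (prog (u Z.+ + M₀) l) (λ {Y} _ → h Y)) (Sgn-0 (prog (u Z.+ + M₀) l)))) (+-identityʳ _)

 -- Only the thresholds survive: y and bar (y + M₀) never occur together.
 collapse : ∀ l z (g : List ℤ → Carrier) → Vanishing g → Sgn (prog z l) g ≈ sumTo (suc l) (λ r → g (part z l r))
 collapse zero z g v = sym (+-identityʳ _)
 collapse (suc l) z g v = +-cong (straight l (z Z.+ + M₀) (λ Y → g (z ∷ Y)) (λ rest → v [] z rest) (λ Pre → v (z ∷ Pre)))
  (collapse l (z Z.+ + M₀) (λ Y → g (bar z ∷ Y)) (λ Pre → v (bar z ∷ Pre)))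

 progs : ℕ → List ℤ → List ℤ
 progs l [] = []
 progs l (z ∷ zs) = prog z l ++ progs l zs

 parts : ℕ → List ℤ → List ℕ → List ℤ
 parts l (z ∷ zs) (r ∷ rs) = part z l r ++ parts l zs rs
 parts l _ _ = []

 collapse-all : ∀ l zs (g : List ℤ → Carrier) → Vanishing g → Sgn (progs l zs) g ≈ ΣL l (length zs) (λ rs → g (parts l zs rs))
 collapse-all l [] g v = refl
 collapse-all l (z ∷ zs) g v = begin
  _ ≈⟨ Sgn-++ (prog z l) (progs l zs) g ⟩
  _ ≈⟨ collapse l z _ (λ Pre u rest → trans (Sgn-cong (progs l zs) (λ {Y} _ → trans (reflexive (E.cong g (++-assoc Pre _ Y))) (v Pre u (rest ++ Y)))) (Sgn-0 (progs l zs))) ⟩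
  _ ≈⟨ sumTo-cong (suc l) (λ r _ → collapse-all l zs (λ Y' → g (part z l r ++ Y')) (λ Pre u rest → trans (reflexive (E.cong g (E.sym (++-assoc (part z l r) Pre _)))) (v (part z l r ++ Pre) u rest))) ⟩
  _ ∎

 sh≡ : ∀ z r → sh z r ≡ z Z.+ + r Z.* + M₀
 sh≡ z zero = lem z (+ M₀)
  where
  lem : ∀ z m → z ≡ z Z.+ (+ 0) Z.* m
  lem = ZS.solve-∀
 sh≡ z (suc r) = E.trans (sh≡ (z Z.+ + M₀) r) (lem z (+ M₀) (+ r))
  where
  lem : ∀ z m r → (z Z.+ m) Z.+ r Z.* m ≡ z Z.+ (+ 1 Z.+ r) Z.* m
  lem = ZS.solve-∀

 prog-∷ʳ : ∀ z k → prog z (suc k) ≡ prog z k ++ (sh z k ∷ [])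
 prog-∷ʳ z zero = E.refl
 prog-∷ʳ z (suc k) = E.cong (z ∷_) (prog-∷ʳ (z Z.+ + M₀) k)

 -- The reflected part of a chain is again a progression, read backwards.
 bar-prog : ∀ z r → map bar (prog z r) ↭ prog (bar (sh z r) Z.+ + M₀) r
 bar-prog z zero = Perm.refl
 bar-prog z (suc r) = Perm.trans (prep (bar z) (bar-prog (z Z.+ + M₀) r))
  (E.subst (λ x → (bar z ∷ prog v r) ↭ x) (E.sym (E.trans (prog-∷ʳ v r) (E.cong (λ x → prog v r ++ (x ∷ [])) (E.trans (sh≡ v r) eq)))) (++-comm (bar z ∷ []) (prog v r)))
  where
  v = bar (sh z (suc r)) Z.+ + M₀
  lem : ∀ e z m r → (Z.- e Z.- (z Z.+ (+ 1 Z.+ r) Z.* m) Z.+ m) Z.+ r Z.* m ≡ Z.- e Z.- z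
  lem = ZS.solve-∀
  eq : v Z.+ + r Z.* + M₀ ≡ bar z
  eq = E.trans (E.cong (λ x → (Z.- e Z.- x Z.+ + M₀) Z.+ + r Z.* + M₀) (sh≡ z (suc r))) (lem e z (+ M₀) (+ r))

 -- Limits along infinite progressions

 cr : List ℤ → List ℤ → Carrier
 cr A B = Π A (λ x → Π B (λ y → w (sm x y)))

 -- The limit of `F` on the union of the infinite progressions that start at vs: each progression
 -- contributes its own A₁, and each pair of progressions the telescoped product A.
 E₁ : (A A₁ : ℤ → Carrier) → List ℤ → Carrier
 E₁ A A₁ [] = 1#
 E₁ A A₁ (v ∷ vs) = A₁ v * Π vs (λ v' → A (sm v v')) * E₁ A A₁ vs

 module Progressions (f : ℤ → Carrier) where
  open Weighted f public

  F-↭ : ∀ {S T} → S ↭ T → F S ≈ F T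
  F-↭ Perm.refl = refl
  F-↭ (prep x p) = *-cong (*-congˡ (Π-↭ _ p)) (F-↭ p)
  F-↭ {_ ∷ _ ∷ S} {_ ∷ _ ∷ T} (swap x y p) = trans (*-cong (*-congˡ (*-cong (w-cong (sm-comm x y)) (Π-↭ _ p))) (*-cong (*-congˡ (Π-↭ _ p)) (F-↭ p)))
   (solve 6 (λ fx w X fy Y F → fx :* (w :* X) :* (fy :* Y :* F) := fy :* (w :* Y) :* (fx :* X :* F)) tt _ _ _ _ _ _)
  F-↭ (Perm.trans p q) = trans (F-↭ p) (F-↭ q)

  F-adjacent : Vanishing F
  F-adjacent [] u rest = trans (*-congʳ (trans (*-congˡ (trans (*-congʳ (trans (w-cong (E.trans (sm-bar u (u Z.+ + M₀)) (lem u (+ M₀)))) (w-zero M≢0))) (zeroˡ _))) (zeroʳ _))) (zeroˡ _)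
   where
   lem : ∀ u m → u Z.- (u Z.+ m) ≡ Z.- m
   lem = ZS.solve-∀
  F-adjacent (x ∷ Pre) u rest = trans (*-congˡ (F-adjacent Pre u rest)) (zeroʳ _)

  F-++ : ∀ A B → F (A ++ B) ≈ F A * F B * cr A B
  F-++ [] B = solve 1 (λ x → x := :1 :* x :* :1) tt (F B)
  F-++ (x ∷ A) B = trans (*-cong (*-congˡ (Π-++ A B _)) (F-++ A B))
   (solve 6 (λ f p q F G c → f :* (p :* q) :* (F :* G :* c) := f :* p :* F :* G :* (q :* c)) tt _ _ _ _ _ _)

  -- Infinite products  A s = Π_{i≥0} a (s + iM)  and  A₁ v = F {v, v+M, v+2M, ...}.
  module Limit (A A₁ : ℤ → Carrier) (e≥0 : + 0 Z.≤ e)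
   (Int-f : ∀ v → Int (f v)) (Int-A : ∀ s → Int (A s)) (Int-A₁ : ∀ s → Int (A₁ s))
   (Ok : ℤ → Set)
   (A-step : ∀ s → s ≢ + 0 → A s ≈ a s * A (s Z.+ + M₀))
   (A-big : ∀ {D} s → + D Z.≤ s → A s ≈[ D ] 1#)
   (A₁-step : ∀ v → Ok v → A₁ v ≈ f v * a (sm v (v Z.+ + M₀)) * A₁ (v Z.+ + M₀))
   (A₁-big : ∀ {D} s → + D Z.≤ s → A₁ s ≈[ D ] 1#) where

   NZ : ℤ → Set
   NZ s = ∀ i → sh s i ≢ + 0

   a-big : ∀ {D} s → 1 N.≤ D → + D Z.≤ s → a s ≈[ D ] 1#
   a-big {suc D} (+ suc k) _ (Z.+≤+ p) = ≈[]-trans (≈⇒≈[] (solve 1 (λ x → x := (x :- :1) :+ :1) tt (a (+ suc k))))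
    (≈[]-trans (≈[]-+ (≈[]-trans (≈⇒≈[] (b≈qa {+ suc k} (λ ()))) (0-*ʳ (Int-a (+ suc k)) (qz≈[]0 (suc k) p))) ≈[]-refl) (≈⇒≈[] (+-identityˡ _)))

   sm-shift : ∀ x y → sm x (y Z.+ + M₀) ≡ sm x y Z.+ + M₀
   sm-shift x y = lem x y (+ M₀) e
    where
    lem : ∀ x y m e → x Z.+ (y Z.+ m) Z.+ e ≡ x Z.+ y Z.+ e Z.+ m
    lem = ZS.solve-∀

   sm-shiftˡ : ∀ x y → sm (x Z.+ + M₀) y ≡ sm x y Z.+ + M₀
   sm-shiftˡ x y = E.trans (sm-comm (x Z.+ + M₀) y) (E.trans (sm-shift y x) (E.cong (Z._+ + M₀) (sm-comm y x)))

   telescope : ∀ k x y → NZ (sm x y) → Π (prog y k) (λ y' → w (sm x y')) * a (sm x (sh y k)) ≈ a (sm x y)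
   telescope zero x y nz = *-identityˡ _
   telescope (suc k) x y nz = begin
    _ ≈⟨ *-assoc _ _ _ ⟩
    _ ≈⟨ *-congˡ (telescope k x (y Z.+ + M₀) (λ i p → nz (suc i) (E.trans (E.cong (λ s → sh s i) (E.sym (sm-shift x y))) p))) ⟩
    _ ≈⟨ *-congˡ (a-cong (sm-shift x y)) ⟩
    _ ≈⟨ w-tel (nz 0) (nz 1) ⟩
    a (sm x y) ∎

   module _ {D : ℕ} (D≥1 : 1 N.≤ D) (Lo : ℕ) where
    Low : ℤ → Set
    Low v = Z.- (+ Lo) Z.≤ v

    -- Terms are at least -Lo and progressions end at or beyond D + Lo, so the exponent left over by
    -- telescoping is at least D.
    Top : ℤ → Set
    Top s = + (D N.+ Lo) Z.≤ s

    Low-shift : ∀ {v} → Low v → Low (v Z.+ + M₀)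
    Low-shift {v} p = ZP.≤-trans p (ZP.≤-trans (ZP.≤-reflexive (E.sym (ZP.+-identityʳ v))) (ZP.+-monoʳ-≤ v (Z.+≤+ N.z≤n)))

    sm-big : ∀ {x y} → Low x → Top y → + D Z.≤ sm x y
    sm-big {x} {y} p q = ZP.≤-trans (ZP.≤-reflexive eq) (ZP.+-mono-≤ (ZP.+-mono-≤ p q) e≥0)
     where
     lem : ∀ d l → d ≡ (Z.- l Z.+ (d Z.+ l)) Z.+ + 0
     lem = ZS.solve-∀
     eq : + D ≡ (Z.- (+ Lo) Z.+ + (D N.+ Lo)) Z.+ + 0
     eq = lem (+ D) (+ Lo)

    Top-big : ∀ {y} → Top y → + D Z.≤ y
    Top-big q = ZP.≤-trans (Z.+≤+ (NP.m≤m+n D Lo)) q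

    telescope-mod : ∀ k x y → NZ (sm x y) → Low x → Top (sh y k) → Π (prog y k) (λ y' → w (sm x y')) ≈[ D ] a (sm x y)
    telescope-mod k x y nz lo to = ≈[]-trans (≈⇒≈[] (sym (*-identityʳ _)))
     (≈[]-trans (≈[]-*ˡ (Int-Π (prog y k) (λ _ → Int-w _)) (≈[]-sym (a-big (sm x (sh y k)) D≥1 (sm-big lo to)))) (≈⇒≈[] (telescope k x y nz)))

    cross-mod : ∀ k v k' v' → NZ (sm v v') → Low v → Low v' → Top (sh v k) → Top (sh v' k') → cr (prog v k) (prog v' k') ≈[ D ] A (sm v v')
    cross-mod zero v k' v' nz lo lo' to to' = ≈[]-sym (A-big (sm v v') (ZP.≤-trans (sm-big lo' to) (ZP.≤-reflexive (sm-comm v' v))))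
    cross-mod (suc k) v k' v' nz lo lo' to to' = ≈[]-trans
     (≈[]-* (Int-Π (prog v' k') (λ _ → Int-w _)) (Int-A _) (telescope-mod k' v v' nz lo to')
      (≈[]-trans (cross-mod k (v Z.+ + M₀) k' v' (λ i p → nz (suc i) (E.trans (E.cong (λ s → sh s i) (E.sym (sm-shiftˡ v v'))) p)) (Low-shift {v} lo) lo' to to')
       (≈⇒≈[] (reflexive (E.cong A (sm-shiftˡ v v'))))))
     (≈⇒≈[] (sym (A-step (sm v v') (nz 0))))

    single-mod : ∀ k v → (∀ i → Ok (sh v i)) → (∀ i → NZ (sm (sh v i) (sh v (suc i)))) → Low v → Top (sh v k) → F (prog v k) ≈[ D ] A₁ v
    single-mod zero v ok nz lo to = ≈[]-sym (A₁-big v (Top-big to))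
    single-mod (suc k) v ok nz lo to = ≈[]-trans
     (≈[]-* (Int-* (Int-f v) (Int-Π (prog (v Z.+ + M₀) k) (λ _ → Int-w _))) (Int-A₁ _)
      (≈[]-*ˡ (Int-f v) (telescope-mod k v (v Z.+ + M₀) (nz 0) lo to))
      (single-mod k (v Z.+ + M₀) (λ i → ok (suc i)) (λ i → nz (suc i)) (Low-shift {v} lo) to))
     (≈⇒≈[] (sym (A₁-step v (ok 0))))

    -- progressions given by (first term, length)
    Pr : Set
    Pr = ℤ × ℕ

    cat : List Pr → List ℤ
    cat [] = []
    cat ((v , k) ∷ ps) = prog v k ++ cat ps

    record Fine (p : Pr) : Set where
     field
      ok : ∀ i → Ok (sh (proj₁ p) i)
      nz₁ : ∀ i → NZ (sm (sh (proj₁ p) i) (sh (proj₁ p) (suc i)))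
      low : Low (proj₁ p)
      high : Top (sh (proj₁ p) (proj₂ p))
    open Fine

    data AllFine : List Pr → Set where
     [] : AllFine []
     _∷_ : ∀ {p ps} → Fine p × All (λ p' → NZ (sm (proj₁ p) (proj₁ p'))) ps → AllFine ps → AllFine (p ∷ ps)

    Int-F : ∀ Y → Int (F Y)
    Int-F [] = Int-1
    Int-F (y ∷ Y) = Int-* (Int-* (Int-f y) (Int-Π Y (λ _ → Int-w _))) (Int-F Y)

    Int-E₁ : ∀ vs → Int (E₁ A A₁ vs)
    Int-E₁ [] = Int-1
    Int-E₁ (v ∷ vs) = Int-* (Int-* (Int-A₁ v) (Int-Π vs (λ _ → Int-A _))) (Int-E₁ vs)

    private
     cross-cat : ∀ p ps → Fine p → All (λ p' → NZ (sm (proj₁ p) (proj₁ p'))) ps → AllFine ps →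
           cr (prog (proj₁ p) (proj₂ p)) (cat ps) ≈[ D ] Π (map proj₁ ps) (λ v' → A (sm (proj₁ p) v'))
     cross-cat p [] fp [] [] = ≈⇒≈[] (Π-1 (prog (proj₁ p) (proj₂ p)))
     cross-cat p ((v' , k') ∷ ps) fp (n ∷ ns) ((fp' , _) ∷ fs) = ≈[]-trans
      (≈⇒≈[] (trans (Π-cong (prog (proj₁ p) (proj₂ p)) (λ x → Π-++ (prog v' k') (cat ps) _)) (Π-* (prog (proj₁ p) (proj₂ p)) _ _)))
      (≈[]-* (Int-Π (prog (proj₁ p) (proj₂ p)) (λ x → Int-Π (prog v' k') (λ _ → Int-w _))) (Int-Π (map proj₁ ps) (λ _ → Int-A _))
       (cross-mod (proj₂ p) (proj₁ p) k' v' n (low fp) (low fp') (high fp) (high fp')) (cross-cat p ps fp ns fs))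

    F-cat : ∀ ps → AllFine ps → F (cat ps) ≈[ D ] E₁ A A₁ (map proj₁ ps)
    F-cat [] [] = ≈[]-refl
    F-cat ((v , k) ∷ ps) ((fp , ns) ∷ fs) = ≈[]-trans
     (≈⇒≈[] (trans (F-++ (prog v k) (cat ps)) (solve 3 (λ x y z → x :* y :* z := x :* z :* y) tt _ _ _)))
     (≈[]-* (Int-* (Int-F (prog v k)) (Int-Π (prog v k) (λ x → Int-Π (cat ps) (λ _ → Int-w _)))) (Int-E₁ (map proj₁ ps))
      (≈[]-* (Int-F (prog v k)) (Int-Π (map proj₁ ps) (λ _ → Int-A _)) (single-mod k v (ok fp) (nz₁ fp) (low fp) (high fp)) (cross-cat (v , k) ps fp ns fs))
      (F-cat ps fs))

 -- Theta functions and the exact form of a lattice term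

 open Determinants R public

 M : ℤ
 M = + (H N.+ H)

 -- The ratio of consecutive values is an invertible power of q, so the recurrence can also be run
 -- towards negative ρ.
 q-recurrence : ∀ (G : ℤ → Carrier) (E : ℤ → ℤ) → E (+ 0) ≡ + 0 →
         (∀ ρ → G (ρ Z.+ + 1) ≈ qz (E (ρ Z.+ + 1) Z.- E ρ) * G ρ) → ∀ ρ → G ρ ≈ qz (E ρ) * G (+ 0)
 q-recurrence G E E0 step = go
  where
  combine : ∀ {x y z g} → x Z.+ y ≡ z → qz x * (qz y * g) ≈ qz z * g
  combine {x} {y} e = trans (sym (*-assoc _ _ _)) (*-congʳ (trans (sym (qz-+ x y)) (qz-cong e)))
  e₁ : ∀ x y → (x Z.- y) Z.+ y ≡ x
  e₁ = ZS.solve-∀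
  e₂ : ∀ x y → (y Z.- x) Z.+ (x Z.- y) ≡ + 0
  e₂ = ZS.solve-∀
  suc+ : ∀ n → + suc n ≡ + n Z.+ + 1
  suc+ n = E.cong +_ (NP.+-comm 1 n)
  up : ∀ n → G (+ n) ≈ qz (E (+ n)) * G (+ 0)
  up zero = trans (sym (*-identityˡ _)) (*-congʳ (trans (sym qz-0) (qz-cong (E.sym E0))))
  up (suc n) = E.subst (λ k → G k ≈ qz (E k) * G (+ 0)) (E.sym (suc+ n))
   (trans (step (+ n)) (trans (*-congˡ (up n)) (combine (e₁ _ (E (+ n))))))
  back : ∀ ρ → G (ρ Z.+ + 1) ≈ qz (E (ρ Z.+ + 1)) * G (+ 0) → G ρ ≈ qz (E ρ) * G (+ 0)
  back ρ h = begin
   G ρ ≈⟨ *-identityˡ _ ⟨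
   1# * G ρ ≈⟨ *-congʳ (trans (sym qz-0) (qz-cong (E.sym (e₂ (E (ρ Z.+ + 1)) (E ρ))))) ⟩
   qz ((E ρ Z.- E (ρ Z.+ + 1)) Z.+ (E (ρ Z.+ + 1) Z.- E ρ)) * G ρ ≈⟨ combine E.refl ⟨
   qz (E ρ Z.- E (ρ Z.+ + 1)) * (qz (E (ρ Z.+ + 1) Z.- E ρ) * G ρ) ≈⟨ *-congˡ (trans (sym (step ρ)) h) ⟩
   qz (E ρ Z.- E (ρ Z.+ + 1)) * (qz (E (ρ Z.+ + 1)) * G (+ 0)) ≈⟨ combine (e₁ (E ρ) _) ⟩
   _ ∎
  go : ∀ ρ → G ρ ≈ qz (E ρ) * G (+ 0)
  go (+ n) = up n
  go -[1+ zero ] = back -[1+ 0 ] (up 0)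
  go -[1+ suc n ] = back -[1+ suc n ] (go -[1+ n ])

 -- Quasi-periodicity of the reciprocal theta function A s A (m - s).
 module Quasi (m : ℤ) (A : ℤ → Carrier) (A-step : ∀ s → s ≢ + 0 → A s ≈ a s * A (s Z.+ m)) where
  Θ : ℤ → Carrier
  Θ s = A s * A (m Z.- s)

  Θ-cong : ∀ {s s'} → s ≡ s' → Θ s ≈ Θ s'
  Θ-cong p = reflexive (E.cong Θ p)

  A-unstep : ∀ s → s ≢ + 0 → A (s Z.+ m) ≈ (1# - qz s) * A s
  A-unstep s n = sym (trans (*-congˡ (A-step s n)) (trans (sym (*-assoc _ _ _)) (trans (*-congʳ (a-inv n)) (*-identityˡ _))))

  Θ-step : ∀ s → s ≢ + 0 → Θ (s Z.+ m) ≈ - qz s * Θ s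
  Θ-step s n = begin
   _ ≈⟨ *-congˡ (trans (reflexive (E.cong A (e₁ m s))) (A-step (Z.- s) (neg≢0 n))) ⟩
   _ ≈⟨ *-congˡ (*-cong (a-neg′ n) (reflexive (E.cong A (ZP.+-comm (Z.- s) m)))) ⟩
   _ ≈⟨ solve 4 (λ x q y z → x :* (:- (q :* y) :* z) := :- q :* ((y :* x) :* z)) tt (A (s Z.+ m)) (qz s) (a s) (A (m Z.- s)) ⟩
   _ ≈⟨ *-congˡ (*-congʳ (sym (A-step s n))) ⟩
   - qz s * Θ s ∎
   where
   e₁ : ∀ m s → m Z.- (s Z.+ m) ≡ Z.- s
   e₁ = ZS.solve-∀

  Θ-unstep : ∀ s → s Z.- m ≢ + 0 → Θ (s Z.- m) ≈ - qz (m Z.- s) * Θ s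
  Θ-unstep s n = begin
   _ ≈⟨ *-identityˡ _ ⟨
   _ ≈⟨ *-congʳ (trans (sym (qz-inv (s Z.- m))) (*-congʳ (qz-cong (e₂ m s)))) ⟩
   _ ≈⟨ solve 3 (λ x y z → x :* y :* z := :- x :* (:- y :* z)) tt (qz (m Z.- s)) (qz (s Z.- m)) (Θ (s Z.- m)) ⟩
   _ ≈⟨ *-congˡ (sym (Θ-step (s Z.- m) n)) ⟩
   _ ≈⟨ *-congˡ (Θ-cong (e₁ m s)) ⟩
   _ ∎
   where
   e₁ : ∀ m s → (s Z.- m) Z.+ m ≡ s
   e₁ = ZS.solve-∀
   e₂ : ∀ m s → Z.- (s Z.- m) ≡ m Z.- s
   e₂ = ZS.solve-∀

  Θ-2step : ∀ s → s ≢ + 0 → s Z.+ m ≢ + 0 → Θ (s Z.+ m Z.+ m) ≈ qz (s Z.+ s Z.+ m) * Θ s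
  Θ-2step s n n' = begin
   _ ≈⟨ Θ-step (s Z.+ m) n' ⟩
   _ ≈⟨ *-congˡ (Θ-step s n) ⟩
   _ ≈⟨ solve 3 (λ x y z → :- x :* (:- y :* z) := (y :* x) :* z) tt (qz (s Z.+ m)) (qz s) (Θ s) ⟩
   _ ≈⟨ *-congʳ (trans (sym (qz-+ s (s Z.+ m))) (qz-cong (E.sym (ZP.+-assoc s s m)))) ⟩
   _ ∎

 NZℤ : ℤ → ℤ → Set
 NZℤ m s = ∀ k → s Z.+ k Z.* m ≢ + 0

 -- A class of positions v ≡ p (mod M), with threshold v = p + ρ M; the reflected class starts at pt′.
 Class : Set
 Class = ℤ × ℤ

 -- For ρ ≥ 0, β is the sum of 2y + e over the positions y = p, p + M, ..., p + (ρ - 1)M. With Y =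
 -- q^(H - e/2 - pt), the powers q^P and q^P′ are q^(e/2) Y and q^(e/2)/Y, so `ξ` is proportional to
 -- Y + 1/Y, the natural variable of the Weyl denominators of types B and C.
 pt pt′ β P P′ : Class → ℤ
 pt (p , ρ) = p Z.+ ρ Z.* M
 pt′ c = bar (pt c) Z.+ M
 β (p , ρ) = (p Z.+ p Z.+ e) Z.* ρ Z.+ M Z.* (ρ Z.* (ρ Z.- + 1))
 P c = + H Z.- pt c
 P′ c = pt c Z.- + H Z.+ e

 ξ : Class → Carrier
 ξ c = qz (P c) + qz (P′ c)

 open Vandermonde ξ public

 module Exact (A : ℤ → Carrier) (A-step : ∀ s → s ≢ + 0 → A s ≈ a s * A (s Z.+ M)) where
  open Quasi M A A-step public

  private
   q3 : ∀ {x y z} → x Z.+ y ≡ z → qz x * qz y ≈ qz z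
   q3 {x} {y} e = trans (sym (qz-+ x y)) (qz-cong e)

  pair : Class → Class → Carrier
  pair c d = A (sm (pt c) (pt d)) * A (sm (pt c) (pt′ d)) * (A (sm (pt′ c) (pt d)) * A (sm (pt′ c) (pt′ d)))

  σ δ′ : Class → Class → ℤ
  σ c d = sm (pt c) (pt d)
  δ′ c d = pt d Z.- pt c

  -- Of the four factors, two have an argument that is off by one period. Moving these back
  -- completes two reciprocal theta functions and releases (1 - q^(M-σ))(1 - q^δ), which is the
  -- Vandermonde difference times a power of q.
  pair-Θ : ∀ c d → M Z.- σ c d ≢ + 0 → δ′ c d ≢ + 0 →
       pair c d ≈ Θ (σ c d) * Θ (δ′ c d) * (qz (+ H Z.- e Z.- pt c) * (ξ c - ξ d))
  pair-Θ c d n₁ n₂ = begin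
   pair c d
    ≈⟨ *-cong (*-congˡ (reflexive (E.cong A (e₁ e x y M)))) (*-cong (trans (reflexive (E.cong A (e₂ e x y M))) (A-unstep (δ′ c d) n₂)) (trans (reflexive (E.cong A (e₃ e x y M))) (A-unstep (M Z.- σ c d) n₁))) ⟩
   A (σ c d) * A (M Z.- δ′ c d) * (((1# - qz (δ′ c d)) * A (δ′ c d)) * ((1# - qz (M Z.- σ c d)) * A (M Z.- σ c d)))
    ≈⟨ solve 6 (λ s d' u d v s' → s :* d' :* ((u :* d) :* (v :* s')) := (s :* s') :* (d :* d') :* (v :* u)) tt _ _ _ _ _ _ ⟩
   Θ (σ c d) * Θ (δ′ c d) * ((1# - qz (M Z.- σ c d)) * (1# - qz (δ′ c d)))
    ≈⟨ *-congˡ (sym (begin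
      _ ≈⟨ solve 5 (λ z a b c d → z :* ((a :+ b) :- (c :+ d)) := z :* a :+ z :* b :- (z :* c :+ z :* d)) tt Z (qz (P c)) (qz (P′ c)) (qz (P d)) (qz (P′ d)) ⟩
      _ ≈⟨ +-cong (+-cong (trans (q3 (f₁ e x y (+ H))) (qz-+ _ _)) (trans (q3 (f₂ e x (+ H))) qz-0)) (-‿cong (+-cong (q3 (f₃ e x y (+ H))) (q3 (f₄ e x y (+ H))))) ⟩
      _ ≈⟨ solve 2 (λ u v → u :* v :+ :1 :- (u :+ v) := (:1 :- u) :* (:1 :- v)) tt _ _ ⟩
      _ ∎)) ⟩
   Θ (σ c d) * Θ (δ′ c d) * (Z * (ξ c - ξ d)) ∎
   where
   x = pt c
   y = pt d
   Z = qz (+ H Z.- e Z.- pt c)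
   e₁ : ∀ e x y m → x Z.+ (Z.- e Z.- y Z.+ m) Z.+ e ≡ m Z.- (y Z.- x)
   e₁ = ZS.solve-∀
   e₂ : ∀ e x y m → (Z.- e Z.- x Z.+ m) Z.+ y Z.+ e ≡ (y Z.- x) Z.+ m
   e₂ = ZS.solve-∀
   e₃ : ∀ e x y m → (Z.- e Z.- x Z.+ m) Z.+ (Z.- e Z.- y Z.+ m) Z.+ e ≡ (m Z.- (x Z.+ y Z.+ e)) Z.+ m
   e₃ = ZS.solve-∀
   f₁ : ∀ e x y h → (h Z.- e Z.- x) Z.+ (h Z.- x) ≡ ((h Z.+ h) Z.- (x Z.+ y Z.+ e)) Z.+ (y Z.- x)
   f₁ = ZS.solve-∀
   f₂ : ∀ e x h → (h Z.- e Z.- x) Z.+ (x Z.- h Z.+ e) ≡ + 0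
   f₂ = ZS.solve-∀
   f₃ : ∀ e x y h → (h Z.- e Z.- x) Z.+ (h Z.- y) ≡ (h Z.+ h) Z.- (x Z.+ y Z.+ e)
   f₃ = ZS.solve-∀
   f₄ : ∀ e x y h → (h Z.- e Z.- x) Z.+ (y Z.- h Z.+ e) ≡ y Z.- x
   f₄ = ZS.solve-∀

  ΘΘ : ℤ → ℤ → ℤ → ℤ → Carrier
  ΘΘ p p' ρ ρ' = Θ (σ (p , ρ) (p' , ρ')) * Θ (δ′ (p , ρ) (p' , ρ'))

  module _ (p p' : ℤ) (nz₁ : NZℤ M (p Z.+ p' Z.+ e)) (nz₂ : NZℤ M (p' Z.- p)) where
   private
    σ≢0 : ∀ ρ ρ' → σ (p , ρ) (p' , ρ') ≢ + 0
    σ≢0 ρ ρ' z = nz₁ (ρ Z.+ ρ') (E.trans (lem e p p' ρ ρ' M) z)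
     where
     lem : ∀ e p p' ρ ρ' m → p Z.+ p' Z.+ e Z.+ (ρ Z.+ ρ') Z.* m ≡ (p Z.+ ρ Z.* m) Z.+ (p' Z.+ ρ' Z.* m) Z.+ e
     lem = ZS.solve-∀
    Mσ≢0 : ∀ ρ ρ' → M Z.- σ (p , ρ) (p' , ρ') ≢ + 0
    Mσ≢0 ρ ρ' z = nz₁ (ρ Z.+ ρ' Z.- + 1) (E.trans (lem e p p' ρ ρ' M) (E.cong Z.-_ z))
     where
     lem : ∀ e p p' ρ ρ' m → p Z.+ p' Z.+ e Z.+ (ρ Z.+ ρ' Z.- + 1) Z.* m ≡ Z.- (m Z.- ((p Z.+ ρ Z.* m) Z.+ (p' Z.+ ρ' Z.* m) Z.+ e))
     lem = ZS.solve-∀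
    δ≢0 : ∀ ρ ρ' → δ′ (p , ρ) (p' , ρ') ≢ + 0
    δ≢0 ρ ρ' z = nz₂ (ρ' Z.- ρ) (E.trans (lem p p' ρ ρ' M) z)
     where
     lem : ∀ p p' ρ ρ' m → p' Z.- p Z.+ (ρ' Z.- ρ) Z.* m ≡ (p' Z.+ ρ' Z.* m) Z.- (p Z.+ ρ Z.* m)
     lem = ZS.solve-∀

    stepʳ : ∀ ρ ρ' → ΘΘ p p' ρ (ρ' Z.+ + 1) ≈ qz (β (p' , ρ' Z.+ + 1) Z.- β (p' , ρ')) * ΘΘ p p' ρ ρ'
    stepʳ ρ ρ' = begin
     _ ≈⟨ *-cong (trans (Θ-cong (e₁ e p p' ρ ρ' M)) (Θ-step _ (σ≢0 ρ ρ'))) (trans (Θ-cong (e₂ p p' ρ ρ' M)) (Θ-step _ (δ≢0 ρ ρ'))) ⟩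
     _ ≈⟨ solve 4 (λ a b c d → (:- a :* b) :* (:- c :* d) := (a :* c) :* (b :* d)) tt (qz s) (Θ s) (qz d) (Θ d) ⟩
     _ ≈⟨ *-congʳ (q3 (e₃ e p p' ρ ρ' M)) ⟩
     _ ∎
     where
     s = σ (p , ρ) (p' , ρ')
     d = δ′ (p , ρ) (p' , ρ')
     e₁ : ∀ e p p' ρ ρ' m → (p Z.+ ρ Z.* m) Z.+ (p' Z.+ (ρ' Z.+ + 1) Z.* m) Z.+ e ≡ ((p Z.+ ρ Z.* m) Z.+ (p' Z.+ ρ' Z.* m) Z.+ e) Z.+ m
     e₁ = ZS.solve-∀
     e₂ : ∀ p p' ρ ρ' m → (p' Z.+ (ρ' Z.+ + 1) Z.* m) Z.- (p Z.+ ρ Z.* m) ≡ ((p' Z.+ ρ' Z.* m) Z.- (p Z.+ ρ Z.* m)) Z.+ m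
     e₂ = ZS.solve-∀
     e₃ : ∀ e p p' ρ ρ' m → ((p Z.+ ρ Z.* m) Z.+ (p' Z.+ ρ' Z.* m) Z.+ e) Z.+ ((p' Z.+ ρ' Z.* m) Z.- (p Z.+ ρ Z.* m))
        ≡ ((p' Z.+ p' Z.+ e) Z.* (ρ' Z.+ + 1) Z.+ m Z.* ((ρ' Z.+ + 1) Z.* ((ρ' Z.+ + 1) Z.- + 1))) Z.- ((p' Z.+ p' Z.+ e) Z.* ρ' Z.+ m Z.* (ρ' Z.* (ρ' Z.- + 1)))
     e₃ = ZS.solve-∀

    stepˡ : ∀ ρ ρ' → ΘΘ p p' (ρ Z.+ + 1) ρ' ≈ qz ((β (p , ρ Z.+ + 1) Z.+ (ρ Z.+ + 1) Z.* M) Z.- (β (p , ρ) Z.+ ρ Z.* M)) * ΘΘ p p' ρ ρ'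
    stepˡ ρ ρ' = begin
     _ ≈⟨ *-cong (trans (Θ-cong (e₁ e p p' ρ ρ' M)) (Θ-step _ (σ≢0 ρ ρ'))) (trans (Θ-cong (e₂ p p' ρ ρ' M)) (Θ-unstep _ (λ z → δ≢0 (ρ Z.+ + 1) ρ' (E.trans (e₂ p p' ρ ρ' M) z)))) ⟩
     _ ≈⟨ solve 4 (λ a b c d → (:- a :* b) :* (:- c :* d) := (a :* c) :* (b :* d)) tt (qz s) (Θ s) (qz (M Z.- d)) (Θ d) ⟩
     _ ≈⟨ *-congʳ (q3 (e₃ e p p' ρ ρ' M)) ⟩
     _ ∎
     where
     s = σ (p , ρ) (p' , ρ')
     d = δ′ (p , ρ) (p' , ρ')
     e₁ : ∀ e p p' ρ ρ' m → (p Z.+ (ρ Z.+ + 1) Z.* m) Z.+ (p' Z.+ ρ' Z.* m) Z.+ e ≡ ((p Z.+ ρ Z.* m) Z.+ (p' Z.+ ρ' Z.* m) Z.+ e) Z.+ m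
     e₁ = ZS.solve-∀
     e₂ : ∀ p p' ρ ρ' m → (p' Z.+ ρ' Z.* m) Z.- (p Z.+ (ρ Z.+ + 1) Z.* m) ≡ ((p' Z.+ ρ' Z.* m) Z.- (p Z.+ ρ Z.* m)) Z.- m
     e₂ = ZS.solve-∀
     e₃ : ∀ e p p' ρ ρ' m → ((p Z.+ ρ Z.* m) Z.+ (p' Z.+ ρ' Z.* m) Z.+ e) Z.+ (m Z.- ((p' Z.+ ρ' Z.* m) Z.- (p Z.+ ρ Z.* m)))
        ≡ (((p Z.+ p Z.+ e) Z.* (ρ Z.+ + 1) Z.+ m Z.* ((ρ Z.+ + 1) Z.* ((ρ Z.+ + 1) Z.- + 1))) Z.+ (ρ Z.+ + 1) Z.* m) Z.- (((p Z.+ p Z.+ e) Z.* ρ Z.+ m Z.* (ρ Z.* (ρ Z.- + 1))) Z.+ ρ Z.* m)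
     e₃ = ZS.solve-∀

   k₂ : Carrier
   k₂ = ΘΘ p p' (+ 0) (+ 0) * qz (+ H Z.- e Z.- p)

   -- By quasi-periodicity the theta functions depend on the two thresholds only through powers of
   -- q. So `k₂` is free of ρ and ρ', and the Vandermonde difference is the one factor that couples
   -- them.
   pair-exact : ∀ ρ ρ' → pair (p , ρ) (p' , ρ') ≈ k₂ * (qz (β (p , ρ)) * qz (β (p' , ρ')) * (ξ (p , ρ) - ξ (p' , ρ')))
   pair-exact ρ ρ' = begin
    _ ≈⟨ pair-Θ (p , ρ) (p' , ρ') (Mσ≢0 ρ ρ') (δ≢0 ρ ρ') ⟩
    _ ≈⟨ *-congʳ (trans (q-recurrence (λ r → ΘΘ p p' ρ r) (λ r → β (p' , r)) (z₁ e p' M) (stepʳ ρ) ρ')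
            (*-congˡ (q-recurrence (λ r → ΘΘ p p' r (+ 0)) (λ r → β (p , r) Z.+ r Z.* M) (z₂ e p M) (λ r → stepˡ r (+ 0)) ρ))) ⟩
    _ ≈⟨ solve 5 (λ b' b k z x → b' :* (b :* k) :* (z :* x) := (b :* z) :* (b' :* k :* x)) tt _ _ _ _ X ⟩
    _ ≈⟨ *-congʳ (trans (q3 (c₁ (β (p , ρ)) ρ M (+ H) e p)) (qz-+ _ _)) ⟩
    _ ≈⟨ solve 5 (λ b z b' k x → (b :* z) :* (b' :* k :* x) := (k :* z) :* (b :* b' :* x)) tt _ _ _ K X ⟩
    _ ∎
    where
    X = ξ (p , ρ) - ξ (p' , ρ')
    K = ΘΘ p p' (+ 0) (+ 0)
    z₁ : ∀ e p m → (p Z.+ p Z.+ e) Z.* (+ 0) Z.+ m Z.* ((+ 0) Z.* ((+ 0) Z.- + 1)) ≡ + 0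
    z₁ = ZS.solve-∀
    z₂ : ∀ e p m → (p Z.+ p Z.+ e) Z.* (+ 0) Z.+ m Z.* ((+ 0) Z.* ((+ 0) Z.- + 1)) Z.+ (+ 0) Z.* m ≡ + 0
    z₂ = ZS.solve-∀
    c₁ : ∀ b r m h e p → (b Z.+ r Z.* m) Z.+ (h Z.- e Z.- (p Z.+ r Z.* m)) ≡ b Z.+ (h Z.- e Z.- p)
    c₁ = ZS.solve-∀

  module SingleC (p : ℤ) (nz : NZℤ M (p Z.+ p Z.+ e)) where
   k₁ : Carrier
   k₁ = - (Θ (sm p p) * qz (+ H Z.- e Z.- p))

   -- Raising ρ by one moves the argument 2 pt + e by two periods, which doubles the exponent β.
   single-exact : ∀ ρ → A (sm (pt (p , ρ)) (pt (p , ρ))) * A (sm (pt′ (p , ρ)) (pt′ (p , ρ)))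
           ≈ k₁ * (qz (β (p , ρ) Z.+ β (p , ρ)) * (qz (P (p , ρ)) - qz (P′ (p , ρ))))
   single-exact ρ = begin
    A (s ρ) * A (sm (pt′ (p , ρ)) (pt′ (p , ρ)))
     ≈⟨ *-congˡ (trans (reflexive (E.cong A (e₃ e (pt (p , ρ)) M))) (A-unstep (M Z.- s ρ) Ms≢0)) ⟩
    A (s ρ) * ((1# - qz (M Z.- s ρ)) * A (M Z.- s ρ))
     ≈⟨ solve 3 (λ x y z → x :* (y :* z) := (x :* z) :* y) tt _ _ _ ⟩
    Θ (s ρ) * (1# - qz (M Z.- s ρ))
     ≈⟨ *-cong (trans (q-recurrence (λ r → Θ (s r)) (λ r → (β (p , r) Z.+ β (p , r)) Z.+ r Z.* M) (z₀ e p M) stp ρ) (*-congˡ (Θ-cong (s0 e p M))))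
        (sym (begin
         _ ≈⟨ solve 3 (λ z x y → :- (z :* (x :- y)) := z :* y :- z :* x) tt Z _ _ ⟩
         _ ≈⟨ +-cong (trans (q3 (f₂ e (pt (p , ρ)) (+ H))) qz-0) (-‿cong (q3 (f₁ e (pt (p , ρ)) (+ H)))) ⟩
         _ ∎)) ⟩
    (qz ((β (p , ρ) Z.+ β (p , ρ)) Z.+ ρ Z.* M) * Θ (sm p p)) * - (Z * X)
     ≈⟨ solve 4 (λ b t z x → (b :* t) :* :- (z :* x) := (b :* z) :* :- (t :* x)) tt _ _ Z X ⟩
    (qz ((β (p , ρ) Z.+ β (p , ρ)) Z.+ ρ Z.* M) * Z) * - (Θ (sm p p) * X)
     ≈⟨ *-congʳ (trans (q3 (c₁ (β (p , ρ) Z.+ β (p , ρ)) ρ M (+ H) e p)) (qz-+ _ _)) ⟩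
    (qz (β (p , ρ) Z.+ β (p , ρ)) * qz (+ H Z.- e Z.- p)) * - (Θ (sm p p) * X)
     ≈⟨ solve 4 (λ b z t x → (b :* z) :* :- (t :* x) := :- (t :* z) :* (b :* x)) tt _ _ _ X ⟩
    k₁ * (qz (β (p , ρ) Z.+ β (p , ρ)) * X) ∎
    where
    s : ℤ → ℤ
    s ρ = sm (pt (p , ρ)) (pt (p , ρ))
    Z = qz (+ H Z.- e Z.- pt (p , ρ))
    X = qz (P (p , ρ)) - qz (P′ (p , ρ))
    s≢0 : ∀ ρ → s ρ ≢ + 0
    s≢0 ρ z = nz (+ 2 Z.* ρ) (E.trans (lem e p ρ (+ H)) z)
     where
     lem : ∀ e p ρ h → p Z.+ p Z.+ e Z.+ (+ 2 Z.* ρ) Z.* (h Z.+ h) ≡ (p Z.+ ρ Z.* (h Z.+ h)) Z.+ (p Z.+ ρ Z.* (h Z.+ h)) Z.+ e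
     lem = ZS.solve-∀
    sM≢0 : ∀ ρ → s ρ Z.+ M ≢ + 0
    sM≢0 ρ z = nz (+ 2 Z.* ρ Z.+ + 1) (E.trans (lem e p ρ (+ H)) z)
     where
     lem : ∀ e p ρ h → p Z.+ p Z.+ e Z.+ (+ 2 Z.* ρ Z.+ + 1) Z.* (h Z.+ h) ≡ ((p Z.+ ρ Z.* (h Z.+ h)) Z.+ (p Z.+ ρ Z.* (h Z.+ h)) Z.+ e) Z.+ (h Z.+ h)
     lem = ZS.solve-∀
    Ms≢0 : M Z.- s ρ ≢ + 0
    Ms≢0 z = nz (+ 2 Z.* ρ Z.- + 1) (E.trans (lem e p ρ (+ H)) (E.cong Z.-_ z))
     where
     lem : ∀ e p ρ h → p Z.+ p Z.+ e Z.+ (+ 2 Z.* ρ Z.- + 1) Z.* (h Z.+ h) ≡ Z.- ((h Z.+ h) Z.- ((p Z.+ ρ Z.* (h Z.+ h)) Z.+ (p Z.+ ρ Z.* (h Z.+ h)) Z.+ e))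
     lem = ZS.solve-∀
    e₃ : ∀ e x m → (Z.- e Z.- x Z.+ m) Z.+ (Z.- e Z.- x Z.+ m) Z.+ e ≡ (m Z.- (x Z.+ x Z.+ e)) Z.+ m
    e₃ = ZS.solve-∀
    f₁ : ∀ e x h → (h Z.- e Z.- x) Z.+ (h Z.- x) ≡ (h Z.+ h) Z.- (x Z.+ x Z.+ e)
    f₁ = ZS.solve-∀
    f₂ : ∀ e x h → (h Z.- e Z.- x) Z.+ (x Z.- h Z.+ e) ≡ + 0
    f₂ = ZS.solve-∀
    z₀ : ∀ e p m → (((p Z.+ p Z.+ e) Z.* (+ 0) Z.+ m Z.* ((+ 0) Z.* ((+ 0) Z.- + 1))) Z.+ ((p Z.+ p Z.+ e) Z.* (+ 0) Z.+ m Z.* ((+ 0) Z.* ((+ 0) Z.- + 1)))) Z.+ (+ 0) Z.* m ≡ + 0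
    z₀ = ZS.solve-∀
    s0 : ∀ e p m → (p Z.+ (+ 0) Z.* m) Z.+ (p Z.+ (+ 0) Z.* m) Z.+ e ≡ p Z.+ p Z.+ e
    s0 = ZS.solve-∀
    c₁ : ∀ b r m h e p → (b Z.+ r Z.* m) Z.+ (h Z.- e Z.- (p Z.+ r Z.* m)) ≡ b Z.+ (h Z.- e Z.- p)
    c₁ = ZS.solve-∀
    stp : ∀ r → Θ (s (r Z.+ + 1)) ≈ qz (((β (p , r Z.+ + 1) Z.+ β (p , r Z.+ + 1)) Z.+ (r Z.+ + 1) Z.* M) Z.- ((β (p , r) Z.+ β (p , r)) Z.+ r Z.* M)) * Θ (s r)
    stp r = trans (Θ-cong (g₁ e p r M)) (trans (Θ-2step (s r) (s≢0 r) (sM≢0 r)) (*-congʳ (qz-cong (g₂ e p r M))))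
     where
     g₁ : ∀ e p r m → (p Z.+ (r Z.+ + 1) Z.* m) Z.+ (p Z.+ (r Z.+ + 1) Z.* m) Z.+ e ≡ ((p Z.+ r Z.* m) Z.+ (p Z.+ r Z.* m) Z.+ e) Z.+ m Z.+ m
     g₁ = ZS.solve-∀
     g₂ : ∀ e p r m → ((p Z.+ r Z.* m) Z.+ (p Z.+ r Z.* m) Z.+ e) Z.+ ((p Z.+ r Z.* m) Z.+ (p Z.+ r Z.* m) Z.+ e) Z.+ m ≡
      ((((p Z.+ p Z.+ e) Z.* (r Z.+ + 1) Z.+ m Z.* ((r Z.+ + 1) Z.* ((r Z.+ + 1) Z.- + 1))) Z.+ ((p Z.+ p Z.+ e) Z.* (r Z.+ + 1) Z.+ m Z.* ((r Z.+ + 1) Z.* ((r Z.+ + 1) Z.- + 1)))) Z.+ (r Z.+ + 1) Z.* m)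
      Z.- ((((p Z.+ p Z.+ e) Z.* r Z.+ m Z.* (r Z.* (r Z.- + 1))) Z.+ ((p Z.+ p Z.+ e) Z.* r Z.+ m Z.* (r Z.* (r Z.- + 1)))) Z.+ r Z.* m)
     g₂ = ZS.solve-∀

 module SingleB (A₁ : ℤ → Carrier) (A₁-step : ∀ s → s ≢ + 0 → A₁ s ≈ a s * A₁ (s Z.+ + H)) (e≡0 : e ≡ + 0)
         (p : ℤ) (nz : NZℤ (+ H) p) where
  open Quasi (+ H) A₁ A₁-step public renaming (Θ to Θₕ; Θ-cong to Θₕ-cong; A-unstep to A₁-unstep; Θ-step to Θₕ-step; Θ-unstep to Θₕ-unstep; Θ-2step to Θₕ-2step)

  -- Here the period is H, so one step of ρ, which moves pt by M = 2H, is again two periods.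
  single-exact : ∀ ρ → A₁ (pt (p , ρ)) * A₁ (pt′ (p , ρ)) ≈ Θₕ p * (qz (β (p , ρ) Z.+ ρ Z.* + H) * (1# - qz (P (p , ρ))))
  single-exact ρ = begin
   _ ≈⟨ *-congˡ (trans (reflexive (E.cong A₁ (E.trans (E.cong (λ e → Z.- e Z.- v ρ Z.+ M) e≡0) (e₁ (v ρ) (+ H))))) (A₁-unstep (+ H Z.- v ρ) Hv≢0)) ⟩
   _ ≈⟨ solve 3 (λ x y z → x :* (y :* z) := (x :* z) :* y) tt _ _ _ ⟩
   _ ≈⟨ *-congʳ (trans (q-recurrence (λ r → Θₕ (v r)) (λ r → β (p , r) Z.+ r Z.* + H) (z₀ e p M (+ H)) stp ρ) (*-congˡ (Θₕ-cong (v0 p M)))) ⟩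
   _ ≈⟨ solve 3 (λ x y z → x :* y :* z := y :* (x :* z)) tt _ _ _ ⟩
   _ ∎
   where
   v : ℤ → ℤ
   v ρ = pt (p , ρ)
   v≢0 : ∀ ρ → v ρ ≢ + 0
   v≢0 ρ z = nz (+ 2 Z.* ρ) (E.trans (lem p ρ (+ H)) z)
    where
    lem : ∀ p ρ h → p Z.+ (+ 2 Z.* ρ) Z.* h ≡ p Z.+ ρ Z.* (h Z.+ h)
    lem = ZS.solve-∀
   vH≢0 : ∀ ρ → v ρ Z.+ + H ≢ + 0
   vH≢0 ρ z = nz (+ 2 Z.* ρ Z.+ + 1) (E.trans (lem p ρ (+ H)) z)
    where
    lem : ∀ p ρ h → p Z.+ (+ 2 Z.* ρ Z.+ + 1) Z.* h ≡ p Z.+ ρ Z.* (h Z.+ h) Z.+ h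
    lem = ZS.solve-∀
   Hv≢0 : + H Z.- v ρ ≢ + 0
   Hv≢0 z = nz (+ 2 Z.* ρ Z.- + 1) (E.trans (lem p ρ (+ H)) (E.cong Z.-_ z))
    where
    lem : ∀ p ρ h → p Z.+ (+ 2 Z.* ρ Z.- + 1) Z.* h ≡ Z.- (h Z.- (p Z.+ ρ Z.* (h Z.+ h)))
    lem = ZS.solve-∀
   e₁ : ∀ x h → Z.- (+ 0) Z.- x Z.+ (h Z.+ h) ≡ (h Z.- x) Z.+ h
   e₁ = ZS.solve-∀
   v0 : ∀ p m → p Z.+ (+ 0) Z.* m ≡ p
   v0 = ZS.solve-∀
   z₀ : ∀ e p m h → ((p Z.+ p Z.+ e) Z.* (+ 0) Z.+ m Z.* ((+ 0) Z.* ((+ 0) Z.- + 1))) Z.+ (+ 0) Z.* h ≡ + 0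
   z₀ = ZS.solve-∀
   stp : ∀ r → Θₕ (v (r Z.+ + 1)) ≈ qz ((β (p , r Z.+ + 1) Z.+ (r Z.+ + 1) Z.* + H) Z.- (β (p , r) Z.+ r Z.* + H)) * Θₕ (v r)
   stp r = trans (Θₕ-cong (g₁ p r (+ H))) (trans (Θₕ-2step (v r) (v≢0 r) (vH≢0 r)) (*-congʳ (qz-cong
     (E.trans (g₂ p r (+ H)) (E.cong (λ e → (((p Z.+ p Z.+ e) Z.* (r Z.+ + 1) Z.+ M Z.* ((r Z.+ + 1) Z.* ((r Z.+ + 1) Z.- + 1))) Z.+ (r Z.+ + 1) Z.* + H) Z.- (((p Z.+ p Z.+ e) Z.* r Z.+ M Z.* (r Z.* (r Z.- + 1))) Z.+ r Z.* + H)) (E.sym e≡0))))))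
    where
    g₁ : ∀ p r h → p Z.+ (r Z.+ + 1) Z.* (h Z.+ h) ≡ (p Z.+ r Z.* (h Z.+ h)) Z.+ h Z.+ h
    g₁ = ZS.solve-∀
    g₂ : ∀ p r h → (p Z.+ r Z.* (h Z.+ h)) Z.+ (p Z.+ r Z.* (h Z.+ h)) Z.+ h ≡
     (((p Z.+ p Z.+ + 0) Z.* (r Z.+ + 1) Z.+ (h Z.+ h) Z.* ((r Z.+ + 1) Z.* ((r Z.+ + 1) Z.- + 1))) Z.+ (r Z.+ + 1) Z.* h) Z.- (((p Z.+ p Z.+ + 0) Z.* r Z.+ (h Z.+ h) Z.* (r Z.* (r Z.- + 1))) Z.+ r Z.* h)
    g₂ = ZS.solve-∀

 vl : List Class → List ℤ
 vl [] = []
 vl (c ∷ cs) = pt′ c ∷ pt c ∷ vl cs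

 module Assemble (A A₁ : ℤ → Carrier) (A-step : ∀ s → s ≢ + 0 → A s ≈ a s * A (s Z.+ M))
  (Good : ℤ → Set) (Good₂ : ℤ → ℤ → Set)
  (good₂ : ∀ {p p'} → Good₂ p p' → NZℤ M (p Z.+ p' Z.+ e) × NZℤ M (p' Z.- p))
  (k₁ : ℤ → Carrier) (y : Class → Carrier)
  (single : ∀ p ρ → Good p → A₁ (pt (p , ρ)) * A₁ (pt′ (p , ρ)) ≈ k₁ p * y (p , ρ)) where
  open Exact A A-step

  data Goods : List Class → Set where
   [] : Goods []
   _∷_ : ∀ {c cs} → Good (proj₁ c) × All (λ d → Good₂ (proj₁ c) (proj₁ d)) cs → Goods cs → Goods (c ∷ cs)

  κ₂ : ℤ → ℤ → Carrier
  κ₂ p p' = ΘΘ p p' (+ 0) (+ 0) * qz (+ H Z.- e Z.- p)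

  KK : List ℤ → Carrier
  KK [] = 1#
  KK (p ∷ ps) = k₁ p * A M * Π ps (κ₂ p) * KK ps

  private
   pairs : ∀ c cs → All (λ d → Good₂ (proj₁ c) (proj₁ d)) cs →
       Π (vl cs) (λ v → A (sm (pt′ c) v)) * Π (vl cs) (λ v → A (sm (pt c) v)) ≈
       Π (map proj₁ cs) (κ₂ (proj₁ c)) * qz (+ length cs Z.* β c) * Π cs (λ d → qz (β d)) * Π cs (λ d → ξ c - ξ d)
   pairs c [] _ = solve 1 (λ q → :1 :* :1 := :1 :* :1 :* :1 :* :1) tt 1# ⟨≈⟩ *-congʳ (*-congʳ (*-congˡ (trans (sym qz-0) (qz-cong (E.sym (ZP.*-zeroˡ (β c)))))))
    where
    _⟨≈⟩_ : ∀ {x y z} → x ≈ y → y ≈ z → x ≈ z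
    _⟨≈⟩_ = trans
   pairs c (d ∷ cs) (g ∷ gs) = begin
    _ ≈⟨ solve 6 (λ a b x c d y → (a :* (b :* x)) :* (c :* (d :* y)) := (d :* c :* (b :* a)) :* (x :* y)) tt _ _ X _ _ Y ⟩
    _ ≈⟨ *-cong (pair-exact (proj₁ c) (proj₁ d) (proj₁ (good₂ g)) (proj₂ (good₂ g)) (proj₂ c) (proj₂ d)) (pairs c cs gs) ⟩
    _ ≈⟨ solve 8 (λ k b b' x K L B Z → (k :* (b :* b' :* x)) :* (K :* L :* B :* Z) := (k :* K) :* (b :* L) :* (b' :* B) :* (x :* Z)) tt _ _ _ _ _ _ _ _ ⟩
    _ ≈⟨ *-congʳ (*-congʳ (*-congˡ (trans (sym (qz-+ _ _)) (qz-cong (lem (+ length cs) (β c)))))) ⟩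
    _ ∎
    where
    X = Π (vl cs) (λ v → A (sm (pt′ c) v))
    Y = Π (vl cs) (λ v → A (sm (pt c) v))
    lem : ∀ l b → b Z.+ l Z.* b ≡ (+ 1 Z.+ l) Z.* b
    lem = ZS.solve-∀

   sm-dual : ∀ c → sm (pt′ c) (pt c) ≡ M
   sm-dual c = lem e (pt c) M
    where
    lem : ∀ e x m → (Z.- e Z.- x Z.+ m) Z.+ x Z.+ e ≡ m
    lem = ZS.solve-∀

   -- In a list of N classes each class meets N - 1 others and collects (N - 1)β from them. The
   -- extra factor q^β makes this Nβ, a form that passes through the induction; `E₁-exact` divides
   -- it out again.
   raw : ∀ cs → Goods cs → E₁ A A₁ (vl cs) * Π cs (λ c → qz (β c)) ≈ KK (map proj₁ cs) * Π cs (λ c → y c * qz (+ length cs Z.* β c)) * V cs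
   raw [] _ = solve 0 (:1 :* :1 := :1 :* :1 :* :1) tt
   raw (c ∷ cs) ((g , gs) ∷ Gs) = begin
    _ ≈⟨ solve 8 (λ a' m x a y E b B → (a' :* (m :* x) :* (a :* y :* E)) :* (b :* B) := (a :* a') :* m :* (x :* y) :* b :* (E :* B)) tt _ _ _ _ _ _ _ _ ⟩
    _ ≈⟨ *-cong (*-congʳ (*-cong (*-cong (single (proj₁ c) (proj₂ c) g) (reflexive (E.cong A (sm-dual c)))) (pairs c cs gs))) (raw cs Gs) ⟩
    _ ≈⟨ solve 11 (λ k y m K L B Z b KK Y V → (k :* y) :* m :* (K :* L :* B :* Z) :* b :* (KK :* Y :* V) := (k :* m :* K :* KK) :* ((y :* (b :* L)) :* (B :* Y)) :* (Z :* V)) tt _ _ _ _ _ _ _ _ _ _ _ ⟩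
    _ ≈⟨ *-congʳ (*-congˡ (*-cong (*-congˡ (trans (sym (qz-+ _ _)) (qz-cong (lem (+ length cs) (β c))))) (trans (sym (Π-* cs _ _)) (Π-cong cs (λ d → trans (comm₃″ _ _ _) (*-congˡ (trans (sym (qz-+ _ _)) (qz-cong (lem (+ length cs) (β d)))))))))) ⟩
    _ ∎
    where
    X = Π (vl cs) (λ v → A (sm (pt′ c) v))
    Y = Π (vl cs) (λ v → A (sm (pt c) v))
    B = Π cs (λ d → qz (β d))
    K2 = Π (map proj₁ cs) (κ₂ (proj₁ c))
    Lq = qz (+ length cs Z.* β c)
    Z = Π cs (λ d → ξ c - ξ d)
    lem : ∀ l b → b Z.+ l Z.* b ≡ (+ 1 Z.+ l) Z.* b
    lem = ZS.solve-∀
    comm₃″ : ∀ x y z → x * (y * z) ≈ y * (x * z)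
    comm₃″ = solve 3 (λ x y z → x :* (y :* z) := y :* (x :* z)) tt

  E₁-exact : ∀ cs → Goods cs → E₁ A A₁ (vl cs) ≈ KK (map proj₁ cs) * (Π cs (λ c → y c * qz (+ length cs Z.* β c Z.- β c)) * V cs)
  E₁-exact cs gs = begin
   _ ≈⟨ *-identityʳ _ ⟨
   _ ≈⟨ *-congˡ (trans (sym (Π-1 cs)) (trans (Π-cong cs (λ c → trans (sym (qz-inv (β c))) (*-comm _ _))) (Π-* cs _ _))) ⟩
   _ ≈⟨ *-assoc _ _ _ ⟨
   _ ≈⟨ *-congʳ (raw cs gs) ⟩
   _ ≈⟨ solve 4 (λ k p v i → k :* p :* v :* i := k :* ((p :* i) :* v)) tt _ _ _ _ ⟩
   _ ≈⟨ *-congˡ (*-congʳ (trans (sym (Π-* cs _ _)) (Π-cong cs (λ c → trans (*-assoc _ _ _) (*-congˡ (sym (qz-+ _ _))))))) ⟩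
   _ ∎
   where I = Π cs (λ c → qz (Z.- β c))

 -- Centred chains: divisibility by q and weights

 open import Data.List.Relation.Binary.Permutation.Propositional as Perm using ()
 open import Data.List.Relation.Binary.Permutation.Propositional.Properties using () renaming (++⁺ to ↭-++)

 -- Chains have 2b terms and start b steps below p, so r inverted positions amount to the threshold
 -- ρ = r - b.
 origin : ℕ → ℤ → ℤ
 origin b p = p Z.- + b Z.* M

 classes : ℕ → List ℤ → List ℕ → List Class
 classes b (p ∷ ps) (r ∷ rs) = (p , + r Z.- + b) ∷ classes b ps rs
 classes b _ _ = []

 sh-origin : ∀ b p r → sh (origin b p) r ≡ pt (p , + r Z.- + b)
 sh-origin b p r = E.trans (sh≡ (origin b p) r) (lem p (+ b) (+ r) M)
  where
  lem : ∀ p b r m → (p Z.- b Z.* m) Z.+ r Z.* m ≡ p Z.+ (r Z.- b) Z.* m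
  lem = ZS.solve-∀

 sh-suc : ∀ z r → sh z (suc r) ≡ sh z r Z.+ M
 sh-suc z r = E.trans (sh≡ z (suc r)) (E.trans (lem z (+ r) M) (E.cong (Z._+ M) (E.sym (sh≡ z r))))
  where
  lem : ∀ z r m → z Z.+ (+ 1 Z.+ r) Z.* m ≡ z Z.+ r Z.* m Z.+ m
  lem = ZS.solve-∀

 isNeg : ℤ → ℕ
 isNeg (+ _) = 0
 isNeg -[1+ _ ] = 1

 -- A lower bound for the order in q of a term, since f is divisible by q at every negative
 -- position.
 cnt : List ℤ → ℕ
 cnt [] = 0
 cnt (y ∷ Y) = isNeg y N.+ cnt Y

 cnt-++ : ∀ A B → cnt (A ++ B) ≡ cnt A N.+ cnt B
 cnt-++ [] B = E.refl
 cnt-++ (y ∷ A) B = E.trans (E.cong (isNeg y N.+_) (cnt-++ A B)) (E.sym (NP.+-assoc (isNeg y) (cnt A) (cnt B)))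

 isNeg-< : ∀ {y} → y Z.< + 0 → isNeg y ≡ 1
 isNeg-< Z.-<+ = E.refl
 isNeg-< (Z.+<+ ())

 module Counting (b : ℕ) (p : ℤ) (p≥0 : + 0 Z.≤ p) (p<M : p Z.< M) (p+e≥1 : + 1 Z.≤ p Z.+ e) where
  private
   z = origin b p
   scale : ∀ {k} → + 0 Z.≤ k → + 0 Z.≤ k Z.* M
   scale {+ k} _ = E.subst (+ 0 Z.≤_) (ZP.pos-* k M₀) (Z.+≤+ N.z≤n)

   barneg : ∀ r → b N.≤ r → isNeg (bar (sh z r)) ≡ 1
   barneg r b≤r = isNeg-< (E.subst (Z._< + 0) (E.sym (E.trans (E.cong bar (sh-origin b p r)) (lem e p (+ r Z.- + b) M)))
    (ZP.neg-mono-< {+ 0} {(p Z.+ e) Z.+ (+ r Z.- + b) Z.* M} (ZP.<-≤-trans (Z.+<+ (N.s≤s N.z≤n)) (ZP.≤-trans p+e≥1 (ZP.≤-trans (ZP.≤-reflexive (E.sym (ZP.+-identityʳ _))) (ZP.+-monoʳ-≤ (p Z.+ e) (scale (ZP.i≤j⇒0≤j-i (Z.+≤+ b≤r)))))))))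
    where
    lem : ∀ e p k m → Z.- e Z.- (p Z.+ k Z.* m) ≡ Z.- ((p Z.+ e) Z.+ k Z.* m)
    lem = ZS.solve-∀

   posneg : ∀ r → suc r N.≤ b → isNeg (sh z r) ≡ 1
   posneg r r<b = isNeg-< (E.subst (Z._< + 0) (E.sym (E.trans (sh-origin b p r) (lem p (+ r) (+ b) M)))
    (ZP.<-≤-trans (ZP.+-monoˡ-< (Z.- M Z.- (+ b Z.- (+ 1 Z.+ + r)) Z.* M) p<M)
     (ZP.≤-trans (ZP.≤-reflexive (lem₂ M (+ b Z.- (+ 1 Z.+ + r)))) (ZP.neg-mono-≤ (scale {+ b Z.- + suc r} (ZP.i≤j⇒0≤j-i (Z.+≤+ r<b)))))))
    where
    lem : ∀ p r b m → p Z.+ (r Z.- b) Z.* m ≡ p Z.+ (Z.- m Z.- (b Z.- (+ 1 Z.+ r)) Z.* m)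
    lem = ZS.solve-∀
    lem₂ : ∀ m k → m Z.+ (Z.- m Z.- k Z.* m) ≡ Z.- (k Z.* m)
    lem₂ = ZS.solve-∀

   cnt-bar : ∀ r → r ∸ b N.≤ cnt (map bar (prog z r))
   cnt-bar zero = E.subst (N._≤ 0) (E.sym (NP.0∸n≡0 b)) N.z≤n
   cnt-bar (suc r) = E.subst (suc r ∸ b N.≤_) (E.sym eq) go
    where
    eq : cnt (map bar (prog z (suc r))) ≡ cnt (map bar (prog z r)) N.+ isNeg (bar (sh z r))
    eq = E.trans (E.cong (λ Y → cnt (map bar Y)) (prog-∷ʳ z r)) (E.trans (E.cong cnt (map-++ bar (prog z r) _)) (E.trans (cnt-++ (map bar (prog z r)) _) (E.cong (cnt (map bar (prog z r)) N.+_) (NP.+-identityʳ _))))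
    go : suc r ∸ b N.≤ cnt (map bar (prog z r)) N.+ isNeg (bar (sh z r))
    go with b N.≤? r
    ... | yes q = E.subst₂ N._≤_ (E.sym (E.trans (NP.+-∸-assoc 1 q) (NP.+-comm 1 (r ∸ b)))) (E.cong (cnt (map bar (prog z r)) N.+_) (E.sym (barneg r q))) (NP.+-monoˡ-≤ 1 (cnt-bar r))
    ... | no ¬q = NP.≤-trans (NP.≤-reflexive (NP.m≤n⇒m∸n≡0 (NP.≰⇒> ¬q))) N.z≤n

   cnt-pos : ∀ k r j → b ≡ r N.+ k → k N.≤ j → k N.≤ cnt (prog (sh z r) j)
   cnt-pos zero r j eq _ = N.z≤n
   cnt-pos (suc k) r (suc j) eq (N.s≤s q) = NP.+-mono-≤ (NP.≤-reflexive (E.sym (posneg r (E.subst (suc r N.≤_) (E.trans (E.sym (NP.+-suc r k)) (E.sym eq)) (N.s≤s (NP.m≤m+n r k))))))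
    (E.subst (λ y → k N.≤ cnt (prog y j)) (sh-suc z r) (cnt-pos k (suc r) j (E.trans eq (NP.+-suc r k)) q))

  -- Beyond the centre (r ≥ b) it is the reflected positions from p upwards that are negative;
  -- before it (r < b), the positions below p that were left uninverted.
  cnt-part : ∀ r → r N.≤ b N.+ b → N.∣ r - b ∣ N.≤ cnt (part z (b N.+ b) r)
  cnt-part r r≤ with b N.≤? r
  ... | yes q = E.subst₂ N._≤_ (E.sym (E.trans (NP.∣-∣-comm r b) (NP.m≤n⇒∣m-n∣≡n∸m q))) (E.sym (cnt-++ (map bar (prog z r)) _)) (NP.≤-trans (cnt-bar r) (NP.m≤m+n _ _))
  ... | no ¬q = E.subst₂ N._≤_ (E.sym (NP.m≤n⇒∣m-n∣≡n∸m r≤b)) (E.sym (cnt-++ (map bar (prog z r)) _))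
    (NP.≤-trans (cnt-pos (b ∸ r) r (b N.+ b ∸ r) (E.sym (NP.m+[n∸m]≡n r≤b)) (NP.∸-monoˡ-≤ r (NP.m≤m+n b b))) (NP.m≤n+m _ _))
   where r≤b = NP.<⇒≤ (NP.≰⇒> ¬q)

 module Weights (γ : ℤ → ℤ) (m : ℤ) (γ-bar : ∀ y → γ (bar y) ≡ γ y Z.+ m Z.* (y Z.+ y Z.+ e)) (γ-pos : ∀ k → γ (+ k) ≡ + 0) where
  Γ : List ℤ → ℤ
  Γ [] = + 0
  Γ (y ∷ Y) = γ y Z.+ Γ Y

  Γ-++ : ∀ A B → Γ (A ++ B) ≡ Γ A Z.+ Γ B
  Γ-++ [] B = E.sym (ZP.+-identityˡ _)
  Γ-++ (y ∷ A) B = E.trans (E.cong (λ x → γ y Z.+ x) (Γ-++ A B)) (E.sym (ZP.+-assoc (γ y) (Γ A) (Γ B)))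

  Π-γ : ∀ Y → Π Y (λ y → qz (γ y)) ≈ qz (Γ Y)
  Π-γ [] = sym qz-0
  Π-γ (y ∷ Y) = trans (*-congˡ (Π-γ Y)) (sym (qz-+ _ _))

  module _ (b : ℕ) (p : ℕ) (p<M : + p Z.< M) (bar≥0 : ∀ k → k N.< b → γ (bar (sh (origin b (+ p)) k)) ≡ + 0) where
   private
    z = origin b (+ p)
    l = b N.+ b
    S : ℕ → ℤ
    S r = Γ (part z l r)

    step : ∀ r → r N.< l → S (suc r) ≡ S r Z.+ m Z.* (sh z r Z.+ sh z r Z.+ e)
    step r r<l = E.trans (Γ-++ (map bar (prog z (suc r))) _) (E.trans (E.cong₂ Z._+_ first (E.cong (λ y → Γ (prog y (l ∸ suc r))) (sh-suc z r)))
      (E.trans (lem (Γ (map bar (prog z r))) (γ (sh z r)) (m Z.* (sh z r Z.+ sh z r Z.+ e)) (Γ (prog (sh z r Z.+ M) (l ∸ suc r))))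
      (E.cong (Z._+ m Z.* (sh z r Z.+ sh z r Z.+ e)) (E.trans (E.cong (λ k → Γ (map bar (prog z r)) Z.+ Γ (prog (sh z r) k)) (E.sym (NP.+-∸-assoc 1 r<l))) (E.sym (Γ-++ (map bar (prog z r)) _))))))
     where
     first : Γ (map bar (prog z (suc r))) ≡ Γ (map bar (prog z r)) Z.+ (γ (sh z r) Z.+ m Z.* (sh z r Z.+ sh z r Z.+ e))
     first = E.trans (E.cong (λ Y → Γ (map bar Y)) (prog-∷ʳ z r)) (E.trans (E.cong Γ (map-++ bar (prog z r) _)) (E.trans (Γ-++ (map bar (prog z r)) _)
      (E.cong (λ x → Γ (map bar (prog z r)) Z.+ x) (E.trans (ZP.+-identityʳ _) (γ-bar (sh z r))))))
     lem : ∀ g x y h → (g Z.+ (x Z.+ y)) Z.+ h ≡ (g Z.+ (x Z.+ h)) Z.+ y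
     lem = ZS.solve-∀

    B : ℕ → ℤ
    B r = m Z.* β (+ p , + r Z.- + b)

    B-step : ∀ r → B (suc r) ≡ B r Z.+ m Z.* (sh z r Z.+ sh z r Z.+ e)
    B-step r = E.trans (lem m e (+ p) (+ r) (+ b) M) (E.cong (λ v → B r Z.+ m Z.* (v Z.+ v Z.+ e)) (E.sym (sh-origin b (+ p) r)))
     where
     lem : ∀ m e p r b M → m Z.* ((p Z.+ p Z.+ e) Z.* ((+ 1 Z.+ r) Z.- b) Z.+ M Z.* (((+ 1 Z.+ r) Z.- b) Z.* (((+ 1 Z.+ r) Z.- b) Z.- + 1)))
        ≡ m Z.* ((p Z.+ p Z.+ e) Z.* (r Z.- b) Z.+ M Z.* ((r Z.- b) Z.* ((r Z.- b) Z.- + 1))) Z.+ m Z.* ((p Z.+ (r Z.- b) Z.* M) Z.+ (p Z.+ (r Z.- b) Z.* M) Z.+ e)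
     lem = ZS.solve-∀

    diff : ∀ r → r N.≤ l → S r ≡ B r Z.+ (S 0 Z.- B 0)
    diff zero _ = lem (S 0) (B 0)
     where
     lem : ∀ s b → s ≡ b Z.+ (s Z.- b)
     lem = ZS.solve-∀
    diff (suc r) q = E.trans (step r q) (E.trans (E.cong (Z._+ d) (diff r (NP.<⇒≤ q))) (E.trans (lem (B r) (S 0 Z.- B 0) d) (E.cong (Z._+ (S 0 Z.- B 0)) (E.sym (B-step r)))))
     where
     d = m Z.* (sh z r Z.+ sh z r Z.+ e)
     lem : ∀ b s d → b Z.+ s Z.+ d ≡ b Z.+ d Z.+ s
     lem = ZS.solve-∀

    Γ-bars : ∀ k → k N.≤ b → Γ (map bar (prog z k)) ≡ + 0
    Γ-bars zero _ = E.refl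
    Γ-bars (suc k) q = E.trans (E.cong (λ Y → Γ (map bar Y)) (prog-∷ʳ z k)) (E.trans (E.cong Γ (map-++ bar (prog z k) _)) (E.trans (Γ-++ (map bar (prog z k)) _)
     (E.cong₂ Z._+_ (Γ-bars k (NP.<⇒≤ q)) (E.trans (ZP.+-identityʳ _) (bar≥0 k q)))))

    Γ-prog : ∀ k y → Γ (prog (+ y) k) ≡ + 0
    Γ-prog zero y = E.refl
    Γ-prog (suc k) y = E.trans (E.cong₂ Z._+_ (γ-pos y) (Γ-prog k (y N.+ M₀))) E.refl

    mid : S b ≡ + 0
    mid = E.trans (Γ-++ (map bar (prog z b)) _) (E.cong₂ Z._+_ (Γ-bars b NP.≤-refl) (E.trans (E.cong (λ y → Γ (prog y (l ∸ b))) (E.trans (sh-origin b (+ p) b) (lem (+ p) (+ b) M))) (Γ-prog (l ∸ b) p)))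
     where
     lem : ∀ p b m → p Z.+ (b Z.- b) Z.* m ≡ p
     lem = ZS.solve-∀

    Bb : B b ≡ + 0
    Bb = lem m e (+ p) (+ b) M
     where
     lem : ∀ m e p b M → m Z.* ((p Z.+ p Z.+ e) Z.* (b Z.- b) Z.+ M Z.* ((b Z.- b) Z.* ((b Z.- b) Z.- + 1))) ≡ + 0
     lem = ZS.solve-∀

   -- As functions of r both sides have the same increments, and both are zero at the centre r = b.
   Γ-part : ∀ r → r N.≤ l → Γ (part z l r) ≡ m Z.* β (+ p , + r Z.- + b)
   Γ-part r q = E.trans (diff r q) (E.trans (E.cong (λ x → B r Z.+ x) zeroS) (ZP.+-identityʳ _))
    where
    zeroS : S 0 Z.- B 0 ≡ + 0
    zeroS = E.trans (lem (B b) (S 0 Z.- B 0)) (E.trans (E.cong (Z._- B b) (E.trans (E.sym (diff b (NP.m≤m+n b b))) mid)) (E.trans (E.cong (λ x → + 0 Z.- x) Bb) E.refl))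
     where
     lem : ∀ b s → s ≡ (b Z.+ s) Z.- b
     lem = ZS.solve-∀

 -- The sign sum as a truncated lattice sum

 open import Data.Nat using (_⊔_)
 open import Data.List.Relation.Binary.Permutation.Propositional as Perm using (_↭_)

 0≤⇒≤ : ∀ {x y d} → y ≡ x Z.+ d → + 0 Z.≤ d → x Z.≤ y
 0≤⇒≤ {x} {y} {d} eq p = E.subst (x Z.≤_) (E.sym eq) (E.subst (Z._≤ x Z.+ d) (ZP.+-identityʳ x) (ZP.+-monoʳ-≤ x p))

 M₀≥1 : 1 N.≤ M₀
 M₀≥1 = NP.n≢0⇒n>0 M≢0

 NZ-shift : ∀ {s s'} k → s' ≡ s Z.+ k Z.* M → NZℤ M s → ∀ i → sh s' i ≢ + 0
 NZ-shift {s} {s'} k eq nz i z = nz (k Z.+ + i) (E.trans (lem s k (+ i) M) (E.trans (E.cong (λ x → x Z.+ + i Z.* M) (E.sym eq)) (E.trans (E.sym (sh≡ s' i)) z)))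
  where
  lem : ∀ s k i m → s Z.+ (k Z.+ i) Z.* m ≡ (s Z.+ k Z.* m) Z.+ i Z.* m
  lem = ZS.solve-∀

 NZ-reflect : ∀ {s s'} k → s' ≡ Z.- s Z.+ k Z.* M → NZℤ M s → ∀ i → sh s' i ≢ + 0
 NZ-reflect {s} {s'} k eq nz i z = nz (Z.- (k Z.+ + i)) (E.trans (lem s k (+ i) M) (E.cong Z.-_ (E.trans (E.cong (λ x → x Z.+ + i Z.* M) (E.sym eq)) (E.trans (E.sym (sh≡ s' i)) z))))
  where
  lem : ∀ s k i m → s Z.+ (Z.- (k Z.+ i)) Z.* m ≡ Z.- ((Z.- s Z.+ k Z.* m) Z.+ i Z.* m)
  lem = ZS.solve-∀

 module _ {D D' : ℕ} where
  0-*-0 : ∀ {x y} → x ≈[ D ] 0# → y ≈[ D' ] 0# → x * y ≈[ D N.+ D' ] 0#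
  0-*-0 {x} {y} p q = Int-resp
   (trans (solve 4 (λ u v x y → (u :* (x :- :0)) :* (v :* (y :- :0)) := (u :* v) :* (x :* y :- :0)) tt _ _ x y)
    (*-congʳ (trans (sym (qz-+ _ _)) (qz-cong (E.sym (ZP.neg-distrib-+ (+ D) (+ D')))))))
   (Int-* p q)

 ≈[0] : ∀ {x} → Int x → x ≈[ 0 ] 0#
 ≈[0] {x} i = Int-resp (trans (sym (*-identityˡ _)) (*-cong (sym qz-0) (solve 1 (λ x → x := x :- :0) tt x))) i

 module MainSum (f A A₁ : ℤ → Carrier) (e≥0 : + 0 Z.≤ e) (e≤1 : e Z.≤ + 1)
   (Int-f : ∀ v → Int (f v)) (Int-A : ∀ s → Int (A s)) (Int-A₁ : ∀ s → Int (A₁ s))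
   (Ok : ℤ → Set)
   (A-step : ∀ s → s ≢ + 0 → A s ≈ a s * A (s Z.+ M))
   (A-big : ∀ {D} s → + D Z.≤ s → A s ≈[ D ] 1#)
   (A₁-step : ∀ v → Ok v → A₁ v ≈ f v * a (sm v (v Z.+ M)) * A₁ (v Z.+ M))
   (A₁-big : ∀ {D} s → + D Z.≤ s → A₁ s ≈[ D ] 1#)
   (f-neg : ∀ k → f -[1+ k ] ≈[ 1 ] 0#) where
  open Progressions f
  open Limit A A₁ e≥0 Int-f Int-A Int-A₁ Ok A-step A-big A₁-step A₁-big

  record Good (p : ℕ) : Set where
   field
    p<M : + p Z.< M
    p+e≥1 : + 1 Z.≤ + p Z.+ e
    nz : NZℤ M (+ p Z.+ + p Z.+ e)
    okp : ∀ ρ → Ok (pt (+ p , ρ))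
    okp′ : ∀ ρ → Ok (pt′ (+ p , ρ))
  open Good

  Good₂ : ℕ → ℕ → Set
  Good₂ p p' = NZℤ M (+ p Z.+ + p' Z.+ e) × NZℤ M (+ p' Z.- + p)

  data GoodList : List ℕ → Set where
   [] : GoodList []
   _∷_ : ∀ {p ps} → Good p × All (Good₂ p) ps → GoodList ps → GoodList (p ∷ ps)

  F-count : ∀ Y → F Y ≈[ cnt Y ] 0#
  F-count [] = ≈[0] Int-1
  F-count (y ∷ Y) = 0-*-0 (0-*ʳ (Int-Π Y (λ _ → Int-w _)) (f0 y)) (F-count Y)
   where
   f0 : ∀ y → f y ≈[ isNeg y ] 0#
   f0 (+ k) = ≈[0] (Int-f _)
   f0 -[1+ k ] = f-neg k

  cl : ℕ → List ℕ → List ℕ → List Class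
  cl b ps rs = classes b (map +_ ps) rs

  cl-firsts : ∀ b ps rs → length ps ≡ length rs → map proj₁ (cl b ps rs) ≡ map +_ ps
  cl-firsts b [] [] _ = E.refl
  cl-firsts b (p ∷ ps) (r ∷ rs) e = E.cong (+ p ∷_) (cl-firsts b ps rs (NP.suc-injective e))

  length-cl : ∀ b ps rs → length ps ≡ length rs → length (cl b ps rs) ≡ length ps
  length-cl b [] [] _ = E.refl
  length-cl b (p ∷ ps) (r ∷ rs) e = E.cong suc (length-cl b ps rs (NP.suc-injective e))

  zs : ℕ → List ℕ → List ℤ
  zs b ps = map (λ p → origin b (+ p)) ps

  private
   prs : ℕ → List ℕ → List ℕ → List (ℤ × ℕ)
   prs b (p ∷ ps) (r ∷ rs) = (pt′ (+ p , + r Z.- + b) , r) ∷ (pt (+ p , + r Z.- + b) , b N.+ b ∸ r) ∷ prs b ps rs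
   prs b _ _ = []

   firsts : ∀ b ps rs → map proj₁ (prs b ps rs) ≡ vl (cl b ps rs)
   firsts b [] rs = E.refl
   firsts b (p ∷ ps) [] = E.refl
   firsts b (p ∷ ps) (r ∷ rs) = E.cong (λ x → pt′ (+ p , + r Z.- + b) ∷ pt (+ p , + r Z.- + b) ∷ x) (firsts b ps rs)

   nonneg-* : ∀ k → + 0 Z.≤ + k Z.* M
   nonneg-* k = E.subst (+ 0 Z.≤_) (ZP.pos-* k M₀) (Z.+≤+ N.z≤n)

   M-e-p : ∀ {p} → Good p → + 0 Z.≤ M Z.- e Z.- + p
   M-e-p {p} g = ZP.≤-trans (ZP.i≤j⇒0≤j-i (ZP.i<j⇒suc[i]≤j (p<M g))) (0≤⇒≤ (lem M e (+ p)) (ZP.i≤j⇒0≤j-i e≤1))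
    where
    lem : ∀ m e p → m Z.- e Z.- p ≡ (m Z.- (+ 1 Z.+ p)) Z.+ (+ 1 Z.- e)
    lem = ZS.solve-∀

  module _ {D : ℕ} (D≥1 : 1 N.≤ D) (b R : ℕ) (b-big : R N.+ D N.≤ b) where
   private
    -- Thresholds within R steps of the centre start their progressions no lower than -R M₀, and b ≥
    -- R + D carries the chains to D + R M₀.
    Lo = R N.* M₀
    l = b N.+ b

    parts↭ : ∀ ps rs → length ps ≡ length rs → parts l (zs b ps) rs ↭ cat D≥1 Lo (prs b ps rs)
    parts↭ [] [] _ = Perm.refl
    parts↭ (p ∷ ps) (r ∷ rs) eq = Perm.trans (↭-++ (↭-++ (bar-prog (origin b (+ p)) r) (Perm.refl {xs = prog (sh (origin b (+ p)) r) (l ∸ r)})) (parts↭ ps rs (NP.suc-injective eq)))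
     (Perm.↭-reflexive (E.trans (++-assoc (prog (bar (sh (origin b (+ p)) r) Z.+ M) r) _ _)
      (E.cong (λ v → prog (bar v Z.+ M) r ++ (prog v (l ∸ r) ++ cat D≥1 Lo (prs b ps rs))) (sh-origin b (+ p) r))))

    Close : ℕ → Set
    Close r = (b N.≤ r N.+ R) × (r N.≤ R N.+ b) × (r N.≤ l)

    ∸→- : ∀ {m n} → n N.≤ m → + m Z.- + n ≡ + (m ∸ n)
    ∸→- {m} {n} p = E.trans (ZP.m-n≡m⊖n m n) (ZP.⊖-≥ p)

    topD : ∀ x → + 0 Z.≤ x → + (D N.+ Lo) Z.≤ x Z.+ + b Z.* M
    topD x x≥0 = ZP.≤-trans (Z.+≤+ (NP.≤-trans (NP.+-monoˡ-≤ Lo (E.subst (N._≤ D N.* M₀) (NP.*-identityʳ D) (NP.*-monoʳ-≤ D M₀≥1)))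
      (E.subst (N._≤ b N.* M₀) (E.trans (NP.*-distribʳ-+ M₀ R D) (NP.+-comm (R N.* M₀) (D N.* M₀))) (NP.*-monoˡ-≤ M₀ b-big))))
     (0≤⇒≤ (E.trans (ZP.+-comm x (+ b Z.* M)) (E.cong (Z._+ x) (E.sym (ZP.pos-* b M₀)))) x≥0)

    fine : ∀ p r → Good p → Close r → Fine D≥1 Lo (pt (+ p , + r Z.- + b) , l ∸ r)
    fine p r g (c₁ , c₂ , c₃) = record
     { ok = λ i → E.subst Ok (E.sym (E.trans (sh≡ _ i) (e₁ (+ p) ρ (+ i) M))) (okp g (ρ Z.+ + i))
     ; nz₁ = λ i → NZ-shift {+ p Z.+ + p Z.+ e} (ρ Z.+ ρ Z.+ + i Z.+ + i Z.+ + 1) (E.trans (E.cong₂ sm (sh≡ (pt (+ p , ρ)) i) (sh≡ (pt (+ p , ρ)) (suc i))) (e₂ (+ p) ρ (+ i) M e)) (nz g)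
     ; low = 0≤⇒≤ {d = + p Z.+ + (r N.+ R ∸ b) Z.* M} (E.trans (e₃ (+ p) (+ r) (+ b) (+ R) M) (E.cong₂ Z._+_ (E.cong Z.-_ (E.sym (ZP.pos-* R M₀))) (E.cong (λ x → + p Z.+ x Z.* M) (∸→- {r N.+ R} {b} c₁))))
           (ZP.≤-trans (nonneg-* (r N.+ R ∸ b)) (0≤⇒≤ {d = + p} (ZP.+-comm (+ p) (+ (r N.+ R ∸ b) Z.* M)) (Z.+≤+ N.z≤n)))
     ; high = E.subst (+ (D N.+ Lo) Z.≤_) (E.sym (E.trans (sh≡ _ (l ∸ r)) (E.trans (E.cong (λ x → pt (+ p , ρ) Z.+ x Z.* M) (E.sym (∸→- c₃))) (e₄ (+ p) (+ r) (+ b) M)))) (topD (+ p) (Z.+≤+ N.z≤n)) }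
     where
     ρ = + r Z.- + b
     e₁ : ∀ p ρ i m → (p Z.+ ρ Z.* m) Z.+ i Z.* m ≡ p Z.+ (ρ Z.+ i) Z.* m
     e₁ = ZS.solve-∀
     e₂ : ∀ p ρ i m e → (p Z.+ ρ Z.* m Z.+ i Z.* m) Z.+ (p Z.+ ρ Z.* m Z.+ (+ 1 Z.+ i) Z.* m) Z.+ e ≡ (p Z.+ p Z.+ e) Z.+ (ρ Z.+ ρ Z.+ i Z.+ i Z.+ + 1) Z.* m
     e₂ = ZS.solve-∀
     e₃ : ∀ p r b R m → p Z.+ (r Z.- b) Z.* m ≡ Z.- (R Z.* m) Z.+ (p Z.+ ((r Z.+ R) Z.- b) Z.* m)
     e₃ = ZS.solve-∀
     e₄ : ∀ p r b m → (p Z.+ (r Z.- b) Z.* m) Z.+ ((b Z.+ b) Z.- r) Z.* m ≡ p Z.+ b Z.* m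
     e₄ = ZS.solve-∀

    fine′ : ∀ p r → Good p → Close r → Fine D≥1 Lo (pt′ (+ p , + r Z.- + b) , r)
    fine′ p r g (c₁ , c₂ , c₃) = record
     { ok = λ i → E.subst Ok (E.sym (E.trans (sh≡ _ i) (e₁ e (+ p) ρ (+ i) M))) (okp′ g (ρ Z.- + i))
     ; nz₁ = λ i → NZ-reflect {+ p Z.+ + p Z.+ e} (+ 3 Z.- ρ Z.- ρ Z.+ + i Z.+ + i) (E.trans (E.cong₂ sm (sh≡ (pt′ (+ p , ρ)) i) (sh≡ (pt′ (+ p , ρ)) (suc i))) (e₂ (+ p) ρ (+ i) M e)) (nz g)
     ; low = 0≤⇒≤ {d = (M Z.- e Z.- + p) Z.+ + (R N.+ b ∸ r) Z.* M} (E.trans (e₃ (+ p) (+ r) (+ b) (+ R) M e) (E.cong₂ Z._+_ (E.cong Z.-_ (E.sym (ZP.pos-* R M₀))) (E.cong (λ x → (M Z.- e Z.- + p) Z.+ x Z.* M) (∸→- {R N.+ b} {r} c₂))))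
           (ZP.≤-trans (M-e-p g) (0≤⇒≤ E.refl (nonneg-* (R N.+ b ∸ r))))
     ; high = E.subst (+ (D N.+ Lo) Z.≤_) (E.sym (E.trans (sh≡ _ r) (e₄ (+ p) (+ r) (+ b) M e))) (topD (M Z.- e Z.- + p) (M-e-p g)) }
     where
     ρ = + r Z.- + b
     e₁ : ∀ e p ρ i m → (Z.- e Z.- (p Z.+ ρ Z.* m) Z.+ m) Z.+ i Z.* m ≡ Z.- e Z.- (p Z.+ (ρ Z.- i) Z.* m) Z.+ m
     e₁ = ZS.solve-∀
     e₂ : ∀ p ρ i m e → (Z.- e Z.- (p Z.+ ρ Z.* m) Z.+ m Z.+ i Z.* m) Z.+ (Z.- e Z.- (p Z.+ ρ Z.* m) Z.+ m Z.+ (+ 1 Z.+ i) Z.* m) Z.+ e ≡ Z.- (p Z.+ p Z.+ e) Z.+ (+ 3 Z.- ρ Z.- ρ Z.+ i Z.+ i) Z.* m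
     e₂ = ZS.solve-∀
     e₃ : ∀ p r b R m e → Z.- e Z.- (p Z.+ (r Z.- b) Z.* m) Z.+ m ≡ Z.- (R Z.* m) Z.+ ((m Z.- e Z.- p) Z.+ ((R Z.+ b) Z.- r) Z.* m)
     e₃ = ZS.solve-∀
     e₄ : ∀ p r b m e → (Z.- e Z.- (p Z.+ (r Z.- b) Z.* m) Z.+ m) Z.+ r Z.* m ≡ (m Z.- e Z.- p) Z.+ b Z.* m
     e₄ = ZS.solve-∀

    dual : ∀ c → NZ (sm (pt′ c) (pt c))
    dual c i z = absurd (E.trans (E.sym (E.trans (sh≡ _ i) (lem e (pt c) (+ i) M))) z)
     where
     lem : ∀ e x i m → ((Z.- e Z.- x Z.+ m) Z.+ x Z.+ e) Z.+ i Z.* m ≡ (+ 1 Z.+ i) Z.* m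
     lem = ZS.solve-∀
     absurd : + suc i Z.* M ≢ + 0
     absurd z with NP.m*n≡0⇒m≡0∨n≡0 (suc i) (ZP.+-injective (E.trans (ZP.pos-* (suc i) M₀) z))
     ... | inj₂ x = M≢0 x

    crossings : ∀ p r ps rs → All (Good₂ p) ps →
     All (λ q → NZ (sm (pt′ (+ p , + r Z.- + b)) (proj₁ q))) (prs b ps rs) × All (λ q → NZ (sm (pt (+ p , + r Z.- + b)) (proj₁ q))) (prs b ps rs)
    crossings p r [] rs _ = [] , []
    crossings p r (p' ∷ ps) [] _ = [] , []
    crossings p r (p' ∷ ps) (r' ∷ rs) ((n₁ , n₂) ∷ gs) with crossings p r ps rs gs
    ... | us , vs =
     (NZ-reflect {+ p Z.+ + p' Z.+ e} (+ 2 Z.- ρ Z.- ρ') (e₁ (+ p) (+ p') ρ ρ' M e) n₁ ∷ NZ-shift {+ p' Z.- + p} (+ 1 Z.- ρ Z.+ ρ') (e₂ (+ p) (+ p') ρ ρ' M e) n₂ ∷ us) ,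
     (NZ-reflect {+ p' Z.- + p} (ρ Z.- ρ' Z.+ + 1) (e₃ (+ p) (+ p') ρ ρ' M e) n₂ ∷ NZ-shift {+ p Z.+ + p' Z.+ e} (ρ Z.+ ρ') (e₄ (+ p) (+ p') ρ ρ' M e) n₁ ∷ vs)
     where
     ρ = + r Z.- + b
     ρ' = + r' Z.- + b
     e₁ : ∀ p p' ρ ρ' m e → (Z.- e Z.- (p Z.+ ρ Z.* m) Z.+ m) Z.+ (Z.- e Z.- (p' Z.+ ρ' Z.* m) Z.+ m) Z.+ e ≡ Z.- (p Z.+ p' Z.+ e) Z.+ (+ 2 Z.- ρ Z.- ρ') Z.* m
     e₁ = ZS.solve-∀
     e₂ : ∀ p p' ρ ρ' m e → (Z.- e Z.- (p Z.+ ρ Z.* m) Z.+ m) Z.+ (p' Z.+ ρ' Z.* m) Z.+ e ≡ (p' Z.- p) Z.+ (+ 1 Z.- ρ Z.+ ρ') Z.* m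
     e₂ = ZS.solve-∀
     e₃ : ∀ p p' ρ ρ' m e → (p Z.+ ρ Z.* m) Z.+ (Z.- e Z.- (p' Z.+ ρ' Z.* m) Z.+ m) Z.+ e ≡ Z.- (p' Z.- p) Z.+ (ρ Z.- ρ' Z.+ + 1) Z.* m
     e₃ = ZS.solve-∀
     e₄ : ∀ p p' ρ ρ' m e → (p Z.+ ρ Z.* m) Z.+ (p' Z.+ ρ' Z.* m) Z.+ e ≡ (p Z.+ p' Z.+ e) Z.+ (ρ Z.+ ρ') Z.* m
     e₄ = ZS.solve-∀

    allFine : ∀ ps rs → GoodList ps → All Close rs → AllFine D≥1 Lo (prs b ps rs)
    allFine [] rs _ _ = []
    allFine (p ∷ ps) [] _ _ = []
    allFine (p ∷ ps) (r ∷ rs) ((g , gs) ∷ Gs) (c ∷ cs) with crossings p r ps rs gs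
    ... | us , vs = (fine′ p r g c , dual (+ p , + r Z.- + b) ∷ us) ∷ (fine p r g c , vs) ∷ allFine ps rs Gs cs

   F-parts : ∀ ps rs → length ps ≡ length rs → GoodList ps → All (λ r → (b N.≤ r N.+ R) × (r N.≤ R N.+ b) × (r N.≤ b N.+ b)) rs →
        F (parts (b N.+ b) (zs b ps) rs) ≈[ D ] E₁ A A₁ (vl (cl b ps rs))
   F-parts ps rs eq G C = ≈[]-trans (≈⇒≈[] (F-↭ (parts↭ ps rs eq)))
    (≈[]-trans (F-cat D≥1 Lo (prs b ps rs) (allFine ps rs G C)) (≈⇒≈[] (reflexive (E.cong (E₁ A A₁) (firsts b ps rs)))))

  dev : ℕ → List ℕ → ℕ
  dev b [] = 0
  dev b (r ∷ rs) = N.∣ r - b ∣ ⊔ dev b rs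

  dev≤cnt : ∀ b ps rs → length ps ≡ length rs → GoodList ps → All (N._≤ b N.+ b) rs → dev b rs N.≤ cnt (parts (b N.+ b) (zs b ps) rs)
  dev≤cnt b [] [] _ _ _ = N.z≤n
  dev≤cnt b (p ∷ ps) (r ∷ rs) eq ((g , _) ∷ G) (q ∷ qs) = E.subst (dev b (r ∷ rs) N.≤_) (E.sym (cnt-++ (part (origin b (+ p)) (b N.+ b) r) _))
   (NP.⊔-lub (NP.≤-trans (Counting.cnt-part b (+ p) (Z.+≤+ N.z≤n) (p<M g) (p+e≥1 g) r q) (NP.m≤m+n _ _)) (NP.≤-trans (dev≤cnt b ps rs (NP.suc-injective eq) G qs) (NP.m≤n+m _ _)))

  private
   close : ∀ b R rs → dev b rs N.≤ R → All (N._≤ b N.+ b) rs → All (λ r → (b N.≤ r N.+ R) × (r N.≤ R N.+ b) × (r N.≤ b N.+ b)) rs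
   close b R [] _ _ = []
   close b R (r ∷ rs) d (q ∷ qs) = (NP.≤-trans (NP.m≤n+∣n-m∣ b r) (NP.+-monoʳ-≤ r d₁) ,
     NP.≤-trans (NP.m≤n+∣m-n∣ r b) (E.subst (N._≤ R N.+ b) (NP.+-comm _ b) (NP.+-monoˡ-≤ b d₁)) , q) ∷ close b R rs (NP.≤-trans (NP.m≤n⊔m _ _) d) qs
    where
    d₁ : N.∣ r - b ∣ N.≤ R
    d₁ = NP.≤-trans (NP.m≤m⊔n _ _) d

   shift-dev : ∀ k b rs → dev (b N.+ k) (map (N._+ k) rs) ≡ dev b rs
   shift-dev k b [] = E.refl
   shift-dev k b (r ∷ rs) = E.cong₂ _⊔_ (E.trans (E.cong₂ N.∣_-_∣ (NP.+-comm r k) (NP.+-comm b k)) (NP.∣m+n-m+o∣≡∣n-o∣ k r b)) (shift-dev k b rs)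

   shift-cl : ∀ k b ps rs → cl (b N.+ k) ps (map (N._+ k) rs) ≡ cl b ps rs
   shift-cl k b [] rs = E.refl
   shift-cl k b (p ∷ ps) [] = E.refl
   shift-cl k b (p ∷ ps) (r ∷ rs) = E.cong₂ (λ x y → (+ p , x) ∷ y) (lem (+ r) (+ b) (+ k)) (shift-cl k b ps rs)
    where
    lem : ∀ r b k → (r Z.+ k) Z.- (b Z.+ k) ≡ r Z.- b
    lem = ZS.solve-∀

   length-map′ : ∀ k (rs : List ℕ) → length (map (N._+ k) rs) ≡ length rs
   length-map′ k [] = E.refl
   length-map′ k (_ ∷ rs) = E.cong suc (length-map′ k rs)

   dev≤b : ∀ b rs → All (N._≤ b N.+ b) rs → dev b rs N.≤ b
   dev≤b b [] _ = N.z≤n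
   dev≤b b (r ∷ rs) (q ∷ qs) = NP.⊔-lub (small r q) (dev≤b b rs qs)
    where
    small : ∀ r → r N.≤ b N.+ b → N.∣ r - b ∣ N.≤ b
    small r q with b N.≤? r
    ... | yes p = E.subst (N._≤ b) (E.sym (E.trans (NP.∣-∣-comm r b) (NP.m≤n⇒∣m-n∣≡n∸m p))) (NP.m≤n+o⇒m∸n≤o r b q)
    ... | no ¬p = E.subst (N._≤ b) (E.sym (NP.m≤n⇒∣m-n∣≡n∸m (NP.<⇒≤ (NP.≰⇒> ¬p)))) (NP.m∸n≤m b r)

   shifted≤ : ∀ k b rs → All (N._≤ b N.+ b) rs → All (N._≤ (b N.+ k) N.+ (b N.+ k)) (map (N._+ k) rs)
   shifted≤ k b [] _ = []
   shifted≤ k b (r ∷ rs) (q ∷ qs) = NP.≤-trans (NP.+-monoˡ-≤ k q) (E.subst₂ N._≤_ (E.sym (NP.+-assoc b b k)) (E.sym (NP.+-assoc b k (b N.+ k))) (NP.+-monoʳ-≤ b (NP.m≤n+m (b N.+ k) k))) ∷ shifted≤ k b rs qs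

  -- Thresholds far from the origin contribute nothing, on either side.
  F-parts-all : ∀ {D} → 1 N.≤ D → ∀ b → D N.+ D N.≤ b → ∀ ps rs → length ps ≡ length rs → GoodList ps → All (N._≤ b N.+ b) rs →
         F (parts (b N.+ b) (zs b ps) rs) ≈[ D ] E₁ A A₁ (vl (cl b ps rs))
  F-parts-all {D} D≥1 b big ps rs eq G q with dev b rs N.≤? D
  ... | yes d = F-parts D≥1 b D big ps rs eq G (close b D rs d q)
  -- `E₁` sees only the differences r - b. Re-centring the same thresholds in chains longer by D on
  -- each side brings `F-parts` within reach and shows that `E₁` vanishes too.
  ... | no ¬d = ≈[]-trans (vanish b rs eq q D≤dev) (≈[]-sym (≈[]-trans (≈⇒≈[] (reflexive (E.cong (λ x → E₁ A A₁ (vl x)) (E.sym (shift-cl D b ps rs)))))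
    (≈[]-trans (≈[]-sym (F-parts D≥1 (b N.+ D) b NP.≤-refl ps rs′ eq′ G (close (b N.+ D) b rs′ (E.subst (N._≤ b) (E.sym (shift-dev D b rs)) (dev≤b b rs q)) (shifted≤ D b rs q))))
     (vanish (b N.+ D) rs′ eq′ (shifted≤ D b rs q) (E.subst (D N.≤_) (E.sym (shift-dev D b rs)) D≤dev)))))
   where
   rs′ = map (N._+ D) rs
   eq′ = E.trans eq (E.sym (length-map′ D rs))
   D≤dev : D N.≤ dev b rs
   D≤dev = NP.<⇒≤ (NP.≰⇒> ¬d)
   vanish : ∀ b rs → length ps ≡ length rs → All (N._≤ b N.+ b) rs → D N.≤ dev b rs → F (parts (b N.+ b) (zs b ps) rs) ≈[ D ] 0#
   vanish b rs eq q d = ≈[]-weaken (NP.≤-trans d (dev≤cnt b ps rs eq G q)) (F-count (parts (b N.+ b) (zs b ps) rs))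

  module WeightedSum (γ : ℤ → ℤ) (m : ℤ) (γ≥0 : ∀ y → NonNeg (γ y)) (γ-bar : ∀ y → γ (bar y) ≡ γ y Z.+ m Z.* (y Z.+ y Z.+ e)) (γ-pos : ∀ k → γ (+ k) ≡ + 0)
   (γ-barneg : ∀ k → γ (bar -[1+ k ]) ≡ + 0) where
   open Weights γ m γ-bar γ-pos

   g : ℤ → Carrier
   g y = qz (γ y)

   wt : List Class → Carrier
   wt cs = Π cs (λ c → qz (m Z.* β c))

   private
    vanishing : Vanishing (λ Y → Π Y g * F Y)
    vanishing Pre u rest = trans (*-congˡ (F-adjacent Pre u rest)) (zeroʳ _)

    isNegative : ∀ {y} → isNeg y ≡ 1 → γ (bar y) ≡ + 0
    isNegative { -[1+ k ]} _ = γ-barneg k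

    negOrigin : ∀ b p k → + p Z.< M → k N.< b → γ (bar (sh (origin b (+ p)) k)) ≡ + 0
    negOrigin b p k p<M k<b = isNegative (isNeg-< (E.subst (Z._< + 0) (E.sym (E.trans (sh-origin b (+ p) k) (lem (+ p) (+ k) (+ b) M)))
     (ZP.<-≤-trans (ZP.+-monoˡ-< (Z.- M Z.- (+ b Z.- (+ 1 Z.+ + k)) Z.* M) p<M)
      (ZP.≤-trans (ZP.≤-reflexive (lem₂ M (+ b Z.- (+ 1 Z.+ + k)))) (ZP.neg-mono-≤ (sc (ZP.i≤j⇒0≤j-i (Z.+≤+ k<b))))))))
     where
     sc : + 0 Z.≤ + b Z.- + suc k → + 0 Z.≤ (+ b Z.- + suc k) Z.* M
     sc h with + b Z.- + suc k | h
     ... | + j | _ = nonneg-* j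
     lem : ∀ p r b m → p Z.+ (r Z.- b) Z.* m ≡ p Z.+ (Z.- m Z.- (b Z.- (+ 1 Z.+ r)) Z.* m)
     lem = ZS.solve-∀
     lem₂ : ∀ m k → m Z.+ (Z.- m Z.- k Z.* m) ≡ Z.- (k Z.* m)
     lem₂ = ZS.solve-∀

    wt-parts : ∀ b ps rs → length ps ≡ length rs → GoodList ps → All (N._≤ b N.+ b) rs → Π (parts (b N.+ b) (zs b ps) rs) g ≈ wt (cl b ps rs)
    wt-parts b [] [] _ _ _ = refl
    wt-parts b (p ∷ ps) (r ∷ rs) eq ((gd , _) ∷ G) (q ∷ qs) = trans (Π-++ (part (origin b (+ p)) (b N.+ b) r) _ g)
     (*-cong (trans (Π-γ (part (origin b (+ p)) (b N.+ b) r)) (qz-cong (Γ-part b p (p<M gd) (λ k → negOrigin b p k (p<M gd)) r q))) (wt-parts b ps rs (NP.suc-injective eq) G qs))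

   main-sum : ∀ {D} → 1 N.≤ D → ∀ b → D N.+ D N.≤ b → ∀ ps → GoodList ps →
    Sgn (progs (b N.+ b) (zs b ps)) (λ Y → Π Y g * F Y) ≈[ D ] ΣL (b N.+ b) (length ps) (λ rs → wt (cl b ps rs) * E₁ A A₁ (vl (cl b ps rs)))
   main-sum {D} D≥1 b big ps G = ≈[]-trans
    (≈⇒≈[] (trans (collapse-all (b N.+ b) (zs b ps) _ vanishing) (reflexive (E.cong (λ n → ΣL (b N.+ b) n (λ rs → Π (parts (b N.+ b) (zs b ps) rs) g * F (parts (b N.+ b) (zs b ps) rs))) (len ps)))))
    (ΣL-mod (b N.+ b) (length ps) (λ rs l q → ≈[]-trans (≈[]-*ˡ (Int-Π (parts (b N.+ b) (zs b ps) rs) (λ y → Int-qz⁺ (γ≥0 y))) (F-parts-all D≥1 b big ps rs (E.sym l) G q))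
     (≈⇒≈[] (*-congʳ (wt-parts b ps rs (E.sym l) G q)))))
    where
    len : ∀ ps → length (zs b ps) ≡ length ps
    len [] = E.refl
    len (_ ∷ ps) = E.cong suc (len ps)

-- Duality between the lattice sums of types C and B

module Duality (Q : QRing) (n m : ℕ) (n≥1 : 1 N.≤ n) where
 open import Data.List.Properties using (length-map)

 h : ℕ
 h = m N.+ n N.+ 1

 h≥1 : 1 N.≤ h
 h≥1 = NP.m≤n+m 1 (m N.+ n)

 dbl≢0 : ∀ {k} → 1 N.≤ k → k N.+ k ≢ 0
 dbl≢0 (N.s≤s _) ()

 private module C = LatticeSum Q n (dbl≢0 n≥1) (+ 1) using (Class; M; P; P′; V; classes; pow; pt; qz-cong; β; ξ; module Recurrence)
 private module B = LatticeSum Q h (dbl≢0 h≥1) (+ 0) using (M; P; P′; V; classes; pt; β; ξ; module Recurrence)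

 open QRing Q
 open IntSolver R
 open Sums R
 open Determinants R
 open C using (Class; qz-cong; pow)

 down : ℕ → List ℕ
 down zero = []
 down (suc k) = k ∷ down k

 length-down : ∀ k → length (down k) ≡ k
 length-down zero = E.refl
 length-down (suc k) = E.cong suc (length-down k)

 down< : ∀ k → All (N._< k) (down k)
 down< zero = []
 down< (suc k) = NP.≤-refl ∷ All.map (λ p → NP.m<n⇒m<1+n p) (down< k)

 -- Representatives 0, ..., n - 1 in type C and h - n, ..., h - 1 in type B. They are written H - 1
 -- - k so that P equals k + 1 at ρ = 0, which lets row and column indices change places.
 psC psB : List ℕ
 psC = map (λ k → n ∸ suc k) (down n)
 psB = map (λ k → h ∸ suc k) (down n)

 -- The coefficient of β in type C is h = m + 2 + (n - 1): m from the bounded weight, 2 from the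
 -- class itself, n - 1 from the other classes. In type B it is n = 1 + (n - 1).
 uC uB : Class → Carrier
 uC c = qz (+ h Z.* C.β c) * (qz (C.P c) - qz (C.P′ c))
 uB c = qz (+ n Z.* B.β c Z.+ proj₂ c Z.* + h) * (1# - qz (B.P c))

 SC SB : ℕ → Carrier
 SC b = ΣL (b N.+ b) n (λ rs → Π (C.classes b (map +_ psC) rs) uC * C.V (C.classes b (map +_ psC) rs))
 SB b = ΣL (b N.+ b) n (λ rs → Π (B.classes b (map +_ psB) rs) uB * B.V (B.classes b (map +_ psB) rs))

 private
  q3 : ∀ {x y z} → x Z.+ y ≡ z → qz x * qz y ≈ qz z
  q3 {x} {y} e = trans (sym (qz-+ x y)) (qz-cong e)

 -- The Chebyshev-like polynomials behind the two Weyl denominators.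
 φ : ℕ → Class → Carrier
 φ 0 c = 1#
 φ 1 c = C.ξ c + 0#
 φ (suc (suc k)) c = C.ξ c * φ (suc k) c - qz (+ 1) * φ k c

 ψ : ℕ → Class → Carrier
 ψ 0 c = 1#
 ψ 1 c = B.ξ c + 1#
 ψ (suc (suc k)) c = B.ξ c * ψ (suc k) c - 1# * ψ k c

 -- φ k is (x^(k+1) - y^(k+1))/(x - y) with x = q^P and y = q^P′. The constant q of its recurrence
 -- is xy, as P + P′ = 1 for e = 1.
 φ-closed : ∀ k c → (qz (C.P c) - qz (C.P′ c)) * φ k c ≈ qz (+ suc k Z.* C.P c) - qz (+ suc k Z.* C.P′ c)
 φ-closed 0 c = trans (*-identityʳ _) (+-cong (qz-cong (E.sym (ZP.*-identityˡ _))) (-‿cong (qz-cong (E.sym (ZP.*-identityˡ _)))))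
 φ-closed 1 c = trans (solve 2 (λ x y → (x :- y) :* ((x :+ y) :+ :0) := x :* x :- y :* y) tt _ _) (+-cong (q3 (lem _)) (-‿cong (q3 (lem _))))
  where
  lem : ∀ x → x Z.+ x ≡ (+ 2) Z.* x
  lem = ZS.solve-∀
 φ-closed (suc (suc k)) c = begin
  _ ≈⟨ solve 5 (λ x y f q g → (x :- y) :* ((x :+ y) :* f :- q :* g) := (x :+ y) :* ((x :- y) :* f) :- q :* ((x :- y) :* g)) tt x y (φ (suc k) c) (qz (+ 1)) (φ k c) ⟩
  _ ≈⟨ +-cong (*-congˡ (φ-closed (suc k) c)) (-‿cong (*-cong (sym (q3 (pp (C.pt c) (+ n)))) (φ-closed k c))) ⟩
  _ ≈⟨ +-congʳ (*-congˡ (+-cong (sym (q3 (st (+ suc k) (C.P c)))) (-‿cong (sym (q3 (st (+ suc k) (C.P′ c))))))) ⟩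
  _ ≈⟨ solve 4 (λ x y X Y → (x :+ y) :* (x :* X :- y :* Y) :- (x :* y) :* (X :- Y) := x :* (x :* X) :- y :* (y :* Y)) tt x y X Y ⟩
  _ ≈⟨ +-cong (trans (*-congˡ (q3 (st (+ suc k) (C.P c)))) (q3 (st (+ suc (suc k)) (C.P c)))) (-‿cong (trans (*-congˡ (q3 (st (+ suc k) (C.P′ c)))) (q3 (st (+ suc (suc k)) (C.P′ c))))) ⟩
  _ ∎
  where
  x = qz (C.P c)
  y = qz (C.P′ c)
  X = qz (+ suc k Z.* C.P c)
  Y = qz (+ suc k Z.* C.P′ c)
  pp : ∀ v n → (n Z.- v) Z.+ (v Z.- n Z.+ + 1) ≡ + 1
  pp = ZS.solve-∀
  st : ∀ k p → p Z.+ k Z.* p ≡ (+ 1 Z.+ k) Z.* p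
  st = ZS.solve-∀

 -- For e = 0 the exponents P and P′ are opposite, and ψ k is the geometric sum of q^(jP) over -k ≤
 -- j ≤ k.
 ψ-closed : ∀ k c → (1# - qz (B.P c)) * ψ k c ≈ qz (Z.- (+ k Z.* B.P c)) - qz (+ suc k Z.* B.P c)
 ψ-closed 0 c = trans (*-identityʳ _) (+-cong (trans (sym qz-0) (qz-cong (E.cong Z.-_ (E.sym (ZP.*-zeroˡ (B.P c)))))) (-‿cong (qz-cong (E.sym (ZP.*-identityˡ _)))))
 ψ-closed 1 c = begin
  _ ≈⟨ solve 2 (λ x y → (:1 :- x) :* ((x :+ y) :+ :1) := y :- x :* x :+ (:1 :- x :* y)) tt x (qz (B.P′ c)) ⟩
  _ ≈⟨ +-cong (+-cong (qz-cong (pm (B.pt c) (+ h))) (-‿cong (q3 (lem _)))) (trans (+-congˡ (-‿cong (trans (q3 (pp (B.pt c) (+ h))) qz-0))) (-‿inverseʳ 1#)) ⟩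
  _ ≈⟨ +-identityʳ _ ⟩
  _ ∎
  where
  x = qz (B.P c)
  lem : ∀ x → x Z.+ x ≡ (+ 2) Z.* x
  lem = ZS.solve-∀
  pp : ∀ v n → (n Z.- v) Z.+ (v Z.- n Z.+ + 0) ≡ + 0
  pp = ZS.solve-∀
  pm : ∀ v n → v Z.- n Z.+ + 0 ≡ Z.- (+ 1 Z.* (n Z.- v))
  pm = ZS.solve-∀
 ψ-closed (suc (suc k)) c = begin
  _ ≈⟨ solve 4 (λ x y f g → (:1 :- x) :* ((x :+ y) :* f :- :1 :* g) := (x :+ y) :* ((:1 :- x) :* f) :- (:1 :- x) :* g) tt x y (ψ (suc k) c) (ψ k c) ⟩
  _ ≈⟨ +-cong (*-congˡ (ψ-closed (suc k) c)) (-‿cong (ψ-closed k c)) ⟩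
  _ ≈⟨ solve 6 (λ x y a b c d → (x :+ y) :* (a :- b) :- (c :- d) := x :* a :+ y :* a :- (x :* b :+ y :* b) :- (c :- d)) tt x y _ _ _ _ ⟩
  _ ≈⟨ +-congʳ (+-cong (+-cong (q3 (s₁ (+ k) p)) (q3 (s₂ (+ k) (B.pt c) (+ h)))) (-‿cong (+-cong (q3 (s₃ (+ k) p)) (q3 (s₄ (+ k) (B.pt c) (+ h)))))) ⟩
  _ ≈⟨ solve 4 (λ a b c d → a :+ b :- (c :+ d) :- (a :- d) := b :- c) tt _ _ _ _ ⟩
  _ ∎
  where
  x = qz (B.P c)
  y = qz (B.P′ c)
  p = B.P c
  s₁ : ∀ k p → p Z.+ Z.- ((+ 1 Z.+ k) Z.* p) ≡ Z.- (k Z.* p)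
  s₁ = ZS.solve-∀
  s₂ : ∀ k v n → (v Z.- n Z.+ + 0) Z.+ Z.- ((+ 1 Z.+ k) Z.* (n Z.- v)) ≡ Z.- ((+ 2 Z.+ k) Z.* (n Z.- v))
  s₂ = ZS.solve-∀
  s₃ : ∀ k p → p Z.+ (+ 2 Z.+ k) Z.* p ≡ (+ 3 Z.+ k) Z.* p
  s₃ = ZS.solve-∀
  s₄ : ∀ k v n → (v Z.- n Z.+ + 0) Z.+ (+ 2 Z.+ k) Z.* (n Z.- v) ≡ (+ 1 Z.+ k) Z.* (n Z.- v)
  s₄ = ZS.solve-∀

 private module RC = C.Recurrence (qz (+ 1)) 0# φ (λ _ → refl) (λ _ → refl) (λ _ _ → refl)
 private module RB = B.Recurrence 1# 1# ψ (λ _ → refl) (λ _ → refl) (λ _ _ → refl)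

 private
  downC : ∀ k → RC.down k ≡ down k
  downC zero = E.refl
  downC (suc k) = E.cong (k ∷_) (downC k)
  downB : ∀ k → RB.down k ≡ down k
  downB zero = E.refl
  downB (suc k) = E.cong (k ∷_) (downB k)

  classesC-len : ∀ b ps rs → length rs ≡ length ps → length (C.classes b (map +_ ps) rs) ≡ length ps
  classesC-len b [] [] _ = E.refl
  classesC-len b (p ∷ ps) (r ∷ rs) e = E.cong suc (classesC-len b ps rs (NP.suc-injective e))
  classesB-len : ∀ b ps rs → length rs ≡ length ps → length (B.classes b (map +_ ps) rs) ≡ length ps
  classesB-len b [] [] _ = E.refl
  classesB-len b (p ∷ ps) (r ∷ rs) e = E.cong suc (classesB-len b ps rs (NP.suc-injective e))

  det′-cong : ∀ {I J : Set} {x y : I → J → Carrier} → (∀ i j → x i j ≈ y i j) → ∀ is js → det′ x is js ≈ det′ y is js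
  det′-cong e is [] = refl
  det′-cong e is (j ∷ js) = Sel±-cong is (λ {i} {r} _ → *-cong (e i j) (det′-cong e r js))

  -- A determinant is linear in each column, and the column of a class depends only on that class's
  -- threshold, so every threshold sum moves into its own column.
  expandC : ∀ b (E : ℕ → Class → Carrier) is ps →
   ΣL (b N.+ b) (length ps) (λ rs → det′ E is (C.classes b (map +_ ps) rs)) ≈ det′ (λ k p → sumTo (suc (b N.+ b)) (λ r → E k (+ p , + r Z.- + b))) is ps
  expandC b E is [] = refl
  expandC b E is (p ∷ ps) = begin
   _ ≈⟨ sumTo-cong l (λ r _ → trans (ΣL-Sel (length ps) is _) (Sel±-cong is (λ {i} {s} _ → trans (ΣL-* (b N.+ b) (length ps) (E i (+ p , + r Z.- + b)) (λ rs → det′ E s (C.classes b (map +_ ps) rs))) (*-congˡ (expandC b E s ps))))) ⟩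
   _ ≈⟨ sum-Sel l is (λ r i s → E i (+ p , + r Z.- + b) * X s) ⟩
   _ ≈⟨ Sel±-cong is (λ {i} {s} _ → trans (sumTo-cong l (λ r _ → *-comm (E i (+ p , + r Z.- + b)) (X s))) (trans (sumTo-* l (X s) (λ r → E i (+ p , + r Z.- + b))) (*-comm _ _))) ⟩
   _ ∎
   where
   l = suc (b N.+ b)
   X : List ℕ → Carrier
   X s = det′ (λ k p → sumTo l (λ r → E k (+ p , + r Z.- + b))) s ps
   sum-Sel : ∀ l is (f : ℕ → ℕ → List ℕ → Carrier) → sumTo l (λ r → Sel± is (f r)) ≈ Sel± is (λ i s → sumTo l (λ r → f r i s))
   sum-Sel zero is f = sym (trans (trans (Sel±-cong is (λ _ → sym (zeroˡ 0#))) (Sel±-* is 0# (λ _ _ → 0#))) (zeroˡ _))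
   sum-Sel (suc l) is f = trans (+-congˡ (sum-Sel l is _)) (sym (Sel±-+ is _ _))
   ΣL-Sel : ∀ k is (f : List ℕ → ℕ → List ℕ → Carrier) → ΣL (b N.+ b) k (λ rs → Sel± is (f rs)) ≈ Sel± is (λ i s → ΣL (b N.+ b) k (λ rs → f rs i s))
   ΣL-Sel zero is f = refl
   ΣL-Sel (suc k) is f = trans (sumTo-cong l (λ r _ → ΣL-Sel k is (λ rs → f (r ∷ rs)))) (sum-Sel l is (λ r i s → ΣL (b N.+ b) k (λ rs → f (r ∷ rs) i s)))

  classes≡ : ∀ b ps rs → B.classes b (map +_ ps) rs ≡ C.classes b (map +_ ps) rs
  classes≡ b [] rs = E.refl
  classes≡ b (p ∷ ps) [] = E.refl
  classes≡ b (p ∷ ps) (r ∷ rs) = E.cong ((+ p , + r Z.- + b) ∷_) (classes≡ b ps rs)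

  det-map : ∀ {I J K : Set} (x : I → J → Carrier) (g : K → J) is ks → det′ x is (map g ks) ≈ det′ (λ i k → x i (g k)) is ks
  det-map x g is [] = refl
  det-map x g is (k ∷ ks) = Sel±-cong is (λ {i} {r} _ → *-congˡ (det-map x g r ks))

  det-transpose : ∀ {I J : Set} (x : I → J → Carrier) is js → det′ x is js ≈ det (λ j i → x i j) js is
  det-transpose x is [] = refl
  det-transpose x is (j ∷ js) = Sel±-cong is (λ {i} {r} _ → *-congˡ (det-transpose x r js))

  det-scale : ∀ {I J : Set} (x y : I → J → Carrier) is (js : List J) → All (λ i → All (λ j → x i j ≈ - y i j) js) is → det x is js ≈ pow (- 1#) (length is) * det y is js
  det-scale x y [] js _ = sym (*-identityˡ _)
  det-scale x y (i ∷ is) js (e ∷ es) = trans (Sel±-cong js (λ {j} {r} k → trans (*-cong (proj₁ (All-pick k e)) (det-scale x y is r (All.map (λ q → proj₂ (All-pick k q)) es)))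
   (solve 3 (λ a p d → :- a :* (p :* d) := (:- :1 :* p) :* (a :* d)) tt _ _ _))) (Sel±-* js _ _)

  EC EB : ℕ → Class → Carrier
  EC k c = qz (+ h Z.* C.β c) * (qz (+ suc k Z.* C.P c) - qz (+ suc k Z.* C.P′ c))
  EB k c = qz (+ n Z.* B.β c Z.+ proj₂ c Z.* + h) * (qz (Z.- (+ k Z.* B.P c)) - qz (+ suc k Z.* B.P c))

  mC mB : ℕ → ℕ → ℕ → Carrier
  mC b k k' = sumTo (suc (b N.+ b)) (λ r → EC k (+ (n ∸ suc k') , + r Z.- + b))
  mB b k k' = sumTo (suc (b N.+ b)) (λ r → EB k (+ (h ∸ suc k') , + r Z.- + b))

  length-psC : length psC ≡ n
  length-psC = E.trans (length-map _ (down n)) (length-down n)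
  length-psB : length psB ≡ n
  length-psB = E.trans (length-map _ (down n)) (length-down n)

 SC-det : ∀ b → SC b ≈ det′ (mC b) (down n) (down n)
 SC-det b = begin
  SC b ≈⟨ ΣL-cong (b N.+ b) n (λ rs l _ → begin
    _ ≈⟨ RC.det-V uC n (cs rs) (E.trans (classesC-len b psC rs (E.trans l (E.sym length-psC))) length-psC) ⟨
    _ ≈⟨ reflexive (E.cong (λ d → det (λ k c → uC c * φ k c) d (cs rs)) (downC n)) ⟩
    _ ≈⟨ det≈det′ _ n (down n) (cs rs) (length-down n) (E.trans (classesC-len b psC rs (E.trans l (E.sym length-psC))) length-psC) ⟩
    _ ≈⟨ det′-cong (λ k c → trans (*-assoc _ _ _) (*-congˡ (φ-closed k c))) (down n) (cs rs) ⟩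
    _ ∎) ⟩
  ΣL (b N.+ b) n (λ rs → det′ EC (down n) (cs rs)) ≈⟨ reflexive (E.cong (λ k → ΣL (b N.+ b) k (λ rs → det′ EC (down n) (cs rs))) (E.sym length-psC)) ⟩
  ΣL (b N.+ b) (length psC) (λ rs → det′ EC (down n) (cs rs)) ≈⟨ expandC b EC (down n) psC ⟩
  _ ≈⟨ det-map _ (λ k → n ∸ suc k) (down n) (down n) ⟩
  det′ (mC b) (down n) (down n) ∎
  where
  cs : List ℕ → List Class
  cs rs = C.classes b (map +_ psC) rs

 SB-det : ∀ b → SB b ≈ det′ (mB b) (down n) (down n)
 SB-det b = begin
  SB b ≈⟨ ΣL-cong (b N.+ b) n (λ rs l _ → begin
    _ ≈⟨ RB.det-V uB n (cs rs) (E.trans (classesB-len b psB rs (E.trans l (E.sym length-psB))) length-psB) ⟨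
    _ ≈⟨ reflexive (E.cong (λ d → det (λ k c → uB c * ψ k c) d (cs rs)) (downB n)) ⟩
    _ ≈⟨ det≈det′ _ n (down n) (cs rs) (length-down n) (E.trans (classesB-len b psB rs (E.trans l (E.sym length-psB))) length-psB) ⟩
    _ ≈⟨ det′-cong (λ k c → trans (*-assoc _ _ _) (*-congˡ (ψ-closed k c))) (down n) (cs rs) ⟩
    _ ≈⟨ reflexive (E.cong (det′ EB (down n)) (classes≡ b psB rs)) ⟩
    _ ∎) ⟩
  ΣL (b N.+ b) n (λ rs → det′ EB (down n) (C.classes b (map +_ psB) rs)) ≈⟨ reflexive (E.cong (λ k → ΣL (b N.+ b) k (λ rs → det′ EB (down n) (C.classes b (map +_ psB) rs))) (E.sym length-psB)) ⟩
  ΣL (b N.+ b) (length psB) (λ rs → det′ EB (down n) (C.classes b (map +_ psB) rs)) ≈⟨ expandC b EB (down n) psB ⟩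
  _ ≈⟨ det-map _ (λ k → h ∸ suc k) (down n) (down n) ⟩
  det′ (mB b) (down n) (down n) ∎
  where
  cs : List ℕ → List Class
  cs rs = B.classes b (map +_ psB) rs

 private
  sumTo-last : ∀ l (f : ℕ → Carrier) → sumTo (suc l) f ≈ sumTo l f + f l
  sumTo-last zero f = +-comm _ _
  sumTo-last (suc l) f = trans (+-congˡ (sumTo-last l (λ i → f (suc i)))) (sym (+-assoc _ _ _))

  sumTo-reverse : ∀ l (f : ℕ → Carrier) → sumTo (suc l) f ≈ sumTo (suc l) (λ r → f (l ∸ r))
  sumTo-reverse zero f = refl
  sumTo-reverse (suc l) f = trans (sumTo-last (suc l) f) (trans (+-comm _ _) (+-congˡ (sumTo-reverse l f)))

  -- Every entry is a difference of two theta series. One series agrees with its partner at the same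
  -- ρ, the other at -ρ; the summation range is symmetric, so it can be reversed. The two series
  -- occur with opposite signs on the two sides.
  entry : ∀ b k k' → k N.< n → k' N.< h → mB b k k' ≈ - mC b k' k
  entry b k k' k<n k'<h = begin
   _ ≈⟨ sumTo-cong l (λ r _ → ex (X r) (Y r) (Z r)) ⟩
   _ ≈⟨ trans (sumTo-+ l XY (λ r → - 1# * XZ r)) (+-congˡ (sumTo-* l (- 1#) XZ)) ⟩
   _ ≈⟨ +-cong (trans (sumTo-reverse (b N.+ b) XY) (sumTo-cong l (λ r r<l → qz-cong (second r r<l)))) (*-congˡ (sumTo-cong l (λ r _ → qz-cong (first r)))) ⟩
   _ ≈⟨ solve 2 (λ x y → x :+ :- :1 :* y := :- (y :+ :- :1 :* x)) tt (sumTo l XZ') (sumTo l XY') ⟩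
   _ ≈⟨ -‿cong (trans (+-congˡ (sym (sumTo-* l (- 1#) XZ'))) (sym (sumTo-+ l XY' (λ r → - 1# * XZ' r)))) ⟩
   _ ≈⟨ -‿cong (sumTo-cong l (λ r _ → sym (ex (X' r) (Y' r) (Z' r)))) ⟩
   - mC b k' k ∎
   where
   l = suc (b N.+ b)
   cB cC : ℕ → Class
   cB r = + (h ∸ suc k') , + r Z.- + b
   cC r = + (n ∸ suc k) , + r Z.- + b
   X Y Z X' Y' Z' : ℕ → ℤ
   X r = + n Z.* B.β (cB r) Z.+ proj₂ (cB r) Z.* + h
   Y r = Z.- (+ k Z.* B.P (cB r))
   Z r = + suc k Z.* B.P (cB r)
   X' r = + h Z.* C.β (cC r)
   Y' r = + suc k' Z.* C.P (cC r)
   Z' r = + suc k' Z.* C.P′ (cC r)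
   XY XZ XY' XZ' : ℕ → Carrier
   XY r = qz (X r Z.+ Y r)
   XZ r = qz (X r Z.+ Z r)
   XY' r = qz (X' r Z.+ Y' r)
   XZ' r = qz (X' r Z.+ Z' r)
   ex : ∀ x y z → qz x * (qz y - qz z) ≈ qz (x Z.+ y) + - 1# * qz (x Z.+ z)
   ex x y z = trans (solve 3 (λ x y z → x :* (y :- z) := x :* y :+ :- :1 :* (x :* z)) tt (qz x) (qz y) (qz z)) (+-cong (sym (qz-+ x y)) (*-congˡ (sym (qz-+ x z))))
   pB : + (h ∸ suc k') ≡ + h Z.- (+ 1 Z.+ + k')
   pB = E.sym (E.trans (ZP.m-n≡m⊖n h (suc k')) (ZP.⊖-≥ k'<h))
   pC : + (n ∸ suc k) ≡ + n Z.- (+ 1 Z.+ + k)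
   pC = E.sym (E.trans (ZP.m-n≡m⊖n n (suc k)) (ZP.⊖-≥ k<n))
   first : ∀ r → X r Z.+ Z r ≡ X' r Z.+ Y' r
   first r = E.trans (E.cong (λ p → (+ n Z.* ((p Z.+ p Z.+ + 0) Z.* ρ Z.+ B.M Z.* (ρ Z.* (ρ Z.- + 1))) Z.+ ρ Z.* + h) Z.+ (+ suc k Z.* (+ h Z.- (p Z.+ ρ Z.* B.M)))) pB)
    (E.trans (lem (+ n) (+ h) (+ k) (+ k') ρ) (E.cong (λ p → (+ h Z.* ((p Z.+ p Z.+ + 1) Z.* ρ Z.+ C.M Z.* (ρ Z.* (ρ Z.- + 1)))) Z.+ (+ suc k' Z.* (+ n Z.- (p Z.+ ρ Z.* C.M)))) (E.sym pC)))
    where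
    ρ = + r Z.- + b
    lem : ∀ n h k k' ρ → (n Z.* (((h Z.- (+ 1 Z.+ k')) Z.+ (h Z.- (+ 1 Z.+ k')) Z.+ + 0) Z.* ρ Z.+ (h Z.+ h) Z.* (ρ Z.* (ρ Z.- + 1))) Z.+ ρ Z.* h) Z.+ ((+ 1 Z.+ k) Z.* (h Z.- ((h Z.- (+ 1 Z.+ k')) Z.+ ρ Z.* (h Z.+ h))))
     ≡ (h Z.* (((n Z.- (+ 1 Z.+ k)) Z.+ (n Z.- (+ 1 Z.+ k)) Z.+ + 1) Z.* ρ Z.+ (n Z.+ n) Z.* (ρ Z.* (ρ Z.- + 1)))) Z.+ ((+ 1 Z.+ k') Z.* (n Z.- ((n Z.- (+ 1 Z.+ k)) Z.+ ρ Z.* (n Z.+ n))))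
    lem = ZS.solve-∀
   second : ∀ r → r N.< l → X (b N.+ b ∸ r) Z.+ Y (b N.+ b ∸ r) ≡ X' r Z.+ Z' r
   second r (N.s≤s r≤) = E.trans (E.cong₂ (λ p ρ → (+ n Z.* ((p Z.+ p Z.+ + 0) Z.* ρ Z.+ B.M Z.* (ρ Z.* (ρ Z.- + 1))) Z.+ ρ Z.* + h) Z.+ (Z.- (+ k Z.* (+ h Z.- (p Z.+ ρ Z.* B.M))))) pB rev)
    (E.trans (lem (+ n) (+ h) (+ k) (+ k') ρ) (E.cong (λ p → (+ h Z.* ((p Z.+ p Z.+ + 1) Z.* ρ Z.+ C.M Z.* (ρ Z.* (ρ Z.- + 1)))) Z.+ (+ suc k' Z.* ((p Z.+ ρ Z.* C.M) Z.- + n Z.+ + 1))) (E.sym pC)))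
    where
    ρ = + r Z.- + b
    rv : ∀ b r → (b Z.+ b Z.- r) Z.- b ≡ Z.- (r Z.- b)
    rv = ZS.solve-∀
    rev : + (b N.+ b ∸ r) Z.- + b ≡ Z.- ρ
    rev = E.trans (E.cong (Z._- + b) (E.sym (E.trans (ZP.m-n≡m⊖n (b N.+ b) r) (ZP.⊖-≥ r≤)))) (rv (+ b) (+ r))
    lem : ∀ n h k k' ρ → (n Z.* (((h Z.- (+ 1 Z.+ k')) Z.+ (h Z.- (+ 1 Z.+ k')) Z.+ + 0) Z.* (Z.- ρ) Z.+ (h Z.+ h) Z.* ((Z.- ρ) Z.* ((Z.- ρ) Z.- + 1))) Z.+ (Z.- ρ) Z.* h) Z.+ (Z.- (k Z.* (h Z.- ((h Z.- (+ 1 Z.+ k')) Z.+ (Z.- ρ) Z.* (h Z.+ h)))))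
     ≡ (h Z.* (((n Z.- (+ 1 Z.+ k)) Z.+ (n Z.- (+ 1 Z.+ k)) Z.+ + 1) Z.* ρ Z.+ (n Z.+ n) Z.* (ρ Z.* (ρ Z.- + 1)))) Z.+ ((+ 1 Z.+ k') Z.* (((n Z.- (+ 1 Z.+ k)) Z.+ ρ Z.* (n Z.+ n)) Z.- n Z.+ + 1))
    lem = ZS.solve-∀

 -- The lattice sums of types C and B are determinants of the same theta series, transposed.
 duality : ∀ b → SB b ≈ pow (- 1#) n * SC b
 duality b = begin
  SB b ≈⟨ SB-det b ⟩
  _ ≈⟨ det≈det′ (mB b) n (down n) (down n) (length-down n) (length-down n) ⟨
  _ ≈⟨ det-scale (mB b) (λ k k' → mC b k' k) (down n) (down n) (All.map (λ k<n → All.map (λ k'<n → entry b _ _ k<n (NP.<-≤-trans k'<n n≤h)) (down< n)) (down< n)) ⟩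
  _ ≈⟨ *-cong (reflexive (E.cong (pow (- 1#)) (length-down n))) (sym (det-transpose (mC b) (down n) (down n))) ⟩
  _ ≈⟨ *-congˡ (SC-det b) ⟨
  _ ∎
  where
  n≤h : n N.≤ h
  n≤h = NP.≤-trans (NP.m≤n+m n m) (NP.m≤m+n (m N.+ n) 1)

-- Type C: the bounded Littlewood sum as a lattice sum

module SymplecticSide where
 open import Data.List.Properties using (length-map)

 odd≢0 : ∀ x → x Z.+ x Z.+ + 1 ≢ + 0
 odd≢0 (+ k) e = absurd (ZP.+-injective e)
  where
  absurd : k N.+ k N.+ 1 ≢ 0
  absurd p with k N.+ k | p
  ... | zero | ()
  ... | suc _ | ()
 odd≢0 -[1+ k ] ()

 NZ-range : ∀ M s → 1 N.≤ s → s N.< M → ∀ k → + s Z.+ k Z.* + M ≢ + 0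
 NZ-range M s s≥1 s<M (+ k) e = absurd (ZP.+-injective (E.trans (E.cong (λ x → + s Z.+ x) (ZP.pos-* k M)) e))
  where
  absurd : s N.+ k N.* M ≢ 0
  absurd p = NP.<⇒≢ s≥1 (E.sym (NP.m+n≡0⇒m≡0 s p))
 NZ-range M s s≥1 s<M -[1+ k ] e = NP.<⇒≱ s<M (E.subst (M N.≤_) (E.sym (ZP.+-injective eq)) (NP.m≤m+n M (k N.* M)))
  where
  lem : ∀ s x → s Z.+ (Z.- x) ≡ + 0 → s ≡ x
  lem s x p = E.trans (E.sym (l₁ s x)) (E.trans (E.cong (Z._+ x) p) (ZP.+-identityˡ x))
   where
   l₁ : ∀ s x → (s Z.+ (Z.- x)) Z.+ x ≡ s
   l₁ = ZS.solve-∀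
  eq : + s ≡ + (suc k N.* M)
  eq = E.trans (lem (+ s) (+ suc k Z.* + M) (E.trans (E.cong (λ x → + s Z.+ x) (ZP.neg-distribˡ-* (+ suc k) (+ M))) e)) (E.sym (ZP.pos-* (suc k) M))

 NZ-neg : ∀ M s → (∀ k → s Z.+ k Z.* + M ≢ + 0) → ∀ k → Z.- s Z.+ k Z.* + M ≢ + 0
 NZ-neg M s nz k e = nz (Z.- k) (E.trans (lem s k (+ M)) (E.cong Z.-_ e))
  where
  lem : ∀ s k m → s Z.+ (Z.- k) Z.* m ≡ Z.- (Z.- s Z.+ k Z.* m)
  lem = ZS.solve-∀

 pos-∸ : ∀ {a b} → b N.≤ a → + (a ∸ b) ≡ + a Z.- + b
 pos-∸ {a} {b} p = E.sym (E.trans (ZP.m-n≡m⊖n a b) (ZP.⊖-≥ p))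

 -- `Ainf M s` is 1/(q^s; q^M)_∞, for s < 0 with the finitely many negative factors expanded like
 -- `a`.
 record InfProd (Q : QRing) : Set₁ where
  open QRing Q
  field
   Ainf : ℕ → ℤ → Carrier
   Ainf-step : ∀ {M} → M ≢ 0 → ∀ s → s ≢ + 0 → Ainf M s ≈ a s * Ainf M (s Z.+ + M)
   Ainf-big : ∀ {M} → M ≢ 0 → ∀ {D} s → + D Z.≤ s → Int (qz (Z.- (+ D)) * (Ainf M s - 1#))
   Int-Ainf : ∀ M s → Int (Ainf M s)

 module TypeC (Q : QRing) (I : InfProd Q) (n : ℕ) (n≥1 : 1 N.≤ n) where
  open InfProd I
  private module D₀ = Duality Q n 0 n≥1
  open D₀ using (dbl≢0; down; psC)
  open LatticeSum Q n (dbl≢0 n≥1) (+ 1) using (Carrier; _≈_; _+_; _*_; -_; _-_; 0#; 1#; begin_; _≈⟨_⟩_; _≈⟨_⟨_; _∎; refl; sym; trans; reflexive; solve; _:=_; _:+_; _:*_; _:-_; :-_; :1; :0; _≈[_]_; R; []; _∷_; 0-*ˡ; Class; E₁; Int-resp; Int-Π; M; NZℤ; NonNeg; P; P′; Sep; Separated; Sgn; V; a-cong; a-mul; a-neg; a-neg′; b; b-cong; b-neg; bar; bar-sm; b≈qa; diff≢0; nonNeg; progs; qz-cong; qz≈[]0; sm; sm-bar; sm≢0; tp; vl; w; Π; Π-*; Π-cong; ΣL; ΣL-*; ΣL-cong; β; ≈[]-trans; ≈⇒≈[]; +-cong; +-congˡ; +-congʳ; *-cong; *-congˡ; *-congʳ;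 -‿cong; *-assoc; +-comm; +-identityˡ; +-identityʳ; zeroˡ; -‿inverseʳ; qz; qz-+; a; Int; Int-1; Int-*; Int-neg; Int-qz; Int-a; module Assemble; module Bounded; module Exact; module MainSum; module Quasi; module Weighted)

  f : ℤ → Carrier
  f y = a (sm y y)

  A A₁ : ℤ → Carrier
  A = Ainf (n N.+ n)
  A₁ v = A (sm v v)

  A-step : ∀ s → s ≢ + 0 → A s ≈ a s * A (s Z.+ M)
  A-step = Ainf-step (dbl≢0 n≥1)

  Ok : ℤ → Set
  Ok v = ⊤

  -- The exponents 2v + 1 + 2iM of the single factors and 2v + 1 + (2i+1)M of the telescoped pairs
  -- interlace, and together they fill the product `A` at 2v + 1.
  A₁-step : ∀ v → Ok v → A₁ v ≈ f v * a (sm v (v Z.+ M)) * A₁ (v Z.+ M)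
  A₁-step v _ = begin
   A (sm v v) ≈⟨ A-step (sm v v) (odd≢0 v) ⟩
   _ ≈⟨ *-congˡ (A-step (sm v v Z.+ M) (λ z → odd≢0 (v Z.+ + n) (E.trans (o v (+ n)) z))) ⟩
   _ ≈⟨ *-assoc _ _ _ ⟨
   _ ≈⟨ *-cong (*-congˡ (a-cong (e₁ v M))) (reflexive (E.cong A (e₂ v M))) ⟩
   _ ∎
   where
   o : ∀ v n → (v Z.+ n) Z.+ (v Z.+ n) Z.+ + 1 ≡ (v Z.+ v Z.+ + 1) Z.+ (n Z.+ n)
   o = ZS.solve-∀
   e₁ : ∀ v m → (v Z.+ v Z.+ + 1) Z.+ m ≡ v Z.+ (v Z.+ m) Z.+ + 1
   e₁ = ZS.solve-∀
   e₂ : ∀ v m → (v Z.+ v Z.+ + 1) Z.+ m Z.+ m ≡ (v Z.+ m) Z.+ (v Z.+ m) Z.+ + 1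
   e₂ = ZS.solve-∀

  A-big : ∀ {D} s → + D Z.≤ s → A s ≈[ D ] 1#
  A-big = Ainf-big (dbl≢0 n≥1)

  A₁-big : ∀ {D} s → + D Z.≤ s → A₁ s ≈[ D ] 1#
  A₁-big {D} (+ k) (Z.+≤+ p) = A-big (sm (+ k) (+ k)) (Z.+≤+ (NP.≤-trans p (NP.≤-trans (NP.m≤m+n k k) (NP.m≤m+n (k N.+ k) 1))))

  a-negative : ∀ k → a -[1+ k ] ≈[ 1 ] 0#
  a-negative k = ≈[]-trans (≈⇒≈[] (trans (a-neg′ {+ suc k} (λ ())) (solve 2 (λ x y → :- (x :* y) := (:- y) :* x) tt _ _)))
   (0-*ˡ (Int-neg (Int-a (+ suc k))) (qz≈[]0 (suc k) (N.s≤s N.z≤n)))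

  f-neg : ∀ k → f -[1+ k ] ≈[ 1 ] 0#
  f-neg k = a-negative (k N.+ k)

  open MainSum f A A₁ (Z.+≤+ N.z≤n) (Z.+≤+ (N.s≤s N.z≤n)) (λ v → Int-a _) (λ s → Int-Ainf _ s) (λ s → Int-Ainf _ _) Ok A-step A-big A₁-step A₁-big f-neg public
  open Weighted f public using (F)

  f-bar : ∀ y → f y + f (bar y) ≈ 1#
  f-bar y = trans (+-congˡ (trans (a-cong (lem y)) (a-neg (odd≢0 y)))) (solve 1 (λ x → x :+ (:1 :- x) := :1) tt (f y))
   where
   lem : ∀ y → (Z.- (+ 1) Z.- y) Z.+ (Z.- (+ 1) Z.- y) Z.+ + 1 ≡ Z.- (y Z.+ y Z.+ + 1)
   lem = ZS.solve-∀

  -- Once f (bar y) = 1 - f y and b (-k) = -1 - b k are used, only two products of poles remain.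
  -- Both are instances of `a-mul`, because their exponents add up to 2s + 1 and to z + s + 1.
  f-rel : ∀ {z s} → Sep z s →
     f s * (f z * b (sm z s) + f (bar z) * b (sm (bar z) s)) +
     f (bar s) * (f z * b (sm z (bar s)) + f (bar z) * b (sm (bar z) (bar s))) ≈ 1# * 0#
  f-rel {z} {s} (p , q) = begin
   _ ≈⟨ +-cong (*-congˡ (+-cong refl (*-cong fz′ (b-cong (bar-sm z s))))) (*-cong fs′ (+-cong (*-congˡ (trans (b-cong (E.trans (sm-bar z s) (e₁ z s))) (b-neg nd))) (*-cong fz′ (trans (b-cong (e₂ z s)) (b-neg nσ))))) ⟩
   _ ≈⟨ solve 4 (λ S Z X Y → S :* (Z :* (X :- :1) :+ (:1 :- Z) :* (Y :- :1)) :+ (:1 :- S) :* (Z :* (:- :1 :- (Y :- :1)) :+ (:1 :- Z) :* (:- :1 :- (X :- :1)))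
       := (S :* (Y :+ X :- :1) :- Y :* X) :+ (Z :* Y :- X :* (Z :+ Y :- :1)) :* (:0 :- :1)) tt (f s) (f z) X Y ⟩
   _ ≈⟨ +-cong (trans (+-congˡ (-‿cong rel₁)) (-‿inverseʳ _)) (trans (*-congʳ (trans (+-congʳ rel₂) (-‿inverseʳ _))) (zeroˡ _)) ⟩
   0# + 0# ≈⟨ solve 0 (:0 :+ :0 := :1 :* :0) tt ⟩
   1# * 0# ∎
   where
   X = a (sm z s)
   Y = a (s Z.- z)
   nσ : sm z s ≢ + 0
   nσ = sm≢0 q
   nd : s Z.- z ≢ + 0
   nd = diff≢0 (λ r → p (E.sym r))
   fz′ : f (bar z) ≈ 1# - f z
   fz′ = trans (solve 2 (λ x y → y := (x :+ y) :- x) tt (f z) (f (bar z))) (+-congʳ (f-bar z))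
   fs′ : f (bar s) ≈ 1# - f s
   fs′ = trans (solve 2 (λ x y → y := (x :+ y) :- x) tt (f s) (f (bar s))) (+-congʳ (f-bar s))
   e₁ : ∀ z s → z Z.- s ≡ Z.- (s Z.- z)
   e₁ = ZS.solve-∀
   e₂ : ∀ z s → (Z.- (+ 1) Z.- z) Z.+ (Z.- (+ 1) Z.- s) Z.+ + 1 ≡ Z.- (z Z.+ s Z.+ + 1)
   e₂ = ZS.solve-∀
   e₃ : ∀ z s → (s Z.- z) Z.+ (z Z.+ s Z.+ + 1) ≡ s Z.+ s Z.+ + 1
   e₃ = ZS.solve-∀
   e₄ : ∀ z s → (z Z.+ z Z.+ + 1) Z.+ (s Z.- z) ≡ z Z.+ s Z.+ + 1
   e₄ = ZS.solve-∀
   rel₁ : Y * X ≈ f s * (Y + X - 1#)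
   rel₁ = trans (a-mul nd nσ (λ r → odd≢0 s (E.trans (E.sym (e₃ z s)) r))) (*-congʳ (a-cong (e₃ z s)))
   rel₂ : f z * Y ≈ X * (f z + Y - 1#)
   rel₂ = trans (a-mul (odd≢0 z) nd (λ r → nσ (E.trans (E.sym (e₄ z s)) r))) (*-congʳ (a-cong (e₄ z s)))

  open Weighted.SignSum f 1# 0# (λ _ → ⊤) (λ _ → tt) (λ {y} _ → f-bar y) (λ _ _ → f-rel)

  -- With c = 1 and μ = 0 every further variable multiplies the sign sum by 1.
  base : ∀ S → Separated S → All (λ _ → ⊤) S → Sgn S F ≈ 1#
  base [] _ _ = refl
  base (z ∷ S) sep _ = trans (sign-sum-step z S sep (All.universal (λ _ → tt) _)) (trans (*-congˡ (base S (proj₂ sep) (All.universal (λ _ → tt) _))) (solve 1 (λ x → (:1 :+ :0 :* (:1 :- x)) :* :1 := :1) tt (tp (length S))))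

  X-f : ∀ {i} → ⊤ → qz (sm i i) * f i ≈ - f (bar i)
  X-f {i} _ = begin
   _ ≈⟨ b≈qa (odd≢0 i) ⟨
   _ ≈⟨ solve 2 (λ x y → x :- :1 := :- y :+ ((x :+ y) :- :1)) tt (f i) (f (bar i)) ⟩
   _ ≈⟨ +-congˡ (trans (+-congʳ (f-bar i)) (-‿inverseʳ 1#)) ⟩
   _ ≈⟨ +-identityʳ _ ⟩
   - f (bar i) ∎

  module BL = Bounded f (λ i → qz (sm i i)) (λ _ → ⊤) (λ {i} → X-f {i}) base

  psC< : All (N._< n) psC
  psC< = go (down n) (D₀.down< n)
   where
   go : ∀ ks → All (N._< n) ks → All (N._< n) (map (λ k → n ∸ suc k) ks)
   go [] _ = []
   go (k ∷ ks) (p ∷ ps) = NP.∸-monoʳ-< {n} {suc k} {0} (N.s≤s N.z≤n) p ∷ go ks ps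

  n<2n : n N.< n N.+ n
  n<2n = NP.m<m+n n n≥1

  goodC : ∀ {p} → p N.< n → Good p
  goodC {p} p<n = record
   { p<M = Z.+<+ (NP.<-trans p<n n<2n)
   ; p+e≥1 = Z.+≤+ (NP.m≤n+m 1 p)
   ; nz = λ k z → odd≢0 (+ p Z.+ k Z.* + n) (E.trans (lem (+ p) k (+ n)) z)
   ; okp = λ _ → tt ; okp′ = λ _ → tt }
   where
   lem : ∀ p k n → (p Z.+ k Z.* n) Z.+ (p Z.+ k Z.* n) Z.+ + 1 ≡ p Z.+ p Z.+ + 1 Z.+ k Z.* (n Z.+ n)
   lem = ZS.solve-∀

  good₂C : ∀ {p p'} → p N.< p' → p' N.< n → Good₂ p p'
  good₂C {p} {p'} p<p' p'<n =
   (NZ-range (n N.+ n) (p N.+ p' N.+ 1) (NP.m≤n+m 1 (p N.+ p')) (E.subst (N._≤ n N.+ n) (E.trans (NP.+-suc (suc p) p') (E.cong suc (E.sym (NP.+-comm (p N.+ p') 1)))) (NP.+-mono-≤ (NP.<-trans p<p' p'<n) p'<n))) ,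
   (E.subst (NZℤ M) (pos-∸ (NP.<⇒≤ p<p')) (NZ-range (n N.+ n) (p' ∸ p) (NP.m<n⇒0<n∸m p<p') (NP.≤-<-trans (NP.m∸n≤m p' p) (NP.<-trans p'<n n<2n))))

  goodsC : GoodList psC
  goodsC = go n NP.≤-refl
   where
   later : ∀ j k → suc k N.≤ n → j N.≤ k → All (Good₂ (n ∸ suc k)) (map (λ k → n ∸ suc k) (down j))
   later zero k k<n j≤k = []
   later (suc j) k k<n j≤k = good₂C (NP.∸-monoʳ-< {n} {suc k} {suc j} (N.s≤s j≤k) k<n) (NP.∸-monoʳ-< {n} {suc j} {0} (N.s≤s N.z≤n) (NP.≤-trans (NP.≤-trans j≤k (NP.n≤1+n k)) k<n)) ∷ later j k k<n (NP.<⇒≤ j≤k)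
   go : ∀ k → k N.≤ n → GoodList (map (λ k → n ∸ suc k) (down k))
   go zero _ = []
   go (suc k) k<n = (goodC (NP.∸-monoʳ-< {n} {suc k} {0} (N.s≤s N.z≤n) k<n) , later k k k<n NP.≤-refl) ∷ go k (NP.<⇒≤ k<n)

  open Assemble A A₁ A-step (λ p → NZℤ M (p Z.+ p Z.+ + 1)) (λ p p' → NZℤ M (p Z.+ p' Z.+ + 1) × NZℤ M (p' Z.- p)) (λ g → g)
    (λ p → - (Quasi.Θ M A A-step (sm p p) * qz (+ n Z.- + 1 Z.- p)))
    (λ c → qz (β c Z.+ β c) * (qz (P c) - qz (P′ c)))
    (λ p ρ g → Exact.SingleC.single-exact A A-step p g ρ) public
   using (KK; E₁-exact; Goods; []; _∷_; κ₂)

  KKC : Carrier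
  KKC = KK (map +_ psC)

  Int-KKC : Int KKC
  Int-KKC = go psC psC<
   where
   Int-Θ : ∀ s → Int (Quasi.Θ M A A-step s)
   Int-Θ s = Int-* (Int-Ainf _ s) (Int-Ainf _ _)
   nonneg : ∀ p → p N.< n → Int (qz (+ n Z.- + 1 Z.- + p))
   nonneg p p<n = Int-resp (qz-cong (E.trans (pos-∸ p<n) (lem (+ n) (+ p)))) (Int-qz (n ∸ suc p))
    where
    lem : ∀ n p → n Z.- (+ 1 Z.+ p) ≡ n Z.- + 1 Z.- p
    lem = ZS.solve-∀
   go : ∀ ps → All (N._< n) ps → Int (KK (map +_ ps))
   go [] _ = Int-1
   go (p ∷ ps) (q ∷ qs) = Int-* (Int-* (Int-* (Int-neg (Int-* (Int-Θ _) (nonneg p q))) (Int-Ainf _ _)) (Int-Π (map +_ ps) (λ p' → Int-* (Int-* (Int-Θ _) (Int-Θ _)) (nonneg p q)))) (go ps qs)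

  goods : ∀ b ps rs → GoodList ps → Goods (cl b ps rs)
  goods b [] rs _ = []
  goods b (p ∷ ps) [] _ = []
  goods b (p ∷ ps) (r ∷ rs) ((g , gs) ∷ G) = (Good.nz g , later ps rs gs) ∷ goods b ps rs G
   where
   later : ∀ ps rs → All (Good₂ p) ps → All (λ d → NZℤ M (+ p Z.+ proj₁ d Z.+ + 1) × NZℤ M (proj₁ d Z.- + p)) (cl b ps rs)
   later [] rs _ = []
   later (_ ∷ ps) [] _ = []
   later (_ ∷ ps) (_ ∷ rs) (g ∷ gs) = g ∷ later ps rs gs

  length-psC : length psC ≡ n
  length-psC = E.trans (length-map _ (down n)) (D₀.length-down n)

  module AtLevel (m : ℕ) where
   private module D = Duality Q n m n≥1

   -- Position -1 - k carries the inverse of the variable at k, whose square is q^(2k+1). An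
   -- inverted variable is weighted with the m-th power of that square.
   γ : ℤ → ℤ
   γ (+ _) = + 0
   γ -[1+ k ] = + m Z.* (+ (k N.+ k N.+ 1))

   private
    γ≥0 : ∀ y → NonNeg (γ y)
    γ≥0 (+ _) = nonNeg 0
    γ≥0 -[1+ k ] = E.subst NonNeg (ZP.pos-* m (k N.+ k N.+ 1)) (nonNeg (m N.* (k N.+ k N.+ 1)))

    bar+ : ∀ k → bar (+ k) ≡ -[1+ k ]
    bar+ zero = E.refl
    bar+ (suc k) = E.refl

    γ-bar : ∀ y → γ (bar y) ≡ γ y Z.+ + m Z.* (y Z.+ y Z.+ + 1)
    γ-bar (+ k) = E.trans (E.cong γ (bar+ k)) (E.sym (ZP.+-identityˡ _))
    γ-bar -[1+ k ] = E.sym (E.trans (E.sym (ZP.*-distribˡ-+ (+ m) (+ (k N.+ k N.+ 1)) (-[1+ k ] Z.+ -[1+ k ] Z.+ + 1))) (E.trans (E.cong (+ m Z.*_) (lem (+ k))) (ZP.*-zeroʳ (+ m))))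
     where
     lem : ∀ k → (k Z.+ k Z.+ + 1) Z.+ ((Z.- (+ 1 Z.+ k)) Z.+ (Z.- (+ 1 Z.+ k)) Z.+ + 1) ≡ + 0
     lem = ZS.solve-∀

   open WeightedSum γ (+ m) γ≥0 γ-bar (λ _ → E.refl) (λ _ → E.refl) public using (g; wt; main-sum)

   SgnC : ℕ → Carrier
   SgnC b = Sgn (progs (b N.+ b) (zs b psC)) (λ Y → Π Y g * F Y)

   level-sum : ∀ {D} → 1 N.≤ D → ∀ b → D N.+ D N.≤ b → SgnC b ≈[ D ] KKC * D.SC b
   level-sum {D} D≥1 b big = ≈[]-trans (main-sum D≥1 b big psC goodsC) (≈⇒≈[] (begin
    _ ≈⟨ ΣL-cong (b N.+ b) (length psC) (λ rs l _ → term rs (E.sym l)) ⟩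
    _ ≈⟨ ΣL-* (b N.+ b) (length psC) KKC (λ rs → Π (cs rs) D.uC * V (cs rs)) ⟩
    _ ≈⟨ *-congˡ (reflexive (E.cong (λ k → ΣL (b N.+ b) k (λ rs → Π (cs rs) D.uC * V (cs rs))) length-psC)) ⟩
    KKC * D.SC b ∎))
    where
    cs : List ℕ → List Class
    cs rs = cl b psC rs
    term : ∀ rs → length psC ≡ length rs → wt (cs rs) * E₁ A A₁ (vl (cs rs)) ≈ KKC * (Π (cs rs) D.uC * V (cs rs))
    term rs l = begin
     _ ≈⟨ *-congˡ (E₁-exact (cs rs) (goods b psC rs goodsC)) ⟩
     _ ≈⟨ *-congˡ (*-cong (reflexive (E.cong KK (cl-firsts b psC rs l))) (*-congʳ (Π-cong (cs rs) (λ c → *-congˡ (qz-cong (E.cong (λ k → + k Z.* β c Z.- β c) (E.trans (length-cl b psC rs l) length-psC))))))) ⟩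
     _ ≈⟨ solve 4 (λ w k p v → w :* (k :* (p :* v)) := k :* ((w :* p) :* v)) tt (wt (cs rs)) KKC (Π (cs rs) (λ c → y c * qz (+ n Z.* β c Z.- β c))) (V (cs rs)) ⟩
     _ ≈⟨ *-congˡ (*-congʳ (trans (sym (Π-* (cs rs) _ _)) (Π-cong (cs rs) each))) ⟩
     _ ∎
     where
     y : Class → Carrier
     y c = qz (β c Z.+ β c) * (qz (P c) - qz (P′ c))
     lem : ∀ m n b → (m Z.* b Z.+ (b Z.+ b)) Z.+ (n Z.* b Z.- b) ≡ (m Z.+ n Z.+ + 1) Z.* b
     lem = ZS.solve-∀
     each : ∀ c → qz (+ m Z.* β c) * (y c * qz (+ n Z.* β c Z.- β c)) ≈ D.uC c
     each c = trans (solve 4 (λ a b x d → a :* ((b :* x) :* d) := ((a :* b) :* d) :* x) tt (qz (+ m Z.* β c)) (qz (β c Z.+ β c)) (qz (P c) - qz (P′ c)) (qz (+ n Z.* β c Z.- β c)))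
      (*-congʳ (trans (*-congʳ (sym (qz-+ _ _))) (trans (sym (qz-+ _ _)) (qz-cong (lem (+ m) (+ n) (β c))))))

-- Type B: a sign sum with a product value

module OrthogonalSide where
 open import Data.List.Properties using (length-map; length-++)
 open import Data.List.Relation.Unary.All.Properties using () renaming (++⁺ to All-++)
 open SymplecticSide

 module TypeB (Q : QRing) (I : InfProd Q) (n m : ℕ) (n≥1 : 1 N.≤ n) where
  open InfProd I
  private module D = Duality Q n m n≥1
  open D using (dbl≢0; down; psB; h; h≥1)
  open LatticeSum Q h (dbl≢0 h≥1) (+ 0) using (Carrier; _≈_; _+_; _*_; -_; _-_; 0#; 1#; begin_; _≈⟨_⟩_; _≈⟨_⟨_; _∎; refl; sym; trans; reflexive; solve; _:=_; _:+_; _:*_; _:-_; :-_; :1; :0; _≈[_]_; R; []; _∷_; 0-*ˡ; Class; E₁; Int--; L; M; M₀; M₀≥1; NZℤ; NonSelf; P; Sep; Separated; Sgn; Sgn-cong; V; a-cong; a-inv; a-mul; a-neg; a-neg′; b; b-cong; b-neg; bar; bar-sm; b≈qa; diff≢0; inverse-unique; neg≢0; nonNeg; origin; prog; progs; qz-cong; qz≈[]0; sm; sm-bar; sm≢0; t; tp; tp≈qz; vl; Π; Π-1; Π-cong; ΣL; ΣL-*; ΣL-cong; β; ≈[]-*ˡ; ≈[]-+; ≈[]-sym; ≈[]-trans; ≈⇒≈[]; +-cong; +-congˡ; +-congʳ; *-cong; *-congˡ; *-congʳ; -‿cong; +-assoc; *-assoc; +-comm; *-comm; +-identityˡ; +-identityʳ;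 *-identityˡ; -‿inverseʳ; qz; qz-0; qz-+; a; Int-1; Int-+; Int-*; Int-neg; Int-qz; Int-a; module Assemble; module MainSum; module Quasi; module SingleB; module Weighted)

  η : Carrier
  η = qz (+ h)

  -- This is (1 + ηx)/(1 - x) for x = q^y. As t = η², multiplying it by the telescoped factor 1/(1 -
  -- t x²) leaves 1/((1 - x)(1 - ηx)), which is why its progressions give the product `A₁` with step
  -- h.
  f : ℤ → Carrier
  f y = (1# + η) * a y - η

  h≢0 : h ≢ 0
  h≢0 e = NP.<⇒≢ h≥1 (E.sym e)

  A A₁ : ℤ → Carrier
  A = Ainf (h N.+ h)
  A₁ = Ainf h

  A-step : ∀ s → s ≢ + 0 → A s ≈ a s * A (s Z.+ M)
  A-step = Ainf-step (dbl≢0 h≥1)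

  Ok : ℤ → Set
  Ok v = NZℤ (+ h) v

  private
   ok0 : ∀ {v} → Ok v → v ≢ + 0
   ok0 {v} o z = o (+ 0) (E.trans (ZP.+-identityʳ v) z)
   okh : ∀ {v} → Ok v → v Z.+ + h ≢ + 0
   okh {v} o z = o (+ 1) (E.trans (E.cong (λ x → v Z.+ x) (ZP.*-identityˡ (+ h))) z)

  A₁-step : ∀ v → Ok v → A₁ v ≈ f v * a (sm v (v Z.+ M)) * A₁ (v Z.+ M)
  A₁-step v o = begin
   A₁ v ≈⟨ Ainf-step h≢0 v (ok0 o) ⟩
   _ ≈⟨ *-congˡ (Ainf-step h≢0 (v Z.+ + h) (okh {v} o)) ⟩
   _ ≈⟨ *-congˡ (*-congˡ (reflexive (E.cong A₁ (ZP.+-assoc v (+ h) (+ h))))) ⟩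
   _ ≈⟨ *-assoc _ _ _ ⟨
   _ ≈⟨ *-congʳ (sym key) ⟩
   _ ∎
   where
   x = v Z.+ + h
   e₁ : ∀ v h → v Z.+ (v Z.+ (h Z.+ h)) Z.+ + 0 ≡ (v Z.+ h) Z.+ (v Z.+ h)
   e₁ = ZS.solve-∀
   xx≢0 : x Z.+ x ≢ + 0
   xx≢0 = double x (okh {v} o)
    where
    double : ∀ x → x ≢ + 0 → x Z.+ x ≢ + 0
    double (+ zero) n _ = n E.refl
    double (+ suc k) n ()
    double -[1+ k ] n ()
   halve : (1# + qz x) * a (x Z.+ x) ≈ a x
   halve = inverse-unique (trans (solve 2 (λ q y → (:1 :- q) :* ((:1 :+ q) :* y) := (:1 :- q :* q) :* y) tt (qz x) (a (x Z.+ x))) (trans (*-congʳ (+-congˡ (-‿cong (sym (qz-+ x x))))) (a-inv xx≢0))) (a-inv (okh {v} o))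
   fv : f v ≈ a v * (1# + qz x)
   fv = begin
    _ ≈⟨ solve 2 (λ e x → (:1 :+ e) :* x :- e := x :+ e :* (x :- :1)) tt η (a v) ⟩
    _ ≈⟨ +-congˡ (*-congˡ (b≈qa (ok0 o))) ⟩
    _ ≈⟨ solve 3 (λ x e q → x :+ e :* (q :* x) := x :* (:1 :+ q :* e)) tt (a v) η (qz v) ⟩
    _ ≈⟨ *-congˡ (+-congˡ (sym (qz-+ v (+ h)))) ⟩
    _ ∎
   key : f v * a (sm v (v Z.+ M)) ≈ a v * a x
   key = trans (*-cong fv (a-cong (e₁ v (+ h)))) (trans (*-assoc _ _ _) (*-congˡ halve))

  A-big : ∀ {D} s → + D Z.≤ s → A s ≈[ D ] 1#
  A-big = Ainf-big (dbl≢0 h≥1)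

  A₁-big : ∀ {D} s → + D Z.≤ s → A₁ s ≈[ D ] 1#
  A₁-big = Ainf-big h≢0

  f-neg : ∀ k → f -[1+ k ] ≈[ 1 ] 0#
  f-neg k = ≈[]-trans (≈[]-+ (0-*ˡ (Int-+ Int-1 (Int-qz h)) (≈[]-trans (≈⇒≈[] (trans (a-neg′ {+ suc k} (λ ())) (solve 2 (λ x y → :- (x :* y) := (:- y) :* x) tt _ _)))
    (0-*ˡ (Int-neg (Int-a (+ suc k))) (qz≈[]0 (suc k) (N.s≤s N.z≤n)))))
   (≈[]-trans (≈⇒≈[] (solve 1 (λ x → :- x := (:- :1) :* x) tt η)) (0-*ˡ (Int-neg Int-1) (qz≈[]0 h h≥1)))) (≈⇒≈[] (+-identityˡ _))

  open MainSum f A A₁ (Z.+≤+ N.z≤n) (Z.+≤+ N.z≤n) (λ v → Int-- (Int-* (Int-+ Int-1 (Int-qz h)) (Int-a v)) (Int-qz h)) (λ s → Int-Ainf _ s) (λ s → Int-Ainf _ s) Ok A-step A-big A₁-step A₁-big f-neg public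
  open Weighted f public using (F)

  bar≡ : ∀ y → bar y ≡ Z.- y
  bar≡ y = ZP.+-identityˡ (Z.- y)

  f-bar : ∀ {y} → y ≢ + 0 → f y + f (bar y) ≈ 1# - η
  f-bar {y} y≢0 = trans (+-congˡ (+-congʳ (*-congˡ (trans (a-cong (bar≡ y)) (a-neg y≢0)))))
   (solve 2 (λ e x → ((:1 :+ e) :* x :- e) :+ ((:1 :+ e) :* (:1 :- x) :- e) := :1 :- e) tt η (a y))

  f-rel : ∀ {z s} → z ≢ + 0 → s ≢ + 0 → Sep z s →
     f s * (f z * b (sm z s) + f (bar z) * b (sm (bar z) s)) +
     f (bar s) * (f z * b (sm z (bar s)) + f (bar z) * b (sm (bar z) (bar s))) ≈ (1# - η) * η
  f-rel {z} {s} nz ns (p , q) = begin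
   _ ≈⟨ +-cong (*-congˡ (+-cong refl (*-cong (fb nz) (b-cong (bar-sm z s))))) (*-cong (fb ns) (+-cong (*-congˡ (trans (b-cong (E.trans (sm-bar z s) (e₁ z s))) (b-neg nd))) (*-cong (fb nz) (trans (b-cong (e₂ z s)) (b-neg nσ))))) ⟩
   _ ≈⟨ solve 5 (λ e S Z X Y →
       (((:1 :+ e) :* S :- e) :* (((:1 :+ e) :* Z :- e) :* (X :- :1) :+ (:1 :- (:1 :+ e) :* Z) :* (Y :- :1)))
       :+ ((:1 :- (:1 :+ e) :* S) :* (((:1 :+ e) :* Z :- e) :* (:- :1 :- (Y :- :1)) :+ (:1 :- (:1 :+ e) :* Z) :* (:- :1 :- (X :- :1))))
       := (:1 :- e) :* e :+ (:1 :- e) :* (:1 :+ e) :* ((X :* (Z :+ S :- :1) :- Z :* S) :+ (S :* (Z :+ Y :- :1) :- Z :* Y))) tt η (a s) (a z) X Y ⟩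
   _ ≈⟨ +-congˡ (trans (*-congˡ (+-cong (trans (+-congˡ (-‿cong rel₁)) (-‿inverseʳ _)) (trans (+-congˡ (-‿cong rel₂)) (-‿inverseʳ _)))) (solve 2 (λ x y → x :* y :* (:0 :+ :0) := :0) tt _ _)) ⟩
   _ ≈⟨ +-identityʳ _ ⟩
   _ ∎
   where
   X = a (sm z s)
   Y = a (s Z.- z)
   f′ : ℤ → Carrier
   f′ y = 1# - (1# + η) * a y
   fb : ∀ {y} → y ≢ + 0 → f (bar y) ≈ f′ y
   fb {y} ny = trans (+-congʳ (*-congˡ (trans (a-cong (bar≡ y)) (a-neg ny)))) (solve 2 (λ e x → (:1 :+ e) :* (:1 :- x) :- e := :1 :- (:1 :+ e) :* x) tt η (a y))
   F₁ : Carrier → Carrier → Carrier → Carrier → Carrier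
   F₁ S Z S′ Z′ = S * (Z * (X - 1#) + Z′ * (Y - 1#)) + S′ * (Z * (- 1# - (Y - 1#)) + Z′ * (- 1# - (X - 1#)))
   nσ : sm z s ≢ + 0
   nσ = sm≢0 q
   nd : s Z.- z ≢ + 0
   nd = diff≢0 (λ r → p (E.sym r))
   e₁ : ∀ z s → z Z.- s ≡ Z.- (s Z.- z)
   e₁ = ZS.solve-∀
   e₂ : ∀ z s → (Z.- (+ 0) Z.- z) Z.+ (Z.- (+ 0) Z.- s) Z.+ + 0 ≡ Z.- (z Z.+ s Z.+ + 0)
   e₂ = ZS.solve-∀
   e₄ : ∀ z s → z Z.+ (s Z.- z) ≡ s
   e₄ = ZS.solve-∀
   e₅ : z Z.+ s ≡ sm z s
   e₅ = E.sym (ZP.+-identityʳ (z Z.+ s))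
   rel₁ : a z * a s ≈ X * (a z + a s - 1#)
   rel₁ = trans (a-mul nz ns (λ r → nσ (E.trans (E.sym e₅) r))) (*-congʳ (a-cong e₅))
   rel₂ : a z * Y ≈ a s * (a z + Y - 1#)
   rel₂ = trans (a-mul nz nd (λ r → ns (E.trans (E.sym (e₄ z s)) r))) (*-congʳ (a-cong (e₄ z s)))

  private
   neg0 : ∀ {x} → x ≢ + 0 → bar x ≢ + 0
   neg0 {x} n r = neg≢0 n (E.trans (E.sym (bar≡ x)) r)

  open Weighted.SignSum f (1# - η) η (_≢ + 0) neg0 f-bar f-rel

  -- Each factor equals 1 - η t^L, so this is the finite product (q^h; q^M)_L.
  signprod : ℕ → Carrier
  signprod zero = 1#
  signprod (suc L) = ((1# - η) + η * (1# - tp L)) * signprod L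

  sign-sum : ∀ S → Separated S → All (_≢ + 0) S → Sgn S F ≈ signprod (length S)
  sign-sum [] _ _ = refl
  sign-sum (z ∷ S) sep (n ∷ ns) = trans (sign-sum-step z S sep (n ∷ ns)) (*-congˡ (sign-sum S (proj₂ sep) ns))

  signprod-A : ∀ L → signprod L * A (+ h) ≈ A (+ (h N.+ M₀ N.* L))
  signprod-A zero = trans (*-identityˡ _) (reflexive (E.cong (λ k → A (+ k)) (E.sym (E.trans (E.cong (h N.+_) (NP.*-zeroʳ M₀)) (NP.+-identityʳ h)))))
  signprod-A (suc L) = begin
   _ ≈⟨ *-assoc _ _ _ ⟩
   _ ≈⟨ *-cong (trans (solve 2 (λ e t → (:1 :- e) :+ e :* (:1 :- t) := :1 :- e :* t) tt η (tp L)) (+-congˡ (-‿cong (trans (*-congˡ (tp≈qz L)) (sym (qz-+ (+ h) _)))))) (signprod-A L) ⟩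
   _ ≈⟨ Quasi.A-unstep M A A-step (+ s) (λ r → NP.<⇒≢ (NP.≤-trans h≥1 (NP.m≤m+n h _)) (E.sym (ZP.+-injective r))) ⟨
   _ ≈⟨ reflexive (E.cong (λ k → A (+ k)) (E.trans (NP.+-assoc h (M₀ N.* L) M₀) (E.cong (h N.+_) (E.trans (NP.+-comm (M₀ N.* L) M₀) (E.sym (NP.*-suc M₀ L)))))) ⟩
   _ ∎
   where s = h N.+ M₀ N.* L

  n<h : n N.< h
  n<h = E.subst (n N.<_) (NP.+-comm 1 (m N.+ n)) (N.s≤s (NP.m≤n+m n m))

  h<2h : h N.< h N.+ h
  h<2h = NP.m<m+n h h≥1

  module _ {p : ℕ} (p≥1 : 1 N.≤ p) (p<h : p N.< h) where
   nzh : NZℤ (+ h) (+ p)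
   nzh = NZ-range h p p≥1 p<h

   goodB : Good p
   goodB = record
    { p<M = Z.+<+ (NP.<-trans p<h h<2h)
    ; p+e≥1 = Z.+≤+ (E.subst (1 N.≤_) (E.sym (NP.+-identityʳ p)) p≥1)
    ; nz = λ k z → double (+ p Z.+ k Z.* + h) (nzh k) (E.trans (l₁ (+ p) k (+ h)) z)
    ; okp = λ ρ k z → nzh (+ 2 Z.* ρ Z.+ k) (E.trans (l₂ (+ p) ρ k (+ h)) z)
    ; okp′ = λ ρ k z → NZ-neg h (+ p) nzh (+ 2 Z.- + 2 Z.* ρ Z.+ k) (E.trans (l₃ (+ p) ρ k (+ h)) z) }
    where
    double : ∀ x → x ≢ + 0 → x Z.+ x ≢ + 0
    double (+ zero) n _ = n E.refl
    double (+ suc k) n ()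
    double -[1+ k ] n ()
    l₁ : ∀ p k h → (p Z.+ k Z.* h) Z.+ (p Z.+ k Z.* h) ≡ p Z.+ p Z.+ + 0 Z.+ k Z.* (h Z.+ h)
    l₁ = ZS.solve-∀
    l₂ : ∀ p ρ k h → p Z.+ (+ 2 Z.* ρ Z.+ k) Z.* h ≡ p Z.+ ρ Z.* (h Z.+ h) Z.+ k Z.* h
    l₂ = ZS.solve-∀
    l₃ : ∀ p ρ k h → Z.- p Z.+ (+ 2 Z.- + 2 Z.* ρ Z.+ k) Z.* h ≡ (Z.- (+ 0) Z.- (p Z.+ ρ Z.* (h Z.+ h)) Z.+ (h Z.+ h)) Z.+ k Z.* h
    l₃ = ZS.solve-∀

  good₂B : ∀ {p p'} → 1 N.≤ p → p N.< p' → p' N.< h → Good₂ p p'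
  good₂B {p} {p'} p≥1 p<p' p'<h =
   (NZ-range M₀ (p N.+ p' N.+ 0) (NP.≤-trans p≥1 (NP.≤-trans (NP.m≤m+n p p') (NP.m≤m+n _ 0))) (E.subst (N._< M₀) (E.sym (NP.+-identityʳ (p N.+ p'))) (NP.+-mono-< (NP.<-trans p<p' p'<h) p'<h))) ,
   (E.subst (NZℤ M) (pos-∸ (NP.<⇒≤ p<p')) (NZ-range M₀ (p' ∸ p) (NP.m<n⇒0<n∸m p<p') (NP.≤-<-trans (NP.m∸n≤m p' p) (NP.<-trans p'<h h<2h))))

  range : ∀ {k} → suc k N.≤ n → (1 N.≤ h ∸ suc k) × (h ∸ suc k N.< h)
  range {k} k<n = NP.m<n⇒0<n∸m (NP.≤-<-trans k<n n<h) , NP.∸-monoʳ-< {h} {suc k} {0} (N.s≤s N.z≤n) (NP.<⇒≤ (NP.≤-<-trans k<n n<h))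

  goodsB : GoodList psB
  goodsB = go n NP.≤-refl
   where
   later : ∀ j k → suc k N.≤ n → j N.≤ k → All (Good₂ (h ∸ suc k)) (map (λ k → h ∸ suc k) (down j))
   later zero k k<n j≤k = []
   later (suc j) k k<n j≤k = good₂B (proj₁ (range k<n)) (NP.∸-monoʳ-< {h} {suc k} {suc j} (N.s≤s j≤k) (NP.<⇒≤ (NP.≤-<-trans k<n n<h))) (proj₂ (range {j} (NP.≤-trans (NP.≤-trans j≤k (NP.n≤1+n k)) k<n))) ∷ later j k k<n (NP.<⇒≤ j≤k)
   go : ∀ k → k N.≤ n → GoodList (map (λ k → h ∸ suc k) (down k))
   go zero _ = []
   go (suc k) k<n = (goodB (proj₁ (range k<n)) (proj₂ (range k<n)) , later k k k<n NP.≤-refl) ∷ go k (NP.<⇒≤ k<n)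

  InClass : ℕ → ℤ → Set
  InClass p x = ∃ λ k → x ≡ + p Z.+ k Z.* M

  private
   prog-class : ∀ l z p → InClass p z → All (InClass p) (prog z l)
   prog-class zero z p c = []
   prog-class (suc l) z p (k , e) = (k , e) ∷ prog-class l (z Z.+ M) p (k Z.+ + 1 , E.trans (E.cong (Z._+ M) e) (lem (+ p) k M))
    where
    lem : ∀ p k m → p Z.+ k Z.* m Z.+ m ≡ p Z.+ (k Z.+ + 1) Z.* m
    lem = ZS.solve-∀

   sep-class : ∀ {p x y} → Good p → InClass p x → InClass p y → x ≢ y → Sep x y
   sep-class {p} g (k , E.refl) (k' , E.refl) n = n , λ r → Good.nz g (k Z.+ k') (E.trans (lem (+ p) k k' M) (E.trans (E.cong (λ x → x Z.- bar (+ p Z.+ k' Z.* M)) r) (ZP.+-inverseʳ (bar (+ p Z.+ k' Z.* M)))))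
    where
    lem : ∀ p k k' m → p Z.+ p Z.+ + 0 Z.+ (k Z.+ k') Z.* m ≡ (p Z.+ k Z.* m) Z.- (Z.- (+ 0) Z.- (p Z.+ k' Z.* m))
    lem = ZS.solve-∀

   sep-two : ∀ {p p' x y} → Good₂ p p' → InClass p x → InClass p' y → Sep x y
   sep-two {p} {p'} (g₁ , g₂) (k , E.refl) (k' , E.refl) =
    (λ r → g₂ (k' Z.- k) (E.trans (l₁ (+ p) (+ p') k k' M) (E.trans (E.cong (λ x → (+ p' Z.+ k' Z.* M) Z.- x) r) (ZP.+-inverseʳ (+ p' Z.+ k' Z.* M))))) ,
    (λ r → g₁ (k Z.+ k') (E.trans (l₂ (+ p) (+ p') k k' M) (E.trans (E.cong (λ x → x Z.- bar (+ p' Z.+ k' Z.* M)) r) (ZP.+-inverseʳ (bar (+ p' Z.+ k' Z.* M))))))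
    where
    l₁ : ∀ p p' k k' m → p' Z.- p Z.+ (k' Z.- k) Z.* m ≡ (p' Z.+ k' Z.* m) Z.- (p Z.+ k Z.* m)
    l₁ = ZS.solve-∀
    l₂ : ∀ p p' k k' m → p Z.+ p' Z.+ + 0 Z.+ (k Z.+ k') Z.* m ≡ (p Z.+ k Z.* m) Z.- (Z.- (+ 0) Z.- (p' Z.+ k' Z.* m))
    l₂ = ZS.solve-∀

   above : ∀ l z j → All (λ y → z ≢ y) (prog (z Z.+ + suc j Z.* M) l)
   above zero z j = []
   above (suc l) z j = (λ r → posM (ZP.+-injective (E.trans (ZP.pos-* (suc j) M₀) (E.trans (l₁ z (+ suc j Z.* M)) (E.trans (E.cong (Z._- z) (E.sym r)) (ZP.+-inverseʳ z)))))) ∷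
     E.subst (λ x → All (λ y → z ≢ y) (prog x l)) (l₂ z (+ suc j) M) (above l z (suc j))
    where
    posM : suc j N.* M₀ ≢ 0
    posM e = NP.<⇒≢ (NP.≤-trans M₀≥1 (NP.m≤m+n M₀ (j N.* M₀))) (E.sym e)
    l₁ : ∀ z x → x ≡ (z Z.+ x) Z.- z
    l₁ = ZS.solve-∀
    l₂ : ∀ z j m → z Z.+ (+ 1 Z.+ j) Z.* m ≡ (z Z.+ j Z.* m) Z.+ m
    l₂ = ZS.solve-∀

   sep-map : ∀ {p x} → Good p → InClass p x → ∀ {S} → All (InClass p) S → All (x ≢_) S → All (Sep x) S
   sep-map g c [] [] = []
   sep-map g c (d ∷ ds) (n ∷ ns) = sep-class g c d n ∷ sep-map g c ds ns

   self : ∀ {p x} → Good p → InClass p x → NonSelf x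
   self {p} g (k , E.refl) r = Good.nz g (k Z.+ k) (E.trans (lem (+ p) k M) (E.trans (E.cong (λ x → x Z.- bar (+ p Z.+ k Z.* M)) r) (ZP.+-inverseʳ (bar (+ p Z.+ k Z.* M)))))
    where
    lem : ∀ p k m → p Z.+ p Z.+ + 0 Z.+ (k Z.+ k) Z.* m ≡ (p Z.+ k Z.* m) Z.- (Z.- (+ 0) Z.- (p Z.+ k Z.* m))
    lem = ZS.solve-∀

   sep-prog : ∀ l z p T → Good p → InClass p z → (∀ {x} → InClass p x → All (Sep x) T) → Separated T → Separated (prog z l ++ T)
   sep-prog zero z p T g c h sT = sT
   sep-prog (suc l) z p T g c h sT = (self g c , All-++ (sep-map g c (prog-class l (z Z.+ M) p c′) (E.subst (λ x → All (z ≢_) (prog x l)) (E.cong (λ x → z Z.+ x) (ZP.*-identityˡ M)) (above l z 0))) (h c)) , sep-prog l (z Z.+ M) p T g c′ h sT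
    where
    lem : ∀ p k m → p Z.+ k Z.* m Z.+ m ≡ p Z.+ (k Z.+ + 1) Z.* m
    lem = ZS.solve-∀
    c′ : InClass p (z Z.+ M)
    c′ = proj₁ c Z.+ + 1 , E.trans (E.cong (Z._+ M) (proj₂ c)) (lem (+ p) (proj₁ c) M)

   origin-class : ∀ b p → InClass p (origin b (+ p))
   origin-class b p = Z.- (+ b) , lem (+ p) (+ b) M
    where
    lem : ∀ p b m → p Z.- b Z.* m ≡ p Z.+ (Z.- b) Z.* m
    lem = ZS.solve-∀

   cross-all : ∀ l b p ps → All (Good₂ p) ps → ∀ {x} → InClass p x → All (Sep x) (progs l (zs b ps))
   cross-all l b p [] _ c = []
   cross-all l b p (p' ∷ ps) (g ∷ gs) c = All-++ (All.map (λ d → sep-two g c d) (prog-class l (origin b (+ p')) p' (origin-class b p'))) (cross-all l b p ps gs c)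

  separated-progs : ∀ l b ps → GoodList ps → Separated (progs l (zs b ps))
  separated-progs l b [] _ = tt
  separated-progs l b (p ∷ ps) ((g , gs) ∷ G) = sep-prog l (origin b (+ p)) p (progs l (zs b ps)) g (origin-class b p) (cross-all l b p ps gs) (separated-progs l b ps G)

  nonzero-progs : ∀ l b ps → GoodList ps → All (_≢ + 0) (progs l (zs b ps))
  nonzero-progs l b [] _ = []
  nonzero-progs l b (p ∷ ps) ((g , _) ∷ G) = All-++ (All.map (λ { (k , E.refl) r → Good.okp g k (+ 0) (E.trans (ZP.+-identityʳ _) r) }) (prog-class l (origin b (+ p)) p (origin-class b p))) (nonzero-progs l b ps G)

  length-progs : ∀ l b ps → length (progs l (zs b ps)) ≡ length ps N.* l
  length-progs l b [] = E.refl
  length-progs l b (p ∷ ps) = E.trans (length-++ (prog (origin b (+ p)) l)) (E.cong₂ N._+_ (len l _) (length-progs l b ps))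
   where
   len : ∀ l z → length (prog z l) ≡ l
   len zero z = E.refl
   len (suc l) z = E.cong suc (len l _)

  length-psB : length psB ≡ n
  length-psB = E.trans (length-map _ (down n)) (D.length-down n)

  open Assemble A A₁ A-step (NZℤ (+ h)) (λ p p' → NZℤ M (p Z.+ p' Z.+ + 0) × NZℤ M (p' Z.- p)) (λ g → g)
    (λ p → Quasi.Θ (+ h) A₁ (Ainf-step h≢0) p)
    (λ c → qz (β c Z.+ proj₂ c Z.* + h) * (1# - qz (P c)))
    (λ p ρ g → SingleB.single-exact A₁ (Ainf-step h≢0) E.refl p g ρ) public
   using (KK; E₁-exact; Goods; []; _∷_; κ₂)

  KKB : Carrier
  KKB = KK (map +_ psB)

  private
   nz-of : ∀ {p} → Good p → NZℤ (+ h) (+ p)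
   nz-of {p} g k z = Good.okp g (+ 0) k (E.trans (lem (+ p) k (+ h)) z)
    where
    lem : ∀ p k h → p Z.+ (+ 0) Z.* (h Z.+ h) Z.+ k Z.* h ≡ p Z.+ k Z.* h
    lem = ZS.solve-∀

   goods : ∀ b ps rs → GoodList ps → Goods (cl b ps rs)
   goods b [] rs _ = []
   goods b (p ∷ ps) [] _ = []
   goods b (p ∷ ps) (r ∷ rs) ((g , gs) ∷ G) = (nz-of g , later ps rs gs) ∷ goods b ps rs G
    where
    later : ∀ ps rs → All (Good₂ p) ps → All (λ d → NZℤ M (+ p Z.+ proj₁ d Z.+ + 0) × NZℤ M (proj₁ d Z.- + p)) (cl b ps rs)
    later [] rs _ = []
    later (_ ∷ ps) [] _ = []
    later (_ ∷ ps) (_ ∷ rs) (g ∷ gs) = g ∷ later ps rs gs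

  open WeightedSum (λ _ → + 0) (+ 0) (λ _ → nonNeg 0) (λ y → E.sym (E.trans (ZP.+-identityˡ _) (ZP.*-zeroˡ (y Z.+ y Z.+ + 0)))) (λ _ → E.refl) (λ _ → E.refl) using (g; wt; main-sum)

  -- The same sign sum is evaluated twice, as a lattice sum and by `sign-sum`. Multiplying the
  -- finite product by `A (+ h)`, the inverse of the corresponding infinite product, leaves only a
  -- tail that is 1 modulo q^D.
  product-B : ∀ {D} → 1 N.≤ D → ∀ b → D N.+ D N.≤ b → KKB * D.SB b * A (+ h) ≈[ D ] 1#
  product-B {D} D≥1 b big = ≈[]-trans (≈⇒≈[] (*-comm _ _)) (≈[]-trans (≈[]-*ˡ (Int-Ainf _ _) (≈[]-sym sum)) (≈[]-trans (≈⇒≈[] prod) (A-big (+ (h N.+ M₀ N.* Lp)) (Z.+≤+ large))))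
   where
   Lp = length (progs (b N.+ b) (zs b psB))
   cs : List ℕ → List Class
   cs rs = cl b psB rs
   y : Class → Carrier
   y c = qz (β c Z.+ proj₂ c Z.* + h) * (1# - qz (P c))
   wt1 : ∀ cs → wt cs ≈ 1#
   wt1 cs = trans (Π-cong cs (λ c → trans (qz-cong (ZP.*-zeroˡ (β c))) qz-0)) (Π-1 cs)
   lem : ∀ b x n → (b Z.+ x) Z.+ (n Z.* b Z.- b) ≡ n Z.* b Z.+ x
   lem = ZS.solve-∀
   term : ∀ rs → length psB ≡ length rs → wt (cs rs) * E₁ A A₁ (vl (cs rs)) ≈ KKB * (Π (cs rs) D.uB * V (cs rs))
   term rs l = begin
    _ ≈⟨ trans (*-cong (wt1 (cs rs)) (E₁-exact (cs rs) (goods b psB rs goodsB))) (*-identityˡ _) ⟩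
    _ ≈⟨ *-cong (reflexive (E.cong KK (cl-firsts b psB rs l))) (*-congʳ (Π-cong (cs rs) (λ c → trans (*-congˡ (qz-cong (E.cong (λ k → + k Z.* β c Z.- β c) (E.trans (length-cl b psB rs l) length-psB))))
       (trans (solve 3 (λ x y z → (x :* y) :* z := (x :* z) :* y) tt (qz (β c Z.+ proj₂ c Z.* + h)) (1# - qz (P c)) (qz (+ n Z.* β c Z.- β c))) (*-congʳ (trans (sym (qz-+ _ _)) (qz-cong (lem (β c) (proj₂ c Z.* + h) (+ n))))))))) ⟩
    _ ∎
   sum : Sgn (progs (b N.+ b) (zs b psB)) (λ Y → Π Y g * F Y) ≈[ D ] KKB * D.SB b
   sum = ≈[]-trans (main-sum D≥1 b big psB goodsB) (≈⇒≈[] (begin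
    _ ≈⟨ ΣL-cong (b N.+ b) (length psB) (λ rs l _ → term rs (E.sym l)) ⟩
    _ ≈⟨ ΣL-* (b N.+ b) (length psB) KKB (λ rs → Π (cs rs) D.uB * V (cs rs)) ⟩
    _ ≈⟨ *-congˡ (reflexive (E.cong (λ k → ΣL (b N.+ b) k (λ rs → Π (cs rs) D.uB * V (cs rs))) length-psB)) ⟩
    KKB * D.SB b ∎))
   prod : A (+ h) * Sgn (progs (b N.+ b) (zs b psB)) (λ Y → Π Y g * F Y) ≈ A (+ (h N.+ M₀ N.* Lp))
   prod = begin
    _ ≈⟨ *-congˡ (trans (Sgn-cong (progs (b N.+ b) (zs b psB)) (λ {Y} _ → trans (*-congʳ (trans (Π-cong Y (λ _ → qz-0)) (Π-1 Y))) (*-identityˡ _))) (sign-sum _ (separated-progs (b N.+ b) b psB goodsB) (nonzero-progs (b N.+ b) b psB goodsB))) ⟩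
    _ ≈⟨ *-comm _ _ ⟩
    _ ≈⟨ signprod-A Lp ⟩
    _ ∎
   large : D N.≤ h N.+ M₀ N.* Lp
   large = NP.≤-trans (NP.≤-trans (NP.≤-trans (NP.m≤m+n D D) big) (NP.≤-trans (NP.m≤m+n b b)
    (E.subst (b N.+ b N.≤_) (E.sym (E.trans (length-progs (b N.+ b) b psB) (E.cong (N._* (b N.+ b)) length-psB))) (E.subst (N._≤ n N.* (b N.+ b)) (NP.*-identityˡ _) (NP.*-monoˡ-≤ (b N.+ b) n≥1)))))
    (NP.≤-trans (E.subst (N._≤ M₀ N.* Lp) (NP.*-identityˡ Lp) (NP.*-monoˡ-≤ Lp M₀≥1)) (NP.m≤n+m _ h))

-- From iterated branching to the sign sum of type C

module LittlewoodSum where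
 open import Data.Nat.DivMod using (_%_; [m+kn]%n≡m%n; m<n⇒m%n≡m)
 open import Data.List.Properties using (++-assoc)
 open import Data.List.Relation.Unary.All.Properties using () renaming (++⁺ to All-++)
 open import Data.List.Relation.Binary.Permutation.Propositional as Perm using (_↭_; prep; swap)
 open import Data.List.Relation.Binary.Permutation.Propositional.Properties using (++-comm) renaming (++⁺ to ↭-++)
 open SymplecticSide
 open OrthogonalSide

 rng : ℕ → ℕ → List ℕ
 rng a zero = []
 rng a (suc l) = a ∷ rng (suc a) l

 rng-∷ʳ : ∀ a l → rng a (suc l) ≡ rng a l ++ (a N.+ l ∷ [])
 rng-∷ʳ a zero = E.cong (_∷ []) (E.sym (NP.+-identityʳ a))
 rng-∷ʳ a (suc l) = E.cong (a ∷_) (E.trans (rng-∷ʳ (suc a) l) (E.cong (λ x → rng (suc a) l ++ (x ∷ [])) (E.sym (NP.+-suc a l))))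

 dup : List ℕ → List ℕ
 dup [] = []
 dup (r ∷ rs) = r ∷ r ∷ dup rs

 total : List ℕ → ℕ
 total [] = 0
 total (r ∷ rs) = r N.+ total rs

 module Link (Q : QRing) (I : InfProd Q) (n : ℕ) (n≥1 : 1 N.≤ n) where
  module TC = TypeC Q I n n≥1
  open TC using (f; F; zs; KKC; module BL)
  private module D₀ = Duality Q n 0 n≥1
  open D₀ using (dbl≢0; down; psC)
  open LatticeSum Q n (dbl≢0 n≥1) (+ 1) using (Carrier; _≈_; _+_; _*_; -_; _-_; 0#; 1#; begin_; _≈⟨_⟩_; _≈⟨_⟨_; _∎; refl; sym; trans; reflexive; solve; _:=_; _:+_; _:*_; _:-_; :-_; :1; :0; _≈[_]_; R; []; _∷_; 0-*ʳ; 0-+; AllGeneric; Distinct; Flip; HL; HL-prog; Int-0; Int-HL; Int-Tm; M; M₀≥1; NonNeg; Sep; Separated; Sgn; Sgn-flip; Sgn-↭; Spl; Spl-*; Spl-+; Spl-0; Spl-cong; Tm; V; W; b; bar; bar-prog; flip; le; length-split; nonNeg; origin; pow; prog; progs; qz-cong; qz≈[]0; same; sh; sh-origin; sm; sumTo; sumTo-0; sumTo-cong; sumTo-mod; t; w; xs; Π; Π-1; Π-↭; ΣL; ΣL-*; ΣL-cong; ΣL-mod; δ; δ-cong; ≈[]-*ˡ; ≈[]-+; ≈[]-refl; ≈[]-sym; ≈[]-trans; ≈⇒≈[]; +-cong; +-congˡ; *-cong; *-congˡ; *-congʳ; +-assoc; *-assoc; +-comm; +-identityˡ; +-identityʳ;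 *-identityˡ; *-identityʳ; zeroˡ; qz; qz-0; qz-+; a; Int; Int-+; Int-*; Int-qz; module Progressions)

  N : ℕ
  N = n N.+ n

  instance
   N-nonZero : N.NonZero N
   N-nonZero = N.≢-nonZero (dbl≢0 n≥1)

  SL : ℕ → List ℕ → List ℤ
  SL b [] = []
  SL b (c ∷ cs) = prog (+ c) b ++ SL b cs

  Res : ℕ → ℤ → Set
  Res c x = ∃ λ i → x ≡ + (c N.+ i N.* N)

  private
   residue : ∀ {c c' i j} → c N.< N → c' N.< N → c N.+ i N.* N ≡ c' N.+ j N.* N → c ≡ c'
   residue {c} {c'} {i} {j} p p' e = E.trans (E.sym (E.trans ([m+kn]%n≡m%n c i N) (m<n⇒m%n≡m p))) (E.trans (E.cong (_% N) e) (E.trans ([m+kn]%n≡m%n c' j N) (m<n⇒m%n≡m p')))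

   prog-res : ∀ b c i → All (Res c) (prog (+ (c N.+ i N.* N)) b)
   prog-res zero c i = []
   prog-res (suc b) c i = (i , E.refl) ∷ E.subst (λ x → All (Res c) (prog (+ x) b)) (E.trans (E.cong (c N.+_) (NP.+-comm N (i N.* N))) (E.sym (NP.+-assoc c (i N.* N) N))) (prog-res b c (suc i))

   prog-res₀ : ∀ b c → All (Res c) (prog (+ c) b)
   prog-res₀ b c = E.subst (λ x → All (Res c) (prog (+ x) b)) (NP.+-identityʳ c) (prog-res b c 0)

   Far : ℤ → ℤ → Set
   Far x y = (x ≢ y) × (x Z.- M ≢ y)

   far-res : ∀ {c c' x y} → c N.< N → c' N.< N → c ≢ c' → Res c x → Res c' y → Far x y
   far-res {c} {c'} p p' ne (i , E.refl) (j , E.refl) =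
    (λ r → ne (residue {i = i} {j} p p' (ZP.+-injective r))) ,
    (λ r → ne (residue {i = i} {suc j} p p' (ZP.+-injective (E.trans (l (+ (c N.+ i N.* N)) M) (E.trans (E.cong (Z._+ M) r) (E.cong +_ (E.trans (NP.+-assoc c' (j N.* N) N) (E.cong (c' N.+_) (NP.+-comm (j N.* N) N)))))))))
    where
    l : ∀ x m → x ≡ (x Z.- m) Z.+ m
    l = ZS.solve-∀

   far-up : ∀ b z k → All (Far (+ z)) (prog (+ (z N.+ N N.+ k)) b)
   far-up zero z k = []
   far-up (suc b) z k = ((λ r → NP.<⇒≢ lt (ZP.+-injective r)) , (λ r → NP.<⇒≢ (NP.<-≤-trans lt (NP.m≤m+n _ N)) (ZP.+-injective (E.trans (l (+ z) M) (E.cong (Z._+ M) r))))) ∷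
     E.subst (λ x → All (Far (+ z)) (prog (+ x) b)) (E.sym (NP.+-assoc (z N.+ N) k N)) (far-up b z (k N.+ N))
    where
    l : ∀ x m → x ≡ (x Z.- m) Z.+ m
    l = ZS.solve-∀
    lt : z N.< z N.+ N N.+ k
    lt = NP.<-≤-trans (NP.m<m+n z M₀≥1) (NP.m≤m+n _ k)

   FarList : List ℤ → Set
   FarList [] = ⊤
   FarList (x ∷ S) = All (Far x) S × FarList S

   far⇒generic : ∀ S → FarList S → AllGeneric S
   far⇒distinct : ∀ S → FarList S → Distinct S
   far⇒distinct [] _ = tt
   far⇒distinct (x ∷ S) (p , ps) = All.map proj₁ p , far⇒distinct S ps
   far⇒generic [] _ = []
   far⇒generic (x ∷ S) (p , ps) = (far⇒distinct S ps , All.map proj₁ p , All.map proj₂ p) ∷ far⇒generic S ps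

   far-prog : ∀ b z T → (∀ i → All (Far (+ (z N.+ i N.* N))) T) → FarList T → FarList (prog (+ z) b ++ T)
   far-prog zero z T h fT = fT
   far-prog (suc b) z T h fT = All-++ (E.subst (λ x → All (Far (+ z)) (prog (+ x) b)) (NP.+-identityʳ (z N.+ N)) (far-up b z 0)) (E.subst (λ x → All (Far (+ x)) T) (NP.+-identityʳ z) (h 0)) ,
    far-prog b (z N.+ N) T (λ i → E.subst (λ x → All (Far (+ x)) T) (E.sym (NP.+-assoc z N (i N.* N))) (h (suc i))) fT

   far-SL : ∀ b c cs → c N.< N → All (N._< N) cs → All (c ≢_) cs → ∀ i → All (Far (+ (c N.+ i N.* N))) (SL b cs)
   far-SL b c [] p _ _ i = []
   far-SL b c (c' ∷ cs) p (q ∷ qs) (e ∷ es) i = All-++ (All.map (λ r → far-res p q e (i , E.refl) r) (prog-res₀ b c')) (far-SL b c cs p qs es i)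

   rng< : ∀ a l → a N.+ l N.≤ N → All (N._< N) (rng a l)
   rng< a zero p = []
   rng< a (suc l) p = NP.<-≤-trans (NP.m<m+n a (N.s≤s N.z≤n)) p ∷ rng< (suc a) l (E.subst (N._≤ N) (NP.+-suc a l) p)

   rng≢ : ∀ c a l → c N.< a → All (c ≢_) (rng a l)
   rng≢ c a zero p = []
   rng≢ c a (suc l) p = NP.<⇒≢ p ∷ rng≢ c (suc a) l (NP.m<n⇒m<1+n p)

   far-rng : ∀ b a l → a N.+ l N.≤ N → FarList (SL b (rng a l))
   far-rng b a zero p = tt
   far-rng b a (suc l) p with rng< a (suc l) p
   ... | q ∷ qs = far-prog b a (SL b (rng (suc a) l)) (far-SL b a (rng (suc a) l) q qs (rng≢ a (suc a) l NP.≤-refl)) (far-rng b (suc a) l (E.subst (N._≤ N) (NP.+-suc a l) p))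

  nonneg-SL : ∀ b cs → All NonNeg (SL b cs)
  nonneg-SL b [] = []
  nonneg-SL b (c ∷ cs) = All-++ (go b c) (nonneg-SL b cs)
   where
   go : ∀ b c → All NonNeg (prog (+ c) b)
   go zero c = []
   go (suc b) c = nonNeg c ∷ go b (c N.+ N)

  S : ℕ → List ℤ
  S b = SL b (rng 0 N)

  private
   bar<0 : ∀ {x} → NonNeg x → ∀ {y} → NonNeg y → x ≢ bar y
   bar<0 (nonNeg k) (nonNeg zero) ()
   bar<0 (nonNeg k) (nonNeg (suc j)) ()

   separated : ∀ S → FarList S → All NonNeg S → Separated S
   separated [] _ _ = tt
   separated (x ∷ S) (p , ps) (n ∷ ns) = (bar<0 n n , go p ns) , separated S ps ns
    where
    go : ∀ {T} → All (Far x) T → All NonNeg T → All (Sep x) T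
    go [] [] = []
    go (q ∷ qs) (m ∷ ms) = (proj₁ q , bar<0 n m) ∷ go qs ms

  nice-S : ∀ b → BL.Nice (S b)
  nice-S b = separated (S b) (far-rng b 0 N NP.≤-refl) (nonneg-SL b (rng 0 N)) , All.universal (λ _ → tt) _

  -- A product of closed-form branching matrices, one for each residue class of exponents. The final
  -- factor `HL c []` is 1 if all columns are empty and 0 otherwise.
  LL : ℕ → List ℕ → List ℕ → Carrier
  LL B [] c = HL c []
  LL B (k ∷ ks) c = ΣL B (length c) (λ d → Tm (+ k) c d * LL B ks d)

  HL≈LL : ∀ {D} b B l a → a N.+ l N.≤ N → D N.≤ b → ∀ c → All (N._≤ B) c → HL c (SL b (rng a l)) ≈[ D ] LL B (rng a l) c
  HL≈LL b B zero a p D≤b c q = ≈[]-refl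
  HL≈LL {D} b B (suc l) a p D≤b c q = ≈[]-trans
   (HL-prog b a B c (SL b (rng (suc a) l)) (NP.≤-trans D≤b (NP.≤-trans (E.subst (N._≤ b N.* N) (NP.*-identityʳ b) (NP.*-monoʳ-≤ b M₀≥1)) (NP.m≤n+m _ a))) q (nonneg-SL b (rng (suc a) l)) (far⇒generic _ (far-rng b a (suc l) p)))
   (ΣL-mod B (length c) (λ d _ q' → ≈[]-*ˡ (Int-Tm a c d) (HL≈LL b B l (suc a) (E.subst (N._≤ N) (NP.+-suc a l) p) D≤b d q')))

  -- Summing over the doubled columns gives the bounded Littlewood sum.
  private
   Spl-full : ∀ K (h : List ℤ → List ℤ → Carrier) → Spl K (λ A B → δ (length A) (length K) * h A B) ≈ h K []
   Spl-full [] h = *-identityˡ _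
   Spl-full (k ∷ K) h = trans (+-cong (Spl-full K (λ A B → h (k ∷ A) B)) (trans (Spl-cong K (λ {A} {B} s → trans (*-congʳ (δ< (length A) (suc (length K)) (N.s≤s (E.subst (length A N.≤_) (length-split s) (NP.m≤m+n _ _))))) (zeroˡ _))) (Spl-0 K))) (+-identityʳ _)
    where
    δ< : ∀ m n → m N.< n → δ m n ≈ 0#
    δ< zero (suc n) _ = refl
    δ< (suc m) (suc n) (N.s≤s p) = δ< m n p

  -- The second column has as many boxes as the set K chosen by the first, so it must take all of K.
  HL-double : ∀ c cs T → HL (c ∷ c ∷ cs) T ≈ Spl T (λ K J → δ (length K) c * (xs K * W K J * (xs K * HL cs K)))
  HL-double c cs T = Spl-cong T (λ {K} {J} _ → δ-cong (length K) c (λ l → *-congˡ (begin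
   _ ≈⟨ reflexive (E.cong (λ k → Spl K (λ A B → δ (length A) k * (xs A * W A B * HL cs A))) (E.sym l)) ⟩
   _ ≈⟨ Spl-full K _ ⟩
   _ ≈⟨ *-congʳ (trans (*-congˡ (Π-1 K)) (*-identityʳ _)) ⟩
   _ ∎)))

  private
   sq : ∀ K → qz (+ length K) * (xs K * xs K) ≈ Π K (λ i → qz (sm i i))
   sq [] = trans (*-cong qz-0 (*-identityˡ _)) (*-identityˡ _)
   sq (k ∷ K) = begin
    _ ≈⟨ *-congʳ (qz-+ (+ 1) (+ length K)) ⟩
    _ ≈⟨ solve 4 (λ o l q x → (o :* l) :* ((q :* x) :* (q :* x)) := (q :* q :* o) :* (l :* (x :* x))) tt (qz (+ 1)) (qz (+ length K)) (qz k) (xs K) ⟩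
    _ ≈⟨ *-cong (trans (*-congʳ (sym (qz-+ k k))) (sym (qz-+ _ _))) (sq K) ⟩
    _ ∎

   sum-δ : ∀ B k x → k N.< B → sumTo B (λ c → δ k c * x) ≈ x
   sum-δ (suc B) zero x _ = trans (+-cong (*-identityˡ _) (trans (sumTo-cong B (λ _ _ → zeroˡ x)) (sumTo-0 B))) (+-identityʳ _)
   sum-δ (suc B) (suc k) x (N.s≤s p) = trans (+-cong (zeroˡ _) (sum-δ B k x p)) (+-identityˡ _)

   sum-Spl : ∀ {X : Set} B (T : List X) (u : ℕ → List X → List X → Carrier) → sumTo B (λ c → Spl T (u c)) ≈ Spl T (λ K J → sumTo B (λ c → u c K J))
   sum-Spl zero T u = sym (Spl-0 T)
   sum-Spl (suc B) T u = trans (+-congˡ (sum-Spl B T (λ c → u (suc c)))) (sym (Spl-+ T _ _))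

   ΣL-Spl : ∀ {X : Set} B k (T : List X) (u : List ℕ → List X → List X → Carrier) → ΣL B k (λ r → Spl T (u r)) ≈ Spl T (λ K J → ΣL B k (λ r → u r K J))
   ΣL-Spl B zero T u = refl
   ΣL-Spl B (suc k) T u = trans (sumTo-cong (suc B) (λ c _ → ΣL-Spl B k T (λ r → u (c ∷ r)))) (sum-Spl (suc B) T (λ c K J → ΣL B k (λ r → u (c ∷ r) K J)))

  -- Summing over the column length c removes the condition |K| = c, provided B reaches the size of
  -- the alphabet. The factor q^c supplies one q for each element of K, which turns q^(2i) into the
  -- weight q^(2i+1).
  ΣΦ : ∀ m B T → length T N.≤ B → ΣL B m (λ r → qz (+ total r) * HL (dup r) T) ≈ BL.Φ m T
  ΣΦ zero B T le = trans (*-congʳ qz-0) (*-identityˡ _)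
  ΣΦ (suc m) B T le = begin
   _ ≈⟨ sumTo-cong (suc B) (λ c _ → trans (ΣL-cong B m (λ r _ _ → trans (*-congˡ (HL-double c (dup r) T)) (sym (Spl-* T _ _)))) (ΣL-Spl B m T (λ r K J → qz (+ (c N.+ total r)) * (δ (length K) c * (xs K * W K J * (xs K * HL (dup r) K)))))) ⟩
   _ ≈⟨ sum-Spl (suc B) T (λ c K J → ΣL B m (λ r → qz (+ (c N.+ total r)) * (δ (length K) c * (xs K * W K J * (xs K * HL (dup r) K))))) ⟩
   _ ≈⟨ Spl-cong T (λ {K} {J} s → each K J (NP.≤-trans (E.subst (length K N.≤_) (length-split s) (NP.m≤m+n _ _)) le)) ⟩
   _ ∎
   where
   each : ∀ K J → length K N.≤ B → sumTo (suc B) (λ c → ΣL B m (λ r → qz (+ (c N.+ total r)) * (δ (length K) c * (xs K * W K J * (xs K * HL (dup r) K))))) ≈ Π K (λ i → qz (sm i i)) * BL.Φ m K * W K J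
   each K J le′ = begin
    _ ≈⟨ sumTo-cong (suc B) (λ c _ → trans (ΣL-cong B m (λ r _ _ → trans (comm₃ (qz (+ (c N.+ total r))) (δ (length K) c) (xs K * W K J * (xs K * HL (dup r) K))) (δ-cong (length K) c (λ l → *-congʳ (qz-cong (E.cong (λ k → + (k N.+ total r)) (E.sym l))))))) (ΣL-* B m (δ (length K) c) (λ r → qz (+ (length K N.+ total r)) * (xs K * W K J * (xs K * HL (dup r) K))))) ⟩
    _ ≈⟨ sum-δ (suc B) (length K) (ΣL B m (λ r → qz (+ (length K N.+ total r)) * (xs K * W K J * (xs K * HL (dup r) K)))) (N.s≤s le′) ⟩
    _ ≈⟨ ΣL-cong B m (λ r _ _ → trans (*-congʳ (qz-+ (+ length K) (+ total r))) (solve 5 (λ l t x w h → (l :* t) :* (x :* w :* (x :* h)) := ((l :* (x :* x)) :* w) :* (t :* h)) tt (qz (+ length K)) (qz (+ total r)) (xs K) (W K J) (HL (dup r) K))) ⟩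
    _ ≈⟨ trans (ΣL-* B m _ (λ r → qz (+ total r) * HL (dup r) K)) (*-cong (*-congʳ (sq K)) (ΣΦ m B K le′)) ⟩
    _ ≈⟨ solve 3 (λ x y z → x :* y :* z := x :* z :* y) tt (Π K (λ i → qz (sm i i))) (W K J) (BL.Φ m K) ⟩
    _ ∎
    where
    comm₃ : ∀ x y z → x * (y * z) ≈ y * (x * z)
    comm₃ = solve 3 (λ x y z → x :* (y :* z) := y :* (x :* z)) tt

  LHS : ℕ → ℕ → Carrier
  LHS m B = ΣL B m (λ r → qz (+ total r) * LL B (rng 0 N) (dup r))

  private
   tail : ∀ {D} B k (g : ℕ → Carrier) → (∀ i → B N.≤ i → g i ≈[ D ] 0#) → sumTo (B N.+ k) g ≈[ D ] sumTo B g
   tail zero zero g h = ≈[]-refl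
   tail zero (suc k) g h = 0-+ (h 0 N.z≤n) (tail zero k (λ i → g (suc i)) (λ i _ → h (suc i) N.z≤n))
   tail (suc B) k g h = ≈[]-+ ≈[]-refl (tail B k (λ i → g (suc i)) (λ i q → h (suc i) (N.s≤s q)))

  Int-sumTo : ∀ k {g : ℕ → Carrier} → (∀ i → Int (g i)) → Int (sumTo k g)
  Int-sumTo zero h = Int-0
  Int-sumTo (suc k) h = Int-+ (h 0) (Int-sumTo k (λ i → h (suc i)))

  Int-ΣL : ∀ B k {g : List ℕ → Carrier} → (∀ r → Int (g r)) → Int (ΣL B k g)
  Int-ΣL B zero h = h []
  Int-ΣL B (suc k) h = Int-sumTo (suc B) (λ i → Int-ΣL B k (λ r → h (i ∷ r)))

  -- A list with an entry above B carries a power of q exceeding q^B.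
  enlarge : ∀ {D} m B k (u : List ℕ → Carrier) → D N.≤ B → (∀ r → Int (u r)) →
       ΣL (B N.+ k) m (λ r → qz (+ total r) * u r) ≈[ D ] ΣL B m (λ r → qz (+ total r) * u r)
  enlarge zero B k u p i = ≈[]-refl
  enlarge {D} (suc m) B k u p i = ≈[]-trans
   (tail (suc B) k (λ c → ΣL (B N.+ k) m (λ r → qz (+ (c N.+ total r)) * u (c ∷ r)))
    (λ c q → ≈[]-trans (≈⇒≈[] (pull (B N.+ k) c)) (0-*ʳ (Int-ΣL (B N.+ k) m (λ r → Int-* (Int-qz _) (i (c ∷ r)))) (qz≈[]0 c (NP.≤-trans p (NP.<⇒≤ q))))))
   (sumTo-mod (suc B) (λ c _ → ≈[]-trans (≈⇒≈[] (pull (B N.+ k) c)) (≈[]-trans (≈[]-*ˡ (Int-qz c) (enlarge m B k (λ r → u (c ∷ r)) p (λ r → i (c ∷ r)))) (≈⇒≈[] (sym (pull B c))))))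
   where
   pull : ∀ B c → ΣL B m (λ r → qz (+ (c N.+ total r)) * u (c ∷ r)) ≈ qz (+ c) * ΣL B m (λ r → qz (+ total r) * u (c ∷ r))
   pull B c = trans (ΣL-cong B m (λ r _ _ → trans (*-congʳ (qz-+ (+ c) (+ total r))) (*-assoc _ _ _))) (ΣL-* B m (qz (+ c)) (λ r → qz (+ total r) * u (c ∷ r)))

  Int-LHS : ∀ m B → Int (LHS m B)
  Int-LHS m B = Int-ΣL B m (λ r → Int-* (Int-qz _) (Int-LL (rng 0 N) (dup r)))
   where
   Int-LL : ∀ ks c → Int (LL B ks c)
   Int-LL [] c = Int-HL c [] []
   Int-LL (k ∷ ks) c = Int-ΣL B (length c) (λ d → Int-* (Int-Tm k c d) (Int-LL ks d))

  LHS≈Φ : ∀ {D} m b B → D N.≤ b → D N.≤ B → LHS m B ≈[ D ] BL.Φ m (S b)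
  LHS≈Φ {D} m b B D≤b D≤B = ≈[]-trans
   (ΣL-mod B m (λ r _ q → ≈[]-*ˡ (Int-qz (total r)) (≈[]-sym (HL≈LL b B N 0 NP.≤-refl D≤b (dup r) (dup≤ r q)))))
   -- `ΣΦ` needs entries up to the size of the alphabet, hence the larger range.
   (≈[]-trans (≈[]-sym (enlarge m B (length (S b)) (λ r → HL (dup r) (S b)) D≤B (λ r → Int-HL (dup r) (S b) (nonneg-SL b (rng 0 N)))))
    (≈⇒≈[] (ΣΦ m (B N.+ length (S b)) (S b) (NP.m≤n+m _ B))))
   where
   dup≤ : ∀ r → All (N._≤ B) r → All (N._≤ B) (dup r)
   dup≤ [] [] = []
   dup≤ (x ∷ r) (p ∷ ps) = p ∷ p ∷ dup≤ r ps

  private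
   SL-↭ : ∀ b {cs ds} → cs ↭ ds → SL b cs ↭ SL b ds
   SL-↭ b Perm.refl = Perm.refl
   SL-↭ b (prep c p) = ↭-++ (Perm.refl {xs = prog (+ c) b}) (SL-↭ b p)
   SL-↭ b (swap {xs = cs} {ys = ds} c d p) = Perm.trans (Perm.↭-reflexive (E.sym (++-assoc (prog (+ c) b) (prog (+ d) b) (SL b cs)))) (Perm.trans (↭-++ (++-comm (prog (+ c) b) (prog (+ d) b)) (SL-↭ b p)) (Perm.↭-reflexive (++-assoc (prog (+ d) b) (prog (+ c) b) (SL b ds))))
   SL-↭ b (Perm.trans p q) = Perm.trans (SL-↭ b p) (SL-↭ b q)

   pairIx : List ℕ → List ℕ
   pairIx [] = []
   pairIx (k ∷ ks) = (n N.+ k) ∷ (n ∸ suc k) ∷ pairIx ks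

   pairIx-↭ : ∀ k → k N.≤ n → pairIx (down k) ↭ rng (n ∸ k) (k N.+ k)
   pairIx-↭ zero _ = Perm.refl
   pairIx-↭ (suc k) p = Perm.trans (prep (n N.+ k) (prep (n ∸ suc k) (pairIx-↭ k (NP.<⇒≤ p))))
    (Perm.trans (swap (n N.+ k) (n ∸ suc k) Perm.refl)
    (Perm.trans (prep (n ∸ suc k) (++-comm ((n N.+ k) ∷ []) (rng (n ∸ k) (k N.+ k))))
    (Perm.↭-reflexive (E.trans (E.cong₂ (λ x y → (n ∸ suc k) ∷ (rng x (k N.+ k) ++ (y ∷ []))) e₁ e₂) (E.trans (E.cong ((n ∸ suc k) ∷_) (E.sym (rng-∷ʳ (suc (n ∸ suc k)) (k N.+ k)))) (E.cong (λ l → rng (n ∸ suc k) (suc l)) (E.sym (NP.+-suc k k))))))))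
    where
    e₁ : n ∸ k ≡ suc (n ∸ suc k)
    e₁ = NP.+-∸-assoc 1 p
    e₂ : n N.+ k ≡ suc (n ∸ suc k) N.+ (k N.+ k)
    e₂ = E.trans (E.cong (N._+ k) (E.sym (NP.m∸n+n≡m (NP.<⇒≤ p)))) (E.trans (NP.+-assoc (n ∸ k) k k) (E.cong (N._+ (k N.+ k)) e₁))

   prog-++ : ∀ k l z → prog z (k N.+ l) ≡ prog z k ++ prog (sh z k) l
   prog-++ zero l z = E.refl
   prog-++ (suc k) l z = E.cong (z ∷_) (prog-++ k l (z Z.+ M))

   Flip-map : ∀ T {U V} → Flip U V → Flip (T ++ U) (map bar T ++ V)
   Flip-map [] f = f
   Flip-map (t ∷ T) f = flip (Flip-map T f)

   Flip-++ : ∀ T {U V} → Flip U V → Flip (T ++ U) (T ++ V)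
   Flip-++ [] f = f
   Flip-++ (t ∷ T) f = same (Flip-++ T f)

   -- The chain through p = n - 1 - k has b negative positions. Their reflections form the
   -- progression that starts at n + k, since bar p + M = n + k. So the n centred chains are the 2n
   -- residue classes of the alphabet 1, q, q², ..., up to signs and order.
   chain : ∀ b ks → All (N._< n) ks → ∃ λ T → Flip (progs (b N.+ b) (zs b (map (λ k → n ∸ suc k) ks))) T × T ↭ SL b (pairIx ks)
   chain b [] _ = [] , [] , Perm.refl
   chain b (k ∷ ks) (p ∷ ps) with chain b ks ps
   ... | T , fl , pe = map bar (prog z b) ++ (prog (sh z b) b ++ T) ,
     E.subst (λ x → Flip x (map bar (prog z b) ++ (prog (sh z b) b ++ T))) (E.sym (E.trans (E.cong (_++ progs (b N.+ b) (zs b (map (λ k → n ∸ suc k) ks))) (prog-++ b b z)) (++-assoc (prog z b) (prog (sh z b) b) _)))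
      (Flip-map (prog z b) (Flip-++ (prog (sh z b) b) fl)) ,
     ↭-++ (Perm.trans (bar-prog z b) (Perm.↭-reflexive (E.cong (λ x → prog x b) e₂))) (↭-++ (Perm.↭-reflexive (E.cong (λ x → prog x b) e₁)) pe)
    where
    z = origin b (+ (n ∸ suc k))
    l₁ : ∀ p b m → p Z.+ (b Z.- b) Z.* m ≡ p
    l₁ = ZS.solve-∀
    l₂ : ∀ n k → Z.- (+ 1) Z.- (n Z.- (+ 1 Z.+ k)) Z.+ (n Z.+ n) ≡ n Z.+ k
    l₂ = ZS.solve-∀
    e₁ : sh z b ≡ + (n ∸ suc k)
    e₁ = E.trans (sh-origin b (+ (n ∸ suc k)) b) (l₁ (+ (n ∸ suc k)) (+ b) M)
    e₂ : bar (sh z b) Z.+ M ≡ + (n N.+ k)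
    e₂ = E.trans (E.cong (λ x → bar x Z.+ M) (E.trans e₁ (pos-∸ p))) (l₂ (+ n) (+ k))

  module _ (m : ℕ) where
   module Lv = TC.AtLevel m
   private
    gG : ∀ s → NonNeg s → (Lv.g s ≈ 1#) × (Lv.g (bar s) ≈ pow (qz (sm s s)) m)
    gG (+ k) (nonNeg k) = qz-0 , trans (qz-cong (E.cong Lv.γ (bar+ k))) (powq (k N.+ k N.+ 1) m)
     where
     bar+ : ∀ k → bar (+ k) ≡ -[1+ k ]
     bar+ zero = E.refl
     bar+ (suc k) = E.refl
     powq : ∀ x m → qz (+ m Z.* + x) ≈ pow (qz (+ x)) m
     powq x zero = trans (qz-cong (ZP.*-zeroˡ (+ x))) qz-0
     powq x (suc m) = trans (trans (qz-cong (lem (+ m) (+ x))) (qz-+ _ _)) (*-congˡ (powq x m))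
      where
      lem : ∀ m x → (+ 1 Z.+ m) Z.* x ≡ x Z.+ m Z.* x
      lem = ZS.solve-∀

   Φ≈SgnC : ∀ b → BL.Φ m (S b) ≈ Lv.SgnC b
   Φ≈SgnC b = begin
    BL.Φ m (S b) ≈⟨ BL.Φ≈Sgn m (S b) Lv.g (nice-S b) (All.map (λ {s} p → gG s p) (nonneg-SL b (rng 0 N))) ⟩
    Sgn (S b) G ≈⟨ Sgn-↭ G G-↭ (Perm.↭-sym (Perm.trans (proj₂ (proj₂ ch)) (SL-↭ b (E.subst (λ x → pairIx (down n) ↭ rng x N) (NP.n∸n≡0 n) (pairIx-↭ n NP.≤-refl))))) ⟩
    _ ≈⟨ Sgn-flip G (proj₁ (proj₂ ch)) ⟨
    Lv.SgnC b ∎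
    where
    ch = chain b (down n) (D₀.down< n)
    G : List ℤ → Carrier
    G Y = Π Y Lv.g * F Y
    G-↭ : ∀ {Y Z} → Y ↭ Z → G Y ≈ G Z
    G-↭ p = *-cong (Π-↭ Lv.g p) (Progressions.F-↭ f p)

-- Elimination of the constant

module Quotient where
 open SymplecticSide
 open OrthogonalSide
 open LittlewoodSum

 module Final (Q : QRing) (I : InfProd Q) (n : ℕ) (n≥1 : 1 N.≤ n) where
  open InfProd I
  open Link Q I n n≥1
  open TC using (KKC)
  open Duality Q n 0 n≥1 using (dbl≢0; down)
  open LatticeSum Q n (dbl≢0 n≥1) (+ 1) using (Carrier; _≈_; _+_; _*_; -_; _-_; 0#; 1#; begin_; _≈⟨_⟩_; _≈⟨_⟨_; _∎; refl; sym; trans; reflexive; solve; _:=_; _:+_; _:*_; _:-_; :-_; :1; :0; _≈[_]_; R; []; _∷_; Int-resp; Int-Π; le; pow; qz-cong; t; w; Π; Π-*; Π-congA; Π-map; ≈[]-*; ≈[]-*ˡ; ≈[]-refl; ≈[]-sym; ≈[]-trans; ≈⇒≈[]; *-cong; *-congˡ; *-congʳ; *-comm; *-identityˡ; *-identityʳ; qz; qz-0; qz-+; a; Int; Int-1; Int-*; Int-neg; Int-qz)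

  -- reciprocal theta function
  θi : ℕ → ℕ → Carrier
  θi per s = Ainf per (+ s) * Ainf per (+ per Z.- + s)

  GGl : ℕ → List ℕ → Carrier
  GGl h [] = 1#
  GGl h (k ∷ ks) = θi h (suc k) * Ainf (h N.+ h) (+ (h N.+ h)) * Π ks (λ k' → θi (h N.+ h) (suc k N.+ suc k') * θi (h N.+ h) (k ∸ k')) * GGl h ks

  -- The constant of the type B evaluation, `KKB` times 1/(q^h; q^κ)_∞, with its power of q removed.
  G : ℕ → Carrier
  G h = Ainf (h N.+ h) (+ h) * GGl h (down n)

  -- For each pair of classes, `κ₂` contains a factor q^(H - e - p), which is q^(k+1) for the class
  -- of row k.
  wexp : List ℕ → ℕ
  wexp [] = 0
  wexp (k ∷ ks) = length ks N.* suc k N.+ wexp ks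

  s : Carrier
  s = pow (- 1#) n

  private
   s² : ∀ k → pow (- 1#) k * pow (- 1#) k ≈ 1#
   s² zero = *-identityˡ _
   s² (suc k) = trans (solve 1 (λ x → (:- :1 :* x) :* (:- :1 :* x) := x :* x) tt (pow (- 1#) k)) (s² k)

   Int-s : ∀ k → Int (pow (- 1#) k)
   Int-s zero = Int-1
   Int-s (suc k) = Int-* (Int-neg Int-1) (Int-s k)

   Int-θi : ∀ p k → Int (θi p k)
   Int-θi p k = Int-* (Int-Ainf p _) (Int-Ainf p _)

   Int-GGl : ∀ h ks → Int (GGl h ks)
   Int-GGl h [] = Int-1
   Int-GGl h (k ∷ ks) = Int-* (Int-* (Int-* (Int-θi h _) (Int-Ainf _ _)) (Int-Π ks (λ k' → Int-* (Int-θi _ _) (Int-θi _ _)))) (Int-GGl h ks)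

   Int-G : ∀ h → Int (G h)
   Int-G h = Int-* (Int-Ainf _ _) (Int-GGl h (down n))

   -- Dividing by q^w costs w orders of precision; the sign s is its own inverse.
   cancel : ∀ {D} w {x y} → qz (+ w) * (s * x) ≈[ w N.+ D ] qz (+ w) * (s * y) → x ≈[ D ] y
   cancel {D} w {x} {y} p = Int-resp (begin
    _ ≈⟨ solve 5 (λ s z q x y → s :* (z :* (q :* (s :* x) :- q :* (s :* y))) := (s :* s) :* ((z :* q) :* (x :- y))) tt s (qz (Z.- (+ (w N.+ D)))) (qz (+ w)) x y ⟩
    _ ≈⟨ trans (*-cong (s² n) (*-congʳ (trans (sym (qz-+ _ _)) (qz-cong (lem (+ w) (+ D)))))) (*-identityˡ _) ⟩
    _ ∎) (Int-* (Int-s n) p)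
    where
    lem : ∀ w d → Z.- (w Z.+ d) Z.+ w ≡ Z.- d
    lem = ZS.solve-∀

  module _ (m : ℕ) where
   private
    module TB = TypeB Q I n m n≥1
    module D = Duality Q n m n≥1
    h = D.h

    n<h : n N.< h
    n<h = TB.n<h

    hs : ∀ {k} → suc k N.≤ n → + (h ∸ suc k) ≡ + h Z.- + suc k
    hs k<n = pos-∸ (NP.<⇒≤ (NP.≤-<-trans k<n n<h))

    k₁≈ : ∀ k → suc k N.≤ n → Ainf h (+ (h ∸ suc k)) * Ainf h (+ h Z.- + (h ∸ suc k)) ≈ θi h (suc k)
    k₁≈ k k<n = trans (*-cong (reflexive (E.cong (Ainf h) (hs k<n))) (reflexive (E.cong (Ainf h) (E.trans (E.cong (λ x → + h Z.- x) (hs k<n)) (lem (+ h) (+ suc k)))))) (*-comm _ _)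
     where
     lem : ∀ h k → h Z.- (h Z.- k) ≡ k
     lem = ZS.solve-∀

    κ≈ : ∀ k k' → suc k N.≤ n → k' N.< k → TB.κ₂ (+ (h ∸ suc k)) (+ (h ∸ suc k')) ≈ (θi (h N.+ h) (suc k N.+ suc k') * θi (h N.+ h) (k ∸ k')) * qz (+ suc k)
    κ≈ k k' k<n k'<k = *-cong (*-cong (trans (*-cong (reflexive (E.cong A₂ σ₀)) (reflexive (E.cong A₂ σ₁))) (*-comm _ _)) (*-cong (reflexive (E.cong A₂ δ₀)) (reflexive (E.cong A₂ (E.cong (λ x → + (h N.+ h) Z.- x) δ₀)))))
      (qz-cong (E.trans (E.cong (λ x → + h Z.- + 0 Z.- x) (hs k<n)) (l₃ (+ h) (+ suc k))))
     where
     A₂ = Ainf (h N.+ h)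
     p = + (h ∸ suc k)
     p' = + (h ∸ suc k')
     k'<n = NP.≤-trans k'<k (NP.<⇒≤ k<n)
     l₁ : ∀ h k k' → (h Z.- k Z.+ (+ 0) Z.* (h Z.+ h)) Z.+ (h Z.- k' Z.+ (+ 0) Z.* (h Z.+ h)) Z.+ + 0 ≡ (h Z.+ h) Z.- (k Z.+ k')
     l₁ = ZS.solve-∀
     l₂ : ∀ h k k' → (h Z.+ h) Z.- ((h Z.- k Z.+ (+ 0) Z.* (h Z.+ h)) Z.+ (h Z.- k' Z.+ (+ 0) Z.* (h Z.+ h)) Z.+ + 0) ≡ k Z.+ k'
     l₂ = ZS.solve-∀
     l₃ : ∀ h k → h Z.- + 0 Z.- (h Z.- k) ≡ k
     l₃ = ZS.solve-∀
     l₄ : ∀ h k k' → (h Z.- (+ 1 Z.+ k') Z.+ (+ 0) Z.* (h Z.+ h)) Z.- (h Z.- (+ 1 Z.+ k) Z.+ (+ 0) Z.* (h Z.+ h)) ≡ k Z.- k'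
     l₄ = ZS.solve-∀
     σ₀ : (p Z.+ (+ 0) Z.* + (h N.+ h)) Z.+ (p' Z.+ (+ 0) Z.* + (h N.+ h)) Z.+ + 0 ≡ + (h N.+ h) Z.- + (suc k N.+ suc k')
     σ₀ = E.trans (E.cong₂ (λ x y → (x Z.+ (+ 0) Z.* + (h N.+ h)) Z.+ (y Z.+ (+ 0) Z.* + (h N.+ h)) Z.+ + 0) (hs k<n) (hs k'<n)) (l₁ (+ h) (+ suc k) (+ suc k'))
     σ₁ : + (h N.+ h) Z.- ((p Z.+ (+ 0) Z.* + (h N.+ h)) Z.+ (p' Z.+ (+ 0) Z.* + (h N.+ h)) Z.+ + 0) ≡ + (suc k N.+ suc k')
     σ₁ = E.trans (E.cong₂ (λ x y → + (h N.+ h) Z.- ((x Z.+ (+ 0) Z.* + (h N.+ h)) Z.+ (y Z.+ (+ 0) Z.* + (h N.+ h)) Z.+ + 0)) (hs k<n) (hs k'<n)) (l₂ (+ h) (+ suc k) (+ suc k'))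
     δ₀ : (p' Z.+ (+ 0) Z.* + (h N.+ h)) Z.- (p Z.+ (+ 0) Z.* + (h N.+ h)) ≡ + (k ∸ k')
     δ₀ = E.trans (E.cong₂ (λ x y → (y Z.+ (+ 0) Z.* + (h N.+ h)) Z.- (x Z.+ (+ 0) Z.* + (h N.+ h))) (hs k<n) (hs k'<n)) (E.trans (l₄ (+ h) (+ k) (+ k')) (E.sym (pos-∸ (NP.<⇒≤ k'<k))))

    KKB≈ : ∀ j → j N.≤ n → TB.KK (map +_ (map (λ k → h ∸ suc k) (down j))) ≈ qz (+ wexp (down j)) * GGl h (down j)
    KKB≈ zero _ = trans (sym (*-identityˡ _)) (*-congʳ (sym qz-0))
    KKB≈ (suc k) p = begin
     _ ≈⟨ *-cong (*-cong (*-congʳ (k₁≈ k p)) (trans (Π-map +_ (map g (down k)) _) (trans (Π-map g (down k) _) (trans (Π-congA (All.map (λ {k'} q → κ≈ k k' p q) (D.down< k))) (Π-* (down k) _ _))))) (KKB≈ k (NP.<⇒≤ p)) ⟩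
     _ ≈⟨ solve 6 (λ t a y q w g → t :* a :* (y :* q) :* (w :* g) := (q :* w) :* (t :* a :* y :* g)) tt (θi h (suc k)) A₂ Y (Π (down k) (λ _ → qz (+ suc k))) (qz (+ wexp (down k))) (GGl h (down k)) ⟩
     _ ≈⟨ *-congʳ (trans (*-congʳ (pows (down k))) (sym (qz-+ _ _))) ⟩
     _ ∎
     where
     g : ℕ → ℕ
     g k = h ∸ suc k
     _∷′_ : ℕ → List ℕ → List ℕ
     j ∷′ ks = (j ∸ 1) ∷ ks
     A₂ = Ainf (h N.+ h) (+ (h N.+ h))
     Y = Π (down k) (λ k' → θi (h N.+ h) (suc k N.+ suc k') * θi (h N.+ h) (k ∸ k'))
     pows : ∀ ks → Π ks (λ _ → qz (+ suc k)) ≈ qz (+ (length ks N.* suc k))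
     pows [] = sym qz-0
     pows (_ ∷ ks) = trans (*-congˡ (pows ks)) (sym (qz-+ (+ suc k) _))

   -- The left-hand side is `KKC` times the type C lattice sum. The other factor is, up to the sign
   -- of `duality`, exactly what multiplies the type B lattice sum in `product-B`, so everything
   -- except `KKC` becomes 1.
   evaluate : ∀ {D} → 1 N.≤ D → ∀ B → D N.≤ B → LHS m B * (qz (+ wexp (down n)) * (s * G h)) ≈[ D ] KKC
   evaluate {D} D≥1 B D≤B = ≈[]-trans
    (≈[]-* (Int-LHS m B) Int-X (≈[]-trans (LHS≈Φ m b₀ B (NP.m≤m+n D D) D≤B) (≈[]-trans (≈⇒≈[] (Φ≈SgnC m b₀)) (TC.AtLevel.level-sum m D≥1 b₀ NP.≤-refl))) ≈[]-refl)
    (≈[]-trans (≈⇒≈[] (begin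
     _ ≈⟨ solve 6 (λ K S w s A g → K :* S :* (w :* (s :* (A :* g))) := K :* ((w :* g) :* (s :* S) :* A)) tt KKC (D.SC b₀) (qz (+ wexp (down n))) s (Ainf (h N.+ h) (+ h)) (GGl h (down n)) ⟩
     _ ≈⟨ *-congˡ (*-congʳ (*-cong (sym (KKB≈ n NP.≤-refl)) (sym (D.duality b₀)))) ⟩
     _ ∎))
    (≈[]-trans (≈[]-*ˡ TC.Int-KKC (TB.product-B D≥1 b₀ NP.≤-refl)) (≈⇒≈[] (*-identityʳ _))))
    where
    b₀ = D N.+ D
    Int-X : Int (qz (+ wexp (down n)) * (s * G h))
    Int-X = Int-* (Int-qz _) (Int-* (Int-s n) (Int-G h))

  slack : ℕ
  slack = wexp (down n)

  -- Dividing by the case m = 0, where the sum is 1, removes the unknown constant.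
  quotient : ∀ m {D} → 1 N.≤ D → ∀ B → slack N.+ D N.≤ B → LHS m B * G (m N.+ n N.+ 1) ≈[ D ] G (n N.+ 1)
  quotient m {D} D≥1 B le = cancel slack (≈[]-trans (≈⇒≈[] (solve 4 (λ q s l g → q :* (s :* (l :* g)) := l :* (q :* (s :* g))) tt (qz (+ slack)) s (LHS m B) (G (m N.+ n N.+ 1))))
   (≈[]-trans (evaluate m D'≥1 B le) (≈[]-trans (≈[]-sym (evaluate 0 D'≥1 B le))
    (≈[]-trans (≈[]-* (Int-LHS 0 B) (Int-* (Int-qz _) (Int-* (Int-s n) (Int-G (n N.+ 1)))) (LHS≈Φ 0 (slack N.+ D) B NP.≤-refl le) ≈[]-refl) (≈⇒≈[] (*-identityˡ _))))))
   where
   D'≥1 : 1 N.≤ slack N.+ D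
   D'≥1 = NP.≤-trans D≥1 (NP.m≤n+m D slack)

-- The ring of power series and its infinite products

module PowerSeries where
 open import Algebra.Structures using (IsCommutativeRing)
 open import Data.List using (upTo)
 open import Data.List.Properties using (map-cong; map-applyUpTo)
 open import Defs

 infix 4 _≋_
 record _≋_ (f g : PS) : Set where
  constructor mk
  field at : ∀ d → f d ≡ g d
 open _≋_ public

 shiftˡ : PS → PS
 shiftˡ f d = f (suc d)

 𝟘 : PS
 𝟘 _ = + 0

 ⊝_ : PS → PS
 (⊝ f) d = Z.- f d

 map-upTo-suc : ∀ {A : Set} n (u : ℕ → A) → map u (upTo (suc n)) ≡ u 0 ∷ map (λ i → u (suc i)) (upTo n)
 map-upTo-suc n u = E.cong (u 0 ∷_) (E.trans (map-applyUpTo suc u n) (E.sym (map-applyUpTo (λ i → i) (λ i → u (suc i)) n)))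

 ⊗-0 : ∀ f g → (f ⊗ g) 0 ≡ f 0 Z.* g 0
 ⊗-0 f g = ZP.+-identityʳ _

 ⊗-suc : ∀ f g d → (f ⊗ g) (suc d) ≡ f 0 Z.* g (suc d) Z.+ (shiftˡ f ⊗ g) d
 ⊗-suc f g d = E.cong sumℤ (map-upTo-suc (suc d) (λ i → f i Z.* g (suc d ∸ i)))

 ⊗-local : ∀ d {f f' g g'} → (∀ i → i N.≤ d → f i ≡ f' i) → (∀ i → i N.≤ d → g i ≡ g' i) → (f ⊗ g) d ≡ (f' ⊗ g') d
 ⊗-local zero {f} {f'} {g} {g'} p r = E.trans (⊗-0 f g) (E.trans (E.cong₂ Z._*_ (p 0 z≤n) (r 0 z≤n)) (E.sym (⊗-0 f' g')))
 ⊗-local (suc d) {f} {f'} {g} {g'} p r = E.trans (⊗-suc f g d) (E.trans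
  (E.cong₂ Z._+_ (E.cong₂ Z._*_ (p 0 z≤n) (r (suc d) NP.≤-refl)) (⊗-local d {shiftˡ f} {shiftˡ f'} (λ i l → p (suc i) (s≤s l)) (λ i l → r i (NP.m≤n⇒m≤1+n l))))
  (E.sym (⊗-suc f' g' d)))

 private
  ⊗-sucʳ : ∀ d f g → (f ⊗ g) (suc d) ≡ (f ⊗ shiftˡ g) d Z.+ f (suc d) Z.* g 0
  ⊗-sucʳ zero f g = E.trans (⊗-suc f g 0) (E.cong₂ Z._+_ (E.sym (⊗-0 f (shiftˡ g))) (⊗-0 (shiftˡ f) g))
  ⊗-sucʳ (suc d) f g = E.trans (⊗-suc f g (suc d)) (E.trans (E.cong (λ x → f 0 Z.* g (2 N.+ d) Z.+ x) (⊗-sucʳ d (shiftˡ f) g))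
   (E.trans (E.sym (ZP.+-assoc (f 0 Z.* g (2 N.+ d)) _ _)) (E.cong (Z._+ f (2 N.+ d) Z.* g 0) (E.sym (⊗-suc f (shiftˡ g) d)))))

  comm : ∀ d f g → (f ⊗ g) d ≡ (g ⊗ f) d
  comm zero f g = E.trans (⊗-0 f g) (E.trans (ZP.*-comm (f 0) (g 0)) (E.sym (⊗-0 g f)))
  comm (suc d) f g = E.trans (⊗-suc f g d) (E.trans (E.cong₂ Z._+_ (ZP.*-comm (f 0) _) (comm d (shiftˡ f) g))
   (E.trans (ZP.+-comm (g (suc d) Z.* f 0) _) (E.sym (⊗-sucʳ d g f))))

  distʳ : ∀ d h f g → ((f ⊕ g) ⊗ h) d ≡ (f ⊗ h) d Z.+ (g ⊗ h) d
  distʳ zero h f g = E.trans (⊗-0 (f ⊕ g) h) (E.trans (ZP.*-distribʳ-+ (h 0) (f 0) (g 0)) (E.sym (E.cong₂ Z._+_ (⊗-0 f h) (⊗-0 g h))))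
  distʳ (suc d) h f g = E.trans (⊗-suc (f ⊕ g) h d) (E.trans (E.cong (λ x → (f 0 Z.+ g 0) Z.* h (suc d) Z.+ x) (distʳ d h (shiftˡ f) (shiftˡ g)))
   (E.trans (lem (f 0) (g 0) (h (suc d)) _ _) (E.sym (E.cong₂ Z._+_ (⊗-suc f h d) (⊗-suc g h d)))))
   where
   lem : ∀ a b c x y → (a Z.+ b) Z.* c Z.+ (x Z.+ y) ≡ (a Z.* c Z.+ x) Z.+ (b Z.* c Z.+ y)
   lem = ZS.solve-∀

  scale : ∀ c d f g → ((λ i → c Z.* f i) ⊗ g) d ≡ c Z.* (f ⊗ g) d
  scale c zero f g = E.trans (⊗-0 (λ i → c Z.* f i) g) (E.trans (ZP.*-assoc c (f 0) (g 0)) (E.sym (E.cong (c Z.*_) (⊗-0 f g))))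
  scale c (suc d) f g = E.trans (⊗-suc (λ i → c Z.* f i) g d) (E.trans (E.cong (λ x → (c Z.* f 0) Z.* g (suc d) Z.+ x) (scale c d (shiftˡ f) g))
   (E.trans (lem c (f 0) (g (suc d)) _) (E.sym (E.cong (c Z.*_) (⊗-suc f g d)))))
   where
   lem : ∀ a b c x → (a Z.* b) Z.* c Z.+ a Z.* x ≡ a Z.* (b Z.* c Z.+ x)
   lem = ZS.solve-∀

  assoc : ∀ d f g h → ((f ⊗ g) ⊗ h) d ≡ (f ⊗ (g ⊗ h)) d
  assoc zero f g h = E.trans (⊗-0 (f ⊗ g) h) (E.trans (E.cong (Z._* h 0) (⊗-0 f g)) (E.trans (ZP.*-assoc (f 0) (g 0) (h 0)) (E.sym (E.trans (⊗-0 f (g ⊗ h)) (E.cong (f 0 Z.*_) (⊗-0 g h))))))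
  assoc (suc d) f g h = E.trans (⊗-suc (f ⊗ g) h d) (E.trans
   (E.cong₂ Z._+_ (E.cong (Z._* h (suc d)) (⊗-0 f g))
    (E.trans (⊗-local d {shiftˡ (f ⊗ g)} {(λ i → f 0 Z.* shiftˡ g i) ⊕ (shiftˡ f ⊗ g)} {h} (λ i _ → ⊗-suc f g i) (λ _ _ → E.refl))
     (E.trans (distʳ d h (λ i → f 0 Z.* shiftˡ g i) (shiftˡ f ⊗ g)) (E.cong₂ Z._+_ (scale (f 0) d (shiftˡ g) h) (assoc d (shiftˡ f) g h)))))
   (E.trans (lem (f 0) (g 0) (h (suc d)) ((shiftˡ g ⊗ h) d) ((shiftˡ f ⊗ (g ⊗ h)) d)) (E.sym (E.trans (⊗-suc f (g ⊗ h) d) (E.cong (λ x → f 0 Z.* x Z.+ (shiftˡ f ⊗ (g ⊗ h)) d) (⊗-suc g h d))))))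
   where
   lem : ∀ a b c x y → (a Z.* b) Z.* c Z.+ (a Z.* x Z.+ y) ≡ a Z.* (b Z.* c Z.+ x) Z.+ y
   lem = ZS.solve-∀

  zeroˡ′ : ∀ d g → (𝟘 ⊗ g) d ≡ + 0
  zeroˡ′ zero g = E.trans (⊗-0 𝟘 g) (ZP.*-zeroˡ (g 0))
  zeroˡ′ (suc d) g = E.trans (⊗-suc 𝟘 g d) (E.cong₂ Z._+_ (ZP.*-zeroˡ (g (suc d))) (zeroˡ′ d g))

  identˡ : ∀ d g → (𝟙 ⊗ g) d ≡ g d
  identˡ zero g = E.trans (⊗-0 𝟙 g) (ZP.*-identityˡ (g 0))
  identˡ (suc d) g = E.trans (⊗-suc 𝟙 g d) (E.trans (E.cong₂ Z._+_ (ZP.*-identityˡ (g (suc d))) (zeroˡ′ d g)) (ZP.+-identityʳ _))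

 -- Opaque copies of the operations, so that unification never unfolds them.
 infixl 7 _⋆_
 infixl 6 _⊞_
 infix 8 ⊟_
 abstract
  _⊞_ : PS → PS → PS
  _⊞_ = _⊕_

  ⊟_ : PS → PS
  ⊟_ = ⊝_

  ⊞-at : ∀ f g d → (f ⊞ g) d ≡ f d Z.+ g d
  ⊞-at f g d = E.refl

  ⊟-at : ∀ f d → (⊟ f) d ≡ Z.- f d
  ⊟-at f d = E.refl

  ⊖≡ : ∀ f g → f ⊖ g ≡ f ⊞ ⊟ g
  ⊖≡ f g = E.refl

  _⋆_ : PS → PS → PS
  _⋆_ = _⊗_

  ⋆≡⊗ : ∀ f g → f ⋆ g ≡ f ⊗ g
  ⋆≡⊗ f g = E.refl

  ⋆-0 : ∀ f g → (f ⋆ g) 0 ≡ f 0 Z.* g 0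
  ⋆-0 = ⊗-0

  ⋆-suc : ∀ f g d → (f ⋆ g) (suc d) ≡ f 0 Z.* g (suc d) Z.+ (shiftˡ f ⋆ g) d
  ⋆-suc = ⊗-suc

  ⋆-local : ∀ d {f f' g g'} → (∀ i → i N.≤ d → f i ≡ f' i) → (∀ i → i N.≤ d → g i ≡ g' i) → (f ⋆ g) d ≡ (f' ⋆ g') d
  ⋆-local d {f} {f'} {g} {g'} = ⊗-local d {f} {f'} {g} {g'}

  ⋆-isCommutativeRing : IsCommutativeRing _≋_ _⊞_ _⋆_ ⊟_ 𝟘 𝟙
  ⋆-isCommutativeRing = record
    { isRing = record
     { +-isAbelianGroup = record
      { isGroup = record
       { isMonoid = record
        { isSemigroup = record
         { isMagma = record
          { isEquivalence = record { refl = mk (λ _ → E.refl) ; sym = λ p → mk (λ d → E.sym (at p d)) ; trans = λ p r → mk (λ d → E.trans (at p d) (at r d)) }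
          ; ∙-cong = λ p r → mk (λ d → E.cong₂ Z._+_ (at p d) (at r d)) }
         ; assoc = λ f g h → mk (λ d → ZP.+-assoc (f d) (g d) (h d)) }
        ; identity = (λ f → mk (λ d → ZP.+-identityˡ (f d))) , (λ f → mk (λ d → ZP.+-identityʳ (f d))) }
       ; inverse = (λ f → mk (λ d → ZP.+-inverseˡ (f d))) , (λ f → mk (λ d → ZP.+-inverseʳ (f d)))
       ; ⁻¹-cong = λ p → mk (λ d → E.cong Z.-_ (at p d)) }
      ; comm = λ f g → mk (λ d → ZP.+-comm (f d) (g d)) }
     ; *-cong = λ p r → mk (λ d → ⊗-local d (λ i _ → at p i) (λ i _ → at r i))
     ; *-assoc = λ f g h → mk (λ d → assoc d f g h)
     ; *-identity = (λ g → mk (λ d → identˡ d g)) , (λ g → mk (λ d → E.trans (comm d g 𝟙) (identˡ d g)))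
     ; distrib = (λ f g h → mk (λ d → E.trans (comm d f (g ⊕ h)) (E.trans (distʳ d f g h) (E.cong₂ Z._+_ (comm d g f) (comm d h f))))) , (λ h f g → mk (λ d → distʳ d h f g)) }
    ; *-comm = λ f g → mk (λ d → comm d f g) }

 PSRing : CommutativeRing 0ℓ 0ℓ
 PSRing = record { isCommutativeRing = ⋆-isCommutativeRing }

 module PSR = LightRing PSRing
 module PSS = IntSolver PSRing

 mono-0 : mono 0 ≋ 𝟙
 mono-0 = mk (λ { zero → E.refl ; (suc d) → E.refl })

 mono-suc : ∀ k f d → (mono (suc k) ⋆ f) (suc d) ≡ (mono k ⋆ f) d
 mono-suc k f d = E.trans (⋆-suc (mono (suc k)) f d) (E.trans (E.cong (Z._+ (mono k ⋆ f) d) (ZP.*-zeroˡ (f (suc d)))) (ZP.+-identityˡ _))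

 mono-zero : ∀ f d → (mono 0 ⋆ f) d ≡ f d
 mono-zero f d = at (PSR.trans (PSR.*-congʳ mono-0) (PSR.*-identityˡ f)) d

 mono-< : ∀ k f d → d N.< k → (mono k ⋆ f) d ≡ + 0
 mono-< (suc k) f zero _ = E.trans (⋆-0 (mono (suc k)) f) (ZP.*-zeroˡ (f 0))
 mono-< (suc k) f (suc d) (s≤s p) = E.trans (mono-suc k f d) (mono-< k f d p)

 mono-≥ : ∀ k f d → (mono k ⋆ f) (k N.+ d) ≡ f d
 mono-≥ zero f d = mono-zero f d
 mono-≥ (suc k) f d = E.trans (mono-suc k f (k N.+ d)) (mono-≥ k f d)

 mono-cancel : ∀ k {f g} → mono k ⋆ f ≋ mono k ⋆ g → f ≋ g
 mono-cancel k {f} {g} p = mk (λ d → E.trans (E.sym (mono-≥ k f d)) (E.trans (at p (k N.+ d)) (mono-≥ k g d)))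

 mono-+ : ∀ k l → mono (k N.+ l) ≋ mono k ⋆ mono l
 mono-+ zero l = PSR.sym (PSR.trans (PSR.*-congʳ mono-0) (PSR.*-identityˡ _))
 mono-+ (suc k) l = mk (λ { zero → E.sym (mono-< (suc k) (mono l) 0 (s≤s z≤n)) ; (suc d) → E.trans (at (mono-+ k l) d) (E.sym (mono-suc k (mono l) d)) })

 mono-drop : ∀ D f → (∀ d → d N.< D → f d ≡ + 0) → f ≋ mono D ⋆ (λ d → f (D N.+ d))
 mono-drop D f z = mk go
  where
  go : ∀ d → f d ≡ (mono D ⋆ (λ d → f (D N.+ d))) d
  go d with d NP.<? D
  ... | yes p = E.trans (z d p) (E.sym (mono-< D _ d p))
  ... | no ¬p = E.trans (E.cong f (E.sym e)) (E.trans (E.sym (mono-≥ D (λ d → f (D N.+ d)) (d ∸ D))) (E.cong (mono D ⋆ (λ d → f (D N.+ d))) e))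
   where
   e : D N.+ (d ∸ D) ≡ d
   e = NP.m+[n∸m]≡n (NP.≮⇒≥ ¬p)

 One : PS → Set
 One f = f 0 ≡ + 1

 One-⋆ : ∀ {f g} → One f → One g → One (f ⋆ g)
 One-⋆ {f} {g} p r = E.trans (⋆-0 f g) (E.cong₂ Z._*_ p r)

 One-^ : ∀ {f} k → One f → One (f ^ᵖ k)
 One-^ zero p = E.refl
 One-^ {f} (suc k) p = E.trans (⊗-0 f (f ^ᵖ k)) (E.cong₂ Z._*_ p (One-^ k p))

 private
  pow-low : ∀ g → g 0 ≡ + 0 → ∀ t d → d N.< t → (g ^ᵖ t) d ≡ + 0
  pow-low g z (suc t) zero _ = E.trans (⊗-0 g (g ^ᵖ t)) (E.trans (E.cong (Z._* (g ^ᵖ t) 0) z) (ZP.*-zeroˡ ((g ^ᵖ t) 0)))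
  pow-low g z (suc t) (suc d) (s≤s p) = E.trans (⊗-suc g (g ^ᵖ t) d) (E.cong₂ Z._+_
   (E.trans (E.cong (Z._* (g ^ᵖ t) (suc d)) z) (ZP.*-zeroˡ ((g ^ᵖ t) (suc d))))
   (E.trans (⊗-local d {shiftˡ g} {shiftˡ g} {g ^ᵖ t} {𝟘} (λ _ _ → E.refl) (λ i l → pow-low g z t i (NP.≤-<-trans l p))) (E.trans (comm d (shiftˡ g) 𝟘) (zeroˡ′ d (shiftˡ g)))))

  geo : PS → ℕ → PS
  geo g T d = sumℤ (map (λ t → (g ^ᵖ t) d) (upTo T))

  geo-suc : ∀ g T → geo g (suc T) ≋ 𝟙 ⊞ g ⋆ geo g T
  geo-suc g T = mk (λ d → E.trans (E.cong sumℤ (map-upTo-suc T (λ t → (g ^ᵖ t) d))) (E.trans (E.cong (λ x → 𝟙 d Z.+ x) (E.sym (E.trans (pull g T (λ t → g ^ᵖ t) d) (E.cong sumℤ (map-cong (λ t → E.cong (λ x → x d) (⋆≡⊗ g (g ^ᵖ t))) (upTo T)))))) (E.sym (⊞-at _ _ d))))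
   where
   pull : ∀ g T (u : ℕ → PS) d → (g ⋆ (λ d → sumℤ (map (λ t → u t d) (upTo T)))) d ≡ sumℤ (map (λ t → (g ⋆ u t) d) (upTo T))
   pull g zero u d = at (PSR.zeroʳ g) d
   pull g (suc T) u d = E.trans (⋆-local d {g} {g} {_} {u 0 ⊞ (λ d → sumℤ (map (λ t → u (suc t) d) (upTo T)))} (λ _ _ → E.refl) (λ i _ → E.trans (E.cong sumℤ (map-upTo-suc T (λ t → u t i))) (E.sym (⊞-at _ _ i))))
    (E.trans (E.trans (at (PSR.distribˡ g (u 0) _) d) (⊞-at _ _ d)) (E.trans (E.cong (λ x → (g ⋆ u 0) d Z.+ x) (pull g T (λ t → u (suc t)) d)) (E.sym (E.cong sumℤ (map-upTo-suc T (λ t → (g ⋆ u t) d))))))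

  geo-inv : ∀ g T → geo g T ⋆ (𝟙 ⊞ (⊟ g)) ≋ 𝟙 ⊞ (⊟ (g ^ᵖ T))
  geo-inv g zero = PSR.trans (PSR.zeroˡ _) (PSR.sym (PSR.-‿inverseʳ 𝟙))
  geo-inv g (suc T) = PSR.trans (PSR.*-congʳ (geo-suc g T)) (PSR.trans (PSS.solve 2 (λ g s → (PSS.:1 PSS.:+ g PSS.:* s) PSS.:* (PSS.:1 PSS.:- g) PSS.:= (PSS.:1 PSS.:- g) PSS.:+ g PSS.:* (s PSS.:* (PSS.:1 PSS.:- g))) tt g (geo g T))
   (PSR.trans (PSR.+-congˡ (PSR.*-congˡ (geo-inv g T))) (PSR.trans (PSS.solve 2 (λ g s → (PSS.:1 PSS.:- g) PSS.:+ g PSS.:* (PSS.:1 PSS.:- s) PSS.:= PSS.:1 PSS.:- g PSS.:* s) tt g (g ^ᵖ T)) (PSR.+-congˡ (PSR.-‿cong (PSR.reflexive (⋆≡⊗ g (g ^ᵖ T))))))))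

  geo-stable : ∀ g → g 0 ≡ + 0 → ∀ d i → i N.≤ d → geo g (suc i) i ≡ geo g (suc d) i
  geo-stable g z d i p = go (λ t → g ^ᵖ t) (suc i) (suc d) (s≤s p) (λ t l → pow-low g z t i l)
   where
   go : ∀ (u : ℕ → PS) a b → a N.≤ b → (∀ t → a N.≤ t → u t i ≡ + 0) → sumℤ (map (λ t → u t i) (upTo a)) ≡ sumℤ (map (λ t → u t i) (upTo b))
   go u zero zero _ h = E.refl
   go u zero (suc b) _ h = E.trans (E.trans (go (λ t → u (suc t)) zero b z≤n (λ t _ → h (suc t) z≤n)) (E.sym (ZP.+-identityˡ _))) (E.sym (E.trans (E.cong sumℤ (map-upTo-suc b (λ t → u t i))) (E.cong (λ x → x Z.+ sumℤ (map (λ t → u (suc t) i) (upTo b))) (h 0 z≤n))))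
   go u (suc a) (suc b) (s≤s l) h = E.trans (E.cong sumℤ (map-upTo-suc a (λ t → u t i))) (E.trans (E.cong (λ x → u 0 i Z.+ x) (go (λ t → u (suc t)) a b l (λ t q → h (suc t) (s≤s q)))) (E.sym (E.cong sumℤ (map-upTo-suc b (λ t → u t i)))))

 -- The power g^t starts in degree t, so for coefficients up to d all truncations of the geometric
 -- series agree with the one of length d + 1. That one inverts 1 - g up to g^(d+1).
 inv-inverse : ∀ f → One f → inv f ⋆ f ≋ 𝟙
 inv-inverse f o = mk (λ d → E.trans
  (⋆-local d {inv f} {geo g (suc d)} {f} {𝟙 ⊞ (⊟ g)} (λ i p → geo-stable g z d i p) (λ i _ → E.trans (lem (𝟙 i) (f i)) (E.sym (E.trans (⊞-at 𝟙 (⊟ g) i) (E.cong (λ x → 𝟙 i Z.+ x) (⊟-at g i))))))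
  (E.trans (E.trans (at (geo-inv g (suc d)) d) (E.trans (⊞-at 𝟙 _ d) (E.cong (λ x → 𝟙 d Z.+ x) (⊟-at (g ^ᵖ suc d) d)))) (E.trans (E.cong (λ x → 𝟙 d Z.- x) (pow-low g z (suc d) d NP.≤-refl)) (ZP.+-identityʳ _))))
  where
  g = 𝟙 ⊖ f
  z : g 0 ≡ + 0
  z = E.cong (λ x → + 1 Z.- x) o
  lem : ∀ a b → b ≡ a Z.- (a Z.- b)
  lem = ZS.solve-∀

 cancel-One : ∀ {f g h} → One f → f ⋆ g ≋ f ⋆ h → g ≋ h
 cancel-One {f} {g} {h} o p = PSR.trans (PSR.sym (l g)) (PSR.trans (PSR.*-congˡ p) (l h))
  where
  l : ∀ x → inv f ⋆ (f ⋆ x) ≋ x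
  l x = PSR.trans (PSR.sym (PSR.*-assoc (inv f) f x)) (PSR.trans (PSR.*-congʳ (inv-inverse f o)) (PSR.*-identityˡ x))

 -- `poch` with the first factor split off, the form in which infinite products pass from a to a +
 -- p.
 pc : ℕ → ℕ → ℕ → PS
 pc a p zero = 𝟙
 pc a p (suc k) = (𝟙 ⊖ mono a) ⋆ pc (a N.+ p) p k

 prodPS-cong : ∀ k {u v : ℕ → PS} → (∀ i → i N.< k → u i ≋ v i) → prodPS (map u (upTo k)) ≋ prodPS (map v (upTo k))
 prodPS-suc : ∀ k (u : ℕ → PS) → prodPS (map u (upTo (suc k))) ≋ u 0 ⋆ prodPS (map (λ i → u (suc i)) (upTo k))
 prodPS-suc k u = PSR.reflexive (E.trans (E.cong prodPS (map-upTo-suc k u)) (E.sym (⋆≡⊗ _ _)))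
 prodPS-cong zero h = PSR.refl
 prodPS-cong (suc k) {u} {v} h = PSR.trans (prodPS-suc k u) (PSR.trans (PSR.*-cong (h 0 (s≤s z≤n)) (prodPS-cong k (λ i l → h (suc i) (s≤s l)))) (PSR.sym (prodPS-suc k v)))

 poch-pc : ∀ a p k → poch a p k ≋ pc a p k
 poch-pc a p zero = PSR.refl
 poch-pc a p (suc k) = PSR.trans (prodPS-suc k (λ j → 𝟙 ⊖ mono (a N.+ p N.* j))) (PSR.*-cong
  (PSR.reflexive (E.cong (λ x → 𝟙 ⊖ mono x) (E.trans (E.cong (a N.+_) (NP.*-zeroʳ p)) (NP.+-identityʳ a))))
  (PSR.trans (prodPS-cong k (λ j _ → PSR.reflexive (E.cong (λ x → 𝟙 ⊖ mono x) (E.trans (E.cong (a N.+_) (NP.*-suc p j)) (E.sym (NP.+-assoc a p (p N.* j))))))) (poch-pc (a N.+ p) p k)))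

 private
  1-q-low : ∀ a d → d N.< a → (𝟙 ⊖ mono a) d ≡ 𝟙 d
  1-q-low (suc a) zero _ = E.refl
  1-q-low (suc a) (suc d) (s≤s p) = E.trans (E.cong (λ x → + 0 Z.- x) (z a d p)) E.refl
   where
   z : ∀ a d → d N.< a → mono a d ≡ + 0
   z (suc a) zero _ = E.refl
   z (suc a) (suc d) (s≤s p) = z a d p

  pc-low : ∀ a p k d → d N.< a → pc a p k d ≡ 𝟙 d
  pc-low a p zero d l = E.refl
  pc-low a p (suc k) d l = E.trans (⋆-local d {𝟙 ⊖ mono a} {𝟙} {pc (a N.+ p) p k} {𝟙} (λ i r → 1-q-low a i (NP.≤-<-trans r l)) (λ i r → pc-low (a N.+ p) p k i (NP.<-≤-trans (NP.≤-<-trans r l) (NP.m≤m+n a p)))) (at (PSR.*-identityˡ 𝟙) d)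

  pc-stable : ∀ a p k l d → d N.< a N.+ k N.* p → pc a p (k N.+ l) d ≡ pc a p k d
  pc-stable a p zero l d r = pc-low a p l d (E.subst (d N.<_) (NP.+-identityʳ a) r)
  pc-stable a p (suc k) l d r = ⋆-local d {𝟙 ⊖ mono a} {𝟙 ⊖ mono a} {pc (a N.+ p) p (k N.+ l)} {pc (a N.+ p) p k} (λ _ _ → E.refl)
   (λ i q → pc-stable (a N.+ p) p k l i (E.subst (i N.<_) (E.sym (NP.+-assoc a p (k N.* p))) (NP.≤-<-trans q r)))

 pochInf-pc : ∀ a p → 1 N.≤ p → ∀ k d → d N.< k → pochInf a p d ≡ pc a p k d
 pochInf-pc a p p≥1 k d d<k = E.trans (at (poch-pc a p (suc d)) d)
  (E.trans (E.sym (pc-stable a p (suc d) (k ∸ suc d) d (NP.<-≤-trans (NP.n<1+n d) (NP.≤-trans (E.subst (N._≤ suc d N.* p) (NP.*-identityʳ (suc d)) (NP.*-monoʳ-≤ (suc d) p≥1)) (NP.m≤n+m _ a)))))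
   (E.cong (λ x → pc a p x d) (NP.m+[n∸m]≡n d<k)))

 pochInf-step : ∀ a p → 1 N.≤ p → pochInf a p ≋ (𝟙 ⊖ mono a) ⋆ pochInf (a N.+ p) p
 pochInf-step a p p≥1 = mk (λ d → E.trans (pochInf-pc a p p≥1 (2 N.+ d) d (NP.m≤n+m (suc d) 1))
  (⋆-local d {𝟙 ⊖ mono a} {𝟙 ⊖ mono a} {pc (a N.+ p) p (suc d)} {pochInf (a N.+ p) p} (λ _ _ → E.refl) (λ i l → E.sym (pochInf-pc (a N.+ p) p p≥1 (suc d) i (s≤s l)))))

 pochInf-low : ∀ a p d → d N.< a → pochInf a p d ≡ 𝟙 d
 pochInf-low a p d l = E.trans (at (poch-pc a p (suc d)) d) (pc-low a p (suc d) d l)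

 One-pochInf : ∀ {a} p → 1 N.≤ a → One (pochInf a p)
 One-pochInf p l = pochInf-low _ p 0 l

 One-1-q : ∀ {a} → 1 N.≤ a → One (𝟙 ⊖ mono a)
 One-1-q l = 1-q-low _ 0 l

 inv-low : ∀ f D → One f → (∀ d → d N.< D → f d ≡ 𝟙 d) → ∀ d → d N.< D → inv f d ≡ 𝟙 d
 inv-low f D o h d l = E.trans (E.sym (at (PSR.*-identityʳ (inv f)) d))
  (E.trans (⋆-local d {inv f} {inv f} {𝟙} {f} (λ _ _ → E.refl) (λ i r → E.sym (h i (NP.≤-<-trans r l)))) (at (inv-inverse f o) d))

-- Laurent series as a model of the axioms

module LaurentSeries where
 open import Defs using (PS; 𝟙; mono; _⊖_; inv; pochInf)
 open SymplecticSide using (InfProd)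
 open PowerSeries

 -- num / q^den
 record Frac : Set where
  constructor frac
  field
   den : ℕ
   num : PS
 open Frac

 private
  module S = IntSolver PSRing
  open S using (solve; _:=_; _:+_; _:*_; _:-_; :-_; :1; :0)
  open PSR using (refl; sym; trans; *-cong; *-congˡ; *-congʳ; +-cong; +-congˡ; +-congʳ; reflexive)

 infix 4 _≈ᶠ_
 -- Numerators are not normalised, so equality is by cross multiplication; transitivity holds
 -- because powers of q can be cancelled.
 record _≈ᶠ_ (x y : Frac) : Set where
  constructor cross
  field uncross : mono (den y) ⋆ num x ≋ mono (den x) ⋆ num y
 open _≈ᶠ_

 private
  _+ᶠ_ _*ᶠ_ : Frac → Frac → Frac
  frac k f +ᶠ frac l g = frac (k N.+ l) (mono l ⋆ f ⊞ mono k ⋆ g)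
  frac k f *ᶠ frac l g = frac (k N.+ l) (f ⋆ g)

  -ᶠ_ : Frac → Frac
  -ᶠ frac k f = frac k (⊟ f)

  ι₀ : PS → Frac
  ι₀ = frac 0

  X = mono

  X+ : ∀ k l f → X (k N.+ l) ⋆ f ≋ (X k ⋆ X l) ⋆ f
  X+ k l f = *-congʳ (mono-+ k l)

  X0 : ∀ f → X 0 ⋆ f ≋ f
  X0 f = trans (*-congʳ mono-0) (PSR.*-identityˡ f)

  ≈-trans : ∀ {x y z} → x ≈ᶠ y → y ≈ᶠ z → x ≈ᶠ z
  ≈-trans {frac k f} {frac l g} {frac m h} (cross p) (cross r) = cross (mono-cancel l
   (trans (solve 3 (λ l m f → l :* (m :* f) := m :* (l :* f)) tt (X l) (X m) f)
   (trans (*-congˡ p) (trans (solve 3 (λ m k g → m :* (k :* g) := k :* (m :* g)) tt (X m) (X k) g)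
   (trans (*-congˡ r) (solve 3 (λ k l h → k :* (l :* h) := l :* (k :* h)) tt (X k) (X l) h))))))

  +-cong′ : ∀ {x x' y y'} → x ≈ᶠ x' → y ≈ᶠ y' → (x +ᶠ y) ≈ᶠ (x' +ᶠ y')
  +-cong′ {frac k f} {frac k' f'} {frac l g} {frac l' g'} (cross p) (cross r) = cross
   (trans (X+ k' l' _) (trans (solve 6 (λ k' l' l f k g → (k' :* l') :* (l :* f :+ k :* g) := (l' :* l) :* (k' :* f) :+ (k' :* k) :* (l' :* g)) tt (X k') (X l') (X l) f (X k) g)
   (trans (+-cong (*-congˡ p) (*-congˡ r)) (trans (solve 6 (λ k' l' l f k g → (l' :* l) :* (k :* f) :+ (k' :* k) :* (l :* g) := (k :* l) :* (l' :* f :+ k' :* g)) tt (X k') (X l') (X l) f' (X k) g') (sym (X+ k l _))))))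

  *-cong′ : ∀ {x x' y y'} → x ≈ᶠ x' → y ≈ᶠ y' → (x *ᶠ y) ≈ᶠ (x' *ᶠ y')
  *-cong′ {frac k f} {frac k' f'} {frac l g} {frac l' g'} (cross p) (cross r) = cross
   (trans (X+ k' l' _) (trans (solve 4 (λ k' l' f g → (k' :* l') :* (f :* g) := (k' :* f) :* (l' :* g)) tt (X k') (X l') f g)
   (trans (*-cong p r) (trans (solve 4 (λ k' l' f g → (k' :* f) :* (l' :* g) := (k' :* l') :* (f :* g)) tt (X k) (X l) f' g') (sym (X+ k l _))))))

  same : ∀ {k l f g} → k ≡ l → f ≋ g → frac k f ≈ᶠ frac l g
  same E.refl p = cross (*-congˡ p)

  +-assoc′ : ∀ x y z → ((x +ᶠ y) +ᶠ z) ≈ᶠ (x +ᶠ (y +ᶠ z))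
  +-assoc′ (frac k f) (frac l g) (frac m h) = same (NP.+-assoc k l m)
   (trans (+-congˡ (X+ k l h)) (trans (solve 6 (λ k l m f g h → m :* (l :* f :+ k :* g) :+ (k :* l) :* h := (l :* m) :* f :+ k :* (m :* g :+ l :* h)) tt (X k) (X l) (X m) f g h) (+-congʳ (sym (X+ l m f)))))

  1ᶠ 0ᶠ : Frac
  1ᶠ = ι₀ 𝟙
  0ᶠ = ι₀ 𝟘

 FracRing : CommutativeRing 0ℓ 0ℓ
 FracRing = record
  { Carrier = Frac ; _≈_ = _≈ᶠ_ ; _+_ = _+ᶠ_ ; _*_ = _*ᶠ_ ; -_ = -ᶠ_ ; 0# = 0ᶠ ; 1# = 1ᶠ
  ; isCommutativeRing = record
   { isRing = record
    { +-isAbelianGroup = record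
     { isGroup = record
      { isMonoid = record
       { isSemigroup = record
        { isMagma = record
         { isEquivalence = record { refl = cross refl ; sym = λ p → cross (sym (uncross p)) ; trans = ≈-trans }
         ; ∙-cong = +-cong′ }
        ; assoc = +-assoc′ }
       ; identity = (λ { (frac k f) → same E.refl (trans (+-cong (PSR.zeroʳ _) (X0 f)) (PSR.+-identityˡ f)) })
             , (λ { (frac k f) → same (NP.+-identityʳ k) (trans (+-cong (X0 f) (PSR.zeroʳ _)) (PSR.+-identityʳ f)) }) }
      ; inverse = (λ { (frac k f) → cross (trans (X0 _) (trans (solve 2 (λ x f → x :* (:- f) :+ x :* f := :0) tt (X k) f) (sym (PSR.zeroʳ _)))) })
           , (λ { (frac k f) → cross (trans (X0 _) (trans (solve 2 (λ x f → x :* f :+ x :* (:- f) := :0) tt (X k) f) (sym (PSR.zeroʳ _)))) })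
      ; ⁻¹-cong = λ { {frac k f} {frac l g} (cross p) → cross (trans (solve 2 (λ x f → x :* (:- f) := :- (x :* f)) tt (X l) f) (trans (PSR.-‿cong p) (solve 2 (λ x f → :- (x :* f) := x :* (:- f)) tt (X k) g))) } }
     ; comm = λ { (frac k f) (frac l g) → same (NP.+-comm k l) (PSR.+-comm _ _) } }
    ; *-cong = *-cong′
    ; *-assoc = λ { (frac k f) (frac l g) (frac m h) → same (NP.+-assoc k l m) (PSR.*-assoc f g h) }
    ; *-identity = (λ { (frac k f) → same E.refl (PSR.*-identityˡ f) }) , (λ { (frac k f) → same (NP.+-identityʳ k) (PSR.*-identityʳ f) })
    ; distrib = (λ { (frac k f) (frac l g) (frac m h) → cross
           (trans (X+ (k N.+ l) (k N.+ m) _) (trans (*-congʳ (*-cong (mono-+ k l) (mono-+ k m)))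
           (trans (solve 6 (λ k l m f g h → ((k :* l) :* (k :* m)) :* (f :* (m :* g :+ l :* h)) := (k :* (l :* m)) :* ((k :* m) :* (f :* g) :+ (k :* l) :* (f :* h))) tt (X k) (X l) (X m) f g h)
           (*-cong (sym (trans (mono-+ k (l N.+ m)) (*-congˡ (mono-+ l m)))) (+-cong (*-congʳ (sym (mono-+ k m))) (*-congʳ (sym (mono-+ k l)))))))) })
         , (λ { (frac k f) (frac l g) (frac m h) → cross
           (trans (X+ (l N.+ k) (m N.+ k) _) (trans (*-congʳ (*-cong (mono-+ l k) (mono-+ m k)))
           (trans (solve 6 (λ k l m f g h → ((l :* k) :* (m :* k)) :* ((m :* g :+ l :* h) :* f) := ((l :* m) :* k) :* ((m :* k) :* (g :* f) :+ (l :* k) :* (h :* f))) tt (X k) (X l) (X m) f g h)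
           (*-cong (sym (trans (mono-+ (l N.+ m) k) (*-congʳ (mono-+ l m)))) (+-cong (*-congʳ (sym (mono-+ m k))) (*-congʳ (sym (mono-+ l k)))))))) }) }
   ; *-comm = λ { (frac k f) (frac l g) → same (NP.+-comm k l) (PSR.*-comm f g) } } }

 private
  module L = LightRing FracRing
  module LS = IntSolver FracRing

  qzᶠ : ℤ → Frac
  qzᶠ (+ k) = ι₀ (X k)
  qzᶠ -[1+ k ] = frac (suc k) 𝟙

  qz-⊖ : ∀ a b → qzᶠ (a Z.⊖ b) ≈ᶠ frac b (X a)
  qz-⊖ a zero = cross refl
  qz-⊖ zero (suc b) = cross (*-congˡ (sym mono-0))
  qz-⊖ (suc a) (suc b) = ≈-trans (L.reflexive (E.cong qzᶠ (ZP.[1+m]⊖[1+n]≡m⊖n a b))) (≈-trans (qz-⊖ a b)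
   (cross (trans (*-congʳ (mono-+ 1 b)) (trans (solve 3 (λ o b a → (o :* b) :* a := b :* (o :* a)) tt (X 1) (X b) (X a)) (*-congˡ (sym (mono-+ 1 a)))))))

  repr : ∀ z → ∃ λ a → ∃ λ b → z ≡ a Z.⊖ b
  repr (+ k) = k , 0 , E.refl
  repr -[1+ k ] = 0 , suc k , E.refl

  qz-+ᶠ : ∀ k l → qzᶠ (k Z.+ l) ≈ᶠ (qzᶠ k *ᶠ qzᶠ l)
  qz-+ᶠ k l with repr k | repr l
  ... | a , b , E.refl | c , d , E.refl = ≈-trans (L.reflexive (E.cong qzᶠ eq)) (≈-trans (qz-⊖ (a N.+ c) (b N.+ d))
    (≈-trans (same E.refl (mono-+ a c)) (L.sym (*-cong′ (qz-⊖ a b) (qz-⊖ c d)))))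
   where
   lem : ∀ a b c d → (a Z.- b) Z.+ (c Z.- d) ≡ (a Z.+ c) Z.- (b Z.+ d)
   lem = ZS.solve-∀
   eq : (a Z.⊖ b) Z.+ (c Z.⊖ d) ≡ (a N.+ c) Z.⊖ (b N.+ d)
   eq = E.trans (E.cong₂ Z._+_ (E.sym (ZP.m-n≡m⊖n a b)) (E.sym (ZP.m-n≡m⊖n c d))) (E.trans (lem (+ a) (+ b) (+ c) (+ d)) (ZP.m-n≡m⊖n (a N.+ c) (b N.+ d)))

  geom : ℕ → PS
  geom k = inv (𝟙 ⊖ mono (suc k))

  aᶠ : ℤ → Frac
  aᶠ (+ zero) = 0ᶠ
  aᶠ (+ suc k) = ι₀ (geom k)
  aᶠ -[1+ k ] = L.- (ι₀ (mono (suc k)) *ᶠ ι₀ (geom k))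

  ι-sub : ∀ f g → (ι₀ f L.- ι₀ g) ≈ᶠ ι₀ (f ⊞ ⊟ g)
  ι-sub f g = same E.refl (+-cong (X0 f) (X0 (⊟ g)))

  pos-inv : ∀ k → ((1ᶠ L.- qzᶠ (+ suc k)) *ᶠ ι₀ (geom k)) ≈ᶠ 1ᶠ
  pos-inv k = ≈-trans (*-cong′ (ι-sub 𝟙 (mono (suc k))) (L.refl {ι₀ (geom k)})) (same E.refl
   (trans (*-congʳ (reflexive (E.sym (⊖≡ 𝟙 (mono (suc k)))))) (trans (PSR.*-comm _ _) (inv-inverse _ (One-1-q {suc k} (s≤s z≤n))))))

  neg-inv : ∀ k → ((1ᶠ L.- qzᶠ -[1+ k ]) *ᶠ aᶠ -[1+ k ]) ≈ᶠ 1ᶠ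
  neg-inv k = ≈-trans (LS.solve 3 (λ u v i → (LS.:1 LS.:- u) LS.:* (LS.:- (v LS.:* i)) LS.:= ((u LS.:* v) LS.:- v) LS.:* i) tt (qzᶠ -[1+ k ]) (qzᶠ (+ suc k)) (ι₀ (geom k)))
   (≈-trans (*-cong′ (+-cong′ (≈-trans (L.sym (qz-+ᶠ -[1+ k ] (+ suc k))) (≈-trans (L.reflexive (E.cong qzᶠ (ZP.n⊖n≡0 (suc k)))) (same E.refl mono-0))) (L.refl {L.- qzᶠ (+ suc k)})) (L.refl {ι₀ (geom k)})) (pos-inv k))

  a-invᶠ : ∀ {k} → k ≢ + 0 → ((1ᶠ L.- qzᶠ k) *ᶠ aᶠ k) ≈ᶠ 1ᶠ
  a-invᶠ {+ zero} nz = ⊥-elim (nz E.refl)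
  a-invᶠ {+ suc k} nz = pos-inv k
  a-invᶠ { -[1+ k ]} nz = neg-inv k

  Intᶠ : Frac → Set
  Intᶠ x = ∃ λ f → x ≈ᶠ ι₀ f

  Int-ι : ∀ f → Intᶠ (ι₀ f)
  Int-ι f = f , cross refl

  Int-resp′ : ∀ {x y} → x ≈ᶠ y → Intᶠ x → Intᶠ y
  Int-resp′ e (f , p) = f , ≈-trans (L.sym e) p

  Int-*′ : ∀ {x y} → Intᶠ x → Intᶠ y → Intᶠ (x *ᶠ y)
  Int-*′ (f , p) (g , r) = f ⋆ g , *-cong′ p r

  Int-neg′ : ∀ {x} → Intᶠ x → Intᶠ (-ᶠ x)
  Int-neg′ (f , p) = ⊟ f , L.-‿cong p

  Int-a′ : ∀ k → Intᶠ (aᶠ k)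
  Int-a′ (+ zero) = Int-ι _
  Int-a′ (+ suc k) = Int-ι _
  Int-a′ -[1+ k ] = Int-neg′ (Int-*′ (Int-ι (mono (suc k))) (Int-ι (geom k)))

 LaurentQ : QRing
 LaurentQ = record
  { R = FracRing ; qz = qzᶠ ; qz-0 = same E.refl mono-0 ; qz-+ = qz-+ᶠ ; a = aᶠ ; a-inv = a-invᶠ
  ; Int = Intᶠ ; Int-resp = Int-resp′ ; Int-1 = Int-ι 𝟙
  ; Int-+ = λ { (f , p) (g , r) → mono 0 ⋆ f ⊞ mono 0 ⋆ g , +-cong′ p r }
  ; Int-* = Int-*′ ; Int-neg = Int-neg′ ; Int-qz = λ k → Int-ι _ ; Int-a = Int-a′ }

 private
  base : ℕ → ℕ → Frac
  -- At exponent 0 the product has a pole; 0 is a default value, and `Ainf-stepᶠ` asks for s ≠ 0.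
  base M zero = 0ᶠ
  base M (suc k) = ι₀ (inv (pochInf (suc k) M))

  -- fuel-bounded downward continuation of base to negative exponents
  go : ℕ → ℕ → ℤ → Frac
  go M l (+ k) = base M k
  go M zero -[1+ k ] = 0ᶠ
  go M (suc l) -[1+ k ] = aᶠ -[1+ k ] *ᶠ go M l (-[1+ k ] Z.+ + M)

  go-fuel : ∀ M l l' s → + 0 Z.≤ s Z.+ + l → + 0 Z.≤ s Z.+ + l' → go (suc M) l s ≈ᶠ go (suc M) l' s
  go-fuel M l l' (+ k) _ _ = cross refl
  go-fuel M (suc l) (suc l') -[1+ k ] p p' = *-cong′ (L.refl {aᶠ -[1+ k ]}) (go-fuel M l l' (-[1+ k ] Z.+ + suc M) (up l p) (up l' p'))
   where
   lem : ∀ s m l → s Z.+ (+ 1 Z.+ l) Z.+ m ≡ (s Z.+ (+ 1 Z.+ m)) Z.+ l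
   lem = ZS.solve-∀
   up : ∀ l → + 0 Z.≤ -[1+ k ] Z.+ + suc l → + 0 Z.≤ (-[1+ k ] Z.+ + suc M) Z.+ + l
   up l p = E.subst (+ 0 Z.≤_) (lem -[1+ k ] (+ M) (+ l)) (ZP.+-mono-≤ p (Z.+≤+ (z≤n {M})))

  Ainfᶠ : ℕ → ℤ → Frac
  Ainfᶠ M s = go M Z.∣ s ∣ s

  Ainf-stepᶠ : ∀ {M} → M ≢ 0 → ∀ s → s ≢ + 0 → Ainfᶠ M s ≈ᶠ (aᶠ s *ᶠ Ainfᶠ M (s Z.+ + M))
  Ainf-stepᶠ {zero} M≢0 s nz = ⊥-elim (M≢0 E.refl)
  Ainf-stepᶠ {suc M} _ (+ zero) nz = ⊥-elim (nz E.refl)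
  Ainf-stepᶠ {suc M} _ (+ suc k) nz = same E.refl (cancel-One {pochInf (suc k) (suc M)} (One-pochInf {suc k} (suc M) (s≤s z≤n))
   (trans (PSR.*-comm _ _) (trans (inv-inverse P oP) (sym (trans (*-congʳ (pochInf-step (suc k) (suc M) (s≤s z≤n)))
    (trans (solve 4 (λ f P g i → (f :* P) :* (g :* i) := (g :* f) :* (i :* P)) tt (𝟙 ⊖ mono (suc k)) P' (geom k) (inv P'))
     (trans (*-cong (inv-inverse _ (One-1-q {suc k} (s≤s z≤n))) (inv-inverse P' (One-pochInf {suc k N.+ suc M} (suc M) (s≤s z≤n)))) (PSR.*-identityˡ 𝟙))))))))
   where
   P = pochInf (suc k) (suc M)
   P' = pochInf (suc k N.+ suc M) (suc M)
   oP = One-pochInf {suc k} (suc M) (s≤s z≤n)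
  Ainf-stepᶠ {suc M} _ -[1+ k ] nz = *-cong′ (L.refl {aᶠ -[1+ k ]}) (go-fuel M k Z.∣ s' ∣ s' p₁ (p₂ s'))
   where
   s' = -[1+ k ] Z.+ + suc M
   lem : ∀ m k → m ≡ (Z.- (+ 1 Z.+ k) Z.+ (+ 1 Z.+ m)) Z.+ k
   lem = ZS.solve-∀
   p₁ : + 0 Z.≤ s' Z.+ + k
   p₁ = E.subst (+ 0 Z.≤_) (lem (+ M) (+ k)) (Z.+≤+ z≤n)
   p₂ : ∀ s → + 0 Z.≤ s Z.+ + Z.∣ s ∣
   p₂ (+ j) = Z.+≤+ z≤n
   p₂ -[1+ j ] = E.subst (+ 0 Z.≤_) (E.sym (ZP.n⊖n≡0 (suc j))) (Z.+≤+ z≤n)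

  Int-Ainfᶠ : ∀ M s → Intᶠ (Ainfᶠ M s)
  Int-Ainfᶠ M s = Int-go Z.∣ s ∣ s
   where
   Int-go : ∀ l s → Intᶠ (go M l s)
   Int-go l (+ zero) = Int-ι _
   Int-go l (+ suc k) = Int-ι _
   Int-go zero -[1+ k ] = Int-ι _
   Int-go (suc l) -[1+ k ] = Int-*′ (Int-a′ -[1+ k ]) (Int-go l (-[1+ k ] Z.+ + M))

  Int-drop : ∀ D f → (∀ d → d N.< D → f d ≡ + 0) → Intᶠ (qzᶠ (Z.- (+ D)) *ᶠ ι₀ f)
  Int-drop D f z = (λ d → f (D N.+ d)) , ≈-trans (*-cong′ (L.refl {qzᶠ (Z.- (+ D))}) (≈-trans (same E.refl (mono-drop D f z)) (L.refl {ι₀ (mono D) *ᶠ ι₀ g})))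
   (≈-trans (L.sym (L.*-assoc (qzᶠ (Z.- (+ D))) (qzᶠ (+ D)) (ι₀ g))) (≈-trans (*-cong′ (≈-trans (L.sym (qz-+ᶠ (Z.- (+ D)) (+ D))) (≈-trans (L.reflexive (E.cong qzᶠ (ZP.+-inverseˡ (+ D)))) (same E.refl mono-0))) (L.refl {ι₀ g})) (L.*-identityˡ (ι₀ g))))
   where
   g : PS
   g d = f (D N.+ d)

  Ainf-bigᶠ : ∀ {M} → M ≢ 0 → ∀ {D} s → + D Z.≤ s → Intᶠ (qzᶠ (Z.- (+ D)) *ᶠ (Ainfᶠ M s L.- 1ᶠ))
  Ainf-bigᶠ {M} _ {D} (+ zero) (Z.+≤+ z≤n) = Int-*′ (Int-ι _) (_ , ι-sub 𝟘 𝟙)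
  Ainf-bigᶠ {M} _ {D} (+ suc k) (Z.+≤+ le) = Int-resp′ (*-cong′ (L.refl {qzᶠ (Z.- (+ D))}) (L.sym (ι-sub y 𝟙)))
   (Int-drop D (y ⊞ ⊟ 𝟙) (λ d l → E.trans (⊞-at y (⊟ 𝟙) d) (E.trans (E.cong₂ Z._+_ (inv-low P D (One-pochInf {suc k} M (s≤s z≤n)) (λ i r → pochInf-low (suc k) M i (NP.<-≤-trans r le)) d l) (⊟-at 𝟙 d)) (ZP.+-inverseʳ (𝟙 d)))))
   where
   P = pochInf (suc k) M
   y = inv P

 LaurentI : InfProd LaurentQ
 LaurentI = record { Ainf = Ainfᶠ ; Ainf-step = Ainf-stepᶠ ; Ainf-big = Ainf-bigᶠ ; Int-Ainf = Int-Ainfᶠ }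

 -- What the evaluation of the left-hand side needs to know about Laurent series.
 record Model : Set₁ where
  field
   Q : QRing
   I : InfProd Q
  open QRing Q
  open InfProd I
  field
   ι : PS → Carrier
   ι-cong : ∀ {f g} → f ≋ g → ι f ≈ ι g
   ι-+ : ∀ f g → ι (f ⊞ g) ≈ ι f + ι g
   ι-* : ∀ f g → ι (f ⋆ g) ≈ ι f * ι g
   ι-0 : ι 𝟘 ≈ 0#
   ι-Int : ∀ f → Int (ι f)
   ι-1 : ι 𝟙 ≈ 1#
   ι-qz : ∀ k → qz (+ k) ≈ ι (mono k)
   ι-a : ∀ k → a (+ suc k) ≈ ι (inv (𝟙 ⊖ mono (suc k)))
   ι-Ainf : ∀ M k → Ainf M (+ suc k) ≈ ι (inv (pochInf (suc k) M))
   ι-mod : ∀ D {f g} → Int (qz (Z.- (+ D)) * (ι f - ι g)) → ∀ d → d N.< D → f d ≡ g d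

 laurent : Model
 laurent = record
  { Q = LaurentQ ; I = LaurentI ; ι = ι₀ ; ι-cong = same E.refl
  ; ι-+ = λ f g → same E.refl (sym (+-cong (X0 f) (X0 g))) ; ι-* = λ f g → L.refl {ι₀ (f ⋆ g)} ; ι-0 = L.refl {0ᶠ} ; ι-Int = Int-ι ; ι-1 = L.refl {1ᶠ}
  ; ι-qz = λ k → L.refl {ι₀ (mono k)} ; ι-a = λ k → L.refl {ι₀ (geom k)} ; ι-Ainf = λ M k → L.refl {base M (suc k)} ; ι-mod = mod }
  where
  mod : ∀ D {f g} → Intᶠ (qzᶠ (Z.- (+ D)) *ᶠ (ι₀ f L.- ι₀ g)) → ∀ d → d N.< D → f d ≡ g d
  mod (suc D) {f} {g} (h , p) d l = eq (f d) (g d) (E.trans (E.sym (E.trans (⊞-at f (⊟ g) d) (E.cong (λ x → f d Z.+ x) (⊟-at g d)))) (E.trans (at main d) (mono-< (suc D) h d l)))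
   where
   main : f ⊞ ⊟ g ≋ mono (suc D) ⋆ h
   main = trans (sym (trans (X0 _) (PSR.*-identityˡ _))) (trans (uncross (≈-trans (L.sym (*-cong′ (L.refl {qzᶠ -[1+ D ]}) (ι-sub f g))) p)) (*-congʳ (reflexive (E.cong mono (NP.+-identityʳ (suc D))))))
   eq : ∀ x y → x Z.- y ≡ + 0 → x ≡ y
   eq x y e = ZP.i-j≡0⇒i≡j x y e

-- Theta product identities behind the second equality

module ProductIdentities where
 open import Data.List using (upTo)
 open import Defs using (PS; 𝟙; mono; _⊖_; _^ᵖ_; prodPS; pochInf; theta)
 open PowerSeries

 open PSR using (refl; sym; trans; reflexive; *-cong; *-congˡ; *-congʳ; *-assoc; *-comm; *-identityˡ; *-identityʳ; +-congʳ; +-congˡ; begin_; _≈⟨_⟩_; _≈⟨_⟨_; _∎)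
 open IntSolver PSRing

 PR : ℕ → (ℕ → PS) → PS
 PR zero u = 𝟙
 PR (suc n) u = u n ⋆ PR n u

 PR-cong : ∀ n {u v} → (∀ i → i N.< n → u i ≋ v i) → PR n u ≋ PR n v
 PR-cong zero h = refl
 PR-cong (suc n) h = *-cong (h n NP.≤-refl) (PR-cong n (λ i l → h i (NP.m<n⇒m<1+n l)))

 PR-⋆ : ∀ n u v → PR n (λ i → u i ⋆ v i) ≋ PR n u ⋆ PR n v
 PR-⋆ zero u v = sym (*-identityˡ 𝟙)
 PR-⋆ (suc n) u v = trans (*-congˡ (PR-⋆ n u v)) (solve 4 (λ a b c d → (a :* b) :* (c :* d) := (a :* c) :* (b :* d)) tt (u n) (v n) (PR n u) (PR n v))

 PR-front : ∀ n u → PR (suc n) u ≋ u 0 ⋆ PR n (λ i → u (suc i))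
 PR-front zero u = refl
 PR-front (suc n) u = trans (*-congˡ (PR-front n u)) (solve 3 (λ a b c → a :* (b :* c) := b :* (a :* c)) tt (u (suc n)) (u 0) (PR n (λ i → u (suc i))))

 PR-split : ∀ k l u → PR (k N.+ l) u ≋ PR k u ⋆ PR l (λ i → u (k N.+ i))
 PR-split zero l u = sym (*-identityˡ _)
 PR-split (suc k) l u = trans (PR-front (k N.+ l) u) (trans (*-congˡ (PR-split k l (λ i → u (suc i)))) (trans (sym (*-assoc _ _ _)) (*-congʳ (sym (PR-front k u)))))

 PR-rev : ∀ n {u v} → (∀ i j → suc (i N.+ j) ≡ n → u i ≋ v j) → PR n u ≋ PR n v
 PR-rev zero h = refl
 PR-rev (suc n) {u} {v} h = trans (*-cong (h n 0 (E.cong suc (NP.+-identityʳ n))) (PR-rev n {u} {λ j → v (suc j)} (λ i j e → h i (suc j) (E.trans (E.cong suc (NP.+-suc i j)) (E.cong suc e))))) (sym (PR-front n v))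

 PR-One : ∀ n {u} → (∀ i → One (u i)) → One (PR n u)
 PR-One zero h = E.refl
 PR-One (suc n) {u} h = One-⋆ {u n} {PR n u} (h n) (PR-One n h)

 PR-local : ∀ n {u v} d → (∀ i k → k N.≤ d → u i k ≡ v i k) → PR n u d ≡ PR n v d
 PR-local zero d h = E.refl
 PR-local (suc n) {u} {v} d h = ⋆-local d {u n} {v n} {PR n u} {PR n v} (h n) (λ k l → PR-local n k (λ i k' l' → h i k' (NP.≤-trans l' l)))

 prodPS-PR : ∀ n u → prodPS (map u (upTo n)) ≋ PR n u
 prodPS-PR zero u = refl
 prodPS-PR (suc n) u = trans (prodPS-suc n u) (trans (*-congˡ (prodPS-PR n (λ i → u (suc i)))) (sym (PR-front n u)))

 pwr : PS → ℕ → PS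
 pwr f n = PR n (λ _ → f)

 ^-pwr : ∀ f n → f ^ᵖ n ≋ pwr f n
 ^-pwr f zero = refl
 ^-pwr f (suc n) = trans (reflexive (E.sym (⋆≡⊗ f (f ^ᵖ n)))) (*-congˡ (^-pwr f n))

 pwr-⋆ : ∀ f g n → pwr (f ⋆ g) n ≋ pwr f n ⋆ pwr g n
 pwr-⋆ f g n = PR-⋆ n (λ _ → f) (λ _ → g)

 private
  pc-++ : ∀ k l a p → pc a p (k N.+ l) ≋ pc a p k ⋆ pc (a N.+ k N.* p) p l
  pc-++ zero l a p = trans (reflexive (E.cong (λ x → pc x p l) (E.sym (NP.+-identityʳ a)))) (sym (*-identityˡ _))
  pc-++ (suc k) l a p = trans (*-congˡ (trans (pc-++ k l (a N.+ p) p) (*-congˡ (reflexive (E.cong (λ x → pc x p l) (NP.+-assoc a p (k N.* p))))))) (sym (*-assoc _ _ _))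

  pc-PR : ∀ c a p → pc a p c ≋ PR c (λ i → 𝟙 ⊖ mono (a N.+ i N.* p))
  pc-PR zero a p = refl
  pc-PR (suc c) a p = trans (*-cong (reflexive (E.cong (λ x → 𝟙 ⊖ mono x) (E.sym (NP.+-identityʳ a)))) (trans (pc-PR c (a N.+ p) p) (PR-cong c (λ i _ → reflexive (E.cong (λ x → 𝟙 ⊖ mono x) (NP.+-assoc a p (i N.* p))))))) (sym (PR-front c _))

  pc-split : ∀ k c a p → pc a p (k N.* c) ≋ PR c (λ i → pc (a N.+ i N.* p) (c N.* p) k)
  pc-split zero c a p = go c
   where
   go : ∀ c → 𝟙 ≋ PR c (λ _ → 𝟙)
   go zero = refl
   go (suc c) = trans (go c) (sym (*-identityˡ _))
  pc-split (suc k) c a p = trans (pc-++ c (k N.* c) a p) (trans (*-cong (pc-PR c a p) (trans (pc-split k c (a N.+ c N.* p) p)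
   (PR-cong c (λ i _ → reflexive (E.cong (λ x → pc x (c N.* p) k) (lem a (c N.* p) (i N.* p))))))) (sym (PR-⋆ c _ _)))
   where
   lem : ∀ a b c → a N.+ b N.+ c ≡ a N.+ c N.+ b
   lem = NS.solve-∀

 -- The factors with exponents a + jp are sorted by the residue of j modulo c.
 pochInf-split : ∀ c a p → 1 N.≤ c → 1 N.≤ p → pochInf a p ≋ PR c (λ i → pochInf (a N.+ i N.* p) (c N.* p))
 pochInf-split c a p c≥1 p≥1 = mk (λ d → E.trans (pochInf-pc a p p≥1 (suc d N.* c) d (E.subst (N._≤ suc d N.* c) (NP.*-identityʳ (suc d)) (NP.*-monoʳ-≤ (suc d) c≥1)))
  (E.trans (at (pc-split (suc d) c a p) d) (PR-local c d (λ i k l → E.sym (pochInf-pc (a N.+ i N.* p) (c N.* p) (NP.*-mono-≤ c≥1 p≥1) (suc d) k (s≤s l))))))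

 private
  cancel-0 : ∀ d f g → f 0 ≢ + 0 → g ⋆ f ≋ 𝟘 → g d ≡ + 0
  g0≡0 : ∀ f g → f 0 ≢ + 0 → g ⋆ f ≋ 𝟘 → g 0 ≡ + 0
  g0≡0 f g nz e with ZP.i*j≡0⇒i≡0∨j≡0 (g 0) (E.trans (E.sym (⋆-0 g f)) (at e 0))
  ... | inj₁ z = z
  ... | inj₂ z = ⊥-elim (nz z)
  cancel-0 zero f g nz e = g0≡0 f g nz e
  cancel-0 (suc d) f g nz e = cancel-0 d f (shiftˡ g) nz (mk (λ k → E.trans (E.sym (E.trans (⋆-suc g f k) (E.trans (E.cong (λ x → x Z.* f (suc k) Z.+ (shiftˡ g ⋆ f) k) (g0≡0 f g nz e)) (E.trans (E.cong (Z._+ (shiftˡ g ⋆ f) k) (ZP.*-zeroˡ (f (suc k)))) (ZP.+-identityˡ _))))) (at e (suc k))))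

 -- (f - g)(f + g) = 0, and f + g has constant term 2, so it can be cancelled.
 sq-inj : ∀ {f g} → One f → One g → f ⋆ f ≋ g ⋆ g → f ≋ g
 sq-inj {f} {g} of og e = mk (λ d → ZP.i-j≡0⇒i≡j (f d) (g d) (E.trans (E.sym (E.trans (⊞-at f (⊟ g) d) (E.cong (λ x → f d Z.+ x) (⊟-at g d)))) (cancel-0 d (f ⊞ g) (f ⊞ ⊟ g) nz
  (trans (solve 2 (λ f g → (f :- g) :* (f :+ g) := f :* f :- g :* g) tt f g) (trans (+-congʳ e) (PSR.-‿inverseʳ _))))))
  where
  nz : (f ⊞ g) 0 ≢ + 0
  nz p with E.trans (E.sym (E.trans (⊞-at f g 0) (E.cong₂ Z._+_ of og))) p
  ... | ()

 theta-⋆ : ∀ a p → theta a p ≋ pochInf a p ⋆ pochInf (p ∸ a) p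
 theta-⋆ a p = reflexive (E.sym (⋆≡⊗ _ _))

 module ThetaProducts (h' : ℕ) where
  h κ' κ : ℕ
  h = suc h'
  κ' = h' N.+ h
  κ = suc κ'

  p th T : ℕ → PS
  p k = pochInf k κ
  th k = p k ⋆ p (κ ∸ k)
  T n = PR n (λ i → th (suc i))

  -- By `eta≋` this is (q;q)_∞/(q^κ;q^κ)_∞.
  Q : PS
  Q = PR κ' (λ i → p (suc i))

  One-p : ∀ k → One (p (suc k))
  One-p k = One-pochInf {suc k} κ (s≤s z≤n)

  One-Q : One Q
  One-Q = PR-One κ' One-p

  private
   κ∸ : ∀ i j → i N.+ j ≡ κ → κ ∸ i ≡ j
   κ∸ i j e = E.trans (E.cong (_∸ i) (E.sym e)) (NP.m+n∸m≡n i j)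

  th-sym : ∀ i j → i N.+ j ≡ κ → th i ≋ th j
  th-sym i j e = trans (*-congˡ (reflexive (E.cong p (κ∸ i j e)))) (trans (*-comm _ _) (*-congˡ (reflexive (E.cong p (E.sym (κ∸ j i (E.trans (NP.+-comm j i) e)))))))

  eta≋ : pochInf 1 1 ≋ p κ ⋆ Q
  eta≋ = trans (pochInf-split κ 1 1 (s≤s z≤n) (s≤s z≤n)) (PR-cong κ (λ i _ → reflexive (E.cong₂ (λ x y → pochInf (suc x) y) (NP.*-identityʳ i) (NP.*-identityʳ κ))))

  private
   rev-p : ∀ n (u : ℕ → ℕ) → (∀ i j → suc (i N.+ j) ≡ n → u i N.+ u j ≡ κ) → PR n (λ i → th (u i)) ≋ PR n (λ i → p (u i)) ⋆ PR n (λ i → p (u i))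
   rev-p n u h = trans (PR-⋆ n _ _) (*-congˡ (PR-rev n (λ i j e → reflexive (E.cong p (κ∸ (u i) (u j) (h i j e))))))

   T-full : T κ' ≋ Q ⋆ Q
   T-full = rev-p κ' suc (λ i j e → E.cong suc (E.trans (NP.+-suc i j) e))

  -- By the symmetry th i = th (κ - i), the factors of T b read backwards continue T a up to T κ',
  -- in which every p k with 0 < k < κ occurs twice.
  T-split : ∀ a b → a N.+ b ≡ κ' → T a ⋆ T b ≋ Q ⋆ Q
  T-split a b e = trans (*-congˡ (sym (PR-rev b {λ i → th (suc (a N.+ i))} (λ i j r → th-sym (suc (a N.+ i)) (suc j) (E.trans (lem a i j) (E.cong suc (E.trans (E.cong (a N.+_) r) e)))))))
   (trans (sym (PR-split a b (λ i → th (suc i)))) (trans (reflexive (E.cong T e)) T-full))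
   where
   lem : ∀ a i j → suc (a N.+ i) N.+ suc j ≡ suc (a N.+ suc (i N.+ j))
   lem = NS.solve-∀

  private
   Q≋ : Q ≋ T h' ⋆ p h
   Q≋ = begin
    _ ≈⟨ PR-split h' (suc h') _ ⟩
    _ ≈⟨ *-congˡ (trans (PR-front h' _) (*-cong (reflexive (E.cong (λ x → p (suc x)) (NP.+-identityʳ h'))) (PR-rev h' (λ i j e → reflexive (E.cong p (E.sym (κ∸ (suc j) (suc (h' N.+ suc i)) (E.trans (lem h' i j) (E.cong (λ x → suc (h' N.+ suc x)) e))))))))) ⟩
    _ ≈⟨ solve 3 (λ a b c → a :* (b :* c) := (a :* c) :* b) tt _ (p h) _ ⟩
    _ ≈⟨ *-congʳ (PR-⋆ h' _ _) ⟨
    T h' ⋆ p h ∎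
    where
    lem : ∀ h i j → suc j N.+ suc (h N.+ suc i) ≡ suc (h N.+ suc (suc (i N.+ j)))
    lem = NS.solve-∀

   W : PS
   W = PR h' (λ i → p (suc i N.+ suc i))

   two≋ : pochInf 2 2 ≋ p κ ⋆ W
   two≋ = trans (pochInf-split h 2 2 (s≤s z≤n) (s≤s z≤n)) (PR-cong h (λ i _ → reflexive (E.cong₂ pochInf (l₁ i) (l₂ h'))))
    where
    l₁ : ∀ i → 2 N.+ i N.* 2 ≡ suc i N.+ suc i
    l₁ = NS.solve-∀
    l₂ : ∀ h → suc h N.* 2 ≡ suc (h N.+ suc h)
    l₂ = NS.solve-∀

   W² : PR h' (λ i → th (suc i N.+ suc i)) ≋ W ⋆ W
   W² = rev-p h' (λ i → suc i N.+ suc i) (λ i j e → E.trans (lem i j) (E.cong (λ x → suc (x N.+ suc x)) e))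
    where
    lem : ∀ i j → (suc i N.+ suc i) N.+ (suc j N.+ suc j) ≡ suc (suc (i N.+ j) N.+ suc (suc (i N.+ j)))
    lem = NS.solve-∀

  -- y j and x m collect the theta factors whose largest index is j + 1 in the first product and m +
  -- 1 in the second. So Y n and X m are the complete theta parts of the two right-hand sides.
  y x Y X : ℕ → PS
  y j = th (h' ∸ j) ⋆ T (suc (j N.+ j))
  x m = th (suc (suc m)) ⋆ PR m (λ i → th (m ∸ i) ⋆ th (suc (suc m N.+ suc i)))
  Y n = PR n y
  X m = PR m x

  T-rev : ∀ m → PR m (λ i → th (m ∸ i)) ≋ T m
  T-rev m = PR-rev m (λ i j e → reflexive (E.cong th (E.trans (E.cong (_∸ i) (E.trans (E.sym e) (E.sym (NP.+-suc i j)))) (NP.m+n∸m≡n i (suc j)))))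

  x≋ : ∀ m → th (suc m) ⋆ x m ≋ T (suc m N.+ suc m)
  x≋ m = begin
   _ ≈⟨ *-congˡ (*-congˡ (trans (PR-⋆ m _ _) (*-congʳ (T-rev m)))) ⟩
   _ ≈⟨ solve 4 (λ a b c d → a :* (b :* (c :* d)) := (a :* c) :* (b :* d)) tt (th (suc m)) (th (suc (suc m))) (T m) R ⟩
   _ ≈⟨ *-congˡ (trans (*-congʳ (reflexive (E.cong (λ k → th (suc (suc k))) (E.sym (NP.+-identityʳ m))))) (sym (PR-front m (λ i → th (suc (suc m N.+ i)))))) ⟩
   _ ≈⟨ PR-split (suc m) (suc m) (λ i → th (suc i)) ⟨
   _ ∎
   where R = PR m (λ i → th (suc (suc m N.+ suc i)))

  private
   one-th : ∀ i → i N.≤ κ' → 1 N.≤ i → One (th i)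
   one-th (suc i) l _ = One-⋆ {p (suc i)} {p (κ ∸ suc i)} (One-p i) (One-pochInf {κ ∸ suc i} κ (NP.m<n⇒0<n∸m (s≤s l)))

   OneT : ∀ n → n N.≤ κ' → One (T n)
   OneT zero _ = E.refl
   OneT (suc n) l = One-⋆ {th (suc n)} {T n} (one-th (suc n) l (s≤s z≤n)) (OneT n (NP.<⇒≤ l))

  One-Y : ∀ n → n N.≤ h' → One (Y n)
  One-Y zero _ = E.refl
  One-Y (suc n) l = One-⋆ {y n} {Y n} (One-⋆ {th (h' ∸ n)} {T (suc (n N.+ n))} (one-th (h' ∸ n) (NP.≤-trans (NP.m∸n≤m h' n) (NP.m≤m+n h' h)) (NP.m<n⇒0<n∸m l)) (OneT (suc (n N.+ n)) (E.subst (N._≤ κ') (NP.+-suc n n) (NP.+-mono-≤ (NP.<⇒≤ l) (NP.m≤n⇒m≤1+n l))))) (One-Y n (NP.<⇒≤ l))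

  private
   -- Pair y i with y (h' - 1 - i). Together with th (2i + 2), their partial products T have lengths
   -- adding up to κ - 1, so `T-split` evaluates every pair.
   Y² : (Y h' ⋆ Y h') ⋆ (W ⋆ W) ≋ (T h' ⋆ T h') ⋆ pwr (Q ⋆ Q) h'
   Y² = begin
    _ ≈⟨ *-cong (*-congˡ (PR-rev h' {y} {y′} (λ i j e → rv i j e))) (sym W²) ⟩
    _ ≈⟨ trans (PR-⋆ h' _ _) (*-congʳ (PR-⋆ h' y y′)) ⟨
    _ ≈⟨ PR-cong h' each ⟩
    _ ≈⟨ trans (PR-⋆ h' _ _) (*-congʳ (trans (PR-⋆ h' _ _) (*-congʳ (T-rev h')))) ⟩
    _ ∎
    where
    y′ : ℕ → PS
    y′ i = y (h' ∸ suc i)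
    rv : ∀ i j → suc (i N.+ j) ≡ h' → y i ≋ y′ j
    rv i j e = reflexive (E.cong y (E.sym (E.trans (E.cong (_∸ suc j) (E.trans (E.sym e) (E.cong suc (NP.+-comm i j)))) (NP.m+n∸m≡n (suc j) i))))
    lem : ∀ i j → suc (suc (i N.+ i)) N.+ suc (j N.+ j) ≡ suc (i N.+ j) N.+ suc (suc (i N.+ j))
    lem = NS.solve-∀
    each : ∀ i → i N.< h' → (y i ⋆ y′ i) ⋆ th (suc i N.+ suc i) ≋ (th (h' ∸ i) ⋆ th (suc i)) ⋆ (Q ⋆ Q)
    each i l = trans (*-congʳ (*-congˡ (*-congʳ (reflexive (E.cong th hj)))))
     (trans (solve 5 (λ a t b s c → ((a :* t) :* (b :* s)) :* c := (a :* b) :* ((c :* t) :* s)) tt (th (h' ∸ i)) (T (suc (i N.+ i))) (th (suc i)) (T (suc (j N.+ j))) (th (suc i N.+ suc i)))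
     (*-congˡ (trans (*-congʳ (*-congʳ (reflexive (E.cong (λ k → th (suc k)) (NP.+-suc i i))))) (T-split (suc (suc (i N.+ i))) (suc (j N.+ j)) (E.trans (lem i j) (E.cong (λ k → k N.+ suc k) ij))))))
     where
     j = h' ∸ suc i
     ij : suc (i N.+ j) ≡ h'
     ij = NP.m+[n∸m]≡n l
     hj : h' ∸ j ≡ suc i
     hj = NP.m∸[m∸n]≡n l

   -- The pairing in `Y²` runs over each factor twice, so it determines the square; both sides have
   -- constant term 1, which fixes the root.
   base : pochInf 2 2 ⋆ p h ⋆ Y h' ≋ pwr Q h ⋆ p κ
   base = sq-inj (One-⋆ {pochInf 2 2 ⋆ p h} {Y h'} (One-⋆ {pochInf 2 2} {p h} (One-pochInf {2} 2 (s≤s z≤n)) (One-p h')) (One-Y h' NP.≤-refl)) (One-⋆ {pwr Q h} {p κ} (PR-One h {λ _ → Q} (λ _ → One-Q)) (One-p κ')) (begin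
    _ ≈⟨ *-cong (*-congʳ (*-congʳ two≋)) (*-congʳ (*-congʳ two≋)) ⟩
    _ ≈⟨ solve 4 (λ k w h y → (k :* w :* h :* y) :* (k :* w :* h :* y) := (k :* k) :* (h :* h) :* ((y :* y) :* (w :* w))) tt (p κ) W (p h) (Y h') ⟩
    _ ≈⟨ *-congˡ (trans Y² (*-congˡ (pwr-⋆ Q Q h'))) ⟩
    _ ≈⟨ solve 4 (λ k h t w → (k :* k) :* (h :* h) :* ((t :* t) :* (w :* w)) := (((t :* h) :* w) :* k) :* (((t :* h) :* w) :* k)) tt (p κ) (p h) (T h') (pwr Q h') ⟩
    _ ≈⟨ *-cong (*-congʳ (*-congʳ Q≋)) (*-congʳ (*-congʳ Q≋)) ⟨
    _ ∎)

  -- If m + 1 + n = h', then x m times y n is Q²: y n lends x m the factor th (m + 1), and the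
  -- partial products of lengths 2m + 2 and 2n + 1 exhaust T κ'. Moving one factor from Y to X
  -- therefore changes both sides by the same powers of Q.
  exchange : ∀ m n → m N.+ n ≡ h' → pochInf 2 2 ⋆ p h ⋆ Y n ⋆ pwr Q m ≋ X m ⋆ pwr Q (suc n) ⋆ p κ
  exchange zero n E.refl = trans (*-identityʳ _) (trans base (*-congʳ (sym (*-identityˡ _))))
  exchange (suc m) n e = cancel-One {Q} One-Q (begin
   _ ≈⟨ solve 4 (λ q a y w → q :* (a :* y :* (q :* w)) := (q :* q) :* (a :* y :* w)) tt Q A (Y n) (pwr Q m) ⟩
   _ ≈⟨ *-congʳ (sym xy) ⟩
   _ ≈⟨ solve 5 (λ x y a Y w → (x :* y) :* (a :* Y :* w) := x :* (a :* (y :* Y) :* w)) tt (x m) (y n) A (Y n) (pwr Q m) ⟩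
   _ ≈⟨ *-congˡ (exchange m (suc n) (E.trans (NP.+-suc m n) e)) ⟩
   _ ≈⟨ solve 5 (λ x X q w k → x :* (X :* (q :* w) :* k) := q :* ((x :* X) :* w :* k)) tt (x m) (X m) Q (pwr Q (suc n)) (p κ) ⟩
   _ ∎)
   where
   A = pochInf 2 2 ⋆ p h
   lem : ∀ m n → (suc m N.+ suc m) N.+ suc (n N.+ n) ≡ (suc m N.+ n) N.+ suc (suc m N.+ n)
   lem = NS.solve-∀
   xy : x m ⋆ y n ≋ Q ⋆ Q
   xy = trans (*-congˡ (*-congʳ (reflexive (E.cong th (E.trans (E.cong (_∸ n) (E.sym e)) (NP.m+n∸n≡m (suc m) n))))))
    (trans (solve 3 (λ x a t → x :* (a :* t) := (a :* x) :* t) tt (x m) (th (suc m)) (T (suc (n N.+ n))))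
    (trans (*-congʳ (x≋ m)) (T-split (suc m N.+ suc m) (suc (n N.+ n)) (E.trans (lem m n) (E.cong (λ k → k N.+ suc k) e)))))

  half : ∀ i → pochInf i h ≋ p i ⋆ p (i N.+ h)
  half i = trans (pochInf-split 2 i h (s≤s z≤n) (s≤s z≤n)) (trans (solve 2 (λ a b → a :* (b :* :1) := b :* a) tt _ _)
   (*-cong (reflexive (E.cong₂ pochInf (NP.+-identityʳ i) l₂)) (reflexive (E.cong₂ pochInf (E.cong (i N.+_) (NP.+-identityʳ h)) l₂))))
   where
   l₂ : 2 N.* h ≡ κ
   l₂ = E.cong (λ k → suc (h' N.+ k)) (NP.+-identityʳ h)

  theta-half : ∀ i → i N.≤ h → theta i h ≋ th i ⋆ th (h ∸ i)
  theta-half i l = trans (theta-⋆ i h) (trans (*-cong (half i) (half (h ∸ i)))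
   (trans (solve 4 (λ a b c d → (a :* b) :* (c :* d) := (a :* d) :* (c :* b)) tt (p i) (p (i N.+ h)) (p (h ∸ i)) (p (h ∸ i N.+ h)))
   (*-cong (*-congˡ (reflexive (E.cong p (E.sym (κ∸ i (h ∸ i N.+ h) (E.trans (E.sym (NP.+-assoc i (h ∸ i) h)) (E.cong (N._+ h) (NP.m+[n∸m]≡n l)))))))) (*-congˡ (reflexive (E.cong p (E.sym (κ∸ (h ∸ i) (i N.+ h) (E.trans (E.sym (NP.+-assoc (h ∸ i) i h)) (E.cong (N._+ h) (NP.m∸n+n≡m l)))))))))))

  y≋ : ∀ n → n N.≤ h' → theta (suc n) h ⋆ PR n (λ i → th (n ∸ i) ⋆ th (suc i N.+ suc n)) ≋ y n
  y≋ n l = begin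
   _ ≈⟨ *-cong (theta-half (suc n) (s≤s l)) (trans (PR-⋆ n _ _) (*-cong (T-rev n) (PR-cong n (λ i _ → reflexive (E.cong th (lem i n)))))) ⟩
   _ ≈⟨ solve 4 (λ a b t r → (a :* b) :* (t :* r) := b :* ((a :* t) :* r)) tt (th (suc n)) (th (h' ∸ n)) (T n) R ⟩
   _ ≈⟨ *-congˡ (PR-split (suc n) n (λ i → th (suc i))) ⟨
   y n ∎
   where
   R = PR n (λ i → th (suc (suc n N.+ i)))
   lem : ∀ i n → suc i N.+ suc n ≡ suc (suc n N.+ i)
   lem = NS.solve-∀

-- Matching the evaluation with the product sides

module ProductSide where
 open import Data.List using (upTo; concatMap)
 open import Data.List.Properties using (map-++)
 open import Defs using (PS; _⊗_; _^ᵖ_; prodPS; inv; pochInf; theta; rhs1; rhs2; pairs)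
 open PowerSeries
 open ProductIdentities
 open SymplecticSide using (InfProd; pos-∸)
 open LittlewoodSum using (module Link)
 open Quotient
 open LaurentSeries using (Model)

 module _ where
  open PSR using (refl; sym; trans; reflexive; *-cong; *-congˡ; *-congʳ; *-assoc; *-comm; *-identityˡ; *-identityʳ; begin_; _≈⟨_⟩_; _≈⟨_⟨_; _∎)
  open IntSolver PSRing

  ⊗≋ : ∀ {f f' g g'} → f ≋ f' → g ≋ g' → f ⊗ g ≋ f' ⋆ g'
  ⊗≋ {f} {f'} {g} {g'} p r = trans (reflexive (E.sym (⋆≡⊗ f g))) (*-cong p r)

  private
   prodPS-++ : ∀ xs ys → prodPS (xs ++ ys) ≋ prodPS xs ⋆ prodPS ys
   prodPS-++ [] ys = sym (*-identityˡ _)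
   prodPS-++ (x ∷ xs) ys = trans (⊗≋ refl (prodPS-++ xs ys)) (trans (sym (*-assoc _ _ _)) (*-congʳ (reflexive (⋆≡⊗ x (prodPS xs)))))

   prodPS-concatMap : ∀ {A B : Set} (F : B → PS) (g : A → List B) xs → prodPS (map F (concatMap g xs)) ≋ prodPS (map (λ j → prodPS (map F (g j))) xs)
   prodPS-concatMap F g [] = refl
   prodPS-concatMap F g (x ∷ xs) = trans (reflexive (E.cong prodPS (map-++ F (g x) (concatMap g xs)))) (trans (prodPS-++ (map F (g x)) _) (trans (*-congˡ (prodPS-concatMap F g xs)) (reflexive (⋆≡⊗ _ _))))

   prodPS-map : ∀ {A B : Set} (F : B → PS) (g : A → B) xs → prodPS (map F (map g xs)) ≋ prodPS (map (λ x → F (g x)) xs)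
   prodPS-map F g [] = refl
   prodPS-map F g (x ∷ xs) = trans (⊗≋ {F (g x)} {F (g x)} refl (prodPS-map F g xs)) (reflexive (⋆≡⊗ _ _))

  prod-pairs : ∀ m n k (F : ℕ × ℕ → PS) → prodPS (map F (pairs m n k)) ≋ PR k (λ j → PR j (λ i → F (suc i , suc j)))
  prod-pairs m n k F = trans (prodPS-concatMap F (λ j → map (λ i → (suc i , suc j)) (upTo j)) (upTo k)) (trans (prodPS-PR k _)
   (PR-cong k (λ j _ → trans (prodPS-map F (λ i → (suc i , suc j)) (upTo j)) (prodPS-PR j _))))

  module Sides (m n : ℕ) where
   open ThetaProducts (m N.+ n)

   private
    E = pochInf 1 1
    P = p κ

    h≡ : m N.+ n N.+ 1 ≡ h
    h≡ = NP.+-comm (m N.+ n) 1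

    κ≡ : 2 N.* (m N.+ n N.+ 1) ≡ κ
    κ≡ = E.trans (E.cong (2 N.*_) h≡) (E.cong (λ k → suc (m N.+ n N.+ k)) (NP.+-identityʳ h))

    n≤ : n N.≤ m N.+ n
    n≤ = NP.m≤n+m n m

    OneE : ∀ k → One (E ^ᵖ k)
    OneE k = One-^ k (One-pochInf {1} 1 (s≤s z≤n))

   thetas₁ : PR n (λ i → theta (suc i) h) ⋆ PR n (λ j → PR j (λ i → theta (j ∸ i) κ ⊗ theta (suc i N.+ suc j) κ)) ≋ Y n
   thetas₁ = trans (sym (PR-⋆ n _ _)) (PR-cong n (λ k l → trans (*-congˡ (PR-cong k (λ i _ → ⊗≋ (theta-⋆ (k ∸ i) κ) (theta-⋆ (suc i N.+ suc k) κ)))) (y≋ k (NP.≤-trans (NP.<⇒≤ l) n≤))))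

   thetas₂ : PR m (λ i → theta (suc i N.+ 1) κ) ⋆ PR m (λ j → PR j (λ i → theta (j ∸ i) κ ⊗ theta (suc i N.+ suc j N.+ 1) κ)) ≋ X m
   thetas₂ = trans (sym (PR-⋆ m _ _)) (PR-cong m (λ k _ → *-cong (trans (theta-⋆ (suc k N.+ 1) κ) (reflexive (E.cong th (NP.+-comm (suc k) 1))))
    (PR-cong k (λ i _ → ⊗≋ (theta-⋆ (k ∸ i) κ) (trans (theta-⋆ (suc i N.+ suc k N.+ 1) κ) (reflexive (E.cong th (lem i k))))))))
    where
    lem : ∀ i k → suc i N.+ suc k N.+ 1 ≡ suc (suc k N.+ suc i)
    lem = NS.solve-∀

   side₁ : 1 N.≤ n → (E ^ᵖ (n N.+ 1)) ⋆ rhs1 m n ≋ pochInf 2 2 ⋆ p h ⋆ pwr P n ⋆ Y n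
   side₁ (s≤s {n = n'} z≤n) = begin
    _ ≈⟨ *-congˡ (⊗≋ (⊗≋ (⊗≋ (⊗≋ (⊗≋ refl refl) (^-pwr _ n')) refl) (prodPS-PR n _)) (prod-pairs m n n _)) ⟩
    _ ≈⟨ reflexive (E.cong₂ (λ h κ → (E ^ᵖ (n N.+ 1)) ⋆ (pochInf 2 2 ⋆ pochInf h h ⋆ pwr (pochInf κ κ) n' ⋆ inv (E ^ᵖ (n N.+ 1)) ⋆ PR n (λ i → theta (suc i) h) ⋆ PR n (λ j → PR j (λ i → theta (j ∸ i) κ ⊗ theta (suc i N.+ suc j) κ)))) h≡ κ≡) ⟩
    _ ≈⟨ solve 7 (λ e t h w i a b → e :* (t :* h :* w :* i :* a :* b) := (i :* e) :* (t :* h :* w :* (a :* b))) tt (E ^ᵖ (n N.+ 1)) (pochInf 2 2) (pochInf h h) (pwr P n') (inv (E ^ᵖ (n N.+ 1))) A B ⟩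
    _ ≈⟨ trans (*-cong (inv-inverse (E ^ᵖ (n N.+ 1)) (OneE (n N.+ 1))) (*-cong (*-congʳ (*-congˡ (half h))) thetas₁)) (*-identityˡ _) ⟩
    _ ≈⟨ solve 5 (λ t h k w y → t :* (h :* k) :* w :* y := t :* h :* (k :* w) :* y) tt (pochInf 2 2) (p h) P (pwr P n') (Y n) ⟩
    _ ∎
    where
    h₀ = m N.+ n N.+ 1
    κ₀ = 2 N.* h₀
    A = PR n (λ i → theta (suc i) h)
    B = PR n (λ j → PR j (λ i → theta (j ∸ i) κ ⊗ theta (suc i N.+ suc j) κ))

   side₂ : (E ^ᵖ m) ⋆ rhs2 m n ≋ pwr P m ⋆ X m
   side₂ = begin
    _ ≈⟨ *-congˡ (⊗≋ (⊗≋ (⊗≋ (^-pwr _ m) refl) (prodPS-PR m _)) (prod-pairs m n m _)) ⟩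
    _ ≈⟨ reflexive (E.cong (λ κ → (E ^ᵖ m) ⋆ (pwr (pochInf κ κ) m ⋆ inv (E ^ᵖ m) ⋆ PR m (λ i → theta (suc i N.+ 1) κ) ⋆ PR m (λ j → PR j (λ i → theta (j ∸ i) κ ⊗ theta (suc i N.+ suc j N.+ 1) κ)))) κ≡) ⟩
    _ ≈⟨ solve 5 (λ e w i a b → e :* (w :* i :* a :* b) := (i :* e) :* (w :* (a :* b))) tt (E ^ᵖ m) (pwr P m) (inv (E ^ᵖ m)) A B ⟩
    _ ≈⟨ trans (*-cong (inv-inverse (E ^ᵖ m) (OneE m)) (*-congˡ thetas₂)) (*-identityˡ _) ⟩
    _ ∎
    where
    κ₀ = 2 N.* (m N.+ n N.+ 1)
    A = PR m (λ i → theta (suc i N.+ 1) κ)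
    B = PR m (λ j → PR j (λ i → theta (j ∸ i) κ ⊗ theta (suc i N.+ suc j N.+ 1) κ))

   E^≋ : ∀ k → E ^ᵖ k ≋ pwr P k ⋆ pwr Q k
   E^≋ k = trans (^-pwr E k) (trans (PR-cong k (λ _ _ → eta≋)) (pwr-⋆ P Q k))

   rhs1≋rhs2 : 1 N.≤ n → rhs1 m n ≋ rhs2 m n
   rhs1≋rhs2 n≥1 = cancel-One {E ^ᵖ (n N.+ 1)} (OneE (n N.+ 1)) (cancel-One {E ^ᵖ m} (OneE m) (begin
    _ ≈⟨ *-cong (E^≋ m) (side₁ n≥1) ⟩
    _ ≈⟨ solve 6 (λ a b t h c y → (a :* b) :* (t :* h :* c :* y) := (a :* c) :* (t :* h :* y :* b)) tt (pwr P m) (pwr Q m) (pochInf 2 2) (p h) (pwr P n) (Y n) ⟩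
    _ ≈⟨ *-congˡ (exchange m n E.refl) ⟩
    _ ≈⟨ solve 5 (λ a c x q k → (a :* c) :* (x :* q :* k) := ((k :* c) :* q) :* (a :* x)) tt (pwr P m) (pwr P n) (X m) (pwr Q (suc n)) P ⟩
    _ ≈⟨ *-cong (trans (reflexive (E.cong (E ^ᵖ_) (NP.+-comm n 1))) (E^≋ (suc n))) side₂ ⟨
    _ ≈⟨ solve 3 (λ a b c → a :* (b :* c) := b :* (a :* c)) tt (E ^ᵖ (n N.+ 1)) (E ^ᵖ m) (rhs2 m n) ⟩
    _ ∎))

  -- For m = 0 the product side is 1.
  unit-case : ∀ n → let open ThetaProducts n in pochInf 2 2 ⋆ (p h ⋆ pwr (p κ) n ⋆ Y n) ≋ pochInf 1 1 ^ᵖ (n N.+ 1)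
  unit-case n = begin
   _ ≈⟨ solve 4 (λ t h c y → t :* (h :* c :* y) := c :* (t :* h :* y :* :1)) tt (pochInf 2 2) (p h) (pwr (p κ) n) (Y n) ⟩
   _ ≈⟨ *-congˡ (exchange 0 n E.refl) ⟩
   _ ≈⟨ solve 3 (λ c q k → c :* (:1 :* q :* k) := (k :* c) :* q) tt (pwr (p κ) n) (pwr Q (suc n)) (p κ) ⟩
   _ ≈⟨ trans (reflexive (E.cong (pochInf 1 1 ^ᵖ_) (NP.+-comm n 1))) (trans (^-pwr (pochInf 1 1) (suc n)) (trans (PR-cong (suc n) (λ _ _ → eta≋)) (pwr-⋆ (p κ) Q (suc n)))) ⟨
   _ ∎
   where open ThetaProducts n

 module Evaluate (Mo : Model) (n : ℕ) (n≥1 : 1 N.≤ n) where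
  open Model Mo hiding (Q; I)
  private
   QQ = Model.Q Mo
   II = Model.I Mo
  open InfProd II
  open Final QQ II n n≥1
  open Link QQ II n n≥1 using (LHS)
  open Duality QQ n 0 n≥1 using (dbl≢0; down)
  open LatticeSum QQ n (dbl≢0 n≥1) (+ 1) using (Carrier; _≈_; _+_; _*_; -_; _-_; 0#; 1#; begin_; _≈⟨_⟩_; _≈⟨_⟨_; _∎; refl; sym; trans; reflexive; solve; _:=_; _:+_; _:*_; _:-_; :-_; :1; :0; _≈[_]_; R; []; _∷_; *-inter; M; b; le; t; w; xs; Π; ≈[]-*ˡ; ≈[]-trans; ≈⇒≈[]; *-cong; *-congˡ; *-congʳ; *-assoc; +-comm; *-comm; +-identityʳ; *-identityˡ; *-identityʳ; a; Int; Int-*)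

  private
   ι-inv : ∀ f → One f → ι (inv f) * ι f ≈ 1#
   ι-inv f o = trans (sym (ι-* (inv f) f)) (trans (ι-cong (inv-inverse f o)) ι-1)

   Ainf-inv : ∀ M k → 1 N.≤ k → Ainf M (+ k) * ι (pochInf k M) ≈ 1#
   Ainf-inv M (suc k) _ = trans (*-congʳ (ι-Ainf M k)) (ι-inv (pochInf (suc k) M) (One-pochInf {suc k} M (s≤s z≤n)))

   θi-inv : ∀ M k → 1 N.≤ k → k N.< M → θi M k * ι (theta k M) ≈ 1#
   θi-inv M k k≥1 k<M = begin
    _ ≈⟨ *-cong (*-congˡ (reflexive (E.cong (Ainf M) (E.sym (pos-∸ (NP.<⇒≤ k<M)))))) (trans (ι-cong (theta-⋆ k M)) (ι-* _ _)) ⟩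
    _ ≈⟨ *-inter {X = ℕ} _ _ _ _ ⟩
    _ ≈⟨ *-cong (Ainf-inv M k k≥1) (Ainf-inv M (M ∸ k) (NP.m<n⇒0<n∸m k<M)) ⟩
    1# * 1# ≈⟨ *-identityˡ 1# ⟩
    1# ∎

   cancel₂ : ∀ {x y u v} → x * u ≈ 1# → y * v ≈ 1# → (x * y) * (u * v) ≈ 1#
   cancel₂ p r = trans (*-inter {X = ℕ} _ _ _ _) (trans (*-cong p r) (*-identityˡ 1#))

  module _ (h' : ℕ) (n≤h' : n N.≤ h') where
   open ThetaProducts h' using (h; κ; p; th; Y; y≋; κ')

   -- The inverse of `G h`. For h' = m + n, multiplying by (q²;q²)_∞ gives the first product with
   -- its denominator (q;q)_∞^(n+1) cleared.
   Sp : PS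
   Sp = p h ⋆ pwr (p κ) n ⋆ Y n

   private
    row : ℕ → ℕ → PS
    row k k' = theta (suc k N.+ suc k') κ ⋆ theta (k ∸ k') κ

    Sr : ℕ → PS
    Sr k = PR k (λ k → theta (suc k) h ⋆ p κ ⋆ PR k (row k))

    row-inv : ∀ k → suc k N.≤ n → ∀ j → j N.≤ k → Π (down j) (λ k' → θi κ (suc k N.+ suc k') * θi κ (k ∸ k')) * ι (PR j (row k)) ≈ 1#
    row-inv k k<n zero l = trans (*-identityˡ _) ι-1
    row-inv k k<n (suc j) l = trans (*-congˡ (trans (ι-* _ _) (*-congʳ (ι-* _ _)))) (cancel₂ (cancel₂
      (θi-inv κ (suc k N.+ suc j) (s≤s z≤n) (s≤s (NP.+-mono-≤ (NP.≤-trans k<n n≤h') (NP.≤-trans l (NP.≤-trans (NP.n≤1+n k) (NP.≤-trans k<n (NP.≤-trans n≤h' (NP.n≤1+n h'))))))))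
      (θi-inv κ (k ∸ j) (NP.m<n⇒0<n∸m l) (s≤s (NP.≤-trans (NP.m∸n≤m k j) (NP.≤-trans (NP.≤-trans (NP.n≤1+n k) (NP.≤-trans k<n n≤h')) (NP.m≤m+n h' h))))))
     (row-inv k k<n j (NP.<⇒≤ l)))

    GGl-inv : ∀ k → k N.≤ n → GGl h (down k) * ι (Sr k) ≈ 1#
    GGl-inv zero l = trans (*-identityˡ _) ι-1
    GGl-inv (suc k) l = trans (*-congˡ (trans (ι-* _ _) (*-congʳ (trans (ι-* _ _) (*-congʳ (ι-* _ _)))))) (cancel₂ (cancel₂ (cancel₂
      (θi-inv h (suc k) (s≤s z≤n) (s≤s (NP.≤-trans l n≤h'))) (Ainf-inv κ κ (s≤s z≤n))) (row-inv k l k NP.≤-refl)) (GGl-inv k (NP.<⇒≤ l)))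

    Sr≋ : Sr n ≋ pwr (p κ) n ⋆ Y n
    Sr≋ = PSR.trans (PR-cong n (λ k l → PSR.trans (PSS.solve 3 (λ t k r → t PSS.:* k PSS.:* r PSS.:= k PSS.:* (t PSS.:* r)) tt (theta (suc k) h) (p κ) (PR k (row k)))
     (PSR.*-congˡ (PSR.trans (PSR.*-congˡ (PR-cong k (λ i _ → PSR.trans (PSR.*-comm (theta (suc k N.+ suc i) κ) (theta (k ∸ i) κ)) (PSR.*-cong (theta-⋆ (k ∸ i) κ) (PSR.trans (theta-⋆ (suc k N.+ suc i) κ) (PSR.reflexive (E.cong th (NP.+-comm (suc k) (suc i))))))))) (y≋ k (NP.≤-trans (NP.<⇒≤ l) n≤h')))))) (PR-⋆ n _ _)

   G-inv : G h * ι Sp ≈ 1#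
   G-inv = trans (*-congˡ (trans (ι-cong (PSR.trans (PSR.*-assoc _ _ _) (PSR.*-congˡ (PSR.sym Sr≋)))) (ι-* _ _))) (cancel₂ (Ainf-inv κ h (s≤s z≤n)) (GGl-inv n NP.≤-refl))

  -- Multiply `quotient` by c. On the left S₁ cancels G at level m, and e2 S₀ is cancelled by iE
  -- thanks to `unit-case`. On the right S₀ cancels G at level 0, leaving iE e2 S₁.
  LHS≈rhs1 : ∀ m {D} → 1 N.≤ D → ∀ B → slack N.+ D N.≤ B → LHS m B ≈[ D ] ι (rhs1 m n)
  LHS≈rhs1 m {D} D≥1 B le = ≈[]-trans (≈⇒≈[] (sym lhs)) (≈[]-trans (≈[]-*ˡ Int-c (quotient m D≥1 B le)) (≈⇒≈[] rhs))
   where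
   open Sides m n using (side₁)
   E = pochInf 1 1 ^ᵖ (n N.+ 1)
   oE : One E
   oE = One-^ (n N.+ 1) (One-pochInf {1} 1 (s≤s z≤n))
   n≤m+n = NP.m≤n+m n m
   S₁ = ι (Sp (m N.+ n) n≤m+n)
   S₀ = ι (Sp n NP.≤-refl)
   e2 = ι (pochInf 2 2)
   iE = ι (inv E)
   c = iE * (e2 * S₀) * S₁
   Int-c : Int c
   Int-c = Int-* (Int-* (ι-Int _) (Int-* (ι-Int _) (ι-Int _))) (ι-Int _)
   u₀ : e2 * S₀ ≈ ι E
   u₀ = trans (sym (ι-* _ _)) (ι-cong (unit-case n))
   g₁ : G (m N.+ n N.+ 1) * S₁ ≈ 1#
   g₁ = trans (*-congʳ (reflexive (E.cong G (NP.+-comm (m N.+ n) 1)))) (G-inv (m N.+ n) n≤m+n)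
   g₀ : G (n N.+ 1) * S₀ ≈ 1#
   g₀ = trans (*-congʳ (reflexive (E.cong G (NP.+-comm n 1)))) (G-inv n NP.≤-refl)
   lhs : c * (LHS m B * G (m N.+ n N.+ 1)) ≈ LHS m B
   lhs = trans (solve 5 (λ i e s l g → (i :* e :* s) :* (l :* g) := (i :* e) :* (g :* s) :* l) tt iE (e2 * S₀) S₁ (LHS m B) (G (m N.+ n N.+ 1)))
    (trans (*-congʳ (*-cong (trans (*-congˡ u₀) (ι-inv E oE)) g₁)) (solve 1 (λ l → :1 :* :1 :* l := l) tt (LHS m B)))
   rhs : c * G (n N.+ 1) ≈ ι (rhs1 m n)
   rhs = begin
    _ ≈⟨ solve 5 (λ i e s t g → i :* (e :* s) :* t :* g := (g :* s) :* (i :* (e :* t))) tt iE e2 S₀ S₁ (G (n N.+ 1)) ⟩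
    _ ≈⟨ *-cong g₀ (*-congˡ (trans (sym (ι-* _ _)) (trans (ι-cong (PSR.trans (PSS.solve 4 (λ t h c y → t PSS.:* (h PSS.:* c PSS.:* y) PSS.:= t PSS.:* h PSS.:* c PSS.:* y) tt _ _ _ _) (PSR.sym (side₁ n≥1)))) (ι-* _ _)))) ⟩
    _ ≈⟨ trans (*-identityˡ _) (trans (sym (*-assoc _ _ _)) (trans (*-congʳ (ι-inv E oE)) (*-identityˡ _))) ⟩
    ι (rhs1 m n) ∎

-- Index arrays: validity as a recursive condition

module Arrays where
 open import Data.Nat using (_≤ᵇ_; ⌊_/2⌋)
 open import Data.Bool using (_∧_; T)
 open import Data.List using (upTo; applyUpTo; replicate)
 open import Data.Vec using (Vec; []; _∷_; toList)
 open import Data.Vec.Properties using (length-toList)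
 open import Relation.Nullary using (Dec)
 open import Relation.Nullary.Decidable using (_×-dec_)
 open import Defs using (PS; 𝟙; sumℤ; sumℕ; nth; nthRow; lev; valid)
 import Defs
 open PowerSeries
 open ProductIdentities
 open SymplecticSide using (InfProd)
 open LittlewoodSum using (module Link; rng; dup; total)
 open ProductSide
 open LaurentSeries using (Model)

 sZ : ℕ → (ℕ → ℤ) → ℤ
 sZ n u = sumℤ (map u (upTo n))

 sZ-suc : ∀ n u → sZ (suc n) u ≡ u 0 Z.+ sZ n (λ i → u (suc i))
 sZ-suc n u = E.cong sumℤ (map-upTo-suc n u)

 sZ-cong : ∀ n {u v : ℕ → ℤ} → (∀ i → u i ≡ v i) → sZ n u ≡ sZ n v
 sZ-cong zero h = E.refl
 sZ-cong (suc n) {u} {v} h = E.trans (sZ-suc n u) (E.trans (E.cong₂ Z._+_ (h 0) (sZ-cong n (λ i → h (suc i)))) (E.sym (sZ-suc n v)))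

 sZ-+ : ∀ n u v → sZ n (λ i → u i Z.+ v i) ≡ sZ n u Z.+ sZ n v
 sZ-+ zero u v = E.refl
 sZ-+ (suc n) u v = E.trans (sZ-suc n (λ i → u i Z.+ v i)) (E.trans (E.cong (λ x → u 0 Z.+ v 0 Z.+ x) (sZ-+ n (λ i → u (suc i)) (λ i → v (suc i)))) (E.trans (lem (u 0) (v 0) (sZ n (λ i → u (suc i))) (sZ n (λ i → v (suc i)))) (E.sym (E.cong₂ Z._+_ (sZ-suc n u) (sZ-suc n v)))))
  where
  lem : ∀ a b c d → (a Z.+ b) Z.+ (c Z.+ d) ≡ (a Z.+ c) Z.+ (b Z.+ d)
  lem = ZS.solve-∀

 sZ-* : ∀ n c u → sZ n (λ i → c Z.* u i) ≡ c Z.* sZ n u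
 sZ-* zero c u = E.sym (ZP.*-zeroʳ c)
 sZ-* (suc n) c u = E.trans (sZ-suc n (λ i → c Z.* u i)) (E.trans (E.cong (λ x → c Z.* u 0 Z.+ x) (sZ-* n c (λ i → u (suc i)))) (E.trans (E.sym (ZP.*-distribˡ-+ c (u 0) (sZ n (λ i → u (suc i))))) (E.cong (c Z.*_) (E.sym (sZ-suc n u)))))

 sZ-swap : ∀ m n (u : ℕ → ℕ → ℤ) → sZ m (λ i → sZ n (u i)) ≡ sZ n (λ j → sZ m (λ i → u i j))
 sZ-swap zero n u = E.sym (E.trans (sZ-* n (+ 0) (λ _ → + 0)) (ZP.*-zeroˡ (sZ n (λ _ → + 0))))
 sZ-swap (suc m) n u = E.trans (sZ-suc m (λ i → sZ n (u i))) (E.trans (E.cong (λ x → sZ n (u 0) Z.+ x) (sZ-swap m n (λ i → u (suc i)))) (E.trans (E.sym (sZ-+ n (u 0) (λ j → sZ m (λ i → u (suc i) j)))) (sZ-cong n (λ j → E.sym (sZ-suc m (λ i → u i j))))))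

 sumℕ-sZ : ∀ n u → + sumℕ (map u (upTo n)) ≡ sZ n (λ i → + u i)
 sumℕ-sZ zero u = E.refl
 sumℕ-sZ (suc n) u = E.trans (E.cong (λ l → + sumℕ l) (map-upTo-suc n u)) (E.trans (E.cong (λ x → + u 0 Z.+ x) (sumℕ-sZ n (λ i → u (suc i)))) (E.sym (sZ-suc n (λ i → + u i))))

 PR-swap : ∀ m n (u : ℕ → ℕ → PS) → PR m (λ i → PR n (u i)) ≋ PR n (λ j → PR m (λ i → u i j))
 PR-swap zero n u = go n
  where
  go : ∀ n → 𝟙 ≋ PR n (λ _ → 𝟙)
  go zero = PSR.refl
  go (suc n) = PSR.trans (go n) (PSR.sym (PSR.*-identityˡ _))
 PR-swap (suc m) n u = PSR.trans (PSR.*-congˡ (PR-swap m n u)) (PSR.sym (PR-⋆ n (u m) _))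

 nthL : List ℕ → ℕ → ℕ
 nthL [] _ = 0
 nthL (x ∷ xs) zero = x
 nthL (x ∷ xs) (suc i) = nthL xs i

 nth≡ : ∀ {k} (v : Vec ℕ k) i → nth v i ≡ nthL (toList v) i
 nth≡ [] i = E.refl
 nth≡ (x ∷ v) zero = E.refl
 nth≡ (x ∷ v) (suc i) = nth≡ v i

 nthL-zeros : ∀ k i → nthL (replicate k 0) i ≡ 0
 nthL-zeros zero i = E.refl
 nthL-zeros (suc k) zero = E.refl
 nthL-zeros (suc k) (suc i) = nthL-zeros k i

 length-dup : ∀ {m} (r : Vec ℕ m) → length (dup (toList r)) ≡ 2 N.* m
 length-dup [] = E.refl
 length-dup {suc m} (x ∷ r) = E.trans (E.cong (λ k → suc (suc k)) (length-dup r)) (E.cong suc (E.sym (NP.+-suc m (m N.+ 0))))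

 nthL-beyond : ∀ xs i → length xs N.≤ i → nthL xs i ≡ 0
 nthL-beyond [] i _ = E.refl
 nthL-beyond (x ∷ xs) (suc i) (s≤s l) = nthL-beyond xs i l

 lev-0 : ∀ {m j} (r : Vec ℕ m) (s : Vec (Vec ℕ (2 N.* m)) j) i → lev r s 0 i ≡ nthL (dup (toList r)) i
 lev-0 {m} r s i with suc i ≤ᵇ 2 N.* m in eq
 ... | true = half r i
  where
  half : ∀ {m} (r : Vec ℕ m) i → nth r ⌊ i /2⌋ ≡ nthL (dup (toList r)) i
  half [] i = E.refl
  half (x ∷ r) zero = E.refl
  half (x ∷ r) (suc zero) = E.refl
  half (x ∷ r) (suc (suc i)) = half r i
 ... | false = E.sym (nthL-beyond (dup (toList r)) i (E.subst (N._≤ i) (E.sym (length-dup r)) (NP.≮⇒≥ (λ l → E.subst T eq (NP.≤⇒≤ᵇ l)))))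

 -- the levels of an array, starting from an arbitrary level c
 lv : ∀ {k l} → List ℕ → Vec (Vec ℕ k) l → ℕ → ℕ → ℕ
 lv c s zero = nthL c
 lv c s (suc a) = nthRow s a

 lv-∷ : ∀ {k l} c (d : Vec ℕ k) (s : Vec (Vec ℕ k) l) a i → lv c (d ∷ s) (suc a) i ≡ lv (toList d) s a i
 lv-∷ c d s zero i = nth≡ d i
 lv-∷ c d s (suc a) i = E.refl

 lev≡ : ∀ {m j} (r : Vec ℕ m) (s : Vec (Vec ℕ (2 N.* m)) j) a i → lev r s a i ≡ lv (dup (toList r)) s a i
 lev≡ r s zero i = lev-0 r s i
 lev≡ r s (suc a) i = E.refl

 private
 Desc : List ℕ → Set
 Desc [] = ⊤
 Desc (c ∷ cs) = (nthL cs 0 N.≤ c) × Desc cs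

 Below : List ℕ → List ℕ → Set
 Below [] _ = ⊤
 Below (d ∷ ds) cs = (d N.≤ nthL cs 0) × Below ds (Data.List.drop 1 cs)

 -- The conditions of `valid` regrouped by recursion over the rows, to match the factors of the
 -- product of branching matrices.
 Good : ∀ {k l} → List ℕ → Vec (Vec ℕ k) l → Set
 Good c [] = Desc c
 Good c (d ∷ s) = Desc c × Below (toList d) c × Good (toList d) s

 desc? : ∀ c → Dec (Desc c)
 desc? [] = yes tt
 desc? (c ∷ cs) = (nthL cs 0 N.≤? c) ×-dec desc? cs

 below? : ∀ d c → Dec (Below d c)
 below? [] _ = yes tt
 below? (d ∷ ds) cs = (d N.≤? nthL cs 0) ×-dec below? ds _

 private
  desc⇒ : ∀ c → Desc c → ∀ i → nthL c (suc i) N.≤ nthL c i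
  desc⇒ [] _ i = z≤n
  desc⇒ (c ∷ cs) (p , _) zero = p
  desc⇒ (c ∷ cs) (_ , q) (suc i) = desc⇒ cs q i

  ⇒desc : ∀ c → (∀ i → suc i N.< length c → nthL c (suc i) N.≤ nthL c i) → Desc c
  ⇒desc [] h = tt
  ⇒desc (c ∷ []) h = z≤n , tt
  ⇒desc (c ∷ c' ∷ cs) h = h 0 (s≤s (s≤s z≤n)) , ⇒desc (c' ∷ cs) (λ i l → h (suc i) (s≤s l))

  below⇒ : ∀ d c → Below d c → ∀ i → nthL d i N.≤ nthL c i
  below⇒ [] c _ i = z≤n
  below⇒ (d ∷ ds) [] (p , _) zero = p
  below⇒ (d ∷ ds) (c ∷ _) (p , _) zero = p
  below⇒ (d ∷ ds) [] (_ , q) (suc i) = below⇒ ds [] q i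
  below⇒ (d ∷ ds) (c ∷ cs) (_ , q) (suc i) = below⇒ ds cs q i

  ⇒below : ∀ d c → (∀ i → i N.< length d → nthL d i N.≤ nthL c i) → Below d c
  ⇒below [] c h = tt
  ⇒below (d ∷ ds) [] h = h 0 (s≤s z≤n) , ⇒below ds [] (λ i l → h (suc i) (s≤s l))
  ⇒below (d ∷ ds) (c ∷ cs) h = h 0 (s≤s z≤n) , ⇒below ds cs (λ i l → h (suc i) (s≤s l))

  all-upTo : ∀ n p → Defs.all p (upTo (suc n)) ≡ p 0 ∧ Defs.all (λ i → p (suc i)) (upTo n)
  all-upTo n p = E.cong (p 0 ∧_) (go n (λ i → i))
   where
   go : ∀ n f → Defs.all p (applyUpTo (λ i → suc (f i)) n) ≡ Defs.all (λ i → p (suc i)) (applyUpTo f n)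
   go zero f = E.refl
   go (suc n) f = E.cong (p (suc (f 0)) ∧_) (go n (λ i → f (suc i)))

  ∧⇒ : ∀ x {y} → T (x ∧ y) → T x × T y
  ∧⇒ true t = tt , t

  ⇒∧ : ∀ x {y} → T x → T y → T (x ∧ y)
  ⇒∧ true _ t = t

  all⇒ : ∀ n p → T (Defs.all p (upTo n)) → ∀ i → i N.< n → T (p i)
  all⇒ (suc n) p t zero l = proj₁ (∧⇒ (p 0) (E.subst T (all-upTo n p) t))
  all⇒ (suc n) p t (suc i) (s≤s l) = all⇒ n (λ i → p (suc i)) (proj₂ (∧⇒ (p 0) (E.subst T (all-upTo n p) t))) i l

  ⇒all : ∀ n p → (∀ i → i N.< n → T (p i)) → T (Defs.all p (upTo n))
  ⇒all zero p h = tt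
  ⇒all (suc n) p h = E.subst T (E.sym (all-upTo n p)) (⇒∧ (p 0) (h 0 (s≤s z≤n)) (⇒all n (λ i → p (suc i)) (λ i l → h (suc i) (s≤s l))))

  Good⇒ : ∀ {k l} c (s : Vec (Vec ℕ k) l) → Good c s →
      (∀ a i → lv c s a (suc i) N.≤ lv c s a i) × (∀ a i → lv c s (suc a) i N.≤ lv c s a i)
  Good⇒ c [] g = (λ { zero i → desc⇒ c g i ; (suc a) i → z≤n }) , (λ a i → z≤n)
  Good⇒ c (d ∷ s) (p , q , g) with Good⇒ (toList d) s g
  ... | x , y = (λ { zero i → desc⇒ c p i ; (suc a) i → E.subst₂ N._≤_ (E.sym (lv-∷ c d s a (suc i))) (E.sym (lv-∷ c d s a i)) (x a i) })
        , (λ { zero i → E.subst (N._≤ nthL c i) (E.sym (nth≡ d i)) (below⇒ (toList d) c q i) ; (suc a) i → E.subst₂ N._≤_ (E.sym (lv-∷ c d s (suc a) i)) (E.sym (lv-∷ c d s a i)) (y a i) })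

  ⇒Good : ∀ {k l} c (s : Vec (Vec ℕ k) l) → Desc c → (∀ a → a N.< l → ∀ i → suc i N.< k → lv c s (suc a) (suc i) N.≤ lv c s (suc a) i) →
      (∀ a → a N.< l → ∀ i → i N.< k → lv c s (suc a) i N.≤ lv c s a i) → Good c s
  ⇒Good c [] p x y = p
  ⇒Good {k} c (d ∷ s) p x y = p ,
   ⇒below (toList d) c (λ i l → E.subst (N._≤ nthL c i) (nth≡ d i) (y 0 (s≤s z≤n) i (E.subst (i N.<_) (length-toList d) l))) ,
   ⇒Good (toList d) s (⇒desc (toList d) (λ i l → E.subst₂ N._≤_ (nth≡ d (suc i)) (nth≡ d i) (x 0 (s≤s z≤n) i (E.subst (suc i N.<_) (length-toList d) l))))
    (λ a l i r → x (suc a) (s≤s l) i r)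
    (λ a l i r → E.subst (lv c (d ∷ s) (suc (suc a)) i N.≤_) (lv-∷ c d s a i) (y (suc a) (s≤s l) i r))

  desc-dup⇒ : ∀ {m} (r : Vec ℕ m) → Desc (dup (toList r)) → ∀ i → nth r (suc i) N.≤ nth r i
  desc-dup⇒ [] _ i = z≤n
  desc-dup⇒ (x ∷ []) _ i = z≤n
  desc-dup⇒ (x ∷ y ∷ r) (_ , p , _) zero = p
  desc-dup⇒ (x ∷ y ∷ r) (_ , _ , g) (suc i) = desc-dup⇒ (y ∷ r) g i

  ⇒desc-dup : ∀ {m} (r : Vec ℕ m) → (∀ i → i N.< m ∸ 1 → nth r (suc i) N.≤ nth r i) → Desc (dup (toList r))
  ⇒desc-dup [] h = tt
  ⇒desc-dup (x ∷ []) h = NP.≤-refl , z≤n , tt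
  ⇒desc-dup (x ∷ y ∷ r) h = NP.≤-refl , h 0 (s≤s z≤n) , ⇒desc-dup (y ∷ r) (λ i l → h (suc i) (s≤s l))

  1∸ : ∀ {i k} → suc i N.< k → i N.< k ∸ 1
  1∸ {i} {suc k} (s≤s l) = l

 module _ (m n : ℕ) (n≥1 : 1 N.≤ n) (r : Vec ℕ m) (s : Vec (Vec ℕ (2 N.* m)) (2 N.* n ∸ 1)) where
  private
   c = dup (toList r)
   L = lev r s

   p₁ : ℕ → Bool
   p₁ k = nth r (suc k) ≤ᵇ nth r k
   p₂ p₃ : ℕ → ℕ → Bool
   p₂ j i = L (suc j) (suc i) ≤ᵇ L (suc j) i
   p₃ j i = L (2 N.+ j) i ≤ᵇ L (suc j) i
   p₄ : ℕ → Bool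
   p₄ i = L 1 i ≤ᵇ L 0 i
   q₂ q₃ : ℕ → Bool
   q₂ j = Defs.all (p₂ j) (upTo (2 N.* m ∸ 1))
   q₃ j = Defs.all (p₃ j) (upTo (2 N.* m))
   V₁ V₂ V₃ : Bool
   V₁ = Defs.all p₁ (upTo (m ∸ 1))
   V₂ = Defs.all q₂ (upTo (2 N.* n ∸ 1))
   V₃ = Defs.all q₃ (upTo (2 N.* n ∸ 2))

  valid⇒Good : T (valid m n r s) → Good c s
  valid⇒Good t with ∧⇒ V₁ t
  ... | v₁ , t₁ with ∧⇒ V₂ t₁
  ... | v₂ , t₂ with ∧⇒ V₃ t₂
  ... | v₃ , v₄ = ⇒Good c s (⇒desc-dup r (λ i l → NP.≤ᵇ⇒≤ (nth r (suc i)) (nth r i) (all⇒ (m ∸ 1) p₁ v₁ i l)))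
   (λ a l i q → NP.≤ᵇ⇒≤ (L (suc a) (suc i)) (L (suc a) i) (all⇒ (2 N.* m ∸ 1) (p₂ a) (all⇒ (2 N.* n ∸ 1) q₂ v₂ a l) i (1∸ q)))
   (λ { zero l i q → E.subst (L 1 i N.≤_) (lev≡ r s 0 i) (NP.≤ᵇ⇒≤ (L 1 i) (L 0 i) (all⇒ (2 N.* m) p₄ v₄ i q))
     ; (suc a) l i q → NP.≤ᵇ⇒≤ (L (2 N.+ a) i) (L (suc a) i) (all⇒ (2 N.* m) (p₃ a) (all⇒ (2 N.* n ∸ 2) q₃ v₃ a (E.subst (a N.<_) (NP.∸-+-assoc (2 N.* n) 1 1) (1∸ l))) i q) })

  Good⇒valid : Good c s → T (valid m n r s)
  Good⇒valid g with Good⇒ c s g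
  ... | x , y = ⇒∧ V₁ (⇒all (m ∸ 1) p₁ (λ i l → NP.≤⇒≤ᵇ (desc-dup⇒ r (desc s g) i)))
    (⇒∧ V₂ (⇒all (2 N.* n ∸ 1) q₂ (λ a l → ⇒all (2 N.* m ∸ 1) (p₂ a) (λ i q → NP.≤⇒≤ᵇ (x (suc a) i))))
    (⇒∧ V₃ (⇒all (2 N.* n ∸ 2) q₃ (λ a l → ⇒all (2 N.* m) (p₃ a) (λ i q → NP.≤⇒≤ᵇ (y (suc a) i))))
     (⇒all (2 N.* m) p₄ (λ i q → NP.≤⇒≤ᵇ (E.subst (L 1 i N.≤_) (E.sym (lev≡ r s 0 i)) (y 0 i))))))
   where
   desc : ∀ {l} (s : Vec (Vec ℕ (2 N.* m)) l) → Good c s → Desc c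
   desc [] g = g
   desc (_ ∷ _) (g , _) = g

-- Index arrays: the quadratic exponent

module ArrayExponents where
 open import Data.List using (upTo; replicate)
 open import Data.List.Properties using (length-replicate)
 open import Data.Vec using (Vec; []; _∷_; toList)
 open import Data.Vec.Properties using (length-toList)
 open import Defs using (sumℕ; nth; lev; Cexp; rSum)
 import Defs
 open PowerSeries
 open ProductIdentities
 open SymplecticSide using (InfProd; pos-∸)
 open LittlewoodSum using (module Link; rng; dup; total)
 open ProductSide
 open Arrays
 open LaurentSeries using (Model)

 module Exponents (n : ℕ) where
  -- a + (a + 2n) + ... with k terms
  ew : ℕ → ℕ → ℕ
  ew a zero = 0
  ew a (suc k) = a N.+ ew (a N.+ (n N.+ n)) k

  private
   e : ℤ → ℤ → ℤ
   e a δ = δ Z.* a Z.+ + n Z.* (δ Z.* δ Z.- δ)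

   ew≡ : ∀ a k → + ew a k ≡ e (+ a) (+ k)
   ew≡ a zero = E.sym (E.trans (lem (+ a) (+ n)) E.refl)
    where
    lem : ∀ a n → (+ 0) Z.* a Z.+ n Z.* ((+ 0) Z.* (+ 0) Z.- (+ 0)) ≡ + 0
    lem = ZS.solve-∀
   ew≡ a (suc k) = E.trans (E.cong (λ x → + a Z.+ x) (ew≡ (a N.+ (n N.+ n)) k)) (lem (+ a) (+ n) (+ k))
    where
    lem : ∀ a n k → a Z.+ (k Z.* (a Z.+ (n Z.+ n)) Z.+ n Z.* (k Z.* k Z.- k)) ≡ (+ 1 Z.+ k) Z.* a Z.+ n Z.* ((+ 1 Z.+ k) Z.* (+ 1 Z.+ k) Z.- (+ 1 Z.+ k))
    lem = ZS.solve-∀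

  eT : ℕ → List ℕ → List ℕ → ℕ
  eT a (c ∷ cs) (d ∷ ds) = ew a (c ∸ d) N.+ eT a cs ds
  eT a _ _ = 0

  -- The power of q in the product of branching matrices for the residues a, a + 1, ...; below the
  -- last row of the array comes a row of zeros.
  EX : ∀ {k l} → ℕ → List ℕ → Vec (Vec ℕ k) l → ℕ
  EX a c [] = eT a c (replicate (length c) 0)
  EX a c (d ∷ s) = eT a c (toList d) N.+ EX (suc a) (toList d) s

  private
   eT≡ : ∀ a c d → length c ≡ length d → Below d c → + eT a c d ≡ sZ (length c) (λ i → e (+ a) (+ nthL c i Z.- + nthL d i))
   eT≡ a [] [] _ _ = E.refl
   eT≡ a (c ∷ cs) (d ∷ ds) l (p , q) = E.trans (E.cong₂ Z._+_ (E.trans (ew≡ a (c ∸ d)) (E.cong (e (+ a)) (pos-∸ p))) (eT≡ a cs ds (NP.suc-injective l) q)) (E.sym (sZ-suc (length cs) (λ i → e (+ a) (+ nthL (c ∷ cs) i Z.- + nthL (d ∷ ds) i))))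

   sq : ℤ → ℤ
   sq x = x Z.* x

   linear : ∀ K a (x y : ℕ → ℤ) → sZ K (λ i → e a (x i Z.- y i)) ≡ (a Z.- + n) Z.* (sZ K x Z.- sZ K y) Z.+ + n Z.* sZ K (λ i → sq (x i Z.- y i))
   linear zero a x y = lem a (+ n)
    where
    lem : ∀ a n → + 0 ≡ (a Z.- n) Z.* (+ 0 Z.- + 0) Z.+ n Z.* + 0
    lem = ZS.solve-∀
   linear (suc K) a x y = E.trans (sZ-suc K (λ i → e a (x i Z.- y i))) (E.trans (E.cong (λ z → e a (x 0 Z.- y 0) Z.+ z) (linear K a (λ i → x (suc i)) (λ i → y (suc i))))
    (E.trans (lem a (+ n) (x 0) (y 0) (sZ K (λ i → x (suc i))) (sZ K (λ i → y (suc i))) (sZ K (λ i → sq (x (suc i) Z.- y (suc i)))))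
     (E.sym (E.cong₂ (λ u v → (a Z.- + n) Z.* u Z.+ + n Z.* v) (E.cong₂ Z._-_ (sZ-suc K x) (sZ-suc K y)) (sZ-suc K (λ i → sq (x i Z.- y i)))))))
    where
    lem : ∀ a n x y X Y S → ((x Z.- y) Z.* a Z.+ n Z.* ((x Z.- y) Z.* (x Z.- y) Z.- (x Z.- y))) Z.+ ((a Z.- n) Z.* (X Z.- Y) Z.+ n Z.* S)
       ≡ (a Z.- n) Z.* ((x Z.+ X) Z.- (y Z.+ Y)) Z.+ n Z.* ((x Z.- y) Z.* (x Z.- y) Z.+ S)
    lem = ZS.solve-∀

  tot : ℕ → (ℕ → ℕ) → ℤ
  tot K u = sZ K (λ i → + u i)

  gap : ℕ → (ℕ → ℕ) → (ℕ → ℕ) → ℤ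
  gap K u v = sZ K (λ i → sq (+ u i Z.- + v i))

  private
   below-0 : ∀ k c → Below (replicate k 0) c
   below-0 zero c = _
   below-0 (suc k) c = z≤n , below-0 k _

   level : ∀ a K c d → length c ≡ K → length d ≡ K → Below d c → + eT a c d ≡ (+ a Z.- + n) Z.* (tot K (nthL c) Z.- tot K (nthL d)) Z.+ + n Z.* gap K (nthL c) (nthL d)
   level a K c d E.refl l p = E.trans (eT≡ a c d (E.sym l) p) (linear (length c) (+ a) (λ i → + nthL c i) (λ i → + nthL d i))

   tot-cong : ∀ K {u v : ℕ → ℕ} → (∀ i → u i ≡ v i) → tot K u ≡ tot K v
   tot-cong K h = sZ-cong K (λ i → E.cong +_ (h i))

   gap-cong : ∀ K {u v u' v' : ℕ → ℕ} → (∀ i → u i ≡ u' i) → (∀ i → v i ≡ v' i) → gap K u v ≡ gap K u' v'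
   gap-cong K h h' = sZ-cong K (λ i → E.cong₂ (λ x y → sq (+ x Z.- + y)) (h i) (h' i))

  -- A column that loses δ boxes at residue a contributes (a - n)δ + nδ². Summation by parts over a
  -- turns the linear terms into (a - n) times the top level plus the sum of all lower levels, which
  -- is the linear part of the exponent 𝒞.
  EX≡ : ∀ {K l} a c (s : Vec (Vec ℕ K) l) → length c ≡ K → Good c s →
     + EX a c s ≡ (+ a Z.- + n) Z.* tot K (nthL c) Z.+ sZ l (λ b → tot K (lv c s (suc b))) Z.+ + n Z.* sZ (suc l) (λ b → gap K (lv c s b) (lv c s (suc b)))
  EX≡ {K} a c [] l g = E.trans (level a K c Z l (E.trans (length-replicate (length c)) l) (below-0 (length c) c))
   (E.trans (E.cong₂ (λ t u → (+ a Z.- + n) Z.* (tot K (nthL c) Z.- t) Z.+ + n Z.* u) (E.trans (tot-cong K (nthL-zeros (length c))) (E.trans (sZ-* K (+ 0) (λ _ → + 0)) (ZP.*-zeroˡ (sZ K (λ _ → + 0))))) (gap-cong K {nthL c} (λ _ → E.refl) (nthL-zeros (length c))))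
    (E.trans (lem (+ a Z.- + n) (tot K (nthL c)) (+ n) G) E.refl))
   where
   Z = replicate (length c) 0
   G = gap K (nthL c) (λ _ → 0)
   lem : ∀ b t n g → b Z.* (t Z.- + 0) Z.+ n Z.* g ≡ b Z.* t Z.+ + 0 Z.+ n Z.* (g Z.+ + 0)
   lem = ZS.solve-∀
  EX≡ {K} {suc l} a c (d ∷ s) lc (p , q , g) = E.trans (E.cong₂ Z._+_ (level a K c (toList d) lc (length-toList d) q) (EX≡ (suc a) (toList d) s (length-toList d) g))
   (E.trans (lem (+ a) (+ n) (tot K (nthL c)) (tot K (nthL (toList d))) (gap K (nthL c) (nthL (toList d))) S₁ S₂)
    (E.sym (E.cong₂ (λ x y → (+ a Z.- + n) Z.* tot K (nthL c) Z.+ x Z.+ + n Z.* y)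
     (E.trans (sZ-suc l (λ b → tot K (lv c (d ∷ s) (suc b)))) (E.cong₂ Z._+_ (tot-cong K (nth≡ d)) (sZ-cong l (λ b → tot-cong K {lv c (d ∷ s) (suc (suc b))} (λ i → lv-∷ c d s (suc b) i)))))
     (E.trans (sZ-suc (suc l) (λ b → gap K (lv c (d ∷ s) b) (lv c (d ∷ s) (suc b)))) (E.cong₂ Z._+_ (gap-cong K {nthL c} (λ _ → E.refl) (nth≡ d)) (sZ-cong (suc l) (λ b → gap-cong K {lv c (d ∷ s) (suc b)} {lv c (d ∷ s) (suc (suc b))} (λ i → lv-∷ c d s b i) (λ i → lv-∷ c d s (suc b) i))))))))
   where
   S₁ = sZ l (λ b → tot K (lv (toList d) s (suc b)))
   S₂ = sZ (suc l) (λ b → gap K (lv (toList d) s b) (lv (toList d) s (suc b)))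
   lem : ∀ a n tc td g s₁ s₂ → ((a Z.- n) Z.* (tc Z.- td) Z.+ n Z.* g) Z.+ (((+ 1 Z.+ a) Z.- n) Z.* td Z.+ s₁ Z.+ n Z.* s₂) ≡ (a Z.- n) Z.* tc Z.+ (td Z.+ s₁) Z.+ n Z.* (g Z.+ s₂)
   lem = ZS.solve-∀

  total≡ : ∀ {m} (r : Vec ℕ m) → total (toList r) ≡ sumℕ (map (nth r) (upTo m))
  total≡ [] = E.refl
  total≡ {suc m} (x ∷ r) = E.trans (E.cong (x N.+_) (total≡ r)) (E.sym (E.cong sumℕ (map-upTo-suc m (nth (x ∷ r)))))

  Cexp≡ : 1 N.≤ n → ∀ m (r : Vec ℕ m) s → Good (dup (toList r)) s → Cexp m n r s Z.+ + rSum m n r ≡ + (total (toList r) N.+ EX 0 (dup (toList r)) s)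
  Cexp≡ (s≤s {n = n'} z≤n) m r s g = E.trans (E.cong₂ (λ x y → x Z.+ + y) ce (E.sym (total≡ r))) (ZP.+-comm (+ EX 0 (dup (toList r)) s) (+ total (toList r)))
   where
   c = dup (toList r)
   K = 2 N.* m
   l = 2 N.* n ∸ 1
   L = lev r s
   lem : ∀ n t → Z.- (n Z.* t) ≡ (+ 0 Z.- n) Z.* t
   lem = ZS.solve-∀
   ce : Cexp m n r s ≡ + EX 0 c s
   ce = E.trans (E.cong₂ Z._+_ (E.cong₂ Z._+_
      (E.trans (lem (+ n) (+ sumℕ (map (L 0) (upTo K)))) (E.cong ((+ 0 Z.- + n) Z.*_) (E.trans (sumℕ-sZ K (L 0)) (tot-cong K {L 0} (lev≡ r s 0)))))
      (sZ-cong l (λ b → E.trans (sumℕ-sZ K (L (suc b))) (tot-cong K {L (suc b)} (lev≡ r s (suc b))))))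
     (E.cong (+ n Z.*_) (E.trans (sZ-swap K (suc l) (λ i a → sq (+ L a i Z.- + L (suc a) i))) (sZ-cong (suc l) (λ b → gap-cong K {L b} {L (suc b)} (lev≡ r s b) (lev≡ r s (suc b)))))))
    (E.sym (EX≡ 0 c s (length-dup r) g))

-- Index arrays: the summand, and the left-hand side as a series

module ArraySums where
 open import Data.Nat using (_≤_)
 open import Data.Bool using (if_then_else_; T)
 open import Data.List using (upTo; concatMap; applyUpTo; replicate)
 open import Data.List.Properties using (length-replicate; map-cong)
 open import Data.Vec using (Vec; []; _∷_; toList)
 open import Data.Vec.Properties using (length-toList)
 open import Relation.Nullary using (Dec; ¬_)
 open import Relation.Nullary.Decidable using (_×-dec_)
 open import Defs using (PS; 𝟙; mono; _⊖_; _⊗_; inv; poch; sumℤ; coeffℤ; nth; lev; valid; Dser; termCoeff; allVecs; lhsPartial; rhs1)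
 open PowerSeries
 open ProductIdentities
 open SymplecticSide using (InfProd; pos-∸)
 open Quotient using (module Final)
 open LittlewoodSum using (module Link; rng; dup; total)
 open ProductSide
 open Arrays
 open ArrayExponents
 open LaurentSeries using (Model; laurent)

 module Summand (n : ℕ) where
  P iP : ℕ → PS
  P k = poch (2 N.* n) (2 N.* n) k
  iP k = inv (P k)

  -- `FD` is the factor of the summand as stated, with the inner differences of the lower row in the
  -- denominator. `FT` is the factor of the branching matrix, with those of the upper row.
  FT FD : (ℕ → ℕ) → (ℕ → ℕ) → ℕ → PS
  FT c d i = P (c i ∸ d (suc i)) ⋆ iP (c i ∸ d i) ⋆ iP (c i ∸ c (suc i))
  FD c d i = P (c i ∸ d (suc i)) ⋆ iP (c i ∸ d i) ⋆ iP (d i ∸ d (suc i))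

  FC : (ℕ → ℕ) → ℕ → PS
  FC c i = iP (c i ∸ c (suc i))

  PRODs : ∀ {K l} → List ℕ → Vec (Vec ℕ K) l → PS
  PRODs {K} c [] = PR K (FT (nthL c) (λ _ → 0))
  PRODs {K} c (d ∷ s) = PR K (FT (nthL c) (nthL (toList d))) ⋆ PRODs (toList d) s

  private
   FD-cong : ∀ {c c' d d' : ℕ → ℕ} → (∀ i → c i ≡ c' i) → (∀ i → d i ≡ d' i) → ∀ i → FD c d i ≋ FD c' d' i
   FD-cong {c} {c'} {d} {d'} h k i = PSR.reflexive (E.trans (E.cong₂ (λ x y → P (x ∸ y) ⋆ iP (x ∸ d i) ⋆ iP (d i ∸ y)) (h i) (k (suc i))) (E.cong (λ z → P (c' i ∸ d' (suc i)) ⋆ iP (c' i ∸ z) ⋆ iP (z ∸ d' (suc i))) (k i)))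

   FC-cong : ∀ {c c' : ℕ → ℕ} → (∀ i → c i ≡ c' i) → ∀ i → FC c i ≋ FC c' i
   FC-cong h i = PSR.reflexive (E.cong₂ (λ x y → iP (x ∸ y)) (h i) (h (suc i)))

   inv𝟙 : inv 𝟙 ≋ 𝟙
   inv𝟙 = PSR.trans (PSR.sym (PSR.*-identityʳ _)) (inv-inverse 𝟙 E.refl)

   swap₃ : ∀ a b c d → (a ⋆ b ⋆ c) ⋆ d ≋ (a ⋆ b ⋆ d) ⋆ c
   swap₃ = PSS.solve 4 (λ a b c d → (a PSS.:* b PSS.:* c) PSS.:* d PSS.:= (a PSS.:* b PSS.:* d) PSS.:* c) tt

   shift-row : ∀ K (c d : ℕ → ℕ) → PR K (FD c d) ⋆ PR K (FC c) ≋ PR K (FT c d) ⋆ PR K (FC d)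
   shift-row K c d = PSR.trans (PSR.sym (PR-⋆ K _ _)) (PSR.trans (PR-cong K (λ i _ → swap₃ _ _ _ _)) (PR-⋆ K (FT c d) (FC d)))

  -- Each row hands its factor `FC` down to the next, turning `FD` into `FT` on the way. The process
  -- starts with the last product in `Dser` and ends at the zero row, where `FC` is 1.
  levels : ∀ {K l} c (s : Vec (Vec ℕ K) l) → PR (suc l) (λ a → PR K (FD (lv c s a) (lv c s (suc a)))) ⋆ PR K (FC (nthL c)) ≋ PRODs c s
  levels {K} c [] = PSR.trans (PSR.*-congʳ (PSR.*-identityʳ _)) (PSR.trans (shift-row K (nthL c) (λ _ → 0)) (PSR.trans (PSR.*-congˡ (ones K)) (PSR.*-identityʳ _)))
   where
   ones : ∀ K → PR K (FC (λ _ → 0)) ≋ 𝟙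
   ones zero = PSR.refl
   ones (suc K) = PSR.trans (PSR.*-cong inv𝟙 (ones K)) (PSR.*-identityˡ _)
  levels {K} {suc l} c (d ∷ s) = PSR.trans (PSR.*-congʳ (PSR.trans (PR-front (suc l) (λ a → PR K (FD (lv c (d ∷ s) a) (lv c (d ∷ s) (suc a)))))
    (PSR.*-cong (PR-cong K (λ i _ → FD-cong {nthL c} {nthL c} {nth d} (λ _ → E.refl) (nth≡ d) i)) (PR-cong (suc l) (λ a _ → PR-cong K (λ i _ → FD-cong {lv c (d ∷ s) (suc a)} {lv (toList d) s a} {lv c (d ∷ s) (suc (suc a))} (lv-∷ c d s a) (lv-∷ c d s (suc a)) i))))))
   (PSR.trans (PSS.solve 3 (λ x r b → (x PSS.:* r) PSS.:* b PSS.:= (x PSS.:* b) PSS.:* r) tt (PR K (FD (nthL c) (nthL (toList d)))) rest (PR K (FC (nthL c))))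
   (PSR.trans (PSR.*-congʳ (shift-row K (nthL c) (nthL (toList d))))
   (PSR.trans (PSS.solve 3 (λ x b r → (x PSS.:* b) PSS.:* r PSS.:= x PSS.:* (r PSS.:* b)) tt (PR K (FT (nthL c) (nthL (toList d)))) (PR K (FC (nthL (toList d)))) rest)
   (PSR.*-congˡ (levels (toList d) s)))))
   where rest = PR (suc l) (λ a → PR K (FD (lv (toList d) s a) (lv (toList d) s (suc a))))

  Dser≋ : 1 ≤ n → ∀ m (r : Vec ℕ m) s → Dser m n r s ≋ PRODs (dup (toList r)) s
  Dser≋ (s≤s {n = n'} z≤n) m r s = PSR.trans (⊗≋
    (PSR.trans (prodPS-PR K _) (PSR.trans (PR-cong K (λ i _ → PSR.trans (prodPS-PR (suc l) _) (PR-cong (suc l) (λ a _ → factor a i)))) (PR-swap K (suc l) (λ i a → FD (lv c s a) (lv c s (suc a)) i))))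
    (PSR.trans (prodPS-PR K _) (PR-cong K (λ i _ → FC-cong (lev≡ r s 0) i)))) (levels c s)
   where
   c = dup (toList r)
   K = 2 N.* m
   l = 2 N.* n ∸ 1
   L = lev r s
   factor : ∀ a i → P (L a i ∸ L (suc a) (suc i)) ⊗ iP (L a i ∸ L (suc a) i) ⊗ iP (L (suc a) i ∸ L (suc a) (suc i)) ≋ FD (lv c s a) (lv c s (suc a)) i
   factor a i = PSR.trans (⊗≋ (⊗≋ {P (L a i ∸ L (suc a) (suc i))} {_} {iP (L a i ∸ L (suc a) i)} PSR.refl PSR.refl) PSR.refl) (FD-cong {L a} {lv c s a} {L (suc a)} (lev≡ r s a) (lev≡ r s (suc a)) i)

 coeff-shift : ∀ f d e → coeffℤ f (+ d Z.- + e) ≡ (mono e ⋆ f) d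
 coeff-shift f d e = E.trans (E.cong (coeffℤ f) (ZP.m-n≡m⊖n d e)) (go d e)
  where
  go : ∀ d e → coeffℤ f (d Z.⊖ e) ≡ (mono e ⋆ f) d
  go d zero = E.sym (mono-zero f d)
  go zero (suc e) = E.sym (mono-< (suc e) f 0 (s≤s z≤n))
  go (suc d) (suc e) = E.trans (E.cong (coeffℤ f) (ZP.[1+m]⊖[1+n]≡m⊖n d e)) (E.trans (go d e) (E.sym (mono-suc e f d)))

 coeff-neg : ∀ f k e → coeffℤ f (-[1+ k ] Z.- + e) ≡ + 0
 coeff-neg f k zero = E.refl
 coeff-neg f k (suc e) = E.refl

 module Main (Mo : Model) (n : ℕ) (n≥1 : 1 ≤ n) where
  open Model Mo hiding (Q; I)
  private
   QQ = Model.Q Mo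
   II = Model.I Mo
  open InfProd II
  open Evaluate Mo n n≥1 using (LHS≈rhs1)
  open Final QQ II n n≥1 using (slack)
  open Link QQ II n n≥1 using (LL; LHS)
  open Duality QQ n 0 n≥1 using (dbl≢0)
  open LatticeSum QQ n (dbl≢0 n≥1) (+ 1) using (Carrier; _≈_; _+_; _*_; -_; _-_; 0#; 1#; begin_; _≈⟨_⟩_; _≈⟨_⟨_; _∎; refl; sym; trans; reflexive; solve; _:=_; _:+_; _:*_; _:-_; :-_; :1; :0; _≈[_]_; R; []; _∷_; *-inter; HL; L; Tm; b; fac; fac-ifac; hd; ifac; ifd->; ifd-≤; le->; le-≤; pw; qz-cong; sumTo; sumTo-0; sumTo-cong; tp≈qz; xs; ΣL; ΣL-0; ΣL-cong; ≈[]-trans; ≈⇒≈[]; +-cong; +-congˡ; *-cong; *-congˡ; *-congʳ; -‿cong; +-assoc; *-assoc; *-comm; +-identityˡ; +-identityʳ; *-identityˡ; *-identityʳ; zeroˡ; zeroʳ; distribˡ; -‿inverseˡ; qz; qz-0; qz-+; a)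
  open Summand n
  open Exponents n

  private
   N≡ : 2 N.* n ≡ n N.+ n
   N≡ = E.cong (n N.+_) (NP.+-identityʳ n)

   P≋ : ∀ k → P k ≋ PR k (λ j → 𝟙 ⊖ mono (2 N.* n N.+ 2 N.* n N.* j))
   P≋ k = prodPS-PR k _

   One-P : ∀ k → One (P k)
   One-P k = E.trans (at (P≋ k) 0) (PR-One k (λ j → One-1-q {2 N.* n N.+ 2 N.* n N.* j} (NP.≤-trans n≥1 (NP.≤-trans (NP.m≤m+n n (n N.+ 0)) (NP.m≤m+n (2 N.* n) (2 N.* n N.* j))))))

   ι-⊖ : ∀ k → ι (𝟙 ⊖ mono k) ≈ 1# - qz (+ k)
   ι-⊖ k = trans (ι-cong (PSR.reflexive (⊖≡ 𝟙 (mono k)))) (trans (ι-+ 𝟙 (⊟ mono k)) (+-cong ι-1 neg-ι))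
    where
    neg-ι : ι (⊟ mono k) ≈ - qz (+ k)
    neg-ι = begin
     _ ≈⟨ solve 2 (λ x y → x := (x :+ y) :- y) tt (ι (⊟ mono k)) (ι (mono k)) ⟩
     _ ≈⟨ +-cong (trans (sym (ι-+ (⊟ mono k) (mono k))) (trans (ι-cong (PSR.-‿inverseˡ (mono k))) ι-0)) (-‿cong (sym (ι-qz k))) ⟩
     0# - qz (+ k) ≈⟨ +-identityˡ _ ⟩
     - qz (+ k) ∎

   ι-fac : ∀ k → fac k ≈ ι (P k)
   ι-fac k = trans (go k) (ι-cong (PSR.sym (P≋ k)))
    where
    go : ∀ k → fac k ≈ ι (PR k (λ j → 𝟙 ⊖ mono (2 N.* n N.+ 2 N.* n N.* j)))
    go zero = sym ι-1
    go (suc k) = trans (*-comm _ _) (trans (*-cong (trans (+-congˡ (-‿cong (trans (tp≈qz (suc k)) (qz-cong (E.cong +_ (E.trans (NP.*-suc (n N.+ n) k) (E.cong (λ x → x N.+ x N.* k) (E.sym N≡)))))))) (sym (ι-⊖ _))) (go k)) (sym (ι-* _ _)))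

   ι-ifac : ∀ k → ifac k ≈ ι (iP k)
   ι-ifac k = begin
    ifac k ≈⟨ *-identityˡ _ ⟨
    1# * ifac k ≈⟨ *-congʳ (trans (sym (ι-* (iP k) (P k))) (trans (ι-cong (inv-inverse (P k) (One-P k))) ι-1)) ⟨
    _ ≈⟨ *-congʳ (*-congˡ (ι-fac k)) ⟨
    _ ≈⟨ *-assoc _ _ _ ⟩
    _ ≈⟨ *-congˡ (fac-ifac k) ⟩
    _ ≈⟨ *-identityʳ _ ⟩
    ι (iP k) ∎

   pw-ew : ∀ a k → pw (+ a) k ≈ qz (+ ew a k)
   pw-ew a zero = sym qz-0
   pw-ew a (suc k) = trans (*-congˡ (pw-ew (a N.+ (n N.+ n)) k)) (sym (qz-+ (+ a) _))

   hd≡ : ∀ c → hd c ≡ nthL c 0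
   hd≡ [] = E.refl
   hd≡ (_ ∷ _) = E.refl

   FT′ : List ℕ → List ℕ → ℕ → PS
   FT′ c d = FT (nthL c) (nthL d)

   Tm-exact : ∀ a c d → length c ≡ length d → Desc c → Desc d → Below d c → Tm (+ a) c d ≈ qz (+ eT a c d) * ι (PR (length c) (FT′ c d))
   Tm-exact a [] [] _ _ _ _ = sym (trans (*-cong qz-0 ι-1) (*-identityˡ _))
   Tm-exact a (c ∷ cs) (d ∷ ds) l (p , pc) (q , qd) (b , bd) = begin
    _ ≈⟨ *-cong (le-≤ (E.subst (N._≤ d) (E.sym (hd≡ ds)) q)) (*-cong (*-cong (*-cong (pw-ew a (c ∸ d)) (trans (ifd-≤ b) (ι-ifac (c ∸ d))))
        (*-cong (trans (reflexive (E.cong (λ x → fac (c ∸ x)) (hd≡ ds))) (ι-fac (c ∸ nthL ds 0))) (trans (ifd-≤ (E.subst (N._≤ c) (E.sym (hd≡ cs)) p)) (trans (reflexive (E.cong (λ x → ifac (c ∸ x)) (hd≡ cs))) (ι-ifac (c ∸ nthL cs 0))))))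
        (Tm-exact a cs ds (NP.suc-injective l) pc qd bd)) ⟩
    _ ≈⟨ solve 6 (λ e i f j e' r → :1 :* (e :* i :* (f :* j) :* (e' :* r)) := (e :* e') :* (f :* i :* j :* r)) tt (qz (+ ew a (c ∸ d))) (ι I₁) (ι F₁) (ι I₂) (qz (+ eT a cs ds)) (ι R₀) ⟩
    _ ≈⟨ *-cong (sym (qz-+ _ _)) (trans (*-congʳ (trans (*-congʳ (sym (ι-* F₁ I₁))) (sym (ι-* (F₁ ⋆ I₁) I₂)))) (trans (sym (ι-* (F₁ ⋆ I₁ ⋆ I₂) R₀)) (ι-cong (PSR.sym (PR-front (length cs) (FT′ (c ∷ cs) (d ∷ ds))))))) ⟩
    _ ∎
    where
    I₁ = iP (c ∸ d)
    I₂ = iP (c ∸ nthL cs 0)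
    F₁ = P (c ∸ nthL ds 0)
    R₀ = PR (length cs) (FT′ cs ds)

   -- Each violated inequality puts a zero into `Tm`: either a reciprocal factorial at a negative
   -- index or the indicator `le`.
   Tm-zero′ : ∀ a c d → length c ≡ length d → ¬ (Desc c × Desc d × Below d c) → Tm (+ a) c d ≈ 0#
   Tm-zero′ a [] [] _ h = ⊥-elim (h (tt , tt , tt))
   Tm-zero′ a (c ∷ cs) (d ∷ ds) l h with nthL cs 0 N.≤? c | nthL ds 0 N.≤? d | d N.≤? c
   ... | yes p | yes q | yes b = trans (*-congˡ (trans (*-congˡ (Tm-zero′ a cs ds (NP.suc-injective l) (λ { (x , y , z) → h ((p , x) , (q , y) , (b , z)) }))) (zeroʳ _))) (zeroʳ _)
   ... | no ¬p | _ | _ = trans (*-congˡ (trans (*-congʳ (trans (*-congˡ (trans (*-congˡ (ifd-> (NP.≰⇒> (λ x → ¬p (E.subst (N._≤ c) (hd≡ cs) x))))) (zeroʳ _))) (zeroʳ _))) (zeroˡ _))) (zeroʳ _)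
   ... | yes _ | no ¬q | _ = trans (*-congʳ (le-> (NP.≰⇒> (λ x → ¬q (E.subst (N._≤ d) (hd≡ ds) x))))) (zeroˡ _)
   ... | yes _ | yes _ | no ¬b = trans (*-congˡ (trans (*-congʳ (trans (*-congʳ (trans (*-congˡ (ifd-> (NP.≰⇒> ¬b))) (zeroʳ _))) (zeroˡ _))) (zeroˡ _))) (zeroʳ _)

  TT : ∀ {K l} → ℕ → List ℕ → Vec (Vec ℕ K) l → Carrier
  TT a c [] = Tm (+ a) c (replicate (length c) 0)
  TT a c (d ∷ s) = Tm (+ a) c (toList d) * TT (suc a) (toList d) s

  private
   desc-0 : ∀ k → Desc (replicate k 0)
   desc-0 zero = tt
   desc-0 (suc k) = E.subst (N._≤ 0) (E.sym (nthL-zeros k 0)) z≤n , desc-0 k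

   below-0 : ∀ k c → Below (replicate k 0) c
   below-0 zero c = tt
   below-0 (suc k) c = z≤n , below-0 k _

   good-desc : ∀ {K l} c (s : Vec (Vec ℕ K) l) → Good c s → Desc c
   good-desc c [] g = g
   good-desc c (_ ∷ _) (g , _) = g

  TT-exact : ∀ {K l} a c (s : Vec (Vec ℕ K) l) → length c ≡ K → Good c s → TT a c s ≈ qz (+ EX a c s) * ι (PRODs c s)
  TT-exact a c [] E.refl g = trans (Tm-exact a c _ (E.sym (length-replicate (length c))) g (desc-0 (length c)) (below-0 (length c) c))
   (*-congˡ (ι-cong (PR-cong (length c) (λ i _ → PSR.reflexive (E.cong₂ (λ x y → P (nthL c i ∸ x) ⋆ iP (nthL c i ∸ y) ⋆ iP (nthL c i ∸ nthL c (suc i))) (nthL-zeros (length c) (suc i)) (nthL-zeros (length c) i))))))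
  TT-exact {K} a c (d ∷ s) E.refl (p , q , g) = begin
   _ ≈⟨ *-cong (Tm-exact a c (toList d) (E.sym (length-toList d)) p (good-desc (toList d) s g) q) (TT-exact (suc a) (toList d) s (length-toList d) g) ⟩
   _ ≈⟨ *-inter {X = ℕ} _ _ _ _ ⟩
   _ ≈⟨ *-cong (qz-+ _ _) (ι-* A _) ⟨
   _ ∎
   where A = PR K (FT (nthL c) (nthL (toList d)))

  good? : ∀ {K l} c (s : Vec (Vec ℕ K) l) → Dec (Good c s)
  good? c [] = desc? c
  good? c (d ∷ s) = desc? c ×-dec (below? (toList d) c ×-dec good? (toList d) s)

  TT-zero : ∀ {K l} a c (s : Vec (Vec ℕ K) l) → length c ≡ K → ¬ Good c s → TT a c s ≈ 0#
  TT-zero a c [] e h = Tm-zero′ a c _ (E.sym (length-replicate (length c))) (λ { (x , _) → h x })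
  TT-zero a c (d ∷ s) e h with good? (toList d) s
  ... | no ¬g = trans (*-congˡ (TT-zero (suc a) (toList d) s (length-toList d) ¬g)) (zeroʳ _)
  ... | yes g = trans (*-congʳ (Tm-zero′ a c (toList d) (E.trans e (E.sym (length-toList d))) (λ { (x , _ , z) → h (x , z , g) }))) (zeroˡ _)

  ΣA : ∀ {A : Set} → List A → (A → Carrier) → Carrier
  ΣA [] f = 0#
  ΣA (x ∷ xs) f = f x + ΣA xs f

  private
   ΣA-cong : ∀ {A : Set} (xs : List A) {f g : A → Carrier} → (∀ x → f x ≈ g x) → ΣA xs f ≈ ΣA xs g
   ΣA-cong [] h = refl
   ΣA-cong (x ∷ xs) h = +-cong (h x) (ΣA-cong xs h)

   ΣA-++ : ∀ {A : Set} (xs ys : List A) (f : A → Carrier) → ΣA (xs ++ ys) f ≈ ΣA xs f + ΣA ys f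
   ΣA-++ [] ys f = sym (+-identityˡ _)
   ΣA-++ (x ∷ xs) ys f = trans (+-congˡ (ΣA-++ xs ys f)) (sym (+-assoc _ _ _))

   ΣA-map : ∀ {A B : Set} (g : A → B) xs (f : B → Carrier) → ΣA (map g xs) f ≈ ΣA xs (λ x → f (g x))
   ΣA-map g [] f = refl
   ΣA-map g (x ∷ xs) f = +-congˡ (ΣA-map g xs f)

   ΣA-* : ∀ {A : Set} (xs : List A) c (f : A → Carrier) → ΣA xs (λ x → c * f x) ≈ c * ΣA xs f
   ΣA-* [] c f = sym (zeroʳ c)
   ΣA-* (x ∷ xs) c f = trans (+-congˡ (ΣA-* xs c f)) (sym (distribˡ _ _ _))

   ΣA-concatMap : ∀ {A B : Set} (g : A → List B) xs (f : B → Carrier) → ΣA (concatMap g xs) f ≈ ΣA xs (λ x → ΣA (g x) f)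
   ΣA-concatMap g [] f = refl
   ΣA-concatMap g (x ∷ xs) f = trans (ΣA-++ (g x) _ f) (+-congˡ (ΣA-concatMap g xs f))

   ΣA-upTo : ∀ k (g : ℕ → ℕ) f → ΣA (applyUpTo g k) f ≈ sumTo k (λ i → f (g i))
   ΣA-upTo zero g f = refl
   ΣA-upTo (suc k) g f = +-congˡ (ΣA-upTo k (λ i → g (suc i)) f)

  module _ (m B : ℕ) where
   private
    vecs : ∀ k → List (Vec ℕ k)
    vecs = allVecs m n (upTo (suc B))

    rows : ∀ K l → List (Vec (Vec ℕ K) l)
    rows K = allVecs m n (vecs K)

    ΣA-allVecs : ∀ {A : Set} (xs : List A) k (f : Vec A (suc k) → Carrier) → ΣA (allVecs m n xs (suc k)) f ≈ ΣA xs (λ x → ΣA (allVecs m n xs k) (λ v → f (x ∷ v)))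
    ΣA-allVecs xs k f = trans (ΣA-concatMap (λ x → map (x ∷_) (allVecs m n xs k)) xs f) (ΣA-cong xs (λ x → ΣA-map (x ∷_) (allVecs m n xs k) f))

    ΣA-vecs : ∀ k (f : List ℕ → Carrier) → ΣA (vecs k) (λ v → f (toList v)) ≈ ΣL B k f
    ΣA-vecs zero f = +-identityʳ _
    ΣA-vecs (suc k) f = trans (ΣA-allVecs (upTo (suc B)) k (λ v → f (toList v))) (trans (ΣA-cong (upTo (suc B)) (λ x → ΣA-vecs k (λ v → f (x ∷ v)))) (ΣA-upTo (suc B) (λ i → i) _))

    -- `HL d []` is the indicator of d being a list of zeros.
    collapse-0 : ∀ k (u : List ℕ → Carrier) → ΣL B k (λ d → u d * HL d []) ≈ u (replicate k 0)
    collapse-0 zero u = *-identityʳ _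
    collapse-0 (suc k) u = trans (+-cong (trans (ΣL-cong B k (λ v _ _ → *-congˡ (trans (*-identityˡ _) (trans (*-congʳ (*-identityˡ _)) (*-identityˡ _))))) (collapse-0 k (λ v → u (0 ∷ v))))
     (trans (sumTo-cong B (λ i _ → trans (ΣL-cong B k (λ v _ _ → trans (*-congˡ (zeroˡ _)) (zeroʳ _))) (ΣL-0 B k))) (sumTo-0 B))) (+-identityʳ _)

    LL≈ : ∀ {K} l a c → length c ≡ K → LL B (rng a (suc l)) c ≈ ΣA (rows K l) (TT a c)
    LL≈ zero a c E.refl = trans (collapse-0 (length c) (Tm (+ a) c)) (sym (+-identityʳ _))
    LL≈ {K} (suc l) a c E.refl = begin
     _ ≈⟨ ΣA-vecs K _ ⟨
     _ ≈⟨ ΣA-cong (vecs K) (λ d → trans (*-congˡ (LL≈ l (suc a) (toList d) (length-toList d))) (sym (ΣA-* (rows K l) _ _))) ⟩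
     _ ≈⟨ ΣA-allVecs (vecs K) l _ ⟨
     _ ∎

    K = 2 N.* m
    l = 2 N.* n ∸ 1

    sl≡ : suc l ≡ n N.+ n
    sl≡ = E.trans (NP.m+[n∸m]≡n {1} (NP.≤-trans n≥1 (NP.m≤m+n n (n N.+ 0)))) N≡

    expo : Vec ℕ m → Vec (Vec ℕ K) l → ℕ
    expo r s = total (toList r) N.+ EX 0 (dup (toList r)) s

    term : Vec ℕ m → Vec (Vec ℕ K) l → PS
    term r s = if valid m n r s then mono (expo r s) ⋆ Dser m n r s else 𝟘

    ΣP : ∀ {A : Set} → List A → (A → PS) → PS
    ΣP [] f = 𝟘
    ΣP (x ∷ xs) f = f x ⊞ ΣP xs f

    ι-ΣP : ∀ {A : Set} (xs : List A) f → ι (ΣP xs f) ≈ ΣA xs (λ x → ι (f x))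
    ι-ΣP [] f = ι-0
    ι-ΣP (x ∷ xs) f = trans (ι-+ _ _) (+-congˡ (ι-ΣP xs f))

    series : PS
    series = ΣP (vecs m) (λ r → ΣP (rows K l) (term r))

    ι-term : ∀ r s → ι (term r s) ≈ qz (+ total (toList r)) * TT 0 (dup (toList r)) s
    ι-term r s with valid m n r s in eq
    ... | true = begin
     _ ≈⟨ trans (ι-* _ _) (*-cong (sym (ι-qz _)) (ι-cong (Dser≋ n≥1 m r s))) ⟩
     _ ≈⟨ trans (*-congʳ (qz-+ (+ total (toList r)) (+ EX 0 (dup (toList r)) s))) (*-assoc _ _ _) ⟩
     _ ≈⟨ *-congˡ (TT-exact 0 (dup (toList r)) s (length-dup r) (valid⇒Good m n n≥1 r s (E.subst T (E.sym eq) tt))) ⟨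
     _ ∎
    ... | false = trans ι-0 (sym (trans (*-congˡ (TT-zero 0 (dup (toList r)) s (length-dup r) (λ g → E.subst T eq (Good⇒valid m n n≥1 r s g)))) (zeroʳ _)))

    ι-series : ι series ≈ LHS m B
    ι-series = begin
     ι series ≈⟨ trans (ι-ΣP (vecs m) _) (ΣA-cong (vecs m) (λ r → trans (ι-ΣP (rows K l) (term r)) (trans (ΣA-cong (rows K l) (ι-term r)) (ΣA-* (rows K l) _ _)))) ⟩
     _ ≈⟨ ΣA-cong (vecs m) (λ r → *-congˡ (trans (sym (LL≈ l 0 (dup (toList r)) (length-dup r))) (reflexive (E.cong (λ k → LL B (rng 0 k) (dup (toList r))) sl≡)))) ⟩
     _ ≈⟨ ΣA-vecs m (λ r → qz (+ total r) * LL B (rng 0 (n N.+ n)) (dup r)) ⟩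
     LHS m B ∎

    ΣP-at : ∀ {A : Set} (xs : List A) f d → ΣP xs f d ≡ sumℤ (map (λ x → f x d) xs)
    ΣP-at [] f d = E.refl
    ΣP-at (x ∷ xs) f d = E.trans (⊞-at _ _ d) (E.cong (λ y → f x d Z.+ y) (ΣP-at xs f d))

    sum-concatMap : ∀ {A : Set} (g : A → List ℤ) xs → sumℤ (concatMap g xs) ≡ sumℤ (map (λ x → sumℤ (g x)) xs)
    sum-concatMap g [] = E.refl
    sum-concatMap g (x ∷ xs) = E.trans (sum-++ (g x) (concatMap g xs)) (E.cong (λ y → sumℤ (g x) Z.+ y) (sum-concatMap g xs))
     where
     sum-++ : ∀ xs ys → sumℤ (xs ++ ys) ≡ sumℤ xs Z.+ sumℤ ys
     sum-++ [] ys = E.sym (ZP.+-identityˡ _)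
     sum-++ (x ∷ xs) ys = E.trans (E.cong (λ y → x Z.+ y) (sum-++ xs ys)) (E.sym (ZP.+-assoc x (sumℤ xs) (sumℤ ys)))

    shape : ∀ r s d → valid m n r s ≡ true → termCoeff m n r s d ≡ coeffℤ (Dser m n r s) (d Z.- + expo r s)
    shape r s d eq = E.cong (λ x → coeffℤ (Dser m n r s) (d Z.- x)) (Cexp≡ n≥1 m r s (valid⇒Good m n n≥1 r s (E.subst T (E.sym eq) tt)))

    coeff : ∀ d r s → (if valid m n r s then termCoeff m n r s (+ d) else + 0) ≡ term r s d
    coeff d r s with valid m n r s in eq
    ... | true = E.trans (shape r s (+ d) eq) (coeff-shift (Dser m n r s) d (expo r s))
    ... | false = E.refl

    coeff⁻ : ∀ k r s → (if valid m n r s then termCoeff m n r s -[1+ k ] else + 0) ≡ + 0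
    coeff⁻ k r s with valid m n r s in eq
    ... | true = E.trans (shape r s -[1+ k ] eq) (coeff-neg (Dser m n r s) k (expo r s))
    ... | false = E.refl

   lhs≡series : ∀ d → lhsPartial m n B (+ d) ≡ series d
   lhs≡series d = E.trans (sum-concatMap _ (vecs m)) (E.trans (E.cong sumℤ (map-cong (λ r → E.trans (E.cong sumℤ (map-cong (coeff d r) (rows K l))) (E.sym (ΣP-at (rows K l) (term r) d))) (vecs m))) (E.sym (ΣP-at (vecs m) _ d)))

   -- By `Cexp≡` the exponent of every valid term is a natural number, so no term reaches a negative
   -- degree.
   lhs⁻ : ∀ k → lhsPartial m n B -[1+ k ] ≡ + 0
   lhs⁻ k = E.trans (sum-concatMap _ (vecs m)) (E.trans (E.cong sumℤ (map-cong (λ r → E.trans (E.cong sumℤ (map-cong (coeff⁻ k r) (rows K l))) (zeros (rows K l))) (vecs m))) (zeros (vecs m)))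
    where
    zeros : ∀ {A : Set} (xs : List A) → sumℤ (map (λ _ → + 0) xs) ≡ + 0
    zeros [] = E.refl
    zeros (x ∷ xs) = E.trans (ZP.+-identityˡ _) (zeros xs)

   -- Degree d is visible modulo q^(d+1), and `slack` orders are lost when the power of q in the
   -- type B constant is cancelled.
   lhs≡rhs1 : ∀ d → slack N.+ suc d ≤ B → lhsPartial m n B (+ d) ≡ rhs1 m n d
   lhs≡rhs1 d l = E.trans (lhs≡series d) (ι-mod (suc d) {series} {rhs1 m n} (≈[]-trans (≈⇒≈[] ι-series) (LHS≈rhs1 m (s≤s z≤n) B l)) d NP.≤-refl)

open import Defs
open import Data.Nat using (_≤_; _+_)
open PowerSeries using (at)
open LaurentSeries using (laurent; module Model)
open ProductSide using (module Sides)
open ArraySums using (module Main)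
open Quotient using (module Final)

theorem1p2 : (m n : ℕ) → 1 ≤ m → 1 ≤ n →
  ((d : ℤ) → ∃ λ B₀ → (B : ℕ) → B₀ ≤ B → lhsPartial m n B d ≡ coeffℤ (rhs1 m n) d)
  × ((d : ℕ) → rhs1 m n d ≡ rhs2 m n d)
theorem1p2 m n _ n≥1 =
 (λ { (+ d) → Final.slack (Model.Q laurent) (Model.I laurent) n n≥1 + suc d , λ B → lhs≡rhs1 m B d
   ; -[1+ k ] → 0 , λ B _ → lhs⁻ m B k }) ,
 at (Sides.rhs1≋rhs2 m n n≥1)
 where open Main laurent n n≥1
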